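{- Let $q=2^n\ge 4$ and let $G\in\{PSL_2(q),\,PSU_3(q),\,Sz(q)\}$. Put $\chi(G)=5$ if $G=Sz(q)$ and $\chi(G)=3$ if $G\in\{PSL_2(q),PSU_3(q)\}$. Let $\omega(G)$ be the set of element orders of $G$, let $\pi$ be the set of all odd integers in $\omega(G)\setminus\{2,\chi(G)\}$, and let $X$ be the (unique) conjugacy class of involutions of $G$. Then the $\pi$-local fusion graph $F_\pi(G,X)$ is a vertex-transitive edge-regular Deza graph of diameter $2$ with parameters $(v,k,b,a)$ as follows: (1) $(q^2-1,\ q(q-2),\ q(q-3),\ (q-2)^2)$ if $G=PSL_2(q)$; (2) $((q^2+1)(q-1),\ q^2(q-2),\ (q-2)^2(q+1),\ q^2(q-3))$ if $G=Sz(q)$; (3) $((q^3+1)(q-1),\ q^3(q-2),\ (q-2)^2(q^2+q+1),\ q^3(q-3))$ if $G=PSU_3(q)$. Moreover, $F_\pi(G,X)$ is a divisible design graph in which every class of the canonical partition is the set of involutions of a Sylow $2$-subgroup of $G$.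
   Context: All graphs are finite, undirected, without loops or multiple edges. $PSU_3(q)$ denotes the projective special unitary group of dimension $3$ defined over $\mathbb{F}_{q^2}$. $Sz(q)$ denotes the Suzuki group, which is defined (and simple) for $q=2^n$ with $n\ge 3$ odd; the statement for $Sz(q)$ concerns these $q$ only. Each of the groups $G$ considered has exactly one conjugacy class $X$ of involutions. For a group $G$ with a conjugacy class $X$ of involutions and a set $\pi\subseteq\omega(G)$ consisting only of odd numbers, the $\pi$-local fusion graph $F_\pi(G,X)$ is the graph with vertex set $X$ in which $x$ and $y$ are adjacent if and only if $x\neq y$ and the order of the product $xy$ lies in $\pi$. A regular graph of valency $k$ on $v$ vertices is a Deza graph with parameters $(v,k,b,a)$, where $a\le b$, if for any two distinct vertices the number of their common neighbours is $a$ or $b$ (the values $a$ and $b$ are allowed to be equal). A regular graph is edge-regular if the number of common neighbours of two adjacent vertices is the same for all pairs of adjacent vertices. A graph is vertex-transitive if its automorphism group acts transitively on its vertices. A divisible design graph is a regular graph whose vertex set admits a partition into classes of the same size such that the number of common neighbours of any two distinct vertices depends only on whether these two vertices belong to the same class or not; such a partition is called canonical. -}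

module Defs where

open import Algebra.Bundles using (CommutativeRing; Group)
open import Data.Fin.Base using (Fin; zero; suc)
import Data.Fin.Properties as Fin
open import Data.Fin.Permutation using (Permutation; permutation)
open import Data.Fin.Patterns using (0F; 1F; 2F)
open import Data.Nat.Base as ℕ using (ℕ; zero; suc)
open import Data.Nat.Divisibility using (_∣_)
import Data.Nat.Properties as ℕ
open import Data.Product.Base using (Σ; ∃; ∃-syntax; _×_; _,_; proj₁; proj₂)
open import Data.Sum.Base using (_⊎_; inj₁; inj₂)
open import Data.Vec.Base using (Vec; []; _∷_; lookup)
open import Function.Base using (_∘_)
open import Function.Bundles using (Inverse; _⇔_)
open import Level using (Level; _⊔_) renaming (suc to lsuc)
open import Relation.Binary.Bundles using (Setoid)
open import Relation.Binary.Core using (Rel)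
open import Relation.Binary.Structures using (IsEquivalence)
import Relation.Binary.Construct.On as On
open import Relation.Binary.PropositionalEquality as ≡ using (_≡_; _≢_)
open import Relation.Nullary using (¬_; Dec; yes; no; contradiction)
import Relation.Nullary.Decidable as Dec
open import Relation.Unary using (Pred; _∈_; _⊆_)

private
  variable
    a c ℓ p r : Level

HasSize : Setoid a ℓ → ℕ → Set (a ⊔ ℓ)
HasSize S n = Inverse S (≡.setoid (Fin n))

subsetoid : (S : Setoid a ℓ) → Pred (Setoid.Carrier S) p → Setoid (a ⊔ p) ℓ
subsetoid S P = On.setoid {B = Σ (Setoid.Carrier S) P} S proj₁

module _ (G : Group c ℓ) where
  open Group G
  open import Algebra.Definitions.RawMonoid rawMonoid using ()
    renaming (_×_ to pow)
  open import Algebra.Properties.Group G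
  open import Algebra.Properties.Monoid.Mult monoid using (×-congʳ)
  open import Relation.Binary.Reasoning.Setoid setoid

  record HasOrder (g : Carrier) (n : ℕ) : Set ℓ where
    field
      positive : 0 ℕ.< n
      power    : pow n g ≈ ε
      least    : ∀ m → 0 ℕ.< m → pow m g ≈ ε → n ℕ.≤ m

  ω : Pred ℕ (c ⊔ ℓ)
  ω n = ∃[ g ] HasOrder g n

  Involution : Pred Carrier ℓ
  Involution g = HasOrder g 2

  ConjugacyClass : Carrier → Pred Carrier (c ⊔ ℓ)
  ConjugacyClass t x = ∃[ g ] x ≈ g ∙ t ∙ g ⁻¹

  Central : Pred Carrier (c ⊔ ℓ)
  Central z = ∀ g → z ∙ g ≈ g ∙ z

  record IsSubgroup (H : Pred Carrier p) : Set (c ⊔ ℓ ⊔ p) where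
    field
      resp      : ∀ {x y} → x ≈ y → x ∈ H → y ∈ H
      ε-closed  : ε ∈ H
      ∙-closed  : ∀ {x y} → x ∈ H → y ∈ H → x ∙ y ∈ H
      ⁻¹-closed : ∀ {x} → x ∈ H → x ⁻¹ ∈ H

  subgroup : (H : Pred Carrier p) → IsSubgroup H → Group (c ⊔ p) ℓ
  subgroup H H≤G = record
    { Carrier = Σ Carrier H
    ; _≈_     = λ x y → proj₁ x ≈ proj₁ y
    ; _∙_     = λ x y → proj₁ x ∙ proj₁ y , ∙-closed (proj₂ x) (proj₂ y)
    ; ε       = ε , ε-closed
    ; _⁻¹     = λ x → proj₁ x ⁻¹ , ⁻¹-closed (proj₂ x)
    ; isGroup = record
      { isMonoid = record
        { isSemigroup = record
          { isMagma = record
            { isEquivalence = On.isEquivalence proj₁ isEquivalence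
            ; ∙-cong        = ∙-cong
            }
          ; assoc = λ _ _ _ → assoc _ _ _
          }
        ; identity = (λ _ → identityˡ _) , (λ _ → identityʳ _)
        }
      ; inverse = (λ _ → inverseˡ _) , (λ _ → inverseʳ _)
      ; ⁻¹-cong = ⁻¹-cong
      }
    }
    where open IsSubgroup H≤G

  data ⟨_⟩ (S : Pred Carrier p) : Pred Carrier (c ⊔ ℓ ⊔ p) where
    incl    : ∀ {x} → x ∈ S → ⟨ S ⟩ x
    ε-gen   : ⟨ S ⟩ ε
    ∙-gen   : ∀ {x y} → ⟨ S ⟩ x → ⟨ S ⟩ y → ⟨ S ⟩ (x ∙ y)
    ⁻¹-gen  : ∀ {x} → ⟨ S ⟩ x → ⟨ S ⟩ (x ⁻¹)
    ≈-gen   : ∀ {x y} → x ≈ y → ⟨ S ⟩ x → ⟨ S ⟩ y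

  ⟨_⟩-isSubgroup : (S : Pred Carrier p) → IsSubgroup ⟨ S ⟩
  ⟨ S ⟩-isSubgroup = record
    { resp = ≈-gen ; ε-closed = ε-gen ; ∙-closed = ∙-gen ; ⁻¹-closed = ⁻¹-gen }

  IsPSubgroup : ℕ → Pred Carrier p → Set (c ⊔ ℓ ⊔ p)
  IsPSubgroup p H = IsSubgroup H × (∀ g → g ∈ H → ∃[ k ] HasOrder g (p ℕ.^ k))

  -- A Sylow p-subgroup of a finite group is a maximal p-subgroup.
  IsSylow : ℕ → Pred Carrier (c ⊔ ℓ) → Set (lsuc (c ⊔ ℓ))
  IsSylow p H = IsPSubgroup p H ×
    (∀ (K : Pred Carrier (c ⊔ ℓ)) → IsPSubgroup p K → H ⊆ K → K ⊆ H)

  -- G / Z(G), with the carrier of G and the cosets as equality classes.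
  modCentre : Group c (c ⊔ ℓ)
  modCentre = record
    { Carrier = Carrier
    ; _≈_     = λ x y → Central (x ∙ y ⁻¹)
    ; _∙_     = _∙_
    ; ε       = ε
    ; _⁻¹     = _⁻¹
    ; isGroup = record
      { isMonoid = record
        { isSemigroup = record
          { isMagma = record
            { isEquivalence = record
              { refl  = ≈⇒ refl
              ; sym   = λ {x} {y} z → Z-resp (⁻¹-swap x y) (Z-inv z)
              ; trans = λ {x} {y} {w} z z′ → Z-resp (telescope x y w) (Z-∙ z z′)
              }
            ; ∙-cong = λ {x} {y} {u} {v} z z′ → Z-resp (regroup x y u v z′) (Z-∙ z z′)
            }
          ; assoc = λ x y z → ≈⇒ (assoc x y z)
          }
        ; identity = (λ x → ≈⇒ (identityˡ x)) , (λ x → ≈⇒ (identityʳ x))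
        }
      ; inverse = (λ x → ≈⇒ (inverseˡ x)) , (λ x → ≈⇒ (inverseʳ x))
      ; ⁻¹-cong = λ {x} {y} z → Z-resp (invert x y z) (Z-inv z)
      }
    }
    where
    Z-resp : ∀ {x y} → x ≈ y → Central x → Central y
    Z-resp {x} {y} x≈y z g = begin
      y ∙ g  ≈⟨ ∙-congʳ x≈y ⟨
      x ∙ g  ≈⟨ z g ⟩
      g ∙ x  ≈⟨ ∙-congˡ x≈y ⟩
      g ∙ y  ∎

    Z-ε : Central ε
    Z-ε g = trans (identityˡ g) (sym (identityʳ g))

    Z-∙ : ∀ {x y} → Central x → Central y → Central (x ∙ y)
    Z-∙ {x} {y} zx zy g = begin
      (x ∙ y) ∙ g  ≈⟨ assoc x y g ⟩
      x ∙ (y ∙ g)  ≈⟨ ∙-congˡ (zy g) ⟩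
      x ∙ (g ∙ y)  ≈⟨ assoc x g y ⟨
      (x ∙ g) ∙ y  ≈⟨ ∙-congʳ (zx g) ⟩
      (g ∙ x) ∙ y  ≈⟨ assoc g x y ⟩
      g ∙ (x ∙ y)  ∎

    Z-inv : ∀ {x} → Central x → Central (x ⁻¹)
    Z-inv {x} z g = ∙-cancelˡ x _ _ (begin
      x ∙ (x ⁻¹ ∙ g)  ≈⟨ assoc x (x ⁻¹) g ⟨
      (x ∙ x ⁻¹) ∙ g  ≈⟨ ∙-congʳ (inverseʳ x) ⟩
      ε ∙ g           ≈⟨ Z-ε g ⟩
      g ∙ ε           ≈⟨ ∙-congˡ (inverseʳ x) ⟨
      g ∙ (x ∙ x ⁻¹)  ≈⟨ assoc g x (x ⁻¹) ⟨
      (g ∙ x) ∙ x ⁻¹  ≈⟨ ∙-congʳ (z g) ⟨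
      (x ∙ g) ∙ x ⁻¹  ≈⟨ assoc x g (x ⁻¹) ⟩
      x ∙ (g ∙ x ⁻¹)  ∎)

    ≈⇒ : ∀ {x y} → x ≈ y → Central (x ∙ y ⁻¹)
    ≈⇒ {x} {y} x≈y = Z-resp (sym (trans (∙-congʳ x≈y) (inverseʳ y))) Z-ε

    ⁻¹-swap : ∀ x y → (x ∙ y ⁻¹) ⁻¹ ≈ y ∙ x ⁻¹
    ⁻¹-swap x y = trans (⁻¹-anti-homo-∙ x (y ⁻¹)) (∙-congʳ (⁻¹-involutive y))

    telescope : ∀ x y w → (x ∙ y ⁻¹) ∙ (y ∙ w ⁻¹) ≈ x ∙ w ⁻¹
    telescope x y w = begin
      (x ∙ y ⁻¹) ∙ (y ∙ w ⁻¹)  ≈⟨ assoc x (y ⁻¹) (y ∙ w ⁻¹) ⟩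
      x ∙ (y ⁻¹ ∙ (y ∙ w ⁻¹))  ≈⟨ ∙-congˡ (assoc (y ⁻¹) y (w ⁻¹)) ⟨
      x ∙ ((y ⁻¹ ∙ y) ∙ w ⁻¹)  ≈⟨ ∙-congˡ (∙-congʳ (inverseˡ y)) ⟩
      x ∙ (ε ∙ w ⁻¹)           ≈⟨ ∙-congˡ (identityˡ (w ⁻¹)) ⟩
      x ∙ w ⁻¹                 ∎

    regroup : ∀ x y u v → Central (u ∙ v ⁻¹) →
              (x ∙ y ⁻¹) ∙ (u ∙ v ⁻¹) ≈ (x ∙ u) ∙ (y ∙ v) ⁻¹
    regroup x y u v z = begin
      (x ∙ y ⁻¹) ∙ (u ∙ v ⁻¹)  ≈⟨ assoc x (y ⁻¹) (u ∙ v ⁻¹) ⟩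
      x ∙ (y ⁻¹ ∙ (u ∙ v ⁻¹))  ≈⟨ ∙-congˡ (z (y ⁻¹)) ⟨
      x ∙ ((u ∙ v ⁻¹) ∙ y ⁻¹)  ≈⟨ ∙-congˡ (assoc u (v ⁻¹) (y ⁻¹)) ⟩
      x ∙ (u ∙ (v ⁻¹ ∙ y ⁻¹))  ≈⟨ assoc x u (v ⁻¹ ∙ y ⁻¹) ⟨
      (x ∙ u) ∙ (v ⁻¹ ∙ y ⁻¹)  ≈⟨ ∙-congˡ (⁻¹-anti-homo-∙ y v) ⟨
      (x ∙ u) ∙ (y ∙ v) ⁻¹     ∎

    invert : ∀ x y → Central (x ∙ y ⁻¹) → (x ∙ y ⁻¹) ⁻¹ ≈ x ⁻¹ ∙ y ⁻¹ ⁻¹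
    invert x y z = ∙-cancelˡ x _ _ (begin
      x ∙ (x ∙ y ⁻¹) ⁻¹    ≈⟨ Z-inv z x ⟨
      (x ∙ y ⁻¹) ⁻¹ ∙ x    ≈⟨ ∙-congʳ (⁻¹-swap x y) ⟩
      (y ∙ x ⁻¹) ∙ x       ≈⟨ assoc y (x ⁻¹) x ⟩
      y ∙ (x ⁻¹ ∙ x)       ≈⟨ ∙-congˡ (inverseˡ x) ⟩
      y ∙ ε                ≈⟨ Z-ε y ⟨
      ε ∙ y                ≈⟨ ∙-cong (inverseʳ x) (⁻¹-involutive y) ⟨
      (x ∙ x ⁻¹) ∙ y ⁻¹ ⁻¹ ≈⟨ assoc x (x ⁻¹) (y ⁻¹ ⁻¹) ⟩
      x ∙ (x ⁻¹ ∙ y ⁻¹ ⁻¹) ∎)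

  HasOrder-resp : ∀ {x y n} → x ≈ y → HasOrder x n → HasOrder y n
  HasOrder-resp {x} {y} {n} x≈y o = record
    { positive = positive
    ; power    = trans (×-congʳ n (sym x≈y)) power
    ; least    = λ m 0<m e → least m 0<m (trans (×-congʳ m x≈y) e)
    }
    where open HasOrder o

  HasOrder-comm : ∀ x y {n} → HasOrder (x ∙ y) n → HasOrder (y ∙ x) n
  HasOrder-comm x y {n} o = record
    { positive = positive
    ; power    = vanish x y n power
    ; least    = λ m 0<m e → least m 0<m (vanish y x m e)
    }
    where
    open HasOrder o

    slide : ∀ x y n → y ∙ pow n (x ∙ y) ≈ pow n (y ∙ x) ∙ y
    slide x y zero    = trans (identityʳ y) (sym (identityˡ y))
    slide x y (suc n) = begin
      y ∙ ((x ∙ y) ∙ pow n (x ∙ y))  ≈⟨ assoc y (x ∙ y) _ ⟨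
      (y ∙ (x ∙ y)) ∙ pow n (x ∙ y)  ≈⟨ ∙-congʳ (assoc y x y) ⟨
      ((y ∙ x) ∙ y) ∙ pow n (x ∙ y)  ≈⟨ assoc (y ∙ x) y _ ⟩
      (y ∙ x) ∙ (y ∙ pow n (x ∙ y))  ≈⟨ ∙-congˡ (slide x y n) ⟩
      (y ∙ x) ∙ (pow n (y ∙ x) ∙ y)  ≈⟨ assoc (y ∙ x) _ y ⟨
      ((y ∙ x) ∙ pow n (y ∙ x)) ∙ y  ∎

    vanish : ∀ x y n → pow n (x ∙ y) ≈ ε → pow n (y ∙ x) ≈ ε
    vanish x y n e = ∙-cancelʳ y _ _ (begin
      pow n (y ∙ x) ∙ y  ≈⟨ slide x y n ⟨
      y ∙ pow n (x ∙ y)  ≈⟨ ∙-congˡ e ⟩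
      y ∙ ε              ≈⟨ identityʳ y ⟩
      y                  ≈⟨ identityˡ y ⟨
      ε ∙ y              ∎)

-- Finiteness is not a field: the notions below that need it assert the
-- number of vertices through HasSize.
record Graph v e r : Set (lsuc (v ⊔ e ⊔ r)) where
  field
    vertices : Setoid v e
  open Setoid vertices public renaming (Carrier to Vertex)
  field
    Adj      : Rel Vertex r
    Adj-resp : ∀ {x x′ y y′} → x ≈ x′ → y ≈ y′ → Adj x y → Adj x′ y′
    Adj-sym  : ∀ {x y} → Adj x y → Adj y x
    Adj-irr  : ∀ {x y} → Adj x y → ¬ x ≈ y

module _ {v e r} (Γ : Graph v e r) where
  open Graph Γ

  Regular : ℕ → Set (v ⊔ e ⊔ r)
  Regular k = ∀ x → HasSize (subsetoid vertices (Adj x)) k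

  CommonNeighbours : Vertex → Vertex → ℕ → Set (v ⊔ e ⊔ r)
  CommonNeighbours x y = HasSize (subsetoid vertices (λ z → Adj x z × Adj y z))

  EdgeRegular : Set (v ⊔ e ⊔ r)
  EdgeRegular = (∃[ k ] Regular k) ×
    (∃[ λ′ ] ∀ x y → Adj x y → CommonNeighbours x y λ′)

  record IsDeza (v′ k b a : ℕ) : Set (v ⊔ e ⊔ r) where
    field
      a≤b     : a ℕ.≤ b
      order   : HasSize vertices v′
      regular : Regular k
      common  : ∀ x y → ¬ x ≈ y → CommonNeighbours x y a ⊎ CommonNeighbours x y b

  record Automorphism : Set (v ⊔ e ⊔ r) where
    field
      bijection : Inverse vertices vertices
    open Inverse bijection public using (to)
    field
      preserves : ∀ x y → Adj x y ⇔ Adj (to x) (to y)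

  VertexTransitive : Set (v ⊔ e ⊔ r)
  VertexTransitive = ∀ x y → Σ Automorphism λ φ → Automorphism.to φ x ≈ y

  data Walk : Vertex → Vertex → ℕ → Set (v ⊔ e ⊔ r) where
    here : ∀ {x y} → x ≈ y → Walk x y 0
    step : ∀ {x y z n} → Adj x y → Walk y z n → Walk x z (suc n)

  Distance : Vertex → Vertex → ℕ → Set (v ⊔ e ⊔ r)
  Distance x y d = Walk x y d × (∀ m → Walk x y m → d ℕ.≤ m)

  HasDiameter : ℕ → Set (v ⊔ e ⊔ r)
  HasDiameter d = (∀ x y → ∃[ d′ ] Distance x y d′ × d′ ℕ.≤ d) ×
    (∃[ x ] ∃[ y ] Distance x y d)

  -- A partition of the vertex set is given by the equivalence relation
  -- "being in the same class".
  record IsCanonicalPartition (_∼_ : Rel Vertex p) : Set (v ⊔ e ⊔ r ⊔ p) where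
    field
      equivalence  : IsEquivalence _∼_
      respects     : ∀ {x y} → x ≈ y → x ∼ y
      classSize    : ∃[ m ] ∀ x → HasSize (subsetoid vertices (x ∼_)) m
      sameClass    : ∃[ λ₁ ] ∀ x y → ¬ x ≈ y → x ∼ y → CommonNeighbours x y λ₁
      otherClass   : ∃[ λ₂ ] ∀ x y → ¬ x ∼ y → CommonNeighbours x y λ₂

  record IsDivisibleDesignGraph (_∼_ : Rel Vertex p) : Set (v ⊔ e ⊔ r ⊔ p) where
    field
      regular   : ∃[ k ] Regular k
      canonical : IsCanonicalPartition _∼_

module _ (G : Group c ℓ) where
  open Group G

  fusionGraph : (X : Pred Carrier r) → Pred ℕ p → Graph (c ⊔ r) ℓ (ℓ ⊔ p)
  fusionGraph X π = record
    { vertices = subsetoid setoid X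
    ; Adj      = λ x y → ¬ (proj₁ x ≈ proj₁ y) ×
                   ∃[ n ] n ∈ π × HasOrder G (proj₁ x ∙ proj₁ y) n
    ; Adj-resp = λ x≈x′ y≈y′ (x≉y , n , n∈π , o) →
        (λ e → x≉y (trans x≈x′ (trans e (sym y≈y′)))) ,
        n , n∈π , HasOrder-resp G (∙-cong x≈x′ y≈y′) o
    ; Adj-sym  = λ {x} {y} (x≉y , n , n∈π , o) →
        (λ e → x≉y (sym e)) , n , n∈π , HasOrder-comm G (proj₁ x) (proj₁ y) o
    ; Adj-irr  = proj₁
    }

  -- The odd integers in ω(G) ∖ {2, χ}.
  oddOrdersExcept : ℕ → Pred ℕ (c ⊔ ℓ)
  oddOrdersExcept χ n = ¬ (2 ∣ n) × n ∈ ω G × n ≢ 2 × n ≢ χ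

  FusionGraphProperties : (X : Pred Carrier (c ⊔ ℓ)) (χ v k b a : ℕ) → Set (lsuc (c ⊔ ℓ))
  FusionGraphProperties X χ v k b a =
    let Γ = fusionGraph X (oddOrdersExcept χ)
        open Graph Γ using (Vertex)
    in
    VertexTransitive Γ × EdgeRegular Γ × IsDeza Γ v k b a × HasDiameter Γ 2 ×
    (Σ (Rel Vertex (c ⊔ ℓ)) λ _∼_ →
      IsDivisibleDesignGraph Γ _∼_ ×
      (∀ x → Σ (Pred Carrier (c ⊔ ℓ)) λ S → IsSylow G 2 S ×
        (∀ g → (g ∈ S × Involution G g) ⇔ (∃[ y ] x ∼ y × proj₁ y ≈ g))))

module Matrices (R : CommutativeRing c ℓ) where
  open CommutativeRing R hiding (zero)
  open import Algebra.Definitions.RawMonoid +-rawMonoid using (sum)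
  open import Algebra.Properties.Semiring.Sum semiring
    using (sum-cong-≋; sum-replicate-zero; ∑-comm; *-distribˡ-sum; *-distribʳ-sum)
  open import Relation.Binary.Reasoning.Setoid setoid

  Matrix : ℕ → Set c
  Matrix n = Fin n → Fin n → Carrier

  infix 4 _≋_
  _≋_ : ∀ {n} → Rel (Matrix n) ℓ
  A ≋ B = ∀ i j → A i j ≈ B i j

  infixl 7 _⊗_
  _⊗_ : ∀ {n} → Matrix n → Matrix n → Matrix n
  (A ⊗ B) i j = sum (λ k → A i k * B k j)

  I : ∀ {n} → Matrix n
  I zero    zero    = 1#
  I zero    (suc _) = 0#
  I (suc _) zero    = 0#
  I (suc i) (suc j) = I i j

  _ᵀ : ∀ {n} → Matrix n → Matrix n
  (A ᵀ) i j = A j i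

  fromRows : ∀ {n} → Vec (Vec Carrier n) n → Matrix n
  fromRows rows i j = lookup (lookup rows i) j

  ⊗-cong : ∀ {n} {A A′ B B′ : Matrix n} → A ≋ A′ → B ≋ B′ → A ⊗ B ≋ A′ ⊗ B′
  ⊗-cong A≋ B≋ i j = sum-cong-≋ (λ k → *-cong (A≋ i k) (B≋ k j))

  ⊗-assoc : ∀ {n} (A B C : Matrix n) → (A ⊗ B) ⊗ C ≋ A ⊗ (B ⊗ C)
  ⊗-assoc A B C i l = begin
    sum (λ k → sum (λ j → A i j * B j k) * C k l)
      ≈⟨ sum-cong-≋ (λ k → *-distribʳ-sum (C k l) (λ j → A i j * B j k)) ⟩
    sum (λ k → sum (λ j → A i j * B j k * C k l))
      ≈⟨ sum-cong-≋ (λ k → sum-cong-≋ (λ j → *-assoc (A i j) (B j k) (C k l))) ⟩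
    sum (λ k → sum (λ j → A i j * (B j k * C k l)))
      ≈⟨ ∑-comm (λ k j → A i j * (B j k * C k l)) ⟩
    sum (λ j → sum (λ k → A i j * (B j k * C k l)))
      ≈⟨ sum-cong-≋ (λ j → *-distribˡ-sum (A i j) (λ k → B j k * C k l)) ⟨
    sum (λ j → A i j * sum (λ k → B j k * C k l))
      ∎

  private
    pick : ∀ {n} (i : Fin n) (f : Fin n → Carrier) → sum (λ k → I i k * f k) ≈ f i
    pick {suc n} zero f = begin
      1# * f zero + sum (λ k → 0# * f (suc k))
        ≈⟨ +-cong (*-identityˡ _) (sum-cong-≋ {n} (λ k → zeroˡ (f (suc k)))) ⟩
      f zero + sum {n} (λ _ → 0#)  ≈⟨ +-congˡ (sum-replicate-zero n) ⟩
      f zero + 0#                  ≈⟨ +-identityʳ _ ⟩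
      f zero                       ∎
    pick {suc n} (suc i) f = begin
      0# * f zero + sum (λ k → I i k * f (suc k))
        ≈⟨ +-cong (zeroˡ _) (pick i (f ∘ suc)) ⟩
      0# + f (suc i)  ≈⟨ +-identityˡ _ ⟩
      f (suc i)       ∎

    I-sym : ∀ {n} (i j : Fin n) → I i j ≈ I j i
    I-sym zero    zero    = refl
    I-sym zero    (suc j) = refl
    I-sym (suc i) zero    = refl
    I-sym (suc i) (suc j) = I-sym i j

  ⊗-identityˡ : ∀ {n} (A : Matrix n) → I ⊗ A ≋ A
  ⊗-identityˡ A i j = pick i (λ k → A k j)

  ⊗-identityʳ : ∀ {n} (A : Matrix n) → A ⊗ I ≋ A
  ⊗-identityʳ A i j = trans
    (sum-cong-≋ (λ k → trans (*-comm (A i k) (I k j)) (*-congʳ (I-sym k j))))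
    (pick j (A i))

  record Invertible (n : ℕ) : Set (c ⊔ ℓ) where
    field
      mat  : Matrix n
      inv  : Matrix n
      invʳ : mat ⊗ inv ≋ I
      invˡ : inv ⊗ mat ≋ I

  open Invertible public

  private
    ≋-trans : ∀ {n} {A B C : Matrix n} → A ≋ B → B ≋ C → A ≋ C
    ≋-trans p q i j = trans (p i j) (q i j)

    ≋-sym : ∀ {n} {A B : Matrix n} → A ≋ B → B ≋ A
    ≋-sym p i j = sym (p i j)

    cancel : ∀ {n} (A B B′ A′ : Matrix n) → B ⊗ B′ ≋ I → A ⊗ A′ ≋ I →
             (A ⊗ B) ⊗ (B′ ⊗ A′) ≋ I
    cancel A B B′ A′ e e′ =
      ≋-trans (⊗-assoc A B (B′ ⊗ A′))
      (≋-trans (⊗-cong {A = A} (λ _ _ → refl)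
        (≋-trans (≋-sym (⊗-assoc B B′ A′))
        (≋-trans (⊗-cong {B = A′} e (λ _ _ → refl)) (⊗-identityˡ A′)))) e′)

    inv-unique : ∀ {n} (A B A′ B′ : Matrix n) → A′ ⊗ A ≋ I → B ⊗ B′ ≋ I →
                 A ≋ B → A′ ≋ B′
    inv-unique A B A′ B′ e e′ A≋B =
      ≋-trans (≋-sym (⊗-identityʳ A′))
      (≋-trans (⊗-cong {A = A′} (λ _ _ → refl) (≋-sym e′))
      (≋-trans (≋-sym (⊗-assoc A′ B B′))
      (≋-trans (⊗-cong {B = B′}
        (≋-trans (⊗-cong {A = A′} (λ _ _ → refl) (≋-sym A≋B)) e) (λ _ _ → refl))
        (⊗-identityˡ B′))))

  GL : ℕ → Group (c ⊔ ℓ) ℓ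
  GL n = record
    { Carrier = Invertible n
    ; _≈_     = λ A B → mat A ≋ mat B
    ; _∙_     = λ A B → record
        { mat  = mat A ⊗ mat B
        ; inv  = inv B ⊗ inv A
        ; invʳ = cancel (mat A) (mat B) (inv B) (inv A) (invʳ B) (invʳ A)
        ; invˡ = cancel (inv B) (inv A) (mat A) (mat B) (invˡ A) (invˡ B)
        }
    ; ε       = record
        { mat = I ; inv = I ; invʳ = ⊗-identityˡ I ; invˡ = ⊗-identityˡ I }
    ; _⁻¹     = λ A → record
        { mat = inv A ; inv = mat A ; invʳ = invˡ A ; invˡ = invʳ A }
    ; isGroup = record
      { isMonoid = record
        { isSemigroup = record
          { isMagma = record
            { isEquivalence = record
                { refl = λ _ _ → refl ; sym = ≋-sym ; trans = ≋-trans }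
            ; ∙-cong = ⊗-cong
            }
          ; assoc = λ A B C → ⊗-assoc (mat A) (mat B) (mat C)
          }
        ; identity = (λ A → ⊗-identityˡ (mat A)) , (λ A → ⊗-identityʳ (mat A))
        }
      ; inverse = invˡ , invʳ
      ; ⁻¹-cong = λ {A} {B} →
          inv-unique (mat A) (mat B) (inv A) (inv B) (invˡ A) (invʳ B)
      }
    }

  det₂ : Matrix 2 → Carrier
  det₂ A = A 0F 0F * A 1F 1F - A 0F 1F * A 1F 0F

  det₃ : Matrix 3 → Carrier
  det₃ A =
    (A 0F 0F * A 1F 1F * A 2F 2F + A 0F 1F * A 1F 2F * A 2F 0F + A 0F 2F * A 1F 0F * A 2F 1F)
    - (A 0F 2F * A 1F 1F * A 2F 0F + A 0F 1F * A 1F 0F * A 2F 2F + A 0F 0F * A 1F 2F * A 2F 1F)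

  private
    open import Algebra.Solver.Ring.NaturalCoefficients.Default commutativeSemiring
      using (solve; con; _:+_; _:*_; _:=_)
    open import Algebra.Properties.Ring ring
      using (-‿distribˡ-*; -‿distribʳ-*; -‿involutive; -0#≈0#; -‿+-comm)

    minus-unique : ∀ {x y u w} → x + u ≈ y + w → x - y ≈ w - u
    minus-unique {x} {y} {u} {w} e = begin
      x - y                ≈⟨ +-identityʳ _ ⟨
      x - y + 0#           ≈⟨ +-congˡ (-‿inverseʳ u) ⟨
      x - y + (u - u)      ≈⟨ solve 4 (λ x y u v → x :+ y :+ (u :+ v) := x :+ u :+ (y :+ v)) refl x (- y) u (- u) ⟩
      x + u + (- y - u)    ≈⟨ +-congʳ e ⟩
      y + w + (- y - u)    ≈⟨ solve 4 (λ y w z v → y :+ w :+ (z :+ v) := y :+ z :+ (w :+ v)) refl y w (- y) (- u) ⟩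
      y - y + (w - u)      ≈⟨ +-congʳ (-‿inverseʳ y) ⟩
      0# + (w - u)         ≈⟨ +-identityˡ _ ⟩
      w - u                ∎

    expand : ∀ p n p′ n′ → (p - n) * (p′ - n′) ≈ (p * p′ + n * n′) - (p * n′ + n * p′)
    expand p n p′ n′ = begin
      (p - n) * (p′ - n′)
        ≈⟨ solve 4 (λ p n p′ n′ → (p :+ n) :* (p′ :+ n′)
                   := p :* p′ :+ n :* n′ :+ (p :* n′ :+ n :* p′)) refl p (- n) p′ (- n′) ⟩
      p * p′ + (- n) * (- n′) + (p * (- n′) + (- n) * p′)
        ≈⟨ +-cong
             (+-congˡ (trans (sym (-‿distribˡ-* n (- n′)))
               (trans (-‿cong (sym (-‿distribʳ-* n n′))) (-‿involutive _))))
             (trans (+-cong (sym (-‿distribʳ-* p n′)) (sym (-‿distribˡ-* n p′)))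
               (-‿+-comm _ _)) ⟩
      p * p′ + n * n′ - (p * n′ + n * p′) ∎

    det-from : ∀ {P N p n p′ n′} →
               P + (p * n′ + n * p′) ≈ N + (p * p′ + n * n′) →
               P - N ≈ (p - n) * (p′ - n′)
    det-from e = trans (minus-unique e) (sym (expand _ _ _ _))

  det₂-⊗ : ∀ A B → det₂ (A ⊗ B) ≈ det₂ A * det₂ B
  det₂-⊗ A B = det-from (solve 8
    (λ a b c d x y z w →
      let dot = λ a b x y → a :* x :+ (b :* y :+ con 0)
      in dot a b x z :* dot c d y w :+ (a :* d :* (y :* z) :+ b :* c :* (x :* w))
         := dot a b y w :* dot c d x z :+ (a :* d :* (x :* w) :+ b :* c :* (y :* z)))
    refl (A 0F 0F) (A 0F 1F) (A 1F 0F) (A 1F 1F) (B 0F 0F) (B 0F 1F) (B 1F 0F) (B 1F 1F))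

  det₃-⊗ : ∀ A B → det₃ (A ⊗ B) ≈ det₃ A * det₃ B
  det₃-⊗ A B = det-from (solve 18
    (λ a b c d e f g h i a′ b′ c′ d′ e′ f′ g′ h′ i′ →
      let dot = λ x y z u v w → x :* u :+ (y :* v :+ (z :* w :+ con 0))
          A₁ = dot a b c a′ d′ g′ ; A₂ = dot a b c b′ e′ h′ ; A₃ = dot a b c c′ f′ i′
          D₁ = dot d e f a′ d′ g′ ; D₂ = dot d e f b′ e′ h′ ; D₃ = dot d e f c′ f′ i′
          G₁ = dot g h i a′ d′ g′ ; G₂ = dot g h i b′ e′ h′ ; G₃ = dot g h i c′ f′ i′
          pos = λ a b c d e f g h i → a :* e :* i :+ b :* f :* g :+ c :* d :* h
          neg = λ a b c d e f g h i → c :* e :* g :+ b :* d :* i :+ a :* f :* h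
          p = pos a b c d e f g h i ; n = neg a b c d e f g h i
          p′ = pos a′ b′ c′ d′ e′ f′ g′ h′ i′ ; n′ = neg a′ b′ c′ d′ e′ f′ g′ h′ i′
      in pos A₁ A₂ A₃ D₁ D₂ D₃ G₁ G₂ G₃ :+ (p :* n′ :+ n :* p′)
         := neg A₁ A₂ A₃ D₁ D₂ D₃ G₁ G₂ G₃ :+ (p :* p′ :+ n :* n′))
    refl
    (A 0F 0F) (A 0F 1F) (A 0F 2F) (A 1F 0F) (A 1F 1F) (A 1F 2F) (A 2F 0F) (A 2F 1F) (A 2F 2F)
    (B 0F 0F) (B 0F 1F) (B 0F 2F) (B 1F 0F) (B 1F 1F) (B 1F 2F) (B 2F 0F) (B 2F 1F) (B 2F 2F))

  private
    det₂-cong : ∀ {A B} → A ≋ B → det₂ A ≈ det₂ B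
    det₂-cong e = +-cong (*-cong (e 0F 0F) (e 1F 1F))
      (-‿cong (*-cong (e 0F 1F) (e 1F 0F)))

    det₃-cong : ∀ {A B} → A ≋ B → det₃ A ≈ det₃ B
    det₃-cong e = +-cong
      (+-cong (+-cong (term 0F 0F 1F 1F 2F 2F) (term 0F 1F 1F 2F 2F 0F)) (term 0F 2F 1F 0F 2F 1F))
      (-‿cong (+-cong (+-cong (term 0F 2F 1F 1F 2F 0F) (term 0F 1F 1F 0F 2F 2F)) (term 0F 0F 1F 2F 2F 1F)))
      where term = λ i j k l m n → *-cong (*-cong (e i j) (e k l)) (e m n)

    minus-0 : ∀ {x} → x - 0# ≈ x
    minus-0 = trans (+-congˡ -0#≈0#) (+-identityʳ _)

    det₂-I : det₂ I ≈ 1#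
    det₂-I = trans (+-cong (*-identityˡ _) (-‿cong (zeroˡ _))) minus-0

    det₃-I : det₃ I ≈ 1#
    det₃-I = begin
      det₃ I
        ≈⟨ +-cong (solve 1 (λ x → x :* x :* x :+ con 0 :* con 0 :* con 0 :+ con 0 :* con 0 :* con 0
                                  := x :* x :* x) refl 1#)
                  (-‿cong (solve 1 (λ x → con 0 :* x :* con 0 :+ con 0 :* con 0 :* x :+ x :* con 0 :* con 0
                                  := con 0) refl 1#)) ⟩
      1# * 1# * 1# - 0#  ≈⟨ minus-0 ⟩
      1# * 1# * 1#       ≈⟨ *-identityʳ _ ⟩
      1# * 1#            ≈⟨ *-identityʳ _ ⟩
      1#                 ∎

    kernel : ∀ {n} (d : Matrix n → Carrier) →
             (∀ {A B} → A ≋ B → d A ≈ d B) → (∀ A B → d (A ⊗ B) ≈ d A * d B) →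
             d I ≈ 1# → IsSubgroup (GL n) (λ A → d (mat A) ≈ 1#)
    kernel d d-cong d-⊗ d-I = record
      { resp      = λ e p → trans (d-cong (λ i j → sym (e i j))) p
      ; ε-closed  = d-I
      ; ∙-closed  = λ {A} {B} p q →
          trans (d-⊗ (mat A) (mat B)) (trans (*-cong p q) (*-identityˡ 1#))
      ; ⁻¹-closed = λ {A} p → begin
          d (inv A)              ≈⟨ *-identityˡ _ ⟨
          1# * d (inv A)         ≈⟨ *-congʳ p ⟨
          d (mat A) * d (inv A)  ≈⟨ d-⊗ (mat A) (inv A) ⟨
          d (mat A ⊗ inv A)      ≈⟨ d-cong (invʳ A) ⟩
          d I                    ≈⟨ d-I ⟩
          1#                     ∎
      }

  InSL₂ : Pred (Invertible 2) ℓ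
  InSL₂ A = det₂ (mat A) ≈ 1#

  InSL₃ : Pred (Invertible 3) ℓ
  InSL₃ A = det₃ (mat A) ≈ 1#

  InSL₂-isSubgroup : IsSubgroup (GL 2) InSL₂
  InSL₂-isSubgroup = kernel det₂ det₂-cong det₂-⊗ det₂-I

  InSL₃-isSubgroup : IsSubgroup (GL 3) InSL₃
  InSL₃-isSubgroup = kernel det₃ det₃-cong det₃-⊗ det₃-I

  -- J is the matrix of the Hermitian form x₀ȳ₂ + x₁ȳ₁ + x₂ȳ₀.
  J : Matrix 3
  J = fromRows
    ( (0# ∷ 0# ∷ 1# ∷ [])
    ∷ (0# ∷ 1# ∷ 0# ∷ [])
    ∷ (1# ∷ 0# ∷ 0# ∷ [])
    ∷ [])

  module Unitary (σ : Carrier → Carrier)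
    (σ-cong : ∀ {x y} → x ≈ y → σ x ≈ σ y)
    (σ-+ : ∀ x y → σ (x + y) ≈ σ x + σ y)
    (σ-* : ∀ x y → σ (x * y) ≈ σ x * σ y)
    (σ-0 : σ 0# ≈ 0#)
    (σ-1 : σ 1# ≈ 1#) where

    star : ∀ {n} → Matrix n → Matrix n
    star A = (λ i j → σ (A i j)) ᵀ

    InU₃ : Pred (Invertible 3) ℓ
    InU₃ A = mat A ⊗ J ⊗ star (mat A) ≋ J

    private
      star-cong : ∀ {n} {A B : Matrix n} → A ≋ B → star A ≋ star B
      star-cong e i j = σ-cong (e j i)

      σ-sum : ∀ {n} (f : Fin n → Carrier) → σ (sum f) ≈ sum (σ ∘ f)
      σ-sum {zero}  f = σ-0
      σ-sum {suc n} f = trans (σ-+ _ _) (+-congˡ (σ-sum (f ∘ suc)))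

      star-⊗ : ∀ {n} (A B : Matrix n) → star (A ⊗ B) ≋ star B ⊗ star A
      star-⊗ {n} A B i j = trans (σ-sum (λ k → A j k * B k i))
        (sum-cong-≋ {n} (λ k → trans (σ-* (A j k) (B k i)) (*-comm _ _)))

      star-I : ∀ {n} → star (I {n}) ≋ I
      star-I zero    zero    = σ-1
      star-I zero    (suc _) = σ-0
      star-I (suc _) zero    = σ-0
      star-I (suc i) (suc j) = star-I i j

      ≋-refl : ∀ {n} {A : Matrix n} → A ≋ A
      ≋-refl i j = refl

    InU₃-isSubgroup : IsSubgroup (GL 3) InU₃
    InU₃-isSubgroup = record
      { resp      = λ {A} {B} e p → ≋-trans
          (⊗-cong {A = mat B ⊗ J} (⊗-cong {B = J} (≋-sym e) ≋-refl) (star-cong (≋-sym e))) p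
      ; ε-closed  = ≋-trans (⊗-cong {A = I ⊗ J} (⊗-identityˡ J) star-I) (⊗-identityʳ J)
      ; ∙-closed  = λ {A} {B} p q → closed (mat A) (mat B) p q
      ; ⁻¹-closed = λ {A} p → inverted (mat A) (inv A) (invˡ A) p
      }
      where
      form : ∀ A B → A ⊗ B ⊗ J ⊗ star (A ⊗ B) ≋ A ⊗ (B ⊗ J ⊗ star B) ⊗ star A
      form A B =
        ≋-trans (⊗-cong {A = A ⊗ B ⊗ J} (⊗-assoc A B J) (star-⊗ A B))
        (≋-trans (≋-sym (⊗-assoc (A ⊗ (B ⊗ J)) (star B) (star A)))
        (⊗-cong {B = star A} (⊗-assoc A (B ⊗ J) (star B)) ≋-refl))

      closed : ∀ A B → A ⊗ J ⊗ star A ≋ J → B ⊗ J ⊗ star B ≋ J →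
               A ⊗ B ⊗ J ⊗ star (A ⊗ B) ≋ J
      closed A B p q = ≋-trans (form A B)
        (≋-trans (⊗-cong {B = star A} (⊗-cong {A = A} ≋-refl q) ≋-refl) p)

      inverted : ∀ A A′ → A′ ⊗ A ≋ I → A ⊗ J ⊗ star A ≋ J → A′ ⊗ J ⊗ star A′ ≋ J
      inverted A A′ e p =
        ≋-trans (⊗-cong {B = star A′} (⊗-cong {A = A′} ≋-refl (≋-sym p)) ≋-refl)
        (≋-trans (≋-sym (form A′ A))
        (≋-trans (⊗-cong {A = A′ ⊗ A ⊗ J} (⊗-cong {B = J} e ≋-refl)
                   (≋-trans (star-cong e) star-I))
        (≋-trans (⊗-identityʳ (I ⊗ J)) (⊗-identityˡ J))))

record FiniteField c ℓ (q : ℕ) : Set (lsuc (c ⊔ ℓ)) where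
  field
    commutativeRing : CommutativeRing c ℓ
  open CommutativeRing commutativeRing public
  field
    1≉0           : ¬ 1# ≈ 0#
    invertible    : ∀ x → ¬ x ≈ 0# → ∃[ y ] x * y ≈ 1#
    cardinality   : HasSize setoid q

module _ {q : ℕ} (F : FiniteField c ℓ q) where
  open FiniteField F hiding (zero)
  open import Algebra.Properties.Ring ring using (+-cancelˡ)
  open import Algebra.Properties.Semiring.Mult semiring using (×1-homo-*)
  open import Algebra.Definitions.RawMonoid +-rawMonoid using (sum)
    renaming (_×_ to _·_)
  open import Algebra.Properties.Semiring.Sum semiring
    using (sum-cong-≋; ∑-distrib-+; sum-replicate; sum-permute)
  open import Algebra.Properties.CommutativeSemiring.Exp commutativeSemiring
    using (_^_; ^-congˡ; ^-distrib-*; ^-assocʳ)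
  open import Relation.Binary.Reasoning.Setoid setoid
  private
    open module # = Inverse cardinality using (to; from)

    from∘to : ∀ x → from (to x) ≈ x
    from∘to x = #.inverseʳ ≡.refl

    ≈-dec : ∀ x y → Dec (x ≈ y)
    ≈-dec x y = Dec.map′
      (λ e → trans (sym (from∘to x)) (trans (reflexive (≡.cong from e)) (from∘to y)))
      #.to-cong (to x Fin.≟ to y)

    integral : ∀ x y → x * y ≈ 0# → x ≈ 0# ⊎ y ≈ 0#
    integral x y xy≈0 with ≈-dec x 0#
    ... | yes x≈0 = inj₁ x≈0
    ... | no  x≉0 = let (z , xz≈1) = invertible x x≉0 in inj₂ (begin
      y            ≈⟨ *-identityˡ y ⟨
      1# * y       ≈⟨ *-congʳ xz≈1 ⟨
      x * z * y    ≈⟨ *-congʳ (*-comm x z) ⟩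
      z * x * y    ≈⟨ *-assoc z x y ⟩
      z * (x * y)  ≈⟨ *-congˡ xy≈0 ⟩
      z * 0#       ≈⟨ zeroʳ z ⟩
      0#           ∎)

    shift : Permutation q q
    shift = permutation
      (λ i → to (from i + 1#)) (λ i → to (from i - 1#))
      (λ i → back (from i - 1#) 1# i (cancel (-‿inverseˡ 1#)))
      (λ i → back (from i + 1#) (- 1#) i (cancel (-‿inverseʳ 1#)))
      where
      cancel : ∀ {x y z} → y + z ≈ 0# → x + y + z ≈ x
      cancel e = trans (+-assoc _ _ _) (trans (+-congˡ e) (+-identityʳ _))

      back : ∀ x y i → x + y ≈ from i → to (from (to x) + y) ≡ i
      back x y i e = #.inverseˡ (trans (+-congʳ (from∘to x)) e)

    -- ∑ x = ∑ (x + 1) = ∑ x + q · 1 over all x in F.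
    q·1≈0 : q · 1# ≈ 0#
    q·1≈0 = +-cancelˡ (sum from) _ _ (begin
      sum from + q · 1#                 ≈⟨ +-congˡ (sum-replicate q) ⟨
      sum from + sum {q} (λ _ → 1#)     ≈⟨ ∑-distrib-+ from (λ _ → 1#) ⟨
      sum (λ i → from i + 1#)           ≈⟨ sum-cong-≋ (λ i → sym (from∘to (from i + 1#))) ⟩
      sum (λ i → from (to (from i + 1#))) ≈⟨ sum-permute from shift ⟨
      sum from                          ≈⟨ +-identityʳ _ ⟨
      sum from + 0#                     ∎)

  2^k-elements⇒1+1≈0 : ∀ k → q ≡ 2 ℕ.^ k → 1# + 1# ≈ 0#
  2^k-elements⇒1+1≈0 k ≡.refl =
    trans (+-congˡ (sym (+-identityʳ 1#))) (descend k q·1≈0)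
    where
    descend : ∀ k → (2 ℕ.^ k) · 1# ≈ 0# → 2 · 1# ≈ 0#
    descend zero    e = contradiction (trans (sym (+-identityʳ 1#)) e) 1≉0
    descend (suc k) e
      with integral (2 · 1#) ((2 ℕ.^ k) · 1#) (trans (sym (×1-homo-* 2 (2 ℕ.^ k))) e)
    ... | inj₁ e′ = e′
    ... | inj₂ e′ = descend k e′

  ^2^k-distrib-+ : 1# + 1# ≈ 0# →
                   ∀ k x y → (x + y) ^ (2 ℕ.^ k) ≈ x ^ (2 ℕ.^ k) + y ^ (2 ℕ.^ k)
  ^2^k-distrib-+ 1+1≈0 zero    x y = trans (*-identityʳ _)
    (sym (+-cong (*-identityʳ x) (*-identityʳ y)))
  ^2^k-distrib-+ 1+1≈0 (suc k) x y = begin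
    (x + y) ^ (2 ℕ.* 2 ℕ.^ k)                ≈⟨ ^-assocʳ (x + y) 2 (2 ℕ.^ k) ⟨
    ((x + y) ^ 2) ^ (2 ℕ.^ k)                ≈⟨ ^-congˡ (2 ℕ.^ k) square ⟩
    (x ^ 2 + y ^ 2) ^ (2 ℕ.^ k)              ≈⟨ ^2^k-distrib-+ 1+1≈0 k (x ^ 2) (y ^ 2) ⟩
    (x ^ 2) ^ (2 ℕ.^ k) + (y ^ 2) ^ (2 ℕ.^ k) ≈⟨ +-cong (^-assocʳ x 2 (2 ℕ.^ k)) (^-assocʳ y 2 (2 ℕ.^ k)) ⟩
    x ^ (2 ℕ.* 2 ℕ.^ k) + y ^ (2 ℕ.* 2 ℕ.^ k) ∎
    where
    open import Algebra.Solver.Ring.NaturalCoefficients.Default commutativeSemiring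
      using (solve; con; _:+_; _:*_; _:=_)

    square : (x + y) ^ 2 ≈ x ^ 2 + y ^ 2
    square = begin
      (x + y) * ((x + y) * 1#)
        ≈⟨ solve 3 (λ x y o → (x :+ y) :* ((x :+ y) :* o)
             := x :* (x :* o) :+ y :* (y :* o) :+ (x :* y :* o :+ x :* y :* o)) refl x y 1# ⟩
      x ^ 2 + y ^ 2 + (x * y * 1# + x * y * 1#)  ≈⟨ +-congˡ (distribˡ (x * y) 1# 1#) ⟨
      x ^ 2 + y ^ 2 + x * y * (1# + 1#)          ≈⟨ +-congˡ (*-congˡ 1+1≈0) ⟩
      x ^ 2 + y ^ 2 + x * y * 0#                 ≈⟨ +-congˡ (zeroʳ (x * y)) ⟩
      x ^ 2 + y ^ 2 + 0#                         ≈⟨ +-identityʳ _ ⟩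
      x ^ 2 + y ^ 2                              ∎

  0^2^k≈0 : ∀ k → 0# ^ (2 ℕ.^ k) ≈ 0#
  0^2^k≈0 zero    = zeroˡ 1#
  0^2^k≈0 (suc k) = begin
    0# ^ (2 ℕ.* 2 ℕ.^ k)   ≈⟨ ^-assocʳ 0# 2 (2 ℕ.^ k) ⟨
    (0# ^ 2) ^ (2 ℕ.^ k)   ≈⟨ ^-congˡ (2 ℕ.^ k) (zeroˡ (0# ^ 1)) ⟩
    0# ^ (2 ℕ.^ k)         ≈⟨ 0^2^k≈0 k ⟩
    0#                     ∎

  1^n≈1 : ∀ n → 1# ^ n ≈ 1#
  1^n≈1 zero    = refl
  1^n≈1 (suc n) = trans (*-identityˡ _) (1^n≈1 n)

PSL₂ : ∀ {q} → FiniteField c ℓ q → Group (c ⊔ ℓ) (c ⊔ ℓ)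
PSL₂ F = modCentre (subgroup (GL 2) InSL₂ InSL₂-isSubgroup)
  where open Matrices (FiniteField.commutativeRing F)

-- Over the field with q² elements, q = 2ⁿ, with conjugation x̄ = x^q.
module SpecialUnitary (n : ℕ) (F : FiniteField c ℓ ((2 ℕ.^ n) ℕ.^ 2)) where
  open FiniteField F using (commutativeRing; commutativeSemiring; Carrier)
  open Matrices commutativeRing public
  open import Algebra.Properties.CommutativeSemiring.Exp commutativeSemiring
    using (_^_; ^-congˡ; ^-distrib-*)

  bar : Carrier → Carrier
  bar x = x ^ (2 ℕ.^ n)

  open Unitary bar
    (^-congˡ (2 ℕ.^ n))
    (^2^k-distrib-+ F (2^k-elements⇒1+1≈0 F (n ℕ.* 2) (ℕ.^-*-assoc 2 n 2)) n)
    (λ x y → ^-distrib-* x y (2 ℕ.^ n))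
    (0^2^k≈0 F n)
    (1^n≈1 F (2 ℕ.^ n)) public

  InSU₃ : Pred (Invertible 3) ℓ
  InSU₃ A = A ∈ InSL₃ × A ∈ InU₃

  InSU₃-isSubgroup : IsSubgroup (GL 3) InSU₃
  InSU₃-isSubgroup = record
    { resp      = λ {A} {B} e (s , u) → S.resp {A} {B} e s , U.resp {A} {B} e u
    ; ε-closed  = S.ε-closed , U.ε-closed
    ; ∙-closed  = λ {A} {B} (s , u) (s′ , u′) →
        S.∙-closed {A} {B} s s′ , U.∙-closed {A} {B} u u′
    ; ⁻¹-closed = λ {A} (s , u) → S.⁻¹-closed {A} s , U.⁻¹-closed {A} u
    }
    where
    module S = IsSubgroup InSL₃-isSubgroup
    module U = IsSubgroup InU₃-isSubgroup

PSU₃ : ∀ n → FiniteField c ℓ ((2 ℕ.^ n) ℕ.^ 2) → Group (c ⊔ ℓ) (c ⊔ ℓ)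
PSU₃ n F = modCentre (subgroup (GL 3) InSU₃ InSU₃-isSubgroup)
  where open SpecialUnitary n F

-- Suzuki's generating matrices of Sz(q) ≤ GL₄(q), q = 2^(2m+1).
module Suzuki (m : ℕ) (F : FiniteField c ℓ (2 ℕ.^ (1 ℕ.+ 2 ℕ.* m))) where
  open FiniteField F using (commutativeRing; semiring; Carrier; _≈_; _+_; _*_; 0#; 1#)
  open Matrices commutativeRing public
  open import Algebra.Properties.Semiring.Exp semiring using (_^_)

  -- The automorphism θ of F with θ² the Frobenius automorphism x ↦ x²; its
  -- inverse on λ is λ^(2^m), as 2^m * 2^(m+1) = q.
  θ : Carrier → Carrier
  θ x = x ^ (2 ℕ.^ (1 ℕ.+ m))

  S : Carrier → Carrier → Matrix 4
  S a b = fromRows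
    ( (1# ∷ 0# ∷ 0# ∷ 0# ∷ [])
    ∷ (a ∷ 1# ∷ 0# ∷ 0# ∷ [])
    ∷ (b ∷ θ a ∷ 1# ∷ 0# ∷ [])
    ∷ (a * a * θ a + a * b + θ b ∷ a * θ a + b ∷ a ∷ 1# ∷ [])
    ∷ [])

  -- For u = λ and w = λ⁻¹.
  M : Carrier → Carrier → Matrix 4
  M u w = fromRows
    ( (u ^ (1 ℕ.+ 2 ℕ.^ m) ∷ 0# ∷ 0# ∷ 0# ∷ [])
    ∷ (0# ∷ u ^ (2 ℕ.^ m) ∷ 0# ∷ 0# ∷ [])
    ∷ (0# ∷ 0# ∷ w ^ (2 ℕ.^ m) ∷ 0# ∷ [])
    ∷ (0# ∷ 0# ∷ 0# ∷ w ^ (1 ℕ.+ 2 ℕ.^ m) ∷ [])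
    ∷ [])

  T : Matrix 4
  T = fromRows
    ( (0# ∷ 0# ∷ 0# ∷ 1# ∷ [])
    ∷ (0# ∷ 0# ∷ 1# ∷ 0# ∷ [])
    ∷ (0# ∷ 1# ∷ 0# ∷ 0# ∷ [])
    ∷ (1# ∷ 0# ∷ 0# ∷ 0# ∷ [])
    ∷ [])

  data Generator (g : Invertible 4) : Set (c ⊔ ℓ) where
    isS : ∀ a b → mat g ≋ S a b → Generator g
    isM : ∀ u w → u * w ≈ 1# → mat g ≋ M u w → Generator g
    isT : mat g ≋ T → Generator g

Sz : ∀ m → FiniteField c ℓ (2 ℕ.^ (1 ℕ.+ 2 ℕ.* m)) → Group (c ⊔ ℓ) ℓ
Sz m F = subgroup (GL 4) (⟨_⟩ (GL 4) Generator) (⟨_⟩-isSubgroup (GL 4) Generator)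
  where open Suzuki m F

{-# OPTIONS --safe #-}
module Submission where

-- Two involutions of G commute exactly when they lie in the same Sylow
-- 2-subgroup, and each Sylow subgroup contains q - 1 of them.  For involutions
-- x, y of different Sylow subgroups x y has odd order, since an involution in
-- ⟨ x y ⟩ would commute with both, and the order is χ exactly when a pairing
-- with values in 𝔽_q*, read off from the trace of x y, takes the value 1 at
-- (x , y).  So x is adjacent to all but one of the involutions of every other
-- Sylow subgroup, which gives the valency and the number of common neighbours
-- of two commuting involutions.  For x, y that do not commute one has to count
-- the involutions z for which x z and y z both have order χ: they correspond to
-- the points where a norm form takes a prescribed value, and the torus fixing
-- the two Sylow subgroups of x and y permutes the nonzero values of that norm
-- transitively, so each value is taken equally often.  The involutions are found by
-- linear algebra in PSL₂(q) and PSU₃(q) and by the Bruhat decomposition in Sz(q).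

-- Origin of χ: the torus makes the order of `x a ∙ y b` depend on a b alone, and for a = b = 1 both
-- matrices have entries in 𝔽₂. There they are two distinct involutions of SL₂(2), which is dihedral
-- of order 6, or of Sz(2), a Frobenius group of order 20, so their product has order 3 or 5; in
-- PSU₃(q) they lie in a copy of SL₂(q). The parameters depend on three numbers: m = q - 1, the
-- number r of the remaining Sylow 2-subgroups, which is q, q² or q³, and the size N₀ = (r - 1) / (q
-- - 1) of a fibre of the norm. The obstacle in PSU₃(q) is the centre of SU₃(q), which may have
-- order 3. Elements are matrices up to a scalar, so order 3 is detected by the vanishing of the
-- trace and not by its value, unipotence is stated up to scalars, and involutions have to be lifted
-- to matrices of square 1. The field is abstract, so existence comes from counting: square roots
-- because squaring is injective, an element outside 𝔽_q because X^q + X has at most q roots, and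
-- the order of the subfield because the large field is the sum of two copies of it.

open import Defs
open import Algebra.Bundles using (CommutativeRing; Group)
open import Data.Bool.Base using (Bool; true; false; _∧_)
open import Data.Empty using (⊥)
open import Data.Fin.Base using (Fin; zero; suc; combine; finToFun; fromℕ<; funToFin; inject≤; join; remQuot; splitAt; toℕ)
open import Data.Fin.Patterns using (0F; 1F; 2F; 3F; 4F; 5F; 6F; 7F; 8F; 9F)
open import Data.Fin.Permutation using (Permutation; permutation; ↔⇒≡)
import Data.Fin.Properties as Fin
open import Data.List.Base as List using (List; []; _∷_)
open import Data.Nat.Base as ℕ using (ℕ; zero; suc; s≤s; z≤n)
open import Data.Nat.Divisibility using (_∣_; divides)
import Data.Nat.Properties as ℕ
import Data.Nat.Tactic.RingSolver as ℕ-Solver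
open import Data.Product.Base using (Σ; ∃; ∃-syntax; _×_; _,_; proj₁; proj₂)
open import Data.Product.Relation.Binary.Pointwise.NonDependent using (_×ₛ_)
open import Data.Sum.Base using (_⊎_; inj₁; inj₂)
open import Data.Sum.Relation.Binary.Pointwise using (_⊎ₛ_; inj₁; inj₂)
open import Data.Unit.Base using (⊤; tt)
open import Data.Vec.Base as Vec using (Vec; []; _∷_; lookup)
import Data.Vec.Properties as Vec
open import Function.Base using (_∘_; id)
open import Function.Bundles using (Inverse; mk⇔)
import Function.Construct.Composition as Comp
import Function.Construct.Identity as Identity
import Function.Construct.Symmetry as Symm
open import Level using (Level; _⊔_; Lift; lift) renaming (suc to lsuc)
open import Relation.Binary.Bundles using (Setoid)
open import Relation.Binary.Definitions using (tri<; tri≈; tri>)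
open import Relation.Binary.PropositionalEquality as ≡ using (_≡_)
open import Relation.Nullary using (¬_; Dec; yes; no; contradiction)
import Relation.Nullary.Decidable as Dec
open import Relation.Nullary.Decidable using (¬?)
open import Relation.Unary using (Pred; Decidable)

-- The arithmetic of the parameters

module Parameters where
  open import Data.Nat.Base using (_+_; _*_; _∸_; _^_; _≤_; _<_)
  open import Relation.Binary.PropositionalEquality using (refl; sym; trans; cong; subst)
  open import Data.Nat.Solver using (module +-*-Solver)
  open +-*-Solver using (solve; con; _:+_; _:*_; _:^_; _:=_)

  -- Writing q as 4 + k lets the truncated subtractions q ∸ 1, q ∸ 2 and q ∸ 3 compute, which leaves
  -- polynomial identities in k over ℕ.
  at-least-4 : (P : ℕ → Set) → (∀ k → P (4 + k)) → ∀ q → 4 ≤ q → P q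
  at-least-4 P p q 4≤q with ℕ.m≤n⇒∃[o]m+o≡n 4≤q
  ... | k , refl = p k

  ≤-by : ∀ {a b} d → b ≡ a + d → a ≤ b
  ≤-by {a} d e = subst (a ≤_) (sym e) (ℕ.m≤m+n a d)

  -- The numbers of common neighbours computed by FusionGraph for m = q - 1.
  same other : (q r N : ℕ) → ℕ
  same q r N = (q ∸ 1 ∸ 1 ∸ 1) * r
  other q r N = (q ∸ 1 ∸ 1) * (r ∸ 1 ∸ N)

  -- The r - 1 points other than the base point fall into q - 1 fibres of size N, and q - 2 of them
  -- remain when one fibre is removed.
  fibre : ∀ k {r} N → r ≡ suc ((3 + k) * N) → other (4 + k) r N ≡ (2 + k) * ((2 + k) * N)
  fibre k N refl = cong ((2 + k) *_) (ℕ.m+n∸m≡n N ((2 + k) * N))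

  -- The vertices are the m = q - 1 involutions of one Sylow subgroup and m for each of the r
  -- others. The strict inequalities are for the diameter: any two vertices have a common neighbour,
  -- and a class has at least two members.
  record Arithmetic (q r N v k b a : ℕ) : Set where
    field
      v≡      : v ≡ (q ∸ 1) + (q ∸ 1) * r
      k≡      : k ≡ (q ∸ 1 ∸ 1) * r
      a≤b     : a ≤ b
      0<same  : 0 < same q r N
      0<other : 0 < other q r N
      0<m∸1   : 0 < q ∸ 1 ∸ 1

  psl₂ : ∀ q → 4 ≤ q → Arithmetic q q 1 (q ^ 2 ∸ 1) (q * (q ∸ 2)) (q * (q ∸ 3)) ((q ∸ 2) ^ 2) ×
    (q * (q ∸ 3) ≡ same q q 1 × (q ∸ 2) ^ 2 ≡ other q q 1)
  psl₂ = at-least-4 _ λ k → record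
    { v≡ = cong (_∸ 1) (size k)
    ; k≡ = ℕ.*-comm (4 + k) (2 + k)
    -- Here the commuting pairs have more common neighbours, by exactly q - 4, so a = b for q = 4.
    ; a≤b = ≤-by k (gap k)
    ; 0<same = s≤s z≤n
    ; 0<other = s≤s z≤n
    ; 0<m∸1 = s≤s z≤n
    } , ℕ.*-comm (4 + k) (1 + k) , cong ((2 + k) *_) (ℕ.*-identityʳ (2 + k))
    where
    size : ∀ k → (4 + k) ^ 2 ≡ suc ((3 + k) + (3 + k) * (4 + k))
    size = solve 1 (λ k → (con 4 :+ k) :^ 2 := con 1 :+ ((con 3 :+ k) :+ (con 3 :+ k) :* (con 4 :+ k))) refl
    gap : ∀ k → (4 + k) * (1 + k) ≡ (2 + k) ^ 2 + k
    gap = solve 1 (λ k → (con 4 :+ k) :* (con 1 :+ k) := (con 2 :+ k) :^ 2 :+ k) refl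

  sz : ∀ q → 4 ≤ q → Arithmetic q (q * q) (q + 1)
      ((q ^ 2 + 1) * (q ∸ 1)) (q ^ 2 * (q ∸ 2)) ((q ∸ 2) ^ 2 * (q + 1)) (q ^ 2 * (q ∸ 3)) ×
    (q ^ 2 * (q ∸ 3) ≡ same q (q * q) (q + 1) × (q ∸ 2) ^ 2 * (q + 1) ≡ other q (q * q) (q + 1)) ×
    (q * q ≡ suc ((q ∸ 1) * (q + 1)))
  sz = at-least-4 _ λ k → record
    { v≡ = vertices k
    ; k≡ = valency k
    ; a≤b = ≤-by 4 (gap k)
    ; 0<same = s≤s z≤n
    ; 0<other = subst (0 <_) (sym (fibre k (4 + k + 1) (size k))) (s≤s z≤n)
    ; 0<m∸1 = s≤s z≤n
    } , (common k , trans (square k) (sym (fibre k (4 + k + 1) (size k)))) , size k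
    where
    vertices : ∀ k → ((4 + k) ^ 2 + 1) * (3 + k) ≡ (3 + k) + (3 + k) * ((4 + k) * (4 + k))
    vertices = solve 1 (λ k → ((con 4 :+ k) :^ 2 :+ con 1) :* (con 3 :+ k) := (con 3 :+ k) :+ (con 3 :+ k) :* ((con 4 :+ k) :* (con 4 :+ k))) refl
    valency : ∀ k → (4 + k) ^ 2 * (2 + k) ≡ (2 + k) * ((4 + k) * (4 + k))
    valency = solve 1 (λ k → (con 4 :+ k) :^ 2 :* (con 2 :+ k) := (con 2 :+ k) :* ((con 4 :+ k) :* (con 4 :+ k))) refl
    gap : ∀ k → (2 + k) ^ 2 * (4 + k + 1) ≡ (4 + k) ^ 2 * (1 + k) + 4
    gap = solve 1 (λ k → (con 2 :+ k) :^ 2 :* (con 4 :+ k :+ con 1) := (con 4 :+ k) :^ 2 :* (con 1 :+ k) :+ con 4) refl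
    size : ∀ k → (4 + k) * (4 + k) ≡ suc ((3 + k) * (4 + k + 1))
    size = solve 1 (λ k → (con 4 :+ k) :* (con 4 :+ k) := con 1 :+ ((con 3 :+ k) :* (con 4 :+ k :+ con 1))) refl
    common : ∀ k → (4 + k) ^ 2 * (1 + k) ≡ (1 + k) * ((4 + k) * (4 + k))
    common = solve 1 (λ k → (con 4 :+ k) :^ 2 :* (con 1 :+ k) := (con 1 :+ k) :* ((con 4 :+ k) :* (con 4 :+ k))) refl
    square : ∀ k → (2 + k) ^ 2 * (4 + k + 1) ≡ (2 + k) * ((2 + k) * (4 + k + 1))
    square = solve 1 (λ k → (con 2 :+ k) :^ 2 :* (con 4 :+ k :+ con 1) := (con 2 :+ k) :* ((con 2 :+ k) :* (con 4 :+ k :+ con 1))) refl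

  psu₃ : ∀ q → 4 ≤ q → Arithmetic q (q ^ 2 * q) (q ^ 2 + q + 1)
      ((q ^ 3 + 1) * (q ∸ 1)) (q ^ 3 * (q ∸ 2)) ((q ∸ 2) ^ 2 * (q ^ 2 + q + 1)) (q ^ 3 * (q ∸ 3)) ×
    (q ^ 3 * (q ∸ 3) ≡ same q (q ^ 2 * q) (q ^ 2 + q + 1) ×
     (q ∸ 2) ^ 2 * (q ^ 2 + q + 1) ≡ other q (q ^ 2 * q) (q ^ 2 + q + 1)) ×
    (q ^ 2 * q ≡ suc ((q ∸ 1) * (q ^ 2 + q + 1)))
  psu₃ = at-least-4 _ λ k → record
    { v≡ = vertices k
    ; k≡ = valency k
    ; a≤b = ≤-by ((4 + k) ^ 2 + 4) (gap k)
    ; 0<same = s≤s z≤n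
    ; 0<other = subst (0 <_) (sym (fibre k ((4 + k) ^ 2 + (4 + k) + 1) (size k))) (s≤s z≤n)
    ; 0<m∸1 = s≤s z≤n
    } , (common k , trans (square k ((4 + k) ^ 2 + (4 + k) + 1)) (sym (fibre k ((4 + k) ^ 2 + (4 + k) + 1) (size k)))) , size k
    where
    vertices : ∀ k → ((4 + k) ^ 3 + 1) * (3 + k) ≡ (3 + k) + (3 + k) * ((4 + k) ^ 2 * (4 + k))
    vertices = solve 1 (λ k → ((con 4 :+ k) :^ 3 :+ con 1) :* (con 3 :+ k) := (con 3 :+ k) :+ (con 3 :+ k) :* ((con 4 :+ k) :^ 2 :* (con 4 :+ k))) refl
    valency : ∀ k → (4 + k) ^ 3 * (2 + k) ≡ (2 + k) * ((4 + k) ^ 2 * (4 + k))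
    valency = solve 1 (λ k → (con 4 :+ k) :^ 3 :* (con 2 :+ k) := (con 2 :+ k) :* ((con 4 :+ k) :^ 2 :* (con 4 :+ k))) refl
    gap : ∀ k → (2 + k) ^ 2 * ((4 + k) ^ 2 + (4 + k) + 1) ≡ (4 + k) ^ 3 * (1 + k) + ((4 + k) ^ 2 + 4)
    gap = solve 1 (λ k → (con 2 :+ k) :^ 2 :* ((con 4 :+ k) :^ 2 :+ (con 4 :+ k) :+ con 1) := (con 4 :+ k) :^ 3 :* (con 1 :+ k) :+ ((con 4 :+ k) :^ 2 :+ con 4)) refl
    size : ∀ k → (4 + k) ^ 2 * (4 + k) ≡ suc ((3 + k) * ((4 + k) ^ 2 + (4 + k) + 1))
    size = solve 1 (λ k → (con 4 :+ k) :^ 2 :* (con 4 :+ k) := con 1 :+ ((con 3 :+ k) :* ((con 4 :+ k) :^ 2 :+ (con 4 :+ k) :+ con 1))) refl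
    common : ∀ k → (4 + k) ^ 3 * (1 + k) ≡ (1 + k) * ((4 + k) ^ 2 * (4 + k))
    common = solve 1 (λ k → (con 4 :+ k) :^ 3 :* (con 1 :+ k) := (con 1 :+ k) :* ((con 4 :+ k) :^ 2 :* (con 4 :+ k))) refl
    square : ∀ k N → (2 + k) ^ 2 * N ≡ (2 + k) * ((2 + k) * N)
    square = solve 2 (λ k N → (con 2 :+ k) :^ 2 :* N := (con 2 :+ k) :* ((con 2 :+ k) :* N)) refl

-- Finite cardinalities

module Counting where

  private
    variable
      a b ℓ ℓ′ p p′ : Level

  module _ (A : Setoid a ℓ) (B : Setoid b ℓ′) where
    private
      module A = Setoid A
      module B = Setoid B

    mkInverse : (to : A.Carrier → B.Carrier) (from : B.Carrier → A.Carrier) →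
                (∀ {x y} → x A.≈ y → to x B.≈ to y) →
                (∀ {x y} → x B.≈ y → from x A.≈ from y) →
                (∀ y → to (from y) B.≈ y) → (∀ x → from (to x) A.≈ x) → Inverse A B
    mkInverse to from to-cong from-cong to-from from-to = record
      { to = to ; from = from ; to-cong = to-cong ; from-cong = from-cong
      ; inverse = (λ e → B.trans (to-cong e) (to-from _)) , (λ e → A.trans (from-cong e) (from-to _)) }

    restrict : {P : Pred A.Carrier p} {P′ : Pred B.Carrier p′} (f : Inverse A B) →
               (∀ x → P x → P′ (Inverse.to f x)) → (∀ y → P′ y → P (Inverse.from f y)) →
               Inverse (subsetoid A P) (subsetoid B P′)
    restrict f P⇒P′ P′⇒P = record
      { to = λ (x , px) → to x , P⇒P′ x px ; from = λ (y , py) → from y , P′⇒P y py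
      ; to-cong = to-cong ; from-cong = from-cong
      ; inverse = (λ e → proj₁ inverse e) , (λ e → proj₂ inverse e) }
      where open Inverse f

    size-⊎ : ∀ {m n} → HasSize A m → HasSize B n → HasSize (A ⊎ₛ B) (m ℕ.+ n)
    size-⊎ {m} {n} f g = record
      { to = to ; from = λ i → from (splitAt m i)
      ; to-cong = to-cong
      ; from-cong = λ { ≡.refl → Setoid.refl (A ⊎ₛ B) }
      ; inverse = (λ {x} e → ≡.trans (to-cong e) (to-from x))
                , (λ { {x} ≡.refl → from-to x }) }
      where
      module f = Inverse f
      module g = Inverse g
      to : A.Carrier ⊎ B.Carrier → Fin (m ℕ.+ n)
      to (inj₁ x) = join m n (inj₁ (f.to x))
      to (inj₂ y) = join m n (inj₂ (g.to y))
      from : Fin m ⊎ Fin n → A.Carrier ⊎ B.Carrier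
      from (inj₁ i) = inj₁ (f.from i)
      from (inj₂ j) = inj₂ (g.from j)
      to-cong : ∀ {x y} → Setoid._≈_ (A ⊎ₛ B) x y → to x ≡ to y
      to-cong (inj₁ e) = ≡.cong (join m n ∘ inj₁) (f.to-cong e)
      to-cong (inj₂ e) = ≡.cong (join m n ∘ inj₂) (g.to-cong e)
      to-from : ∀ i → to (from (splitAt m i)) ≡ i
      to-from i = ≡.trans (lem (splitAt m i)) (Fin.join-splitAt m n i)
        where
        lem : ∀ s → to (from s) ≡ join m n s
        lem (inj₁ i) = ≡.cong (join m n ∘ inj₁) (f.inverseˡ A.refl)
        lem (inj₂ j) = ≡.cong (join m n ∘ inj₂) (g.inverseˡ B.refl)
      from-to : ∀ x → Setoid._≈_ (A ⊎ₛ B) (from (splitAt m (to x))) x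
      from-to (inj₁ x) rewrite Fin.splitAt-join m n (inj₁ (f.to x)) = inj₁ (f.inverseʳ ≡.refl)
      from-to (inj₂ y) rewrite Fin.splitAt-join m n (inj₂ (g.to y)) = inj₂ (g.inverseʳ ≡.refl)

    -- The fibres over equivalent points have different enumerations, so each
    -- fibre is enumerated through the representative from (to x) of its base point.
    size-fibred : ∀ {m k} (R : A.Carrier → B.Carrier → Set p) →
                  (∀ {x x′ y} → x A.≈ x′ → R x y → R x′ y) →
                  HasSize A m → (∀ x → HasSize (subsetoid B (R x)) k) →
                  HasSize (subsetoid (A ×ₛ B) (λ (x , y) → R x y)) (m ℕ.* k)
    size-fibred {m = m} {k} R resp f g = record
      { to = to ; from = λ i → from (remQuot k i)
      ; to-cong = λ {x} {y} → to-cong x y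
      ; from-cong = λ { ≡.refl → A.refl , B.refl }
      ; inverse = (λ {x} {y} e → ≡.trans (to-cong y (from (remQuot k x)) e) (to-from x))
                , (λ { {x} ≡.refl → from-to x }) }
      where
      module f = Inverse f
      rep : A.Carrier → A.Carrier
      rep x = f.from (f.to x)
      rep≈ : ∀ x → rep x A.≈ x
      rep≈ x = f.inverseʳ ≡.refl
      Tot : Set _
      Tot = Σ (A.Carrier × B.Carrier) λ (x , y) → R x y
      gi : ∀ i y → R (f.from i) y → Fin k
      gi i y r = Inverse.to (g (f.from i)) (y , r)
      gi-cong : ∀ {i i′ y y′ r r′} → i ≡ i′ → y B.≈ y′ → gi i y r ≡ gi i′ y′ r′
      gi-cong {i} ≡.refl e = Inverse.to-cong (g (f.from i)) e
      to : Tot → Fin (m ℕ.* k)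
      to ((x , y) , r) = combine (f.to x) (gi (f.to x) y (resp (A.sym (rep≈ x)) r))
      from : Fin m × Fin k → Tot
      from (i , j) with Inverse.from (g (f.from i)) j
      ... | y , r = (f.from i , y) , r
      to-cong : ∀ s t → Setoid._≈_ (A ×ₛ B) (proj₁ s) (proj₁ t) → to s ≡ to t
      to-cong s t (e , e′) = ≡.cong₂ combine (f.to-cong e) (gi-cong (f.to-cong e) e′)
      to-from : ∀ i → to (from (remQuot k i)) ≡ i
      to-from i = ≡.trans (lem (remQuot k i)) (Fin.combine-remQuot {m} k i)
        where
        lem : ∀ s → to (from s) ≡ combine (proj₁ s) (proj₂ s)
        lem (i , j) = ≡.cong₂ combine (f.inverseˡ A.refl)
          (≡.trans (gi-cong {i′ = i} {r′ = proj₂ (Inverse.from (g (f.from i)) j)} (f.inverseˡ A.refl) B.refl)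
            (Inverse.inverseˡ (g (f.from i)) B.refl))
      from-to : ∀ s → Setoid._≈_ (A ×ₛ B) (proj₁ (from (remQuot k (to s)))) (proj₁ s)
      from-to s@((x , y) , r) = ≡.subst (λ t → Setoid._≈_ (A ×ₛ B) (proj₁ (from t)) (proj₁ s))
        (≡.sym (Fin.remQuot-combine (f.to x) (gi (f.to x) y (resp (A.sym (rep≈ x)) r))))
        (rep≈ x , Inverse.inverseʳ (g (rep x)) ≡.refl)

  size-transport : {A : Setoid a ℓ} {B : Setoid b ℓ′} → Inverse A B → ∀ {n} → HasSize A n → HasSize B n
  size-transport f s = Comp.inverse (Symm.inverse f) s

  size-⇔ : (S : Setoid a ℓ) {P : Pred (Setoid.Carrier S) p} {P′ : Pred (Setoid.Carrier S) p′} →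
           (∀ x → P x → P′ x) → (∀ x → P′ x → P x) →
           ∀ {n} → HasSize (subsetoid S P) n → HasSize (subsetoid S P′) n
  size-⇔ S P⇒P′ P′⇒P = size-transport (restrict S S (Identity.inverse S) P⇒P′ P′⇒P)

  size-⊤ : ∀ {n} {S : Setoid a ℓ} → HasSize S n → HasSize (subsetoid S (λ _ → ⊤)) n
  size-⊤ {S = S} = size-transport (mkInverse S (subsetoid S (λ _ → ⊤)) (_, tt) proj₁ id id
    (λ _ → Setoid.refl S) (λ _ → Setoid.refl S))

  size-flatten : ∀ {n} (S : Setoid a ℓ) (P : Pred (Setoid.Carrier S) p) (P′ : Pred (Setoid.Carrier S) p′) →
    HasSize (subsetoid (subsetoid S P) (λ (x , _) → P′ x)) n → HasSize (subsetoid S (λ x → P x × P′ x)) n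
  size-flatten S P P′ = size-transport (mkInverse (subsetoid (subsetoid S P) (λ (x , _) → P′ x)) (subsetoid S (λ x → P x × P′ x))
    (λ ((x , p) , q) → x , p , q) (λ (x , p , q) → (x , p) , q) id id
    (λ _ → Setoid.refl S) (λ _ → Setoid.refl S))

  size-unique : {A : Setoid a ℓ} → ∀ {m n} → HasSize A m → HasSize A n → m ≡ n
  size-unique f g = ↔⇒≡ (Comp.inverse (Symm.inverse f) g)

  size-× : (A : Setoid a ℓ) (B : Setoid b ℓ′) → ∀ {m n} → HasSize A m → HasSize B n →
           HasSize (A ×ₛ B) (m ℕ.* n)
  size-× A B f g = size-transport
    (mkInverse (subsetoid (A ×ₛ B) (λ _ → B.Carrier)) (A ×ₛ B) proj₁ (λ s → s , proj₂ s) id id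
      (λ _ → A.refl , B.refl) (λ _ → A.refl , B.refl))
    (size-fibred A B (λ _ _ → B.Carrier) (λ _ r → r) f
      (λ x → size-transport
        (mkInverse B (subsetoid B (λ _ → B.Carrier)) (λ y → y , y) proj₁ id id
          (λ _ → B.refl) (λ _ → B.refl)) g))
    where
    module A = Setoid A
    module B = Setoid B

  module Finite (S : Setoid a ℓ) {n : ℕ} (size : HasSize S n) where
    open Setoid S
    private module # = Inverse size

    from-to : ∀ x → #.from (#.to x) ≈ x
    from-to x = #.inverseʳ ≡.refl

    to-injective : ∀ {x y} → #.to x ≡ #.to y → x ≈ y
    to-injective e = trans (sym (from-to _)) (trans (reflexive (≡.cong #.from e)) (from-to _))

    dec : ∀ x y → Dec (x ≈ y)
    dec x y = Dec.map′ to-injective #.to-cong (#.to x Fin.≟ #.to y)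

    any : {P : Pred Carrier p} → (∀ {x y} → x ≈ y → P x → P y) → Decidable P →
          Dec (∃ P)
    any resp P? = Dec.map′ (λ (i , p) → #.from i , p)
      (λ (x , p) → #.to x , resp (sym (from-to x)) p) (Fin.any? (P? ∘ #.from))

    -- A missed value y together with the n images would be n + 1 distinct elements of a set of size
    -- n; `g` lists them with y at index 0.
    injective⇒surjective : (f : Carrier → Carrier) → (∀ {x y} → x ≈ y → f x ≈ f y) →
      (∀ {x y} → f x ≈ f y → x ≈ y) → ∀ y → ∃[ x ] f x ≈ y
    injective⇒surjective f f-cong f-inj y with any {P = λ x → f x ≈ y}
      (λ e p → trans (f-cong (sym e)) p) (λ x → dec (f x) y)
    ... | yes p = p
    ... | no ¬p = contradiction (Fin.injective⇒≤ g-inj) (ℕ.<⇒≱ (ℕ.n<1+n n))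
      where
      g : Fin (suc n) → Fin n
      g zero    = #.to y
      g (suc i) = #.to (f (#.from i))
      g-inj : ∀ {i j} → g i ≡ g j → i ≡ j
      g-inj {zero}  {zero}  e = ≡.refl
      g-inj {zero}  {suc j} e = contradiction (#.from j , to-injective (≡.sym e)) ¬p
      g-inj {suc i} {zero}  e = contradiction (#.from i , to-injective e) ¬p
      g-inj {suc i} {suc j} e = ≡.cong suc (≡.trans (≡.sym (#.inverseˡ refl))
        (≡.trans (#.to-cong (f-inj (to-injective e))) (#.inverseˡ refl)))

  sizeFin : ∀ {n} {P : Pred (Fin n) p} → Decidable P → ∃[ k ] HasSize (subsetoid (≡.setoid (Fin n)) P) k
  sizeFin {n = zero} P? = 0 , record
    { to = proj₁ ; from = λ () ; to-cong = id ; from-cong = λ { {()} }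
    ; inverse = (λ { {()} }) , (λ { {() , _} }) }
  sizeFin {n = suc n} {P} P? with sizeFin {P = P ∘ suc} (P? ∘ suc) | P? zero
  ... | k , f | yes p₀ = suc k , mkInverse _ _ to from
      (λ {x} {y} → to-cong x y) (λ { ≡.refl → ≡.refl }) to-from from-to′
    where
    module f = Inverse f
    to : Σ (Fin (suc n)) P → Fin (suc k)
    to (zero  , _) = zero
    to (suc i , p) = suc (f.to (i , p))
    from : Fin (suc k) → Σ (Fin (suc n)) P
    from zero    = zero , p₀
    from (suc j) = suc (proj₁ (f.from j)) , proj₂ (f.from j)
    to-cong : ∀ x y → proj₁ x ≡ proj₁ y → to x ≡ to y
    to-cong (zero  , _) (.zero    , _) ≡.refl = ≡.refl
    to-cong (suc i , _) (.(suc i) , _) ≡.refl = ≡.cong suc (f.to-cong ≡.refl)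
    to-from : ∀ j → to (from j) ≡ j
    to-from zero    = ≡.refl
    to-from (suc j) = ≡.cong suc (f.inverseˡ ≡.refl)
    from-to′ : ∀ x → proj₁ (from (to x)) ≡ proj₁ x
    from-to′ (zero  , _) = ≡.refl
    from-to′ (suc i , p) = ≡.cong suc (f.inverseʳ {i , p} ≡.refl)
  ... | k , f | no ¬p₀ = k , mkInverse _ _ to from
      (λ {x} {y} → to-cong x y) (λ { ≡.refl → ≡.refl }) (λ j → f.inverseˡ ≡.refl) from-to′
    where
    module f = Inverse f
    to : Σ (Fin (suc n)) P → Fin k
    to (zero  , p) = contradiction p ¬p₀
    to (suc i , p) = f.to (i , p)
    from : Fin k → Σ (Fin (suc n)) P
    from j = suc (proj₁ (f.from j)) , proj₂ (f.from j)
    to-cong : ∀ x y → proj₁ x ≡ proj₁ y → to x ≡ to y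
    to-cong (zero  , p) y ≡.refl = contradiction p ¬p₀
    to-cong (suc i , _) (.(suc i) , _) ≡.refl = f.to-cong ≡.refl
    from-to′ : ∀ x → proj₁ (from (to x)) ≡ proj₁ x
    from-to′ (zero  , p) = contradiction p ¬p₀
    from-to′ (suc i , p) = ≡.cong suc (f.inverseʳ {i , p} ≡.refl)

  module Partition (S : Setoid a ℓ) {P : Pred (Setoid.Carrier S) p}
    (resp : ∀ {x y} → Setoid._≈_ S x y → P x → P y) (P? : Decidable P) where
    open Setoid S

    private
      case : Σ Carrier P ⊎ Σ Carrier (λ x → ¬ P x) → Carrier
      case (inj₁ (x , _)) = x
      case (inj₂ (x , _)) = x

    partition : Inverse (subsetoid S P ⊎ₛ subsetoid S (λ x → ¬ P x)) S
    partition = mkInverse (subsetoid S P ⊎ₛ subsetoid S (λ x → ¬ P x)) S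
      case (λ x → dec⇒ x (P? x)) case-cong (λ {x} {y} → cong′ (P? x) (P? y))
      (λ x → case-dec x (P? x)) (λ x → inv x (P? (case x)))
      where
      dec⇒ : ∀ x → Dec (P x) → Σ Carrier P ⊎ Σ Carrier (λ x → ¬ P x)
      dec⇒ x (yes p) = inj₁ (x , p)
      dec⇒ x (no ¬p) = inj₂ (x , ¬p)
      _≋_ = Setoid._≈_ (subsetoid S P ⊎ₛ subsetoid S (λ x → ¬ P x))
      case-cong : ∀ {x y} → x ≋ y → case x ≈ case y
      case-cong (inj₁ e) = e
      case-cong (inj₂ e) = e
      cong′ : ∀ {x y} (d : Dec (P x)) (d′ : Dec (P y)) → x ≈ y → dec⇒ x d ≋ dec⇒ y d′
      cong′ (yes _) (yes _) e = inj₁ e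
      cong′ (yes p) (no ¬p) e = contradiction (resp e p) ¬p
      cong′ (no ¬p) (yes p) e = contradiction (resp (sym e) p) ¬p
      cong′ (no _)  (no _)  e = inj₂ e
      case-dec : ∀ x d → case (dec⇒ x d) ≈ x
      case-dec x (yes _) = refl
      case-dec x (no _)  = refl
      inv : ∀ x d → dec⇒ (case x) d ≋ x
      inv (inj₁ _)       (yes _) = inj₁ refl
      inv (inj₁ (_ , p)) (no ¬p) = contradiction p ¬p
      inv (inj₂ (_ , n)) (yes p) = contradiction p n
      inv (inj₂ _)       (no _)  = inj₂ refl

  module Subset (S : Setoid a ℓ) {n : ℕ} (size : HasSize S n) {P : Pred (Setoid.Carrier S) p}
    (resp : ∀ {x y} → Setoid._≈_ S x y → P x → P y) (P? : Decidable P) where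
    open Setoid S
    open Finite S size
    open Partition S resp P? using (partition)
    private module # = Inverse size

    subset-size : ∃[ k ] HasSize (subsetoid S P) k
    subset-size with sizeFin (P? ∘ #.from)
    ... | k , f = k , Comp.inverse (restrict S (≡.setoid (Fin n)) size
        (λ x px → resp (sym (from-to x)) px) (λ _ px → px)) f

    complement-size : ∀ {k} → HasSize (subsetoid S P) k → HasSize (subsetoid S (λ x → ¬ P x)) (n ℕ.∸ k)
    complement-size {k} s = ≡.subst (HasSize (subsetoid S (λ x → ¬ P x))) k′≡n∸k s′
      where
      ¬P-size : ∃[ k′ ] HasSize (subsetoid S (λ x → ¬ P x)) k′
      ¬P-size with sizeFin (¬? ∘ P? ∘ #.from)
      ... | k′ , f = k′ , Comp.inverse (restrict S (≡.setoid (Fin n)) size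
        (λ x np p → np (resp (from-to x) p)) (λ _ np → np)) f
      k′ = proj₁ ¬P-size
      s′ = proj₂ ¬P-size
      k′≡n∸k : k′ ≡ n ℕ.∸ k
      k′≡n∸k = ≡.trans (≡.sym (ℕ.m+n∸m≡n k k′)) (≡.cong (ℕ._∸ k)
        (size-unique (size-transport partition (size-⊎ _ _ s s′)) size))

  singleton-size : (S : Setoid a ℓ) (x : Setoid.Carrier S) → HasSize (subsetoid S (λ y → Setoid._≈_ S y x)) 1
  singleton-size S x = mkInverse _ _ (λ _ → zero) (λ _ → x , refl) (λ _ → ≡.refl) (λ _ → refl)
    (λ { zero → ≡.refl }) (λ (_ , e) → sym e)
    where open Setoid S

  -- Double counting of the pairs (k , s) with R k s.
  module EqualFibres (U : Setoid a ℓ) (Q : Setoid b ℓ′) {m r N : ℕ} .{{_ : ℕ.NonZero m}}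
    (U-size : HasSize U m) (Q-size : HasSize Q r) (r≡ : r ≡ suc (m ℕ.* N))
    (o : Setoid.Carrier Q) (R : Setoid.Carrier U → Setoid.Carrier Q → Set p)
    (R-respˡ : ∀ {k k′ s} → Setoid._≈_ U k k′ → R k s → R k′ s)
    (R-respʳ : ∀ {k s s′} → Setoid._≈_ Q s s′ → R k s → R k s′)
    (R? : ∀ k s → Dec (R k s))
    (R-apart : ∀ {k s} → R k s → ¬ Setoid._≈_ Q s o)
    (R-total : ∀ s → ¬ Setoid._≈_ Q s o → ∃[ k ] R k s)
    (R-unique : ∀ {k k′ s} → R k s → R k′ s → Setoid._≈_ U k k′)
    (k₀ : Setoid.Carrier U) (R-equal : ∀ k → Inverse (subsetoid Q (R k₀)) (subsetoid Q (R k))) where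
    private
      module U = Setoid U
      module Q = Setoid Q
      base : ∃[ n ] HasSize (subsetoid Q (R k₀)) n
      base = Subset.subset-size Q Q-size R-respʳ (R? k₀)
      n = proj₁ base

      fibre : ∀ k → HasSize (subsetoid Q (R k)) n
      fibre k = size-transport (R-equal k) (proj₂ base)

      pairs : Inverse (subsetoid (U ×ₛ Q) (λ (k , s) → R k s)) (subsetoid Q (λ s → ¬ s Q.≈ o))
      pairs = mkInverse (subsetoid (U ×ₛ Q) (λ (k , s) → R k s)) (subsetoid Q (λ s → ¬ s Q.≈ o))
        (λ ((k , s) , r) → s , R-apart r) (λ (s , s≉o) → (proj₁ (R-total s s≉o) , s) , proj₂ (R-total s s≉o))
        proj₂
        (λ {(s , p)} {(s′ , p′)} e → R-unique (R-respʳ e (proj₂ (R-total s p))) (proj₂ (R-total s′ p′)) , e)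
        (λ _ → Q.refl) (λ ((k , s) , r) → R-unique (proj₂ (R-total s (R-apart r))) r , Q.refl)

      -- Both sides count the points other than o: each of them lies in exactly one of the m fibres,
      -- and there are r - 1 = m N of them.
      m*n≡m*N : m ℕ.* n ≡ m ℕ.* N
      m*n≡m*N = ≡.trans (size-unique (size-transport pairs (size-fibred U Q R R-respˡ U-size fibre))
          (Subset.complement-size Q Q-size (λ e p → Q.trans (Q.sym e) p) (λ s → Finite.dec Q Q-size s o) (singleton-size Q o)))
        (≡.cong (ℕ._∸ 1) r≡)

    fibre-size : ∀ k → HasSize (subsetoid Q (R k)) N
    fibre-size k = ≡.subst (HasSize (subsetoid Q (R k))) (ℕ.*-cancelˡ-≡ n N m m*n≡m*N) (fibre k)

-- Orders and involutions in groups

odd-half : ∀ n → ¬ 2 ∣ n → ∃[ k ] n ≡ suc (k ℕ.* 2)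
odd-half zero          odd = contradiction (divides 0 ≡.refl) odd
odd-half (suc zero)    odd = 0 , ≡.refl
odd-half (suc (suc n)) odd with odd-half n (λ (divides q e) → odd (divides (suc q) (≡.cong (λ m → suc (suc m)) e)))
... | k , e = suc k , ≡.cong (λ m → suc (suc m)) e

module GroupLemmas {c ℓ : Level} (G : Group c ℓ) where
  open Group G
  open import Algebra.Definitions.RawMonoid rawMonoid public using () renaming (_×_ to pow)
  open import Algebra.Properties.Group G
  open import Algebra.Properties.Monoid.Mult monoid using (×-congʳ; ×-homo-+; ×-assocˡ)
  open import Relation.Binary.Reasoning.Setoid setoid

  conj : Carrier → Carrier → Carrier
  conj g x = g ∙ x ∙ g ⁻¹

  Comm : Carrier → Carrier → Set ℓ
  Comm x y = x ∙ y ≈ y ∙ x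

  conj-cong : ∀ {g h x y} → g ≈ h → x ≈ y → conj g x ≈ conj h y
  conj-cong e e′ = ∙-cong (∙-cong e e′) (⁻¹-cong e)

  conj-congʳ : ∀ g {x y} → x ≈ y → conj g x ≈ conj g y
  conj-congʳ g = conj-cong refl

  conj-∙ : ∀ g x y → conj g (x ∙ y) ≈ conj g x ∙ conj g y
  conj-∙ g x y = sym (begin
    g ∙ x ∙ g ⁻¹ ∙ (g ∙ y ∙ g ⁻¹)     ≈⟨ assoc (g ∙ x) (g ⁻¹) _ ⟩
    g ∙ x ∙ (g ⁻¹ ∙ (g ∙ y ∙ g ⁻¹))   ≈⟨ ∙-congˡ (trans (∙-congˡ (assoc g y _)) (sym (assoc _ _ _))) ⟩
    g ∙ x ∙ (g ⁻¹ ∙ g ∙ (y ∙ g ⁻¹))   ≈⟨ ∙-congˡ (trans (∙-congʳ (inverseˡ g)) (identityˡ _)) ⟩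
    g ∙ x ∙ (y ∙ g ⁻¹)                ≈⟨ assoc (g ∙ x) y _ ⟨
    g ∙ x ∙ y ∙ g ⁻¹                  ≈⟨ ∙-congʳ (assoc g x y) ⟩
    g ∙ (x ∙ y) ∙ g ⁻¹                ∎)

  conj-conj : ∀ g h x → conj g (conj h x) ≈ conj (g ∙ h) x
  conj-conj g h x = begin
    g ∙ (h ∙ x ∙ h ⁻¹) ∙ g ⁻¹     ≈⟨ ∙-congʳ (assoc g (h ∙ x) _) ⟨
    g ∙ (h ∙ x) ∙ h ⁻¹ ∙ g ⁻¹     ≈⟨ ∙-congʳ (∙-congʳ (assoc g h x)) ⟨
    g ∙ h ∙ x ∙ h ⁻¹ ∙ g ⁻¹       ≈⟨ assoc _ _ _ ⟩
    g ∙ h ∙ x ∙ (h ⁻¹ ∙ g ⁻¹)     ≈⟨ ∙-congˡ (⁻¹-anti-homo-∙ g h) ⟨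
    g ∙ h ∙ x ∙ (g ∙ h) ⁻¹        ∎

  conj-ε : ∀ g → conj g ε ≈ ε
  conj-ε g = trans (∙-congʳ (identityʳ g)) (inverseʳ g)

  ε-conj : ∀ x → conj ε x ≈ x
  ε-conj x = trans (∙-cong (identityˡ x) ε⁻¹≈ε) (identityʳ x)

  conj-inverseˡ : ∀ g x → conj (g ⁻¹) (conj g x) ≈ x
  conj-inverseˡ g x = trans (conj-conj _ _ x) (trans (conj-cong (inverseˡ g) refl) (ε-conj x))

  conj-inverseʳ : ∀ g x → conj g (conj (g ⁻¹) x) ≈ x
  conj-inverseʳ g x = trans (conj-conj _ _ x) (trans (conj-cong (inverseʳ g) refl) (ε-conj x))

  conj-injective : ∀ g {x y} → conj g x ≈ conj g y → x ≈ y
  conj-injective g e = trans (sym (conj-inverseˡ g _)) (trans (conj-congʳ (g ⁻¹) e) (conj-inverseˡ g _))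

  conj-flip : ∀ {g x y} → conj g x ≈ y → x ≈ conj (g ⁻¹) y
  conj-flip e = trans (sym (conj-inverseˡ _ _)) (conj-congʳ _ e)

  conj-≈⇒ : ∀ g x y → conj g x ≈ y → g ∙ x ≈ y ∙ g
  conj-≈⇒ g x y e = trans (sym (trans (assoc _ _ _) (trans (∙-congˡ (inverseˡ g)) (identityʳ _)))) (∙-congʳ e)

  conj-≈⇐ : ∀ g x y → g ∙ x ≈ y ∙ g → y ≈ conj g x
  conj-≈⇐ g x y e = sym (trans (∙-congʳ e) (trans (assoc y g _) (trans (∙-congˡ (inverseʳ g)) (identityʳ y))))

  conj-fix : ∀ {g x} → Comm g x → conj g x ≈ x
  conj-fix {g} {x} e = trans (∙-congʳ e) (trans (assoc x g _) (trans (∙-congˡ (inverseʳ g)) (identityʳ x)))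

  fix-comm : ∀ {g x} → conj g x ≈ x → Comm g x
  fix-comm {g} {x} = conj-≈⇒ g x x

  Comm-resp : ∀ {x x′ y y′} → x ≈ x′ → y ≈ y′ → Comm x y → Comm x′ y′
  Comm-resp e e′ c = trans (∙-cong (sym e) (sym e′)) (trans c (∙-cong e′ e))

  Comm-conj : ∀ g {x y} → Comm x y → Comm (conj g x) (conj g y)
  Comm-conj g {x} {y} e = trans (sym (conj-∙ g x y)) (trans (conj-congʳ g e) (conj-∙ g y x))

  Comm-unconj : ∀ g {x y} → Comm (conj g x) (conj g y) → Comm x y
  Comm-unconj g e = Comm-resp (conj-inverseˡ g _) (conj-inverseˡ g _) (Comm-conj (g ⁻¹) e)

  pow-conj : ∀ g n x → pow n (conj g x) ≈ conj g (pow n x)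
  pow-conj g zero    x = sym (conj-ε g)
  pow-conj g (suc n) x = trans (∙-congˡ (pow-conj g n x)) (sym (conj-∙ g x (pow n x)))

  pow-ε : ∀ n → pow n ε ≈ ε
  pow-ε zero    = refl
  pow-ε (suc n) = trans (identityˡ _) (pow-ε n)

  pow-conj-ε : ∀ g n {x} → pow n x ≈ ε → pow n (conj g x) ≈ ε
  pow-conj-ε g n e = trans (pow-conj g n _) (trans (conj-congʳ g e) (conj-ε g))

  HasOrder-conj : ∀ g {x n} → HasOrder G x n → HasOrder G (conj g x) n
  HasOrder-conj g {x} {n} o = record
    { positive = positive
    ; power    = pow-conj-ε g n power
    ; least    = λ m 0<m e → least m 0<m
        (trans (×-congʳ m (sym (conj-inverseˡ g x))) (pow-conj-ε (g ⁻¹) m e))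
    }
    where open HasOrder o

  HasOrder-unconj : ∀ g {x n} → HasOrder G (conj g x) n → HasOrder G x n
  HasOrder-unconj g o = HasOrder-resp G (conj-inverseˡ g _) (HasOrder-conj (g ⁻¹) o)

  HasOrder-unique : ∀ {g m n} → HasOrder G g m → HasOrder G g n → m ≡ n
  HasOrder-unique o o′ = ℕ.≤-antisym
    (o.least _ o′.positive o′.power) (o′.least _ o.positive o.power)
    where
    module o = HasOrder o
    module o′ = HasOrder o′

  pow-2⇒ : ∀ {g} → pow 2 g ≈ ε → g ∙ g ≈ ε
  pow-2⇒ e = trans (∙-congˡ (sym (identityʳ _))) e

  pow-2⇐ : ∀ {g} → g ∙ g ≈ ε → pow 2 g ≈ ε
  pow-2⇐ e = trans (∙-congˡ (identityʳ _)) e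

  pow-5 : ∀ g → pow 5 g ≈ g ∙ ((g ∙ g) ∙ (g ∙ g))
  pow-5 g = ∙-congˡ (trans (∙-congˡ (∙-congˡ (∙-congˡ (identityʳ g)))) (sym (assoc g g _)))

  pow-* : ∀ m {n g} → pow n g ≈ ε → pow (m ℕ.* n) g ≈ ε
  pow-* m {n} {g} e = trans (sym (×-assocˡ g m n)) (trans (×-congʳ m e) (pow-ε m))

  involution : ∀ {g} → g ∙ g ≈ ε → ¬ g ≈ ε → Involution G g
  involution {g} g²≈ε g≉ε = record
    { positive = s≤s z≤n
    ; power = pow-2⇐ g²≈ε
    ; least = least
    }
    where
    least : ∀ m → 0 ℕ.< m → pow m g ≈ ε → 2 ℕ.≤ m
    least (suc zero)    _ e = contradiction (trans (sym (identityʳ g)) e) g≉ε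
    least (suc (suc m)) _ _ = s≤s (s≤s z≤n)

  module _ {g} (g-inv : Involution G g) where
    open HasOrder g-inv

    square : g ∙ g ≈ ε
    square = pow-2⇒ power

    nontrivial : ¬ g ≈ ε
    nontrivial e = ℕ.<⇒≱ {1} {2} (s≤s (s≤s z≤n)) (least 1 (s≤s z≤n) (trans (identityʳ g) e))

    self-inverse : g ⁻¹ ≈ g
    self-inverse = sym (inverseʳ-unique g g square)

  -- For n = 2 k + 1 the n-th power of g is g times a power of g ∙ g, which is trivial.
  odd-power : ∀ {g n} → ¬ 2 ∣ n → g ∙ g ≈ ε → pow n g ≈ ε → g ≈ ε
  odd-power {g} {n} odd g²≈ε e with odd-half n odd
  ... | k , ≡.refl = begin
    g                        ≈⟨ identityʳ g ⟨
    g ∙ ε                    ≈⟨ ∙-congˡ (pow-* k (pow-2⇐ g²≈ε)) ⟨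
    g ∙ pow (k ℕ.* 2) g      ≈⟨ e ⟩
    ε                        ∎

  exponent-3 : ∀ {g} → pow 3 g ≈ ε → ¬ g ≈ ε → HasOrder G g 3
  exponent-3 {g} g³≈ε g≉ε = record { positive = s≤s z≤n ; power = g³≈ε ; least = least }
    where
    least : ∀ m → 0 ℕ.< m → pow m g ≈ ε → 3 ℕ.≤ m
    least 1 _ e = contradiction (trans (sym (identityʳ g)) e) g≉ε
    least 2 _ e = contradiction (trans (sym (trans (∙-congˡ e) (identityʳ g))) g³≈ε) g≉ε
    least (suc (suc (suc m))) _ _ = s≤s (s≤s (s≤s z≤n))

  -- Five is prime: subtracting exponents with `split`, as in Euclid's algorithm, reaches the
  -- exponent 1 from 5 and any smaller positive exponent.
  exponent-5 : ∀ {g} → pow 5 g ≈ ε → ¬ g ≈ ε → HasOrder G g 5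
  exponent-5 {g} g⁵≈ε g≉ε = record { positive = s≤s z≤n ; power = g⁵≈ε ; least = least }
    where
    split : ∀ m n → pow m g ≈ ε → pow (m ℕ.+ n) g ≈ ε → pow n g ≈ ε
    split m n e e′ = trans (sym (identityˡ _)) (trans (∙-congʳ (sym e)) (trans (sym (×-homo-+ g m n)) e′))
    one : pow 1 g ≈ ε → g ≈ ε
    one e = trans (sym (identityʳ g)) e
    least : ∀ m → 0 ℕ.< m → pow m g ≈ ε → 5 ℕ.≤ m
    least 1 _ e = contradiction (one e) g≉ε
    least 2 _ e = contradiction (one (split 2 1 e (split 2 3 e g⁵≈ε))) g≉ε
    least 3 _ e = contradiction (one (split 2 1 (split 3 2 e g⁵≈ε) e)) g≉ε
    least 4 _ e = contradiction (one (split 4 1 e g⁵≈ε)) g≉ε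
    least (suc (suc (suc (suc (suc m))))) _ _ = s≤s (s≤s (s≤s (s≤s (s≤s z≤n))))

  pow-inverse : ∀ n {g h} → g ∙ h ≈ ε → pow n g ∙ pow n h ≈ ε
  pow-inverse zero    e = identityˡ ε
  pow-inverse (suc n) {g} {h} e = begin
    g ∙ pow n g ∙ (h ∙ pow n h)   ≈⟨ ∙-congʳ (shift n) ⟩
    pow n g ∙ g ∙ (h ∙ pow n h)   ≈⟨ assoc _ _ _ ⟩
    pow n g ∙ (g ∙ (h ∙ pow n h)) ≈⟨ ∙-congˡ (trans (sym (assoc _ _ _)) (trans (∙-congʳ e) (identityˡ _))) ⟩
    pow n g ∙ pow n h             ≈⟨ pow-inverse n e ⟩
    ε                             ∎
    where
    shift : ∀ n → g ∙ pow n g ≈ pow n g ∙ g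
    shift zero    = trans (identityʳ g) (sym (identityˡ g))
    shift (suc n) = trans (∙-congˡ (shift n)) (sym (assoc _ _ _))

  -- If x y has order 2 m, then (x y)ᵐ is central in the dihedral group ⟨ x , y ⟩.
  dihedral-centre : ∀ {x y n} → Involution G x → Involution G y → 2 ∣ n → HasOrder G (x ∙ y) n →
                    ∃[ z ] Involution G z × Comm x z × Comm z y
  dihedral-centre {x} {y} x-inv y-inv (divides m ≡.refl) o =
    z , z-inv , fix-comm (inverted x x-xy) , sym (fix-comm (inverted y y-xy))
    where
    open HasOrder o
    z = pow m (x ∙ y)
    z² : pow 2 z ≈ ε
    z² = trans (×-assocˡ (x ∙ y) 2 m) (trans (reflexive (≡.cong (λ k → pow k (x ∙ y)) (ℕ.*-comm 2 m))) power)
    0<m : 0 ℕ.< m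
    0<m = ℕ.n≢0⇒n>0 λ { ≡.refl → ℕ.<⇒≢ positive ≡.refl }
    m<m*2 : m ℕ.< m ℕ.* 2
    m<m*2 = ≡.subst (m ℕ.<_) (≡.trans (≡.cong (m ℕ.+_) (≡.sym (ℕ.+-identityʳ m))) (ℕ.*-comm 2 m))
      (ℕ.m<m+n m 0<m)
    z-inv : Involution G z
    z-inv = involution (pow-2⇒ z²) (λ e → ℕ.<⇒≱ m<m*2 (least m 0<m e))
    yx-xy : y ∙ x ∙ (x ∙ y) ≈ ε
    yx-xy = begin
      y ∙ x ∙ (x ∙ y)   ≈⟨ assoc y x _ ⟩
      y ∙ (x ∙ (x ∙ y)) ≈⟨ ∙-congˡ (trans (sym (assoc x x y)) (trans (∙-congʳ (square x-inv)) (identityˡ y))) ⟩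
      y ∙ y             ≈⟨ square y-inv ⟩
      ε                 ∎
    inverted : ∀ g → conj g (x ∙ y) ≈ y ∙ x → conj g z ≈ z
    inverted g e = begin
      conj g z          ≈⟨ pow-conj g m (x ∙ y) ⟨
      pow m (conj g (x ∙ y)) ≈⟨ ×-congʳ m e ⟩
      pow m (y ∙ x)     ≈⟨ inverseˡ-unique _ _ (pow-inverse m yx-xy) ⟩
      z ⁻¹              ≈⟨ self-inverse z-inv ⟩
      z                 ∎
    x-xy : conj x (x ∙ y) ≈ y ∙ x
    x-xy = ∙-cong (trans (sym (assoc x x y)) (trans (∙-congʳ (square x-inv)) (identityˡ y))) (self-inverse x-inv)
    y-xy : conj y (x ∙ y) ≈ y ∙ x
    y-xy = trans (∙-cong (sym (assoc y x y)) (self-inverse y-inv))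
      (trans (assoc _ y y) (trans (∙-congˡ (square y-inv)) (identityʳ _)))

  -- Among N + 1 powers of g two have the same code, so some positive power is trivial. The code
  -- only has to separate elements; it may differ on equal ones, which admits codes of representing
  -- matrices in a projective group.
  module FiniteOrder (_≟_ : ∀ x y → Dec (x ≈ y)) {N : ℕ} (code : Carrier → Fin N)
    (code-injective : ∀ {x y} → code x ≡ code y → x ≈ y) where

    private
      torsion : ∀ g → ∃[ n ] 0 ℕ.< n × pow n g ≈ ε
      torsion g with Fin.pigeonhole (ℕ.n<1+n N) (λ i → code (pow (toℕ i) g))
      ... | i , j , i<j , e = toℕ j ℕ.∸ toℕ i , ℕ.m<n⇒0<n∸m i<j , sym (∙-cancelˡ (pow (toℕ i) g) _ _ (begin
        pow (toℕ i) g ∙ ε                          ≈⟨ identityʳ _ ⟩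
        pow (toℕ i) g                              ≈⟨ code-injective e ⟩
        pow (toℕ j) g                              ≈⟨ reflexive (≡.cong (λ k → pow k g) (≡.sym (ℕ.m+[n∸m]≡n (ℕ.<⇒≤ i<j)))) ⟩
        pow (toℕ i ℕ.+ (toℕ j ℕ.∸ toℕ i)) g        ≈⟨ ×-homo-+ g (toℕ i) _ ⟩
        pow (toℕ i) g ∙ pow (toℕ j ℕ.∸ toℕ i) g    ∎))

      -- Invariant: every positive exponent that kills g is at least k, and `fuel + k` kills it.
      search : ∀ g fuel k → 0 ℕ.< k → (∀ m → 0 ℕ.< m → pow m g ≈ ε → k ℕ.≤ m) →
               pow (fuel ℕ.+ k) g ≈ ε → ∃[ n ] HasOrder G g n
      search g zero       k 0<k least e = k , record { positive = 0<k ; power = e ; least = least }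
      search g (suc fuel) k 0<k least e with pow k g ≟ ε
      ... | yes e′ = k , record { positive = 0<k ; power = e′ ; least = least }
      ... | no ¬e  = search g fuel (suc k) (s≤s z≤n)
        (λ m 0<m e′ → ℕ.≤∧≢⇒< (least m 0<m e′) (λ { ≡.refl → ¬e e′ }))
        (trans (reflexive (≡.cong (λ k → pow k g) (ℕ.+-suc fuel k))) e)

    order : ∀ g → ∃[ n ] HasOrder G g n
    order g with torsion g
    ... | suc n , _ , e = search g n 1 (s≤s z≤n) (λ _ 0<m _ → 0<m)
      (trans (reflexive (≡.cong (λ k → pow k g) (ℕ.+-comm n 1))) e)

-- Fusion graphs of groups of rank one

-- The involutions of a rank one group: x a are the central involutions of the
-- unipotent group { u s } fixing one point, and inv s b are those of the other
-- points, w exchanging the base point and the point with s = 0Q.  Ψ is the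
-- condition on the trace that detects order χ, and W is a Sylow 2-subgroup.
record RankOne {c ℓ a a′ b b′ p p′ : Level} (G : Group c ℓ) (r N₀ m χ : ℕ) :
               Set (lsuc (c ⊔ ℓ ⊔ a ⊔ a′ ⊔ b ⊔ b′ ⊔ p ⊔ p′)) where
  open Group G public
  open GroupLemmas G public
  infix 4 _≟_
  field
    _≟_            : ∀ g h → Dec (g ≈ h)
    {codes}        : ℕ
    code           : Carrier → Fin codes
    code-injective : ∀ {g h} → code g ≡ code h → g ≈ h
    U              : Setoid a a′
    Q              : Setoid b b′
  module U = Setoid U
  module Q = Setoid Q
  field
    U-size         : HasSize U m
    Q-size         : HasSize Q r
    x              : U.Carrier → Carrier
    x-cong         : ∀ {a b} → a U.≈ b → x a ≈ x b
    u              : Q.Carrier → Carrier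
    u-cong         : ∀ {s t} → s Q.≈ t → u s ≈ u t
    w              : Carrier
    0Q             : Q.Carrier
    u-0            : u 0Q ≈ ε
    1U             : U.Carrier
  y : U.Carrier → Carrier
  y b = conj w (x b)
  inv : Q.Carrier → U.Carrier → Carrier
  inv s b = conj (u s) (y b)
  field
    x-involution   : ∀ a → Involution G (x a)
    x-conj         : ∀ a → ∃[ g ] x a ≈ conj g (x 1U)
    x-injective    : ∀ {a b} → x a ≈ x b → a U.≈ b
    inv-injective  : ∀ {s t a b} → inv s a ≈ inv t b → s Q.≈ t × a U.≈ b
    classify       : ∀ g → Involution G g → (∃[ a ] g ≈ x a) ⊎ (∃[ s ] ∃[ b ] g ≈ inv s b)
    x-x-comm       : ∀ a b → Comm (x a) (x b)
    u-x-comm       : ∀ s a → Comm (u s) (x a)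
    x-y-noncomm    : ∀ a b → ¬ Comm (x a) (y b)
    -- In all three groups `ι` is a ↦ a⁻¹: the order of x a ∙ y b is χ when a b = 1.
    ι              : U.Carrier → U.Carrier
    ι-injective    : ∀ {a b} → ι a U.≈ ι b → a U.≈ b
    order-χ⇒       : ∀ a b → HasOrder G (x a ∙ y b) χ → b U.≈ ι a
    order-χ⇐       : ∀ a b → b U.≈ ι a → HasOrder G (x a ∙ y b) χ
    Ψ              : Pred Carrier p
    Ψ?             : Decidable Ψ
    Ψ-resp         : ∀ {g h} → g ≈ h → Ψ g → Ψ h
    Ψ-conj         : ∀ g {h} → Ψ h → Ψ (conj g h)
    Ψ⇒             : ∀ a b → Ψ (x a ∙ y b) → b U.≈ ι a
    Ψ⇐             : ∀ a b → b U.≈ ι a → Ψ (x a ∙ y b)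
    Ψ-y-y          : ∀ a b → ¬ Ψ (y a ∙ y b)
    -- The independence of N₀ from b and c is what makes the number of common neighbours constant on
    -- pairs that do not commute.
    Ψ-fibre        : ∀ b c → HasSize (subsetoid Q (λ s → Ψ (y b ∙ inv s c))) N₀
    W              : Pred Carrier p′
    W-∙            : ∀ {g h} → W g → W h → W (g ∙ h)
    W-comm         : ∀ {g} → W g → Comm g (x 1U)
    -- The Sylow 2-subgroups of PSU₃(q) and Sz(q) have exponent 4, those of PSL₂(q) have exponent 2.
    W-pow          : ∀ {g} → W g → pow 4 g ≈ ε
    -- Such a g normalises the Sylow subgroup of `x 1U`, so it lies in a Borel subgroup, whose
    -- elements of 2-power order are unipotent. This is what the maximality of W rests on.
    W-intro        : ∀ k a {g} → conj g (x 1U) ≈ x a → pow (2 ℕ.^ k) g ≈ ε → W g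

module FusionGraph {c ℓ α α′ β β′ ρ ρ′ : Level} {G : Group c ℓ} {r N₀ m χ : ℕ}
  (R : RankOne {c} {ℓ} {α} {α′} {β} {β′} {ρ} {ρ′} G r N₀ m χ)
  (t : Group.Carrier G) (t-inv : Involution G t) where

  open RankOne R
  open FiniteOrder _≟_ code code-injective
  open Counting
  open import Algebra.Properties.Group G using (inverseʳ-unique)
  open import Algebra.Properties.Monoid.Mult monoid using (×-congʳ)

  -- Commuting involutions and products of order χ

  private
    x₁ : Carrier
    x₁ = x 1U

    x₁-inv = x-involution 1U

    y-involution : ∀ b → Involution G (y b)
    y-involution b = HasOrder-conj w (x-involution b)

    inv-involution : ∀ s b → Involution G (inv s b)
    inv-involution s b = HasOrder-conj (u s) (y-involution b)

    inv-0 : ∀ b → inv 0Q b ≈ y b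
    inv-0 b = trans (conj-cong u-0 refl) (ε-conj _)

    u-x-fix : ∀ s a → conj (u s) (x a) ≈ x a
    u-x-fix s a = conj-fix (u-x-comm s a)

    x-inv-noncomm : ∀ a s b → ¬ Comm (x a) (inv s b)
    x-inv-noncomm a s b e =
      x-y-noncomm a b (Comm-unconj (u s) (Comm-resp (sym (u-x-fix s a)) refl e))

    conj-to : ∀ g → Involution G g → ∃[ h ] conj h x₁ ≈ g
    conj-to g g-inv with classify g g-inv
    ... | inj₁ (a , e) = let (h , e′) = x-conj a in h , trans (sym e′) (sym e)
    ... | inj₂ (s , b , e) = let (h , e′) = x-conj b in
      u s ∙ (w ∙ h) , trans (sym (conj-conj _ _ _)) (trans (conj-congʳ (u s)
        (trans (sym (conj-conj w h x₁)) (conj-congʳ w (sym e′)))) (sym e))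

    conj-from : ∀ g → Involution G g → ∃[ h ] conj h g ≈ x₁
    conj-from g g-inv = let (h , e) = conj-to g g-inv in h ⁻¹ , sym (conj-flip e)

    Comm-x₁ : ∀ {g} → Involution G g → Comm x₁ g → ∃[ a ] g ≈ x a
    Comm-x₁ {g} g-inv e with classify g g-inv
    ... | inj₁ p = p
    ... | inj₂ (s , b , e′) = contradiction (Comm-resp refl e′ e) (x-inv-noncomm 1U s b)

    off-label : ∀ {g} → Involution G g → ¬ Comm x₁ g → ∃[ s ] ∃[ b ] g ≈ inv s b
    off-label {g} g-inv ¬e with classify g g-inv
    ... | inj₁ (a , e) = contradiction (Comm-resp refl (sym e) (x-x-comm 1U a)) ¬e
    ... | inj₂ p = p

    -- After conjugation the middle involution is `x₁`; the involutions that commute with it are the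
    -- `x a`, and these commute with each other.
    Comm-trans : ∀ {g h k} → Involution G g → Involution G h → Involution G k →
                 Comm g h → Comm h k → Comm g k
    Comm-trans {g} {h} {k} g-inv h-inv k-inv e e′ with conj-from h h-inv
    ... | z , zh with Comm-x₁ (HasOrder-conj z g-inv) (Comm-resp zh refl (Comm-conj z (sym e)))
                    | Comm-x₁ (HasOrder-conj z k-inv) (Comm-resp zh refl (Comm-conj z e′))
    ... | a , ea | a′ , ea′ = Comm-unconj z (Comm-resp (sym ea) (sym ea′) (x-x-comm a a′))

    -- By transitivity `inv s c` belongs to the class of the `y a`, so it equals some `y a`, that is
    -- `inv 0Q a`, and the label s of an involution is unique.
    y-inv-comm : ∀ {b s c} → Comm (y b) (inv s c) → s Q.≈ 0Q
    y-inv-comm {b} {s} {c} e = proj₁ (inv-injective (trans inv≈y (sym (inv-0 a))))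
      where
      y-y : Comm (y c) (inv s c)
      y-y = Comm-trans (y-involution c) (y-involution b) (inv-involution s c)
        (Comm-conj w (x-x-comm c b)) e
      x-conj-inv : Comm (x c) (conj (w ⁻¹) (inv s c))
      x-conj-inv = Comm-resp (conj-inverseˡ w _) refl (Comm-conj (w ⁻¹) y-y)
      member : ∃[ a ] conj (w ⁻¹) (inv s c) ≈ x a
      member = Comm-x₁ (HasOrder-conj (w ⁻¹) (inv-involution s c))
        (Comm-trans x₁-inv (x-involution c) (HasOrder-conj (w ⁻¹) (inv-involution s c))
          (x-x-comm 1U c) x-conj-inv)
      a = proj₁ member
      inv≈y : inv s c ≈ y a
      inv≈y = trans (sym (conj-inverseʳ w _)) (conj-congʳ w (proj₂ member))

    y-inv-comm′ : ∀ {b s c} → s Q.≈ 0Q → Comm (y b) (inv s c)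
    y-inv-comm′ {b} {s} {c} e = Comm-resp refl
      (sym (trans (conj-cong (u-cong e) refl) (inv-0 c))) (Comm-conj w (x-x-comm b c))

    Comm? : ∀ g h → Dec (Comm g h)
    Comm? g h = (g ∙ h) ≟ (h ∙ g)

    odd-order : ∀ {g h n} → Involution G g → Involution G h → ¬ Comm g h →
                HasOrder G (g ∙ h) n → ¬ 2 ∣ n
    odd-order g-inv h-inv ¬comm o even with dihedral-centre g-inv h-inv even o
    ... | z , z-inv , e , e′ = ¬comm (Comm-trans g-inv z-inv h-inv e e′)

    Ψ-unconj : ∀ g {h} → Ψ (conj g h) → Ψ h
    Ψ-unconj g p = Ψ-resp (conj-inverseˡ g _) (Ψ-conj (g ⁻¹) p)

    -- Conjugation first moves g to `x₁`; the elements `u s`, which fix `x₁`, then move the second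
    -- Sylow subgroup to that of the `y b`. Statements invariant under conjugation, such as the
    -- equivalence of order χ with `Ψ`, need checking for these pairs only.
    normal-form : ∀ {g h} → Involution G g → Involution G h → ¬ Comm g h →
                  ∃[ z ] ∃[ b ] conj z (g ∙ h) ≈ x₁ ∙ y b
    normal-form {g} {h} g-inv h-inv ¬comm with conj-from g g-inv
    ... | z , zg with classify (conj z h) (HasOrder-conj z h-inv)
    ... | inj₁ (a , e) = contradiction
      (Comm-unconj z (Comm-resp (sym zg) (sym e) (x-x-comm 1U a))) ¬comm
    ... | inj₂ (s , b , e) = u s ⁻¹ ∙ z , b , trans (sym (conj-conj _ _ _))
      (trans (conj-congʳ _ (trans (conj-∙ z g h) (∙-cong (trans zg (sym (u-x-fix s 1U))) e)))
      (trans (conj-congʳ _ (sym (conj-∙ (u s) x₁ (y b)))) (conj-inverseˡ (u s) _)))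

    order-χ⇒Ψ : ∀ {g h} → Involution G g → Involution G h → ¬ Comm g h →
                HasOrder G (g ∙ h) χ → Ψ (g ∙ h)
    order-χ⇒Ψ g-inv h-inv ¬comm o with normal-form g-inv h-inv ¬comm
    ... | z , b , e = Ψ-unconj z (Ψ-resp (sym e)
      (Ψ⇐ 1U b (order-χ⇒ 1U b (HasOrder-resp G e (HasOrder-conj z o)))))

    Ψ⇒order-χ : ∀ {g h} → Involution G g → Involution G h → ¬ Comm g h →
                Ψ (g ∙ h) → HasOrder G (g ∙ h) χ
    Ψ⇒order-χ g-inv h-inv ¬comm o with normal-form g-inv h-inv ¬comm
    ... | z , b , e = HasOrder-unconj z (HasOrder-resp G (sym e)
      (order-χ⇐ 1U b (Ψ⇒ 1U b (Ψ-resp e (Ψ-conj z o)))))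

    x-inv-χ⇒ : ∀ a s b → HasOrder G (x a ∙ inv s b) χ → b U.≈ ι a
    x-inv-χ⇒ a s b o = order-χ⇒ a b (HasOrder-unconj (u s) (HasOrder-resp G
      (sym (trans (conj-∙ (u s) _ _) (∙-congʳ (u-x-fix s a)))) o))

    x-inv-χ⇐ : ∀ a s b → b U.≈ ι a → HasOrder G (x a ∙ inv s b) χ
    x-inv-χ⇐ a s b e = HasOrder-resp G
      (trans (conj-∙ (u s) _ _) (∙-congʳ (u-x-fix s a))) (HasOrder-conj (u s) (order-χ⇐ a b e))

  -- Adjacency, automorphisms and numbers of common neighbours

  Γ = fusionGraph G (ConjugacyClass G t) (oddOrdersExcept G χ)
  open Graph Γ using (Vertex; Adj; Adj-resp; vertices)

  private
    X-inv : ∀ (v : Vertex) → Involution G (proj₁ v)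
    X-inv (v , g , e) = HasOrder-resp G (sym e) (HasOrder-conj g t-inv)

    -- Both t and g are conjugate to `x₁`, so the class of t contains every involution, whichever t
    -- is given.
    vertex : ∀ g → Involution G g → Vertex
    vertex g g-inv = g , k ∙ h ⁻¹ , trans (sym ke) (trans (conj-congʳ k (sym (conj-flip-t)))
        (conj-conj k (h ⁻¹) t))
      where
      h = proj₁ (conj-to t t-inv)
      k = proj₁ (conj-to g g-inv)
      ke = proj₂ (conj-to g g-inv)
      conj-flip-t : conj (h ⁻¹) t ≈ x₁
      conj-flip-t = sym (conj-flip (proj₂ (conj-to t t-inv)))

    vx : U.Carrier → Vertex
    vx a = vertex (x a) (x-involution a)

    vinv : Q.Carrier → U.Carrier → Vertex
    vinv s b = vertex (inv s b) (inv-involution s b)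

    -- If g and h commute then g h squares to the identity, and an odd order of g h forces g = h.
    Adj⇒ : ∀ v w → Adj v w → ¬ Comm (proj₁ v) (proj₁ w) × ¬ HasOrder G (proj₁ v ∙ proj₁ w) χ
    Adj⇒ v@(g , _) w@(h , _) (g≉h , n , (odd , _ , _ , n≢χ) , o) = ¬comm , λ o′ → n≢χ (HasOrder-unique o o′)
      where
      ¬comm : ¬ Comm g h
      ¬comm e = g≉h (trans (sym (trans (assoc g h h) (trans (∙-congˡ (square (X-inv w))) (identityʳ g))))
        (trans (∙-congʳ (odd-power odd gh² (HasOrder.power o))) (identityˡ h)))
        where
        gh² : g ∙ h ∙ (g ∙ h) ≈ ε
        gh² = trans (∙-congʳ e) (trans (assoc h g _) (trans (∙-congˡ (trans (sym (assoc g g h))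
          (trans (∙-congʳ (square (X-inv v))) (identityˡ h)))) (square (X-inv w))))

    -- The order of g h exists by finiteness and is odd by the dihedral argument, which also
    -- excludes 2; g h itself shows that it is an element order.
    Adj⇐ : ∀ v w → ¬ Comm (proj₁ v) (proj₁ w) → ¬ HasOrder G (proj₁ v ∙ proj₁ w) χ → Adj v w
    Adj⇐ v@(g , _) w@(h , _) ¬comm ¬χ with order (g ∙ h)
    ... | n , o = (λ e → ¬comm (trans (∙-congʳ e) (∙-congˡ (sym e)))) , n ,
      (odd , (g ∙ h , o) , (λ { ≡.refl → odd (divides 1 ≡.refl) }) , (λ { ≡.refl → ¬χ o })) , o
      where odd = odd-order (X-inv v) (X-inv w) ¬comm o

    φ : Carrier → Inverse vertices vertices
    φ h = mkInverse vertices vertices (move h) (move (h ⁻¹)) (conj-congʳ h) (conj-congʳ (h ⁻¹))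
      (λ v → conj-inverseʳ h (proj₁ v)) (λ v → conj-inverseˡ h (proj₁ v))
      where
      move : Carrier → Vertex → Vertex
      move h (v , g , e) = conj h v , h ∙ g , trans (conj-congʳ h e) (conj-conj h g t)

    infixr 9 _▹_
    _▹_ : Carrier → Vertex → Vertex
    h ▹ v = Inverse.to (φ h) v

    ▹-Adj : ∀ h v w → Adj v w → Adj (h ▹ v) (h ▹ w)
    ▹-Adj h v w (v≉w , n , π , o) =
      (λ e → v≉w (conj-injective h e)) , n , π , HasOrder-resp G (conj-∙ h _ _) (HasOrder-conj h o)

    ▹-Adj′ : ∀ h v w → Adj (h ▹ v) (h ▹ w) → Adj v w
    ▹-Adj′ h v w (v≉w , n , π , o) =
      (λ e → v≉w (conj-congʳ h e)) , n , π , HasOrder-unconj h (HasOrder-resp G (sym (conj-∙ h _ _)) o)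

    module _ (h : Carrier) {v v′ : Vertex} (ev : conj h (proj₁ v) ≈ proj₁ v′) where

      ▹-Adjʳ : ∀ z → Adj v z → Adj v′ (h ▹ z)
      ▹-Adjʳ z p = Adj-resp {h ▹ v} {v′} {h ▹ z} {h ▹ z} ev refl (▹-Adj h v z p)

      ▹-Adjˡ : ∀ z → Adj v′ z → Adj v (Inverse.from (φ h) z)
      ▹-Adjˡ z p = ▹-Adj′ h v (Inverse.from (φ h) z) (Adj-resp {v′} {h ▹ v} {z} {h ▹ Inverse.from (φ h) z}
        (sym ev) (sym (conj-inverseʳ h (proj₁ z))) p)

      neighbours-reduce : ∀ {n} → HasSize (subsetoid vertices (Adj v′)) n →
                          HasSize (subsetoid vertices (Adj v)) n
      neighbours-reduce = Comp.inverse (restrict vertices vertices (φ h) ▹-Adjʳ ▹-Adjˡ)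

    module _ (h : Carrier) {v v′ w w′ : Vertex}
      (ev : conj h (proj₁ v) ≈ proj₁ v′) (ew : conj h (proj₁ w) ≈ proj₁ w′) where

      common-reduce : ∀ {n} → CommonNeighbours Γ v′ w′ n → CommonNeighbours Γ v w n
      common-reduce = Comp.inverse (restrict vertices vertices (φ h)
        (λ z (p , q) → ▹-Adjʳ h {v} {v′} ev z p , ▹-Adjʳ h {w} {w′} ew z q)
        (λ z (p , q) → ▹-Adjˡ h {v} {v′} ev z p , ▹-Adjˡ h {w} {w′} ew z q))

    -- An involution that does not commute with `x₁` has a unique label `inv s b`, so a set of them
    -- is counted by its labels. The labels are fibred over b because adjacency to an `x a`
    -- restricts b alone, and the fibres in s then have constant size.
    off-size : ∀ {p d e} (P : Pred Vertex p) (D : Pred U.Carrier d) (E : U.Carrier → Pred Q.Carrier e) →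
      (∀ {v w} → proj₁ v ≈ proj₁ w → P v → P w) → (∀ v → P v → ¬ Comm x₁ (proj₁ v)) →
      (∀ {b b′ s} → b U.≈ b′ → E b s → E b′ s) →
      (∀ s b → P (vinv s b) → D b × E b s) → (∀ s b → D b → E b s → P (vinv s b)) →
      ∀ {k l} → HasSize (subsetoid U D) k → (∀ b → D b → HasSize (subsetoid Q (E b)) l) →
      HasSize (subsetoid vertices P) (k ℕ.* l)
    off-size {p} {d} {e} P D E P-resp P⇒ E-resp to-label from-label {k} {l} sD sE =
      size-transport {A = L} {B = V} (mkInverse L V enc dec
        (λ {x} {y} → enc-cong x y)
        (λ {v} {w} e → inv-inj (dec v) (dec w) (trans (sym (enc-dec v)) (trans e (enc-dec w))))
        (λ v → sym (enc-dec v))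
        (λ l → inv-inj (dec (enc l)) l (sym (enc-dec (enc l)))))
      (size-fibred (subsetoid U D) Q (λ (b , _) s → E b s) (λ e → E-resp e) sD (λ (b , d) → sE b d))
      where
      L = subsetoid (subsetoid U D ×ₛ Q) (λ ((b , _) , s) → E b s)
      V = subsetoid vertices P
      module L = Setoid L
      enc : L.Carrier → Σ Vertex P
      enc (((b , d) , s) , e) = vinv s b , from-label s b d e
      enc-cong : ∀ x y → x L.≈ y → proj₁ (proj₁ (enc x)) ≈ proj₁ (proj₁ (enc y))
      enc-cong x y (eb , es) = conj-cong (u-cong es) (conj-congʳ w (x-cong eb))
      label : ∀ v → P v → ∃[ s ] ∃[ b ] proj₁ v ≈ inv s b
      label v p = off-label (X-inv v) (P⇒ v p)
      dec : Σ Vertex P → L.Carrier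
      dec (v , p) = ((proj₁ (proj₂ (label v p)) , proj₁ q) , proj₁ (label v p)) , proj₂ q
        where
        q : D (proj₁ (proj₂ (label v p))) × E (proj₁ (proj₂ (label v p))) (proj₁ (label v p))
        q = to-label _ _ (P-resp {v} {vinv _ _} (proj₂ (proj₂ (label v p))) p)
      enc-dec : ∀ (v : Σ Vertex P) → proj₁ (proj₁ v) ≈ proj₁ (proj₁ (enc (dec v)))
      enc-dec (v , p) = proj₂ (proj₂ (label v p))
      inv-inj : ∀ x y → proj₁ (proj₁ (enc x)) ≈ proj₁ (proj₁ (enc y)) → x L.≈ y
      inv-inj x y e = proj₂ (inv-injective e) , proj₁ (inv-injective e)

    module FU = Finite U U-size
    module FQ = Finite Q Q-size

    class-size : HasSize (subsetoid vertices (λ v → Comm x₁ (proj₁ v))) m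
    class-size = size-transport (mkInverse U (subsetoid vertices (λ v → Comm x₁ (proj₁ v)))
      (λ a → vx a , x-x-comm 1U a) (λ (v , e) → proj₁ (Comm-x₁ (X-inv v) e))
      x-cong
      (λ {(v , p)} {(w , q)} e → x-injective (trans (sym (proj₂ (Comm-x₁ (X-inv v) p)))
        (trans e (proj₂ (Comm-x₁ (X-inv w) q)))))
      (λ (v , p) → sym (proj₂ (Comm-x₁ (X-inv v) p)))
      (λ a → x-injective (sym (proj₂ (Comm-x₁ (X-inv (vx a)) (x-x-comm 1U a))))))
      U-size

    vertices-size : HasSize vertices (m ℕ.+ m ℕ.* r)
    vertices-size = size-transport
      (Partition.partition vertices (λ e p → Comm-resp refl e p) (λ v → Comm? x₁ (proj₁ v)))
      (size-⊎ _ _ class-size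
        (off-size (λ v → ¬ Comm x₁ (proj₁ v)) (λ _ → ⊤) (λ _ _ → ⊤)
          (λ e p q → p (Comm-resp refl (sym e) q)) (λ _ p → p) (λ _ _ → tt)
          (λ _ _ _ → tt , tt) (λ s b _ _ → x-inv-noncomm 1U s b)
          (size-⊤ U-size) (λ _ _ → size-⊤ Q-size)))

    U-minus : ∀ a → HasSize (subsetoid U (λ b → ¬ b U.≈ a)) (m ℕ.∸ 1)
    U-minus a = Subset.complement-size U U-size (λ e p → U.trans (U.sym e) p) (λ b → FU.dec b a)
      (singleton-size U a)

    x₁-regular : HasSize (subsetoid vertices (Adj (vx 1U))) ((m ℕ.∸ 1) ℕ.* r)
    x₁-regular = off-size (Adj (vx 1U)) (λ b → ¬ b U.≈ ι 1U) (λ _ _ → ⊤)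
      (λ {v} {w} e p → Adj-resp {vx 1U} {vx 1U} {v} {w} refl e p)
      (λ v p → proj₁ (Adj⇒ (vx 1U) v p)) (λ _ _ → tt)
      (λ s b p → (λ e → proj₂ (Adj⇒ (vx 1U) (vinv s b) p) (x-inv-χ⇐ 1U s b e)) , tt)
      (λ s b d _ → Adj⇐ (vx 1U) (vinv s b) (x-inv-noncomm 1U s b) (λ o → d (x-inv-χ⇒ 1U s b o)))
      (U-minus (ι 1U)) (λ _ _ → size-⊤ Q-size)

    same-count other-count : ℕ
    same-count = (m ℕ.∸ 1 ℕ.∸ 1) ℕ.* r
    other-count = (m ℕ.∸ 1) ℕ.* (r ℕ.∸ 1 ℕ.∸ N₀)

    -- The two involutions rule out the labels `ι 1U` and `ι a`, different by injectivity, in each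
    -- of the r other Sylow subgroups; nothing in their own class is adjacent to them.
    x₁-same : ∀ a → ¬ 1U U.≈ a → CommonNeighbours Γ (vx 1U) (vx a) same-count
    x₁-same a 1≉a = off-size (λ v → Adj (vx 1U) v × Adj (vx a) v) (λ b → ¬ b U.≈ ι 1U × ¬ b U.≈ ι a) (λ _ _ → ⊤)
      (λ {v} {w} e (p , q) → Adj-resp {vx 1U} {vx 1U} {v} {w} refl e p , Adj-resp {vx a} {vx a} {v} {w} refl e q)
      (λ v (p , _) → proj₁ (Adj⇒ (vx 1U) v p)) (λ _ _ → tt)
      (λ s b (p , q) → ((λ e → proj₂ (Adj⇒ (vx 1U) (vinv s b) p) (x-inv-χ⇐ 1U s b e))
                      , (λ e → proj₂ (Adj⇒ (vx a) (vinv s b) q) (x-inv-χ⇐ a s b e))) , tt)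
      (λ s b (d , d′) _ → Adj⇐ (vx 1U) (vinv s b) (x-inv-noncomm 1U s b) (λ o → d (x-inv-χ⇒ 1U s b o))
                        , Adj⇐ (vx a) (vinv s b) (x-inv-noncomm a s b) (λ o → d′ (x-inv-χ⇒ a s b o)))
      (size-flatten U (λ b → ¬ b U.≈ ι 1U) (λ b → ¬ b U.≈ ι a)
        (Subset.complement-size (subsetoid U (λ b → ¬ b U.≈ ι 1U)) (U-minus (ι 1U))
          (λ e p → U.trans (U.sym e) p) (λ (b , _) → FU.dec b (ι a))
          (singleton-size (subsetoid U (λ b → ¬ b U.≈ ι 1U)) (ι a , λ e → 1≉a (U.sym (ι-injective e))))))
      (λ _ _ → size-⊤ Q-size)

    y-inv-Ψ-resp : ∀ {b s s′ c} → s Q.≈ s′ → Ψ (y b ∙ inv s c) → Ψ (y b ∙ inv s′ c)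
    y-inv-Ψ-resp e = Ψ-resp (∙-congˡ (conj-cong (u-cong e) refl))

    Ψ⇒≉0 : ∀ {b s c} → Ψ (y b ∙ inv s c) → ¬ s Q.≈ 0Q
    Ψ⇒≉0 {b} {s} {c} p e = Ψ-y-y b c (Ψ-resp (∙-congˡ (trans (conj-cong (u-cong e) refl) (inv-0 c))) p)

    -- `Ψ` fails at `0Q`, so removing `0Q` leaves its fibre whole and the two subtractions are
    -- independent.
    off-χ-size : ∀ b c → HasSize (subsetoid Q (λ s → ¬ s Q.≈ 0Q × ¬ Ψ (y b ∙ inv s c))) (r ℕ.∸ 1 ℕ.∸ N₀)
    off-χ-size b c = size-flatten Q (λ s → ¬ s Q.≈ 0Q) (λ s → ¬ Ψ (y b ∙ inv s c))
      (Subset.complement-size (subsetoid Q (λ s → ¬ s Q.≈ 0Q))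
        (Subset.complement-size Q Q-size (λ e p → Q.trans (Q.sym e) p) (λ s → FQ.dec s 0Q) (singleton-size Q 0Q))
        y-inv-Ψ-resp (λ (s , _) → Ψ? (y b ∙ inv s c))
        (size-transport (mkInverse (subsetoid Q (λ s → Ψ (y b ∙ inv s c)))
            (subsetoid (subsetoid Q (λ s → ¬ s Q.≈ 0Q)) (λ (s , _) → Ψ (y b ∙ inv s c)))
            (λ (s , p) → (s , Ψ⇒≉0 p) , p) (λ ((s , _) , p) → s , p) id id
            (λ _ → Q.refl) (λ _ → Q.refl))
          (Ψ-fibre b c)))

    vy : U.Carrier → Vertex
    vy b = vertex (y b) (y-involution b)

    -- For each of the m - 1 labels c that `x₁` admits, y b excludes s = `0Q`, where the involutions
    -- commute with it, and the N₀ values of s with product of order χ.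
    x₁-other : ∀ b → CommonNeighbours Γ (vx 1U) (vy b) other-count
    x₁-other b = off-size (λ v → Adj (vx 1U) v × Adj (vy b) v)
      (λ c → ¬ c U.≈ ι 1U) (λ c s → ¬ s Q.≈ 0Q × ¬ Ψ (y b ∙ inv s c))
      (λ {v} {w} e (p , q) → Adj-resp {vx 1U} {vx 1U} {v} {w} refl e p , Adj-resp {vy b} {vy b} {v} {w} refl e q)
      (λ v (p , _) → proj₁ (Adj⇒ (vx 1U) v p))
      (λ e (p , q) → p , λ r → q (Ψ-resp (∙-congˡ (conj-congʳ _ (conj-congʳ w (x-cong (U.sym e))))) r))
      (λ s c (p , q) → (λ e → proj₂ (Adj⇒ (vx 1U) (vinv s c) p) (x-inv-χ⇐ 1U s c e)) ,
        let (¬comm , ¬χ) = Adj⇒ (vy b) (vinv s c) q in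
        (λ e → ¬comm (y-inv-comm′ e)) , (λ ψ → ¬χ (Ψ⇒order-χ (y-involution b) (inv-involution s c) ¬comm ψ)))
      (λ s c d (s≉0 , ¬ψ) → Adj⇐ (vx 1U) (vinv s c) (x-inv-noncomm 1U s c) (λ o → d (x-inv-χ⇒ 1U s c o)) ,
        let ¬comm = λ e → s≉0 (y-inv-comm e) in
        Adj⇐ (vy b) (vinv s c) ¬comm (λ o → ¬ψ (order-χ⇒Ψ (y-involution b) (inv-involution s c) ¬comm o)))
      (U-minus (ι 1U)) (λ c _ → off-χ-size b c)

    regular : Regular Γ ((m ℕ.∸ 1) ℕ.* r)
    regular v = let (h , e) = conj-from (proj₁ v) (X-inv v) in
      neighbours-reduce h {v} {vx 1U} e x₁-regular

    same : ∀ v w → ¬ proj₁ v ≈ proj₁ w → Comm (proj₁ v) (proj₁ w) → CommonNeighbours Γ v w same-count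
    same v w v≉w e with conj-from (proj₁ v) (X-inv v)
    ... | h , hv with Comm-x₁ (HasOrder-conj h (X-inv w)) (Comm-resp hv refl (Comm-conj h e))
    ... | a , hw = common-reduce h {v} {vx 1U} {w} {vx a} hv hw (x₁-same a
      (λ e′ → v≉w (conj-injective h (trans hv (trans (x-cong e′) (sym hw))))))

    other : ∀ v w → ¬ Comm (proj₁ v) (proj₁ w) → CommonNeighbours Γ v w other-count
    other v w ¬comm with conj-from (proj₁ v) (X-inv v)
    ... | h , hv with classify (conj h (proj₁ w)) (HasOrder-conj h (X-inv w))
    ... | inj₁ (a , e) = contradiction
      (Comm-unconj h (Comm-resp (sym hv) (sym e) (x-x-comm 1U a))) ¬comm
    -- The second reduction, by `u s ⁻¹`, fixes `x₁` and moves the label s to `0Q`.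
    ... | inj₂ (s , b , e) = common-reduce h {v} {vx 1U} {w} {vinv s b} hv e
      (common-reduce (u s ⁻¹) {vx 1U} {vx 1U} {vinv s b} {vy b}
        (sym (conj-flip (u-x-fix s 1U))) (conj-inverseˡ (u s) (y b)) (x₁-other b))

    vertex-transitive : VertexTransitive Γ
    vertex-transitive v w = record
      { bijection = φ h
      ; preserves = λ z z′ → mk⇔ (▹-Adj h z z′) (▹-Adj′ h z z′) } ,
      trans (sym (conj-conj _ _ _)) (trans (conj-congʳ _ (proj₂ (conj-from (proj₁ v) (X-inv v))))
        (proj₂ (conj-to (proj₁ w) (X-inv w))))
      where h = proj₁ (conj-to (proj₁ w) (X-inv w)) ∙ proj₁ (conj-from (proj₁ v) (X-inv v))

    edge-regular : EdgeRegular Γ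
    -- Adjacent involutions do not commute, so only the count for different classes occurs.
    edge-regular = (_ , regular) , (_ , λ v w p → other v w (proj₁ (Adj⇒ v w p)))

    inhabited : ∀ {a ℓ n} {S : Setoid a ℓ} → 0 ℕ.< n → HasSize S n → Setoid.Carrier S
    inhabited 0<n s = Inverse.from s (fromℕ< 0<n)

    Adj? : ∀ v w → Dec (Adj v w)
    Adj? v w with Comm? (proj₁ v) (proj₁ w)
    ... | yes e = no λ p → proj₁ (Adj⇒ v w p) e
    ... | no ¬e with order (proj₁ v ∙ proj₁ w)
    ... | n , o with n ℕ.≟ χ
    ... | yes ≡.refl = no λ p → proj₂ (Adj⇒ v w p) o
    ... | no n≢χ = yes (Adj⇐ v w ¬e (λ o′ → n≢χ (HasOrder-unique o o′)))

  -- Diameter two, the divisible design and the Sylow 2-subgroups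

  module _ (0<same : 0 ℕ.< (m ℕ.∸ 1 ℕ.∸ 1) ℕ.* r) (0<other : 0 ℕ.< (m ℕ.∸ 1) ℕ.* (r ℕ.∸ 1 ℕ.∸ N₀))
           (1<m : 0 ℕ.< m ℕ.∸ 1) where

    private
      common : ∀ v w → ¬ proj₁ v ≈ proj₁ w → ∃[ z ] Adj v z × Adj w z
      common v w v≉w with Comm? (proj₁ v) (proj₁ w)
      ... | yes e = inhabited 0<same (same v w v≉w e)
      ... | no ¬e = inhabited 0<other (other v w ¬e)

      walk₂ : ∀ v w → ¬ proj₁ v ≈ proj₁ w → ¬ Adj v w → Distance Γ v w 2
      walk₂ v w v≉w ¬adj = let (z , p , q) = common v w v≉w in
        step {x = v} {z} {w} p (step {x = z} {w} {w} (Graph.Adj-sym Γ {w} {z} q) (here refl)) , far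
        where
        far : ∀ d → Walk Γ v w d → 2 ℕ.≤ d
        far 0 (here e) = contradiction e v≉w
        far 1 (step {y = z} p (here e)) = contradiction (Adj-resp {v} {v} {z} {w} refl e p) ¬adj
        far (suc (suc d)) _ = s≤s (s≤s z≤n)

    -- Distance 2 is attained inside a class: commuting involutions are never adjacent, and since m
    -- > 1 the class of `x₁` has a second member.
    diameter : HasDiameter Γ 2
    diameter = distance , vx 1U , vx a , walk₂ (vx 1U) (vx a) (λ e → a≉1 (U.sym (x-injective e)))
        (λ p → proj₁ (Adj⇒ (vx 1U) (vx a) p) (x-x-comm 1U a))
      where
      other-a : Σ U.Carrier λ b → ¬ b U.≈ 1U
      other-a = inhabited 1<m (U-minus 1U)
      a = proj₁ other-a
      a≉1 = proj₂ other-a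
      distance : ∀ v w → ∃[ d ] Distance Γ v w d × d ℕ.≤ 2
      distance v w with proj₁ v ≟ proj₁ w | Adj? v w
      ... | yes e | _ = 0 , (here e , λ _ _ → z≤n) , z≤n
      ... | no ¬e | yes p = 1 , (step {x = v} {w} {w} p (here refl) , near) , s≤s z≤n
        where
        near : ∀ d → Walk Γ v w d → 1 ℕ.≤ d
        near 0 (here e) = contradiction e ¬e
        near (suc d) _ = s≤s z≤n
      ... | no ¬e | no ¬p = 2 , walk₂ v w ¬e ¬p , ℕ.≤-refl

    private
      infix 4 _∼_
      _∼_ : Vertex → Vertex → Set (c ⊔ ℓ)
      v ∼ w = Lift c (Comm (proj₁ v) (proj₁ w))

      class-∼ : ∀ v → HasSize (subsetoid vertices (v ∼_)) m
      class-∼ v = let (h , hv) = conj-from (proj₁ v) (X-inv v) in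
        Comp.inverse (restrict vertices vertices (φ h)
          (λ z (lift e) → Comm-resp hv refl (Comm-conj h e))
          (λ z e → lift (Comm-unconj h (Comm-resp (sym hv) (sym (conj-inverseʳ h (proj₁ z))) e))))
        class-size

      ddg : IsDivisibleDesignGraph Γ _∼_
      ddg = record
        { regular = _ , regular
        ; canonical = record
          { equivalence = record
            { refl  = lift refl
            ; sym   = λ (lift e) → lift (sym e)
            ; trans = λ {u} {v} {w} (lift e) (lift e′) → lift (Comm-trans (X-inv u) (X-inv v) (X-inv w) e e′)
            }
          ; respects   = λ e → lift (trans (∙-congʳ e) (∙-congˡ (sym e)))
          ; classSize  = _ , class-∼
          ; sameClass  = _ , λ v w v≉w (lift e) → same v w v≉w e
          ; otherClass = _ , λ v w ¬e → other v w (λ e → ¬e (lift e))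
          }
        }

      -- The Sylow subgroup of v, described without a conjugating element: the elements of exponent
      -- dividing 4 that centralise v. Closure under products is carried over from `W` by
      -- conjugation.
      S : Vertex → Pred Carrier (c ⊔ ℓ)
      S v g = Lift c (Comm g (proj₁ v) × pow 4 g ≈ ε)

      to-W : ∀ {h v g} → conj h (proj₁ v) ≈ x₁ → S v g → W (conj h g)
      to-W {h} hv (lift (e , e′)) = W-intro 2 1U
        (conj-fix (Comm-resp refl hv (Comm-conj h e))) (pow-conj-ε h 4 e′)

      from-W : ∀ {h v g} → conj h (proj₁ v) ≈ x₁ → W (conj h g) → S v g
      from-W {h} hv p = lift
        ( Comm-unconj h (Comm-resp refl (sym hv) (W-comm p))
        , trans (×-congʳ 4 (sym (conj-inverseˡ h _))) (pow-conj-ε (h ⁻¹) 4 (W-pow p)))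

      S-isSubgroup : ∀ v → IsSubgroup G (S v)
      S-isSubgroup v = record
        { resp      = λ e (lift (p , q)) → lift (Comm-resp e refl p , trans (×-congʳ 4 (sym e)) q)
        ; ε-closed  = lift (trans (identityˡ _) (sym (identityʳ _)) , pow-ε 4)
        ; ∙-closed  = λ p q → let (h , hv) = conj-from (proj₁ v) (X-inv v) in
            from-W {h} {v} hv (W-resp h hv (to-W {h} {v} hv p) (to-W {h} {v} hv q))
        ; ⁻¹-closed = λ {g} (lift (p , q)) → lift
            ( fix-comm (trans (conj-congʳ _ (sym (conj-fix p))) (conj-inverseˡ g _))
            , trans (sym (identityˡ _)) (trans (∙-congʳ (sym q)) (pow-inverse 4 (inverseʳ g))))
        }
        where
        W-resp : ∀ h → conj h (proj₁ v) ≈ x₁ → ∀ {g k} → W (conj h g) → W (conj h k) → W (conj h (g ∙ k))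
        W-resp h hv {g} {k} p q = W-intro 2 1U
          (conj-fix (Comm-resp (sym (conj-∙ h g k)) refl (W-comm (W-∙ p q))))
          (trans (×-congʳ 4 (conj-∙ h g k)) (W-pow (W-∙ p q)))

      two-power : ∀ g → pow 4 g ≈ ε → ∃[ k ] HasOrder G g (2 ℕ.^ k)
      two-power g e with g ≟ ε
      ... | yes g≈ε = 0 , record { positive = s≤s z≤n ; power = trans (identityʳ g) g≈ε ; least = λ _ 0<m _ → 0<m }
      ... | no g≉ε with (g ∙ g) ≟ ε
      ... | yes g²≈ε = 1 , involution g²≈ε g≉ε
      ... | no g²≉ε = 2 , record { positive = s≤s z≤n ; power = e ; least = least }
        where
        least : ∀ m → 0 ℕ.< m → pow m g ≈ ε → 4 ℕ.≤ m
        least 1 _ e′ = contradiction (trans (sym (identityʳ g)) e′) g≉ε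
        least 2 _ e′ = contradiction (pow-2⇒ e′) g²≉ε
        least 3 _ e′ = contradiction (trans (sym (trans (∙-congˡ e′) (identityʳ g))) e) g≉ε
        least (suc (suc (suc (suc m)))) _ _ = s≤s (s≤s (s≤s (s≤s z≤n)))

      -- Let g belong to a larger 2-subgroup K. If `g₀` and its conjugate by g commute, then g maps
      -- the class of `g₀` to itself and `W-intro` applies. If not, their product lies in K and has
      -- odd order, hence order 1; then the two involutions are equal and do commute.
      sylow : ∀ v → IsSylow G 2 (S v)
      sylow v = (S-isSubgroup v , λ g (lift (_ , e)) → two-power g e) , maximal
        where
        g₀ = proj₁ v
        v∈S : S v g₀
        v∈S = lift (refl , pow-* 2 {2} (HasOrder.power (X-inv v)))
        maximal : ∀ (K : Pred Carrier (c ⊔ ℓ)) → IsPSubgroup G 2 K → (∀ {g} → S v g → K g) → ∀ {g} → K g → S v g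
        maximal K (K≤G , K-2) S⊆K {g} g∈K with Comm? g₀ (conj g g₀)
        ... | yes e = inside
          where
          h = proj₁ (conj-from g₀ (X-inv v))
          hv = proj₂ (conj-from g₀ (X-inv v))
          twist : conj (conj h g) x₁ ≈ conj h (conj g g₀)
          twist = trans (conj-congʳ _ (sym hv)) (trans (conj-conj _ h _) (trans
            (conj-cong (trans (assoc _ _ _) (trans (∙-congˡ (inverseˡ h)) (identityʳ _))) refl)
            (sym (conj-conj h g g₀))))
          in-class : ∃[ a ] conj (conj h g) x₁ ≈ x a
          in-class = Comm-x₁ (HasOrder-conj _ x₁-inv)
            (Comm-resp hv (sym twist) (Comm-conj h e))
          inside : S v g
          inside = let (k , o) = K-2 g g∈K in from-W {h} {v} hv
            (W-intro k (proj₁ in-class) (proj₂ in-class) (pow-conj-ε h (2 ℕ.^ k) (HasOrder.power o)))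
        ... | no ¬e = contradiction outside λ ()
          where
          open IsSubgroup K≤G
          y∈K : K (conj g g₀)
          y∈K = ∙-closed (∙-closed g∈K (S⊆K v∈S)) (⁻¹-closed g∈K)
          y-inv = HasOrder-conj g (X-inv v)
          outside : ⊥
          outside with K-2 (g₀ ∙ conj g g₀) (∙-closed (S⊆K v∈S) y∈K)
          ... | suc k , o = odd-order (X-inv v) y-inv ¬e o (divides (2 ℕ.^ k) (ℕ.*-comm 2 (2 ℕ.^ k)))
          ... | zero  , o = ¬e (Comm-resp refl
            (trans (sym (self-inverse (X-inv v))) (sym (inverseʳ-unique g₀ (conj g g₀)
              (trans (sym (identityʳ _)) (HasOrder.power o))))) refl)

    -- Which of the two counts is the smaller one depends on the group, hence the disjunction: it is
    -- the commuting pairs in PSU₃(q) and Sz(q), and the others in PSL₂(q).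
    fusion-graph-properties : ∀ {v k b a} → v ≡ m ℕ.+ m ℕ.* r → k ≡ (m ℕ.∸ 1) ℕ.* r → a ℕ.≤ b →
      (a ≡ (m ℕ.∸ 1 ℕ.∸ 1) ℕ.* r × b ≡ (m ℕ.∸ 1) ℕ.* (r ℕ.∸ 1 ℕ.∸ N₀)) ⊎
      (b ≡ (m ℕ.∸ 1 ℕ.∸ 1) ℕ.* r × a ≡ (m ℕ.∸ 1) ℕ.* (r ℕ.∸ 1 ℕ.∸ N₀)) →
      FusionGraphProperties G (ConjugacyClass G t) χ v k b a
    fusion-graph-properties {b = b} {a} ≡.refl ≡.refl a≤b counts =
      vertex-transitive , edge-regular ,
      record { a≤b = a≤b ; order = vertices-size ; regular = regular ; common = λ v w v≉w → counted v w v≉w counts } ,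
      diameter , _∼_ , ddg , λ v → S v , sylow v , λ g → mk⇔
        (λ (lift (e , _) , g-inv) → vertex g g-inv , lift (sym e) , refl)
        (λ (w , lift e , w≈g) →
          lift (Comm-resp w≈g refl (sym e) , trans (×-congʳ 4 (sym w≈g)) (pow-* 2 {2} (HasOrder.power (X-inv w)))) ,
          HasOrder-resp G w≈g (X-inv w))
      where
      counted : ∀ v w → ¬ proj₁ v ≈ proj₁ w → _ → CommonNeighbours Γ v w a ⊎ CommonNeighbours Γ v w b
      counted v w v≉w counts with Comm? (proj₁ v) (proj₁ w)
      counted v w v≉w (inj₁ (≡.refl , ≡.refl)) | yes e = inj₁ (same v w v≉w e)
      counted v w v≉w (inj₁ (≡.refl , ≡.refl)) | no ¬e = inj₂ (other v w ¬e)
      counted v w v≉w (inj₂ (≡.refl , ≡.refl)) | yes e = inj₂ (same v w v≉w e)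
      counted v w v≉w (inj₂ (≡.refl , ≡.refl)) | no ¬e = inj₁ (other v w ¬e)

-- Polynomial identities in characteristic two

infixl 6 _:+_
infixl 7 _:*_ _:⊗_

-- Negation is the identity in characteristic two; it is a constructor because the determinants are
-- defined by a difference, and evaluation has to reproduce them definitionally.
data Expr (k : ℕ) : Set where
  var       : Fin k → Expr k
  :0 :1     : Expr k
  _:+_ _:*_ : Expr k → Expr k → Expr k
  :-_       : Expr k → Expr k

-- A polynomial over 𝔽₂ is the list of the exponent vectors of its monomials,
-- in lexicographic order.
Monomial : ℕ → Set
Monomial = Vec ℕ

Polynomial : ℕ → Set
Polynomial k = List (Monomial k)

data Comparison {a} {A : Set a} (x y : A) : Set a where
  less greater : Comparison x y
  equal    : x ≡ y → Comparison x y

compareℕ : (m n : ℕ) → Comparison m n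
compareℕ zero    zero    = equal ≡.refl
compareℕ zero    (suc n) = less
compareℕ (suc m) zero    = greater
compareℕ (suc m) (suc n) with compareℕ m n
... | less   = less
... | greater   = greater
... | equal e = equal (≡.cong suc e)

compare : ∀ {k} (m n : Monomial k) → Comparison m n
compare []      []      = equal ≡.refl
compare (i ∷ m) (j ∷ n) with compareℕ i j
... | less   = less
... | greater   = greater
... | equal e with compare m n
... | less   = less
... | greater   = greater
... | equal e′ = equal (≡.cong₂ _∷_ e e′)

add : ∀ {k} → Polynomial k → Polynomial k → Polynomial k
add []      q = q
add (m ∷ p) q = go q
  where
  go : Polynomial _ → Polynomial _
  go []      = m ∷ p
  go (n ∷ q) with compare m n
  ... | less   = m ∷ add p (n ∷ q)
  ... | greater   = n ∷ go q
  -- Equal monomials cancel, as 1 + 1 = 0.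
  ... | equal _ = add p q

mul : ∀ {k} → Polynomial k → Polynomial k → Polynomial k
mul []      q = []
mul (m ∷ p) q = add (List.map (Vec.zipWith ℕ._+_ m) q) (mul p q)

monomial : ∀ {k} → Fin k → Monomial k
monomial {suc k} zero    = 1 ∷ Vec.replicate k 0
monomial {suc k} (suc i) = 0 ∷ monomial i

normalise : ∀ {k} → Expr k → Polynomial k
normalise (var i)  = monomial i ∷ []
normalise :0       = []
normalise :1       = Vec.replicate _ 0 ∷ []
normalise (a :+ b) = add (normalise a) (normalise b)
normalise (a :* b) = mul (normalise a) (normalise b)
normalise (:- a)   = normalise a

isZero : ∀ {k} → Polynomial k → Bool
isZero []      = true
isZero (_ ∷ _) = false

every : ∀ {n} → (Fin n → Bool) → Bool
every {zero}  f = true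
every {suc n} f = f zero ∧ every (f ∘ suc)

every-sound : ∀ {n} (f : Fin n → Bool) → every f ≡ true → ∀ i → f i ≡ true
every-sound {suc n} f e i with f zero in e₀
every-sound {suc n} f e zero    | true = e₀
every-sound {suc n} f e (suc i) | true = every-sound (f ∘ suc) e i

-- An element of the ideal generated by the relations l + r, with the cofactors as a certificate. A
-- list of cofactors that is too short is completed by zeros.
weighted : ∀ {k} → List (Expr k × Expr k) → List (Expr k) → Expr k
weighted []             _        = :0
weighted (_ ∷ _)        []       = :0
weighted ((l , r) ∷ hs) (c ∷ cs) = c :* (l :+ r) :+ weighted hs cs

data MExpr (n k : ℕ) : Set where
  rows : Vec (Vec (Expr k) n) n → MExpr n k
  _:⊗_ : MExpr n k → MExpr n k → MExpr n k

-- The final `:0` mirrors the recursion of `sum`, so that the entries of a symbolic product evaluate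
-- to those of `_⊗_` term by term.
Σ-expr : ∀ {n k} → (Fin n → Expr k) → Expr k
Σ-expr {zero}  f = :0
Σ-expr {suc n} f = f zero :+ Σ-expr (f ∘ suc)

entry : ∀ {n k} → MExpr n k → Fin n → Fin n → Expr k
entry (rows A) i j = lookup (lookup A i) j
entry (A :⊗ B) i j = Σ-expr (λ k → entry A i k :* entry B k j)

module Characteristic2 {c ℓ : Level} (R : CommutativeRing c ℓ)
  (1+1≈0 : CommutativeRing._≈_ R (CommutativeRing._+_ R (CommutativeRing.1# R) (CommutativeRing.1# R)) (CommutativeRing.0# R)) where

  open CommutativeRing R hiding (zero)
  
  open import Algebra.Properties.CommutativeSemiring.Exp commutativeSemiring using (_^_; ^-homo-*)
  open import Algebra.Properties.Semiring.Sum semiring using (sum; sum-cong-≋)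
  open import Algebra.Properties.CommutativeSemigroup *-commutativeSemigroup using () renaming (interchange to *-interchange)
  open import Algebra.Properties.CommutativeSemigroup +-commutativeSemigroup using () renaming (interchange to +-interchange; x∙yz≈y∙xz to +-left-swap)
  open import Relation.Binary.Reasoning.Setoid setoid
  open Matrices R using (Matrix; _≋_; _⊗_; fromRows)

  x+x≈0 : ∀ x → x + x ≈ 0#
  x+x≈0 x = begin
    x + x            ≈⟨ +-cong (*-identityʳ x) (*-identityʳ x) ⟨
    x * 1# + x * 1#  ≈⟨ distribˡ x 1# 1# ⟨
    x * (1# + 1#)    ≈⟨ *-congˡ 1+1≈0 ⟩
    x * 0#           ≈⟨ zeroʳ x ⟩
    0#               ∎

  x+y≈0⇒x≈y : ∀ {x y} → x + y ≈ 0# → x ≈ y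
  x+y≈0⇒x≈y {x} {y} e = begin
    x            ≈⟨ +-identityʳ x ⟨
    x + 0#       ≈⟨ +-congˡ (x+x≈0 y) ⟨
    x + (y + y)  ≈⟨ +-assoc x y y ⟨
    x + y + y    ≈⟨ +-congʳ e ⟩
    0# + y       ≈⟨ +-identityˡ y ⟩
    y            ∎

  x≈y⇒x+y≈0 : ∀ {x y} → x ≈ y → x + y ≈ 0#
  x≈y⇒x+y≈0 {x} {y} e = trans (+-congʳ e) (x+x≈0 y)

  -x≈x : ∀ x → - x ≈ x
  -x≈x x = sym (x+y≈0⇒x≈y (-‿inverseʳ x))

  ⟦_⟧ : ∀ {k} → Expr k → Vec Carrier k → Carrier
  ⟦ var i ⟧ ρ  = lookup ρ i
  ⟦ :0 ⟧ ρ     = 0#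
  ⟦ :1 ⟧ ρ     = 1#
  ⟦ a :+ b ⟧ ρ = ⟦ a ⟧ ρ + ⟦ b ⟧ ρ
  ⟦ a :* b ⟧ ρ = ⟦ a ⟧ ρ * ⟦ b ⟧ ρ
  ⟦ :- a ⟧ ρ   = - ⟦ a ⟧ ρ

  ⟦⟧-cong : ∀ {k} (a : Expr k) (ρ ρ′ : Vec Carrier k) → (∀ i → lookup ρ i ≈ lookup ρ′ i) → ⟦ a ⟧ ρ ≈ ⟦ a ⟧ ρ′
  ⟦⟧-cong (var i)  ρ ρ′ p = p i
  ⟦⟧-cong :0       ρ ρ′ p = refl
  ⟦⟧-cong :1       ρ ρ′ p = refl
  ⟦⟧-cong (a :+ b) ρ ρ′ p = +-cong (⟦⟧-cong a ρ ρ′ p) (⟦⟧-cong b ρ ρ′ p)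
  ⟦⟧-cong (a :* b) ρ ρ′ p = *-cong (⟦⟧-cong a ρ ρ′ p) (⟦⟧-cong b ρ ρ′ p)
  ⟦⟧-cong (:- a)   ρ ρ′ p = -‿cong (⟦⟧-cong a ρ ρ′ p)

  private
    ⟦_⟧ₘ : ∀ {k} → Monomial k → Vec Carrier k → Carrier
    ⟦ [] ⟧ₘ    []      = 1#
    ⟦ i ∷ m ⟧ₘ (x ∷ ρ) = x ^ i * ⟦ m ⟧ₘ ρ

    ⟦_⟧ₚ : ∀ {k} → Polynomial k → Vec Carrier k → Carrier
    ⟦ [] ⟧ₚ    ρ = 0#
    ⟦ m ∷ p ⟧ₚ ρ = ⟦ m ⟧ₘ ρ + ⟦ p ⟧ₚ ρ

    one-sound : ∀ {k} (ρ : Vec Carrier k) → ⟦ Vec.replicate k 0 ⟧ₘ ρ ≈ 1#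
    one-sound []      = refl
    one-sound (x ∷ ρ) = trans (*-identityˡ _) (one-sound ρ)

    monomial-sound : ∀ {k} (i : Fin k) ρ → ⟦ monomial i ⟧ₘ ρ ≈ lookup ρ i
    monomial-sound zero    (x ∷ ρ) = trans (*-cong (*-identityʳ x) (one-sound ρ)) (*-identityʳ x)
    monomial-sound (suc i) (x ∷ ρ) = trans (*-identityˡ _) (monomial-sound i ρ)

    product-sound : ∀ {k} (m n : Monomial k) ρ → ⟦ Vec.zipWith ℕ._+_ m n ⟧ₘ ρ ≈ ⟦ m ⟧ₘ ρ * ⟦ n ⟧ₘ ρ
    product-sound []      []      []      = sym (*-identityˡ 1#)
    product-sound (i ∷ m) (j ∷ n) (x ∷ ρ) =
      trans (*-cong (^-homo-* x i j) (product-sound m n ρ)) (*-interchange _ _ _ _)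

    add-sound : ∀ {k} (p q : Polynomial k) ρ → ⟦ add p q ⟧ₚ ρ ≈ ⟦ p ⟧ₚ ρ + ⟦ q ⟧ₚ ρ
    add-sound []      q       ρ = sym (+-identityˡ _)
    add-sound (m ∷ p) q       ρ = go q
      where
      go : ∀ q → ⟦ add (m ∷ p) q ⟧ₚ ρ ≈ ⟦ m ∷ p ⟧ₚ ρ + ⟦ q ⟧ₚ ρ
      go []      = sym (+-identityʳ _)
      go (n ∷ q) with compare m n
      ... | less = trans (+-congˡ (add-sound p (n ∷ q) ρ)) (sym (+-assoc _ _ _))
      ... | greater = trans (+-congˡ (go q)) (+-left-swap _ _ _)
      ... | equal ≡.refl = begin
        ⟦ add p q ⟧ₚ ρ                                     ≈⟨ add-sound p q ρ ⟩
        ⟦ p ⟧ₚ ρ + ⟦ q ⟧ₚ ρ                                ≈⟨ +-identityˡ _ ⟨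
        0# + (⟦ p ⟧ₚ ρ + ⟦ q ⟧ₚ ρ)                         ≈⟨ +-congʳ (x+x≈0 (⟦ m ⟧ₘ ρ)) ⟨
        ⟦ m ⟧ₘ ρ + ⟦ m ⟧ₘ ρ + (⟦ p ⟧ₚ ρ + ⟦ q ⟧ₚ ρ)        ≈⟨ +-interchange _ _ _ _ ⟩
        ⟦ m ⟧ₘ ρ + ⟦ p ⟧ₚ ρ + (⟦ m ⟧ₘ ρ + ⟦ q ⟧ₚ ρ)        ∎

    scale-sound : ∀ {k} (m : Monomial k) q ρ → ⟦ List.map (Vec.zipWith ℕ._+_ m) q ⟧ₚ ρ ≈ ⟦ m ⟧ₘ ρ * ⟦ q ⟧ₚ ρ
    scale-sound m []      ρ = sym (zeroʳ _)
    scale-sound m (n ∷ q) ρ = trans (+-cong (product-sound m n ρ) (scale-sound m q ρ)) (sym (distribˡ _ _ _))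

    mul-sound : ∀ {k} (p q : Polynomial k) ρ → ⟦ mul p q ⟧ₚ ρ ≈ ⟦ p ⟧ₚ ρ * ⟦ q ⟧ₚ ρ
    mul-sound []      q ρ = sym (zeroˡ _)
    mul-sound (m ∷ p) q ρ = trans (add-sound (List.map _ q) (mul p q) ρ)
      (trans (+-cong (scale-sound m q ρ) (mul-sound p q ρ)) (sym (distribʳ _ _ _)))

    normalise-sound : ∀ {k} (a : Expr k) ρ → ⟦ a ⟧ ρ ≈ ⟦ normalise a ⟧ₚ ρ
    normalise-sound (var i)  ρ = sym (trans (+-identityʳ _) (monomial-sound i ρ))
    normalise-sound :0       ρ = refl
    normalise-sound :1       ρ = sym (trans (+-identityʳ _) (one-sound ρ))
    normalise-sound (a :+ b) ρ = trans (+-cong (normalise-sound a ρ) (normalise-sound b ρ))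
      (sym (add-sound (normalise a) (normalise b) ρ))
    normalise-sound (a :* b) ρ = trans (*-cong (normalise-sound a ρ) (normalise-sound b ρ))
      (sym (mul-sound (normalise a) (normalise b) ρ))
    normalise-sound (:- a)   ρ = trans (-x≈x _) (normalise-sound a ρ)

    isZero-sound : ∀ {k} (a : Expr k) ρ → isZero (normalise a) ≡ true → ⟦ a ⟧ ρ ≈ 0#
    isZero-sound a ρ e = trans (normalise-sound a ρ) (lem (normalise a) e)
      where
      lem : ∀ p → isZero p ≡ true → ⟦ p ⟧ₚ ρ ≈ 0#
      lem [] _ = refl

  -- The last relation is not paired with a unit, so that a single proof or a plain tuple of proofs
  -- can be supplied.
  Holds : ∀ {k} → Vec Carrier k → List (Expr k × Expr k) → Set ℓ
  Holds ρ []             = Lift ℓ ⊤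
  Holds ρ ((l , r) ∷ []) = ⟦ l ⟧ ρ ≈ ⟦ r ⟧ ρ
  Holds ρ ((l , r) ∷ hs@(_ ∷ _)) = ⟦ l ⟧ ρ ≈ ⟦ r ⟧ ρ × Holds ρ hs

  private
    weighted-sound : ∀ {k} (ρ : Vec Carrier k) hs cs → Holds ρ hs → ⟦ weighted hs cs ⟧ ρ ≈ 0#
    weighted-sound ρ []             cs       _ = refl
    weighted-sound ρ (_ ∷ [])       []       _ = refl
    weighted-sound ρ (_ ∷ _ ∷ _)    []       _ = refl
    weighted-sound ρ (_ ∷ [])       (c ∷ cs) h =
      trans (+-identityʳ _) (trans (*-congˡ (x≈y⇒x+y≈0 h)) (zeroʳ _))
    weighted-sound ρ (_ ∷ hs@(_ ∷ _)) (c ∷ cs) (h , hh) =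
      trans (+-cong (trans (*-congˡ (x≈y⇒x+y≈0 h)) (zeroʳ _)) (weighted-sound ρ hs cs hh)) (+-identityʳ _)

  -- a + b is the combination of the relations hs with coefficients cs.
  solve-under : ∀ {k} (ρ : Vec Carrier k) (a b : Expr k) hs cs →
    isZero (normalise (a :+ b :+ weighted hs cs)) ≡ true → Holds ρ hs → ⟦ a ⟧ ρ ≈ ⟦ b ⟧ ρ
  solve-under ρ a b hs cs e h = x+y≈0⇒x≈y (trans (sym (trans (+-congˡ (weighted-sound ρ hs cs h)) (+-identityʳ _)))
    (isZero-sound (a :+ b :+ weighted hs cs) ρ e))

  solve : ∀ {k} (ρ : Vec Carrier k) (a b : Expr k) → isZero (normalise (a :+ b)) ≡ true → ⟦ a ⟧ ρ ≈ ⟦ b ⟧ ρ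
  solve ρ a b e = x+y≈0⇒x≈y (isZero-sound (a :+ b) ρ e)

  ⟦_⟧ᴹ : ∀ {n k} → MExpr n k → Vec Carrier k → Matrix n
  ⟦ rows A ⟧ᴹ ρ = fromRows (Vec.map (Vec.map (λ a → ⟦ a ⟧ ρ)) A)
  ⟦ A :⊗ B ⟧ᴹ ρ = ⟦ A ⟧ᴹ ρ ⊗ ⟦ B ⟧ᴹ ρ

  private
    Σ-expr-sound : ∀ {n k} (f : Fin n → Expr k) ρ → ⟦ Σ-expr f ⟧ ρ ≈ sum (λ i → ⟦ f i ⟧ ρ)
    Σ-expr-sound {zero}  f ρ = refl
    Σ-expr-sound {suc n} f ρ = +-congˡ (Σ-expr-sound (f ∘ suc) ρ)

  entry-sound : ∀ {n k} (A : MExpr n k) ρ i j → ⟦ entry A i j ⟧ ρ ≈ ⟦ A ⟧ᴹ ρ i j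
  entry-sound (rows A) ρ i j = reflexive (≡.sym (≡.trans
    (≡.cong (λ r → lookup r j) (Vec.lookup-map i (Vec.map (λ a → ⟦ a ⟧ ρ)) A))
    (Vec.lookup-map j (λ a → ⟦ a ⟧ ρ) (lookup A i))))
  entry-sound {n} (A :⊗ B) ρ i j = trans (Σ-expr-sound (λ k → entry A i k :* entry B k j) ρ)
    (sum-cong-≋ {n} (λ k → *-cong (entry-sound A ρ i k) (entry-sound B ρ k j)))

  ⟦⟧ᴹ-cong : ∀ {n k} (A : MExpr n k) (ρ ρ′ : Vec Carrier k) → (∀ i → lookup ρ i ≈ lookup ρ′ i) → ⟦ A ⟧ᴹ ρ ≋ ⟦ A ⟧ᴹ ρ′
  ⟦⟧ᴹ-cong A ρ ρ′ p i j = trans (sym (entry-sound A ρ i j)) (trans (⟦⟧-cong (entry A i j) ρ ρ′ p) (entry-sound A ρ′ i j))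

  -- All entries share the relations, and each entry has its own cofactors in cs. The condition is a
  -- closed Boolean computation, so its proof is `refl`.
  solveᴹ-under : ∀ {n k} (ρ : Vec Carrier k) (A B : MExpr n k) hs (cs : Vec (Vec (List (Expr k)) n) n) →
    every (λ i → every (λ j → isZero (normalise (entry A i j :+ entry B i j :+ weighted hs (lookup (lookup cs i) j))))) ≡ true →
    Holds ρ hs → ⟦ A ⟧ᴹ ρ ≋ ⟦ B ⟧ᴹ ρ
  solveᴹ-under ρ A B hs cs e h i j = trans (sym (entry-sound A ρ i j)) (trans
    (solve-under ρ (entry A i j) (entry B i j) hs (lookup (lookup cs i) j)
      (every-sound _ (every-sound _ e i) j) h)
    (entry-sound B ρ i j))

  solveᴹ : ∀ {n k} (ρ : Vec Carrier k) (A B : MExpr n k) →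
    every (λ i → every (λ j → isZero (normalise (entry A i j :+ entry B i j)))) ≡ true →
    ⟦ A ⟧ᴹ ρ ≋ ⟦ B ⟧ᴹ ρ
  solveᴹ ρ A B e i j = trans (sym (entry-sound A ρ i j)) (trans
    (solve ρ (entry A i j) (entry B i j) (every-sound _ (every-sound _ e i) j)) (entry-sound B ρ i j))

-- Finite fields of characteristic two

module FieldLemmas {c ℓ : Level} {q : ℕ} (F : FiniteField c ℓ q) (e : ℕ) (q≡2^e : q ≡ 2 ℕ.^ e) where
  open FiniteField F public hiding (zero)
  open Counting
  open Finite setoid cardinality public using (any; injective⇒surjective) renaming (dec to infix 4 _≟_)
  open Characteristic2 commutativeRing (2^k-elements⇒1+1≈0 F e q≡2^e) public
  open import Algebra.Properties.Semiring.Exp semiring public using (_^_; ^-assocʳ; ^-congˡ)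
  open import Algebra.Properties.CommutativeSemiring.Exp commutativeSemiring public using (^-distrib-*)
  open import Algebra.Properties.CommutativeMonoid.Sum *-commutativeMonoid
    using (∑-distrib-+; sum-permute; sum-cong-≋; sum-replicate)
    renaming (sum to product)
  open import Relation.Binary.Reasoning.Setoid setoid

  infix 8 _⁻¹
  -- Made total by the default value 0 at 0.
  _⁻¹ : Carrier → Carrier
  x ⁻¹ with x ≟ 0#
  ... | yes _  = 0#
  ... | no x≉0 = proj₁ (invertible x x≉0)

  ⁻¹-inverseʳ : ∀ {x} → ¬ x ≈ 0# → x * x ⁻¹ ≈ 1#
  ⁻¹-inverseʳ {x} x≉0 with x ≟ 0#
  ... | yes x≈0 = contradiction x≈0 x≉0
  ... | no x≉0′ = proj₂ (invertible x x≉0′)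

  ⁻¹-inverseˡ : ∀ {x} → ¬ x ≈ 0# → x ⁻¹ * x ≈ 1#
  ⁻¹-inverseˡ x≉0 = trans (*-comm _ _) (⁻¹-inverseʳ x≉0)

  *-cancelˡ : ∀ {x y z} → ¬ x ≈ 0# → x * y ≈ x * z → y ≈ z
  *-cancelˡ {x} {y} {z} x≉0 eq = begin
    y              ≈⟨ *-identityˡ y ⟨
    1# * y         ≈⟨ *-congʳ (⁻¹-inverseˡ x≉0) ⟨
    x ⁻¹ * x * y   ≈⟨ *-assoc _ x y ⟩
    x ⁻¹ * (x * y) ≈⟨ *-congˡ eq ⟩
    x ⁻¹ * (x * z) ≈⟨ *-assoc _ x z ⟨
    x ⁻¹ * x * z   ≈⟨ *-congʳ (⁻¹-inverseˡ x≉0) ⟩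
    1# * z         ≈⟨ *-identityˡ z ⟩
    z              ∎

  integral : ∀ {x y} → x * y ≈ 0# → ¬ x ≈ 0# → y ≈ 0#
  integral xy≈0 x≉0 = *-cancelˡ x≉0 (trans xy≈0 (sym (zeroʳ _)))

  *-≉0 : ∀ {x y} → ¬ x ≈ 0# → ¬ y ≈ 0# → ¬ x * y ≈ 0#
  *-≉0 x≉0 y≉0 eq = y≉0 (integral eq x≉0)

  unit-≉0 : ∀ {x y} → x * y ≈ 1# → ¬ x ≈ 0#
  unit-≉0 eq x≈0 = 1≉0 (trans (sym eq) (trans (*-congʳ x≈0) (zeroˡ _)))

  unit-≉0ʳ : ∀ {x y} → x * y ≈ 1# → ¬ y ≈ 0#
  unit-≉0ʳ eq = unit-≉0 (trans (*-comm _ _) eq)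

  ⁻¹-≉0 : ∀ {x} → ¬ x ≈ 0# → ¬ x ⁻¹ ≈ 0#
  ⁻¹-≉0 x≉0 = unit-≉0 (⁻¹-inverseˡ x≉0)

  ⁻¹-unique : ∀ {x y} → x * y ≈ 1# → y ≈ x ⁻¹
  ⁻¹-unique eq = *-cancelˡ (unit-≉0 eq) (trans eq (sym (⁻¹-inverseʳ (unit-≉0 eq))))

  ^-≉0 : ∀ {x} n → ¬ x ≈ 0# → ¬ x ^ n ≈ 0#
  ^-≉0 zero    x≉0 = 1≉0
  ^-≉0 (suc n) x≉0 = *-≉0 x≉0 (^-≉0 n x≉0)

  x²≈0⇒x≈0 : ∀ {x} → x * x ≈ 0# → x ≈ 0#
  x²≈0⇒x≈0 {x} eq with x ≟ 0#
  ... | yes x≈0 = x≈0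
  ... | no x≉0  = integral eq x≉0

  -- In characteristic two x² + y² = (x + y)². Together with finiteness this makes square roots
  -- exist and be unique, which replaces every choice of sign.
  square-injective : ∀ {x y} → x * x ≈ y * y → x ≈ y
  square-injective {x} {y} eq = x+y≈0⇒x≈y (x²≈0⇒x≈0 (trans
    (solve (x ∷ y ∷ []) ((var 0F :+ var 1F) :* (var 0F :+ var 1F)) (var 0F :* var 0F :+ var 1F :* var 1F) ≡.refl)
    (x≈y⇒x+y≈0 eq)))

  x²≈1⇒x≈1 : ∀ {x} → x * x ≈ 1# → x ≈ 1#
  x²≈1⇒x≈1 eq = square-injective (trans eq (sym (*-identityˡ 1#)))

  √-exists : ∀ x → ∃[ y ] y * y ≈ x
  √-exists = injective⇒surjective (λ x → x * x) (λ eq → *-cong eq eq) square-injective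

  -- It forces the diagonal entries of a triangular matrix of 2-power order to be 1, or to be equal
  -- when the power is only a scalar matrix.
  2^k-injective : ∀ k {x y} → x ^ (2 ℕ.^ k) ≈ y ^ (2 ℕ.^ k) → x ≈ y
  2^k-injective zero    eq = trans (sym (*-identityʳ _)) (trans eq (*-identityʳ _))
  2^k-injective (suc k) {x} {y} eq = square-injective (trans (square x) (trans
    (2^k-injective k (trans (^-assocʳ x 2 (2 ℕ.^ k)) (trans eq (sym (^-assocʳ y 2 (2 ℕ.^ k))))))
    (sym (square y))))
    where
    square : ∀ x → x * x ≈ x ^ 2
    square x = *-congˡ (sym (*-identityʳ x))

  x²≈x⇒0∨1 : ∀ {x} → x * x ≈ x → x ≈ 0# ⊎ x ≈ 1#
  x²≈x⇒0∨1 {x} eq with x ≟ 0#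
  ... | yes x≈0 = inj₁ x≈0
  ... | no x≉0  = inj₂ (*-cancelˡ x≉0 (trans eq (sym (*-identityʳ x))))

  nonzero-size : HasSize (subsetoid setoid (λ x → ¬ x ≈ 0#)) (q ℕ.∸ 1)
  nonzero-size = Subset.complement-size setoid cardinality (λ eq p → trans (sym eq) p) (_≟ 0#)
    (singleton-size setoid 0#)

  -- Multiplication by x permutes the nonzero elements, so their product is
  -- multiplied by x ^ (q - 1).
  private
    module Fermat {x : Carrier} (x≉0 : ¬ x ≈ 0#) where
      module N = Inverse nonzero-size

      elem : Fin (q ℕ.∸ 1) → Carrier
      elem = proj₁ ∘ N.from

      times : ∀ {x} → ¬ x ≈ 0# → Fin (q ℕ.∸ 1) → Fin (q ℕ.∸ 1)
      times {x} x≉0 i = N.to (x * elem i , *-≉0 x≉0 (proj₂ (N.from i)))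

      elem-times : ∀ {x} (x≉0 : ¬ x ≈ 0#) i → elem (times x≉0 i) ≈ x * elem i
      elem-times x≉0 i = N.inverseʳ ≡.refl

      cancel : ∀ {x y} (x≉0 : ¬ x ≈ 0#) (y≉0 : ¬ y ≈ 0#) → x * y ≈ 1# → ∀ i → times x≉0 (times y≉0 i) ≡ i
      cancel {x} {y} x≉0 y≉0 eq i = N.inverseˡ (begin
        x * elem (times y≉0 i)  ≈⟨ *-congˡ (elem-times y≉0 i) ⟩
        x * (y * elem i)        ≈⟨ *-assoc x y _ ⟨
        x * y * elem i          ≈⟨ *-congʳ eq ⟩
        1# * elem i             ≈⟨ *-identityˡ _ ⟩
        elem i                  ∎)

      π : Permutation (q ℕ.∸ 1) (q ℕ.∸ 1)
      π = permutation (times x≉0) (times (⁻¹-≉0 x≉0))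
        (cancel x≉0 (⁻¹-≉0 x≉0) (⁻¹-inverseʳ x≉0)) (cancel (⁻¹-≉0 x≉0) x≉0 (⁻¹-inverseˡ x≉0))

      product-≉0 : ∀ {n} (f : Fin n → Carrier) → (∀ i → ¬ f i ≈ 0#) → ¬ product f ≈ 0#
      product-≉0 {zero}  f p = 1≉0
      product-≉0 {suc n} f p = *-≉0 (p 0F) (product-≉0 (f ∘ suc) (p ∘ suc))

      x^q-1≈1 : x ^ (q ℕ.∸ 1) ≈ 1#
      x^q-1≈1 = *-cancelˡ (product-≉0 elem (proj₂ ∘ N.from)) (begin
        product elem * x ^ (q ℕ.∸ 1)                   ≈⟨ *-comm _ _ ⟩
        x ^ (q ℕ.∸ 1) * product elem                   ≈⟨ *-congʳ (sum-replicate (q ℕ.∸ 1)) ⟨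
        product {q ℕ.∸ 1} (λ _ → x) * product elem     ≈⟨ ∑-distrib-+ (λ _ → x) elem ⟨
        product (λ i → x * elem i)                     ≈⟨ sum-cong-≋ (elem-times x≉0) ⟨
        product (λ i → elem (times x≉0 i))             ≈⟨ sum-permute elem π ⟨
        product elem                                   ≈⟨ *-identityʳ _ ⟨
        product elem * 1#                              ∎)

  fermat : ∀ x → x ^ q ≈ x
  fermat x = trans (reflexive (≡.cong (x ^_) (positive (Inverse.to cardinality x)))) x^q≈x
    -- The index of x in the enumeration of the field shows that q is not 0, so q ∸ 1 is a true
    -- predecessor.
    where
    positive : ∀ {n} → Fin n → n ≡ suc (n ℕ.∸ 1)
    positive {suc n} _ = ≡.refl
    x^q≈x : x * x ^ (q ℕ.∸ 1) ≈ x
    x^q≈x with x ≟ 0#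
    ... | yes x≈0 = trans (*-congʳ x≈0) (trans (zeroˡ _) (sym x≈0))
    ... | no x≉0  = trans (*-congˡ (Fermat.x^q-1≈1 x≉0)) (*-identityʳ x)

  -- Horner form of the monic polynomial of degree d, with the lower coefficients in the vector,
  -- constant term first.
  monic : ∀ {d} → Vec Carrier d → Carrier → Carrier
  monic []      x = 1#
  monic (a ∷ v) x = a + x * monic v x

  private
    quotient : ∀ {d} → Vec Carrier (suc d) → Carrier → Vec Carrier d
    quotient (a ∷ [])        r = []
    quotient (a ∷ v@(_ ∷ _)) r = monic v r ∷ quotient v r

    -- The remainder theorem by synthetic division: p(x) - p(r) = (x - r) s(x) with s the
    -- `quotient`; signs do not matter in characteristic two.
    division : ∀ {d} (v : Vec Carrier (suc d)) r x → monic v x + monic v r ≈ (x + r) * monic (quotient v r) x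
    division (a ∷ [])        r x = solve (a ∷ r ∷ x ∷ [])
      (var 0F :+ var 2F :* :1 :+ (var 0F :+ var 1F :* :1)) ((var 2F :+ var 1F) :* :1) ≡.refl
    division (a ∷ v@(_ ∷ _)) r x = solve-under (a ∷ r ∷ x ∷ monic v x ∷ monic v r ∷ monic (quotient v r) x ∷ [])
      (var 0F :+ var 2F :* var 3F :+ (var 0F :+ var 1F :* var 4F))
      ((var 2F :+ var 1F) :* (var 4F :+ var 2F :* var 5F))
      ((var 3F :+ var 4F , (var 2F :+ var 1F) :* var 5F) ∷ []) (var 2F ∷ []) ≡.refl (division v r x)

  -- Dividing by the factor of the first root leaves a polynomial of degree one less that vanishes
  -- at all other points.
  root-bound : ∀ {d} (v : Vec Carrier d) (f : Fin (suc d) → Carrier) → (∀ {i j} → f i ≈ f j → i ≡ j) →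
               ¬ (∀ i → monic v (f i) ≈ 0#)
  root-bound []        f f-inj roots = 1≉0 (roots 0F)
  root-bound v@(_ ∷ _) f f-inj roots = root-bound (quotient v (f 0F)) (f ∘ suc)
    (λ eq → Fin.suc-injective (f-inj eq))
    (λ i → integral (trans (sym (division v (f 0F) (f (suc i)))) (trans (+-cong (roots (suc i)) (roots 0F)) (+-identityˡ 0#)))
      (λ eq → Fin.0≢1+n (≡.sym (f-inj (x+y≈0⇒x≈y eq)))))

  -- x ^ n = x has at most n solutions.
  moved-element : ∀ n → 2 ℕ.≤ n → n ℕ.< q → ∃[ x ] ¬ x ^ n ≈ x
  moved-element n 2≤n n<q with any {P = λ x → ¬ x ^ n ≈ x}
    (λ eq p eq′ → p (trans (^-congˡ n eq) (trans eq′ (sym eq)))) (λ x → ¬? (x ^ n ≟ x))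
  ... | yes p = p
  -- The polynomial is X^n + X with n = k + 2; as n is at least 2, the coefficient 1 of X is
  -- separate from the leading one.
  moved-element (suc (suc k)) (s≤s (s≤s _)) n<q | no ¬p = contradiction
    (λ i → trans (poly _) (x≈y⇒x+y≈0 (fixed _))) (root-bound (0# ∷ 1# ∷ Vec.replicate k 0#) points points-inj)
    where
    fixed : ∀ x → x ^ suc (suc k) ≈ x
    fixed x with x ^ suc (suc k) ≟ x
    ... | yes eq = eq
    ... | no neq = contradiction (x , neq) ¬p
    monomial-≈ : ∀ k x → monic (Vec.replicate k 0#) x ≈ x ^ k
    monomial-≈ zero    x = refl
    monomial-≈ (suc k) x = trans (+-identityˡ _) (*-congˡ (monomial-≈ k x))
    poly : ∀ x → monic (0# ∷ 1# ∷ Vec.replicate k 0#) x ≈ x ^ suc (suc k) + x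
    poly x = trans (+-congˡ (*-congˡ (+-congˡ (*-congˡ (monomial-≈ k x)))))
      (solve (x ∷ x ^ k ∷ []) (:0 :+ var 0F :* (:1 :+ var 0F :* var 1F))
        (var 0F :* (var 0F :* var 1F) :+ var 0F) ≡.refl)
    points : Fin (suc (suc (suc k))) → Carrier
    points i = Inverse.from cardinality (inject≤ i n<q)
    points-inj : ∀ {i j} → points i ≈ points j → i ≡ j
    points-inj eq = Fin.inject≤-injective n<q n<q _ _ (≡.trans (≡.sym (Inverse.inverseˡ cardinality refl))
      (≡.trans (Inverse.to-cong cardinality eq) (Inverse.inverseˡ cardinality refl)))

-- Matrices and central quotients

module MatrixLemmas {c ℓ : Level} {q : ℕ} (F : FiniteField c ℓ q) (e : ℕ) (q≡2^e : q ≡ 2 ℕ.^ e) where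
  open FieldLemmas F e q≡2^e
  open Matrices commutativeRing public
  open Counting
  open import Algebra.Definitions.RawMonoid +-rawMonoid using (sum)
  open import Algebra.Properties.Semiring.Sum semiring
    using (sum-cong-≋; ∑-comm; *-distribˡ-sum)

  ≋-refl : ∀ {n} {A : Matrix n} → A ≋ A
  ≋-refl i j = refl

  ≋-sym : ∀ {n} {A B : Matrix n} → A ≋ B → B ≋ A
  ≋-sym p i j = sym (p i j)

  ≋-trans : ∀ {n} {A B C : Matrix n} → A ≋ B → B ≋ C → A ≋ C
  ≋-trans p q i j = trans (p i j) (q i j)

  _≟ᴹ_ : ∀ {n} (A B : Matrix n) → Dec (A ≋ B)
  A ≟ᴹ B = Fin.all? (λ i → Fin.all? (λ j → A i j ≟ B i j))

  codeᴹ : ∀ {n} → Matrix n → Fin ((q ℕ.^ n) ℕ.^ n)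
  codeᴹ A = funToFin (λ i → funToFin (λ j → Inverse.to cardinality (A i j)))

  codeᴹ-injective : ∀ {n} (A B : Matrix n) → codeᴹ A ≡ codeᴹ B → A ≋ B
  codeᴹ-injective A B eq i j = Finite.to-injective setoid cardinality
    (funToFin-injective _ _ (funToFin-injective _ _ eq i) j)
    where
    funToFin-injective : ∀ {m n} (f g : Fin m → Fin n) → funToFin f ≡ funToFin g → ∀ i → f i ≡ g i
    funToFin-injective f g eq i = ≡.trans (≡.sym (Fin.finToFun-funToFin f i))
      (≡.trans (≡.cong (λ k → finToFun k i) eq) (Fin.finToFun-funToFin g i))

  infixr 7 _·_
  _·_ : ∀ {n} → Carrier → Matrix n → Matrix n
  (k · A) i j = k * A i j

  ·-⊗ : ∀ {n} k (A B : Matrix n) → (k · A) ⊗ B ≋ k · (A ⊗ B)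
  ·-⊗ {n} k A B i j = trans (sum-cong-≋ {n} (λ l → *-assoc k (A i l) (B l j)))
    (sym (*-distribˡ-sum k (λ l → A i l * B l j)))

  ⊗-· : ∀ {n} k (A B : Matrix n) → A ⊗ (k · B) ≋ k · (A ⊗ B)
  ⊗-· {n} k A B i j = trans (sum-cong-≋ {n} (λ l → trans (sym (*-assoc _ _ _)) (trans (*-congʳ (*-comm _ _)) (*-assoc _ _ _))))
    (sym (*-distribˡ-sum k (λ l → A i l * B l j)))

  ·-cong : ∀ {n k} {A B : Matrix n} → A ≋ B → k · A ≋ k · B
  ·-cong p i j = *-congˡ (p i j)

  tr : ∀ {n} → Matrix n → Carrier
  tr A = sum (λ i → A i i)

  tr-cong : ∀ {n} {A B : Matrix n} → A ≋ B → tr A ≈ tr B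
  tr-cong {n} p = sum-cong-≋ {n} (λ i → p i i)

  tr-· : ∀ {n} k (A : Matrix n) → tr (k · A) ≈ k * tr A
  tr-· k A = sym (*-distribˡ-sum k (λ i → A i i))

  tr-⊗ : ∀ {n} (A B : Matrix n) → tr (A ⊗ B) ≈ tr (B ⊗ A)
  tr-⊗ {n} A B = trans (∑-comm (λ i k → A i k * B k i))
    (sum-cong-≋ {n} (λ k → sum-cong-≋ {n} (λ i → *-comm (A i k) (B k i))))

  tr-conj : ∀ {n} (A A′ M : Matrix n) → A′ ⊗ A ≋ I → tr (A ⊗ M ⊗ A′) ≈ tr M
  tr-conj A A′ M eq = trans (tr-⊗ (A ⊗ M) A′) (tr-cong (≋-trans (≋-sym (⊗-assoc A′ A M))
    (≋-trans (⊗-cong {B = M} eq ≋-refl) (⊗-identityˡ M))))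

  -- Once central elements are known to be scalar, equality modulo the centre is proportionality of
  -- matrices, which is decided by trying all scalars of the finite field.
  module Projective {n : ℕ} {p : Level} (H : Pred (Invertible n) p) (H≤GL : IsSubgroup (GL n) H)
    (central⇒scalar : ∀ z → Central (subgroup (GL n) H H≤GL) z → ∃[ k ] mat (proj₁ z) ≋ k · I) where

    PG : Group (c ⊔ ℓ ⊔ p) (c ⊔ ℓ ⊔ p)
    PG = modCentre (subgroup (GL n) H H≤GL)
    private module PG = Group PG

    m : PG.Carrier → Matrix n
    m g = mat (proj₁ g)

    scaled⇒≈ : ∀ g h k → m g ≋ k · m h → g PG.≈ h
    scaled⇒≈ g h k eq f = ≋-trans (⊗-cong {B = m f} quotient ≋-refl)
      (≋-trans (·-⊗ k I (m f)) (≋-trans (·-cong (≋-trans (⊗-identityˡ (m f)) (≋-sym (⊗-identityʳ (m f)))))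
      (≋-trans (≋-sym (⊗-· k (m f) I)) (⊗-cong {A = m f} ≋-refl (≋-sym quotient)))))
      where
      quotient : m (g PG.∙ h PG.⁻¹) ≋ k · I
      quotient = ≋-trans (⊗-cong {B = inv (proj₁ h)} eq ≋-refl) (≋-trans (·-⊗ k (m h) _) (·-cong (invʳ (proj₁ h))))

    ≋⇒≈ : ∀ g h → m g ≋ m h → g PG.≈ h
    ≋⇒≈ g h eq = scaled⇒≈ g h 1# (λ i j → trans (eq i j) (sym (*-identityˡ _)))

    ≈⇒scaled : ∀ g h → g PG.≈ h → ∃[ k ] m g ≋ k · m h
    ≈⇒scaled g h g≈h = k , ≋-trans (≋-sym (⊗-identityʳ (m g)))
      (≋-trans (⊗-cong {A = m g} ≋-refl (≋-sym (invˡ (proj₁ h))))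
      (≋-trans (≋-sym (⊗-assoc (m g) (inv (proj₁ h)) (m h)))
      (≋-trans (⊗-cong {B = m h} eq ≋-refl)
      (≋-trans (·-⊗ k I (m h)) (·-cong (⊗-identityˡ (m h)))))))
      where
      scalar = central⇒scalar (g PG.∙ h PG.⁻¹) g≈h
      k = proj₁ scalar
      eq = proj₂ scalar

    _≟ᴾ_ : ∀ g h → Dec (g PG.≈ h)
    g ≟ᴾ h with any {P = λ k → m g ≋ k · m h}
      (λ eq p i j → trans (p i j) (*-congʳ eq)) (λ k → m g ≟ᴹ (k · m h))
    ... | yes (k , p) = yes (scaled⇒≈ g h k p)
    ... | no ¬p       = no λ eq → ¬p (≈⇒scaled g h eq)

    codeᴾ : PG.Carrier → Fin ((q ℕ.^ n) ℕ.^ n)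
    codeᴾ g = codeᴹ (m g)

    codeᴾ-injective : ∀ {g h} → codeᴾ g ≡ codeᴾ h → g PG.≈ h
    codeᴾ-injective {g} {h} eq = ≋⇒≈ g h (codeᴹ-injective (m g) (m h) eq)

-- PSL₂(q)

module PSL₂-RankOne {c ℓ : Level} (n : ℕ) (F : FiniteField c ℓ (2 ℕ.^ n)) where
  open FieldLemmas F n ≡.refl
  open MatrixLemmas F n ≡.refl
  open Counting

  private
    U = subsetoid setoid (λ x → ¬ x ≈ 0#)
    module U = Setoid U

    up : ∀ {k} → Expr k → MExpr 2 k
    up a = rows ((:1 ∷ a ∷ []) ∷ (:0 ∷ :1 ∷ []) ∷ [])

    low : ∀ {k} → Expr k → MExpr 2 k
    low a = rows ((:1 ∷ :0 ∷ []) ∷ (a ∷ :1 ∷ []) ∷ [])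

    diag : ∀ {k} → Expr k → Expr k → MExpr 2 k
    diag a b = rows ((a ∷ :0 ∷ []) ∷ (:0 ∷ b ∷ []) ∷ [])

    swap : ∀ {k} → MExpr 2 k
    swap = rows ((:0 ∷ :1 ∷ []) ∷ (:1 ∷ :0 ∷ []) ∷ [])

    one : ∀ {k} → MExpr 2 k
    one = diag :1 :1

    generic : ∀ {k} → MExpr 2 (suc (suc (suc (suc k))))
    generic = rows ((var 0F ∷ var 1F ∷ []) ∷ (var 2F ∷ var 3F ∷ []) ∷ [])

    entries : Matrix 2 → Vec Carrier 4
    entries A = A 0F 0F ∷ A 0F 1F ∷ A 1F 0F ∷ A 1F 1F ∷ []

    Up Low : Carrier → Matrix 2
    Up a = ⟦ up (var 0F) ⟧ᴹ (a ∷ [])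
    Low a = ⟦ low (var 0F) ⟧ᴹ (a ∷ [])

    Swap : Matrix 2
    Swap = ⟦ swap ⟧ᴹ []

    Diag : Carrier → Carrier → Matrix 2
    Diag a b = ⟦ diag (var 0F) (var 1F) ⟧ᴹ (a ∷ b ∷ [])

    I≋ : ⟦ one ⟧ᴹ [] ≋ I
    I≋ 0F 0F = refl
    I≋ 0F 1F = refl
    I≋ 1F 0F = refl
    I≋ 1F 1F = refl

    det-expr : ∀ {k} → MExpr 2 k → Expr k
    det-expr A = entry A 0F 0F :* entry A 1F 1F :+ :- (entry A 0F 1F :* entry A 1F 0F)

    SL₂ = subgroup (GL 2) InSL₂ InSL₂-isSubgroup

    self-inverse-element : (A : Matrix 2) → A ⊗ A ≋ I → det₂ A ≈ 1# → Group.Carrier SL₂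
    self-inverse-element A e d = record { mat = A ; inv = A ; invʳ = e ; invˡ = e } , d

    upᴳ : Carrier → Group.Carrier SL₂
    upᴳ a = self-inverse-element (Up a)
      (≋-trans (solveᴹ (a ∷ []) (up (var 0F) :⊗ up (var 0F)) one ≡.refl) I≋)
      (solve (a ∷ []) (det-expr (up (var 0F))) :1 ≡.refl)

    swapᴳ : Group.Carrier SL₂
    swapᴳ = self-inverse-element Swap
      (≋-trans (solveᴹ [] (swap :⊗ swap) one ≡.refl) I≋)
      (solve [] (det-expr swap) :1 ≡.refl)

    diagᴳ : ∀ a b → a * b ≈ 1# → Group.Carrier SL₂
    diagᴳ a b ab≈1 = record { mat = Diag a b ; inv = Diag b a
      ; invʳ = ≋-trans (solveᴹ-under (a ∷ b ∷ []) (diag (var 0F) (var 1F) :⊗ diag (var 1F) (var 0F)) one hs coeffs ≡.refl ab≈1) I≋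
      ; invˡ = ≋-trans (solveᴹ-under (a ∷ b ∷ []) (diag (var 1F) (var 0F) :⊗ diag (var 0F) (var 1F)) one hs coeffs ≡.refl ab≈1) I≋ } ,
      solve-under (a ∷ b ∷ []) (det-expr (diag (var 0F) (var 1F))) :1 hs (:1 ∷ []) ≡.refl ab≈1
      where
      hs : List (Expr 2 × Expr 2)
      hs = (var 0F :* var 1F , :1) ∷ []
      coeffs : Vec (Vec (List (Expr 2)) 2) 2
      coeffs = ((:1 ∷ []) ∷ [] ∷ []) ∷ ([] ∷ (:1 ∷ []) ∷ []) ∷ []

    -- Entries (1,1) and (0,1) of the equation. The case a = 1 determines the centre, and general a
    -- the elements that normalise the group of the `Up a`.
    from-commute : ∀ (A : Matrix 2) a → A ⊗ Up 1# ≋ Up a ⊗ A → A 1F 0F ≈ 0# × A 0F 0F ≈ a * A 1F 1F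
    from-commute A a e =
      solve-under ρ (var 2F) :0 ((entry left 1F 1F , entry right 1F 1F) ∷ []) (:1 ∷ []) ≡.refl (e 1F 1F) ,
      solve-under ρ (var 0F) (var 4F :* var 3F) ((entry left 0F 1F , entry right 0F 1F) ∷ []) (:1 ∷ []) ≡.refl (e 0F 1F)
      where
      ρ : Vec Carrier 5
      ρ = A 0F 0F ∷ A 0F 1F ∷ A 1F 0F ∷ A 1F 1F ∷ a ∷ []
      left right : MExpr 2 5
      left  = generic :⊗ up :1
      right = up (var 4F) :⊗ generic

    central⇒scalar : ∀ z → Central SL₂ z → ∃[ k ] mat (proj₁ z) ≋ k · I
    central⇒scalar z central = A 0F 0F , scalar
      where
      A = mat (proj₁ z)
      z₁₀≈0 = proj₁ (from-commute A 1# (central (upᴳ 1#)))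
      z₀₀≈z₁₁ = proj₂ (from-commute A 1# (central (upᴳ 1#)))
      z₀₁≈z₁₀ : A 0F 1F ≈ A 1F 0F
      z₀₁≈z₁₀ = solve-under (entries A) (var 1F) (var 2F)
        ((entry (generic :⊗ swap) 0F 0F , entry (swap :⊗ generic) 0F 0F) ∷ []) (:1 ∷ []) ≡.refl (central swapᴳ 0F 0F)
      scalar : A ≋ A 0F 0F · I
      scalar 0F 0F = sym (*-identityʳ _)
      scalar 0F 1F = trans (trans z₀₁≈z₁₀ z₁₀≈0) (sym (zeroʳ _))
      scalar 1F 0F = trans z₁₀≈0 (sym (zeroʳ _))
      scalar 1F 1F = sym (trans (*-identityʳ _) (trans z₀₀≈z₁₁ (*-identityˡ _)))

  open Projective InSL₂ InSL₂-isSubgroup central⇒scalar public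

  private
    module PG = Group (PSL₂ F)
    module GL′ = GroupLemmas (PSL₂ F)

    -- Comparing determinants gives k² = 1, so k = 1 in characteristic two: SL₂(q) has trivial
    -- centre and its quotient is no coarser.
    ≈⇒≋ : ∀ g h → g PG.≈ h → m g ≋ m h
    ≈⇒≋ g h g≈h i j = trans (eq i j) (trans (*-congʳ k≈1) (*-identityˡ _))
      where
      k = proj₁ (≈⇒scaled g h g≈h)
      eq = proj₂ (≈⇒scaled g h g≈h)
      det-scaled : det₂ (m g) ≈ k * k * det₂ (m h)
      det-scaled = trans (+-cong (*-cong (eq 0F 0F) (eq 1F 1F)) (-‿cong (*-cong (eq 0F 1F) (eq 1F 0F))))
        (solve (k ∷ m h 0F 0F ∷ m h 0F 1F ∷ m h 1F 0F ∷ m h 1F 1F ∷ [])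
          (var 0F :* var 1F :* (var 0F :* var 4F) :+ :- (var 0F :* var 2F :* (var 0F :* var 3F)))
          (var 0F :* var 0F :* (var 1F :* var 4F :+ :- (var 2F :* var 3F))) ≡.refl)
      k≈1 : k ≈ 1#
      k≈1 = x²≈1⇒x≈1 (trans (sym (*-identityʳ _)) (trans (*-congˡ (sym (proj₂ h))) (trans (sym det-scaled) (proj₂ g))))

    y : Carrier → PG.Carrier
    y b = GL′.conj swapᴳ (upᴳ b)

    inv′ : Carrier → Carrier → PG.Carrier
    inv′ s b = GL′.conj (upᴳ s) (y b)

    y-expr : ∀ {k} → Expr k → MExpr 2 k
    y-expr b = swap :⊗ up b :⊗ swap

    inv-expr inv-rows : ∀ {k} → Expr k → Expr k → MExpr 2 k
    inv-expr s b = up s :⊗ y-expr b :⊗ up s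
    inv-rows s b = rows ((:1 :+ s :* b ∷ s :* s :* b ∷ []) ∷ (b ∷ :1 :+ s :* b ∷ []) ∷ [])

    m-y : ∀ b → m (y b) ≋ Low b
    m-y b = solveᴹ (b ∷ []) (y-expr (var 0F)) (low (var 0F)) ≡.refl

    m-inv : ∀ s b → m (inv′ s b) ≋ ⟦ inv-rows (var 0F) (var 1F) ⟧ᴹ (s ∷ b ∷ [])
    m-inv s b = solveᴹ (s ∷ b ∷ []) (inv-expr (var 0F) (var 1F)) (inv-rows (var 0F) (var 1F)) ≡.refl

    Unipotent : PG.Carrier → Set (c ⊔ ℓ)
    Unipotent g = ∃[ t ] m g ≋ Up t

    Unipotent-∙ : ∀ {g h} → Unipotent g → Unipotent h → Unipotent (g PG.∙ h)
    Unipotent-∙ (s , es) (t , et) = s + t , ≋-trans (⊗-cong es et)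
      (solveᴹ (s ∷ t ∷ []) (up (var 0F) :⊗ up (var 1F)) (up (var 0F :+ var 1F)) ≡.refl)

    Up-cong : ∀ {a b} → a ≈ b → Up a ≋ Up b
    Up-cong e 0F 0F = refl
    Up-cong e 0F 1F = e
    Up-cong e 1F 0F = refl
    Up-cong e 1F 1F = refl

    Up-comm : ∀ s t → Up s ⊗ Up t ≋ Up t ⊗ Up s
    Up-comm s t = solveᴹ (s ∷ t ∷ []) (up (var 0F) :⊗ up (var 1F)) (up (var 1F) :⊗ up (var 0F)) ≡.refl

    Up-square : ∀ t → Up t ⊗ Up t ≋ I
    Up-square t = ≋-trans (solveᴹ (t ∷ []) (up (var 0F) :⊗ up (var 0F)) one ≡.refl) I≋

    unipotent-square : ∀ g → Unipotent g → g PG.∙ g PG.≈ PG.ε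
    unipotent-square g (t , e) = ≋⇒≈ (g PG.∙ g) PG.ε (≋-trans (⊗-cong e e) (Up-square t))

    triangular-pow : ∀ g → m g 1F 0F ≈ 0# → ∀ k →
      m (GL′.pow k g) 1F 0F ≈ 0# × m (GL′.pow k g) 0F 0F ≈ m g 0F 0F ^ k
    triangular-pow g e zero    = refl , refl
    triangular-pow g e (suc k) =
      trans (+-cong (*-congʳ e) (+-congʳ (*-congˡ (proj₁ ih))))
        (solve (m (GL′.pow k g) 0F 0F ∷ m g 1F 1F ∷ []) (:0 :* var 0F :+ (var 1F :* :0 :+ :0)) :0 ≡.refl) ,
      trans (+-cong (*-congˡ (proj₂ ih)) (+-congʳ (*-congˡ (proj₁ ih))))
        (solve (m g 0F 0F ∷ m g 0F 0F ^ k ∷ m g 0F 1F ∷ [])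
          (var 0F :* var 1F :+ (var 2F :* :0 :+ :0)) (var 0F :* var 1F) ≡.refl)
      where ih = triangular-pow g e k

    -- The intertwining relation makes g upper triangular. A power of exponent `2 ^ k` of its corner
    -- entry is 1, so that entry is 1, and the determinant settles the other one.
    unipotent-intro : ∀ k a g → GL′.conj g (upᴳ 1#) PG.≈ upᴳ a → GL′.pow (2 ℕ.^ k) g PG.≈ PG.ε → Unipotent g
    unipotent-intro k a g e e′ = m g 0F 1F , unipotent
      where
      r≈0 : m g 1F 0F ≈ 0#
      r≈0 = proj₁ (from-commute (m g) a (≈⇒≋ (g PG.∙ upᴳ 1#) (upᴳ a PG.∙ g) (GL′.conj-≈⇒ g (upᴳ 1#) (upᴳ a) e)))
      p≈1 : m g 0F 0F ≈ 1#
      p≈1 = 2^k-injective k (trans (sym (proj₂ (triangular-pow g r≈0 (2 ℕ.^ k))))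
        (trans (≈⇒≋ (GL′.pow (2 ℕ.^ k) g) PG.ε e′ 0F 0F) (sym (1^n≈1 F (2 ℕ.^ k)))))
      s≈1 : m g 1F 1F ≈ 1#
      s≈1 = solve-under (entries (m g)) (var 3F) :1
        ((var 2F , :0) ∷ (var 0F , :1) ∷ (det-expr generic , :1) ∷ [])
        (var 1F ∷ var 3F ∷ :1 ∷ []) ≡.refl (r≈0 , p≈1 , proj₂ g)
      unipotent : m g ≋ Up (m g 0F 1F)
      unipotent 0F 0F = p≈1
      unipotent 0F 1F = refl
      unipotent 1F 0F = r≈0
      unipotent 1F 1F = s≈1

    classify : ∀ g → Involution (PSL₂ F) g →
      (∃[ a ] g PG.≈ upᴳ (proj₁ {B = λ x → ¬ x ≈ 0#} a)) ⊎ (∃[ s ] ∃[ b ] g PG.≈ inv′ s (proj₁ {B = λ x → ¬ x ≈ 0#} b))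
    classify g g-inv = cases (m g 1F 0F ≟ 0#)
      where
      g² : m (g PG.∙ g) ≋ I
      g² = ≈⇒≋ (g PG.∙ g) PG.ε (GL′.square g-inv)
      p≈s : m g 0F 0F ≈ m g 1F 1F
      p≈s = x+y≈0⇒x≈y (x²≈0⇒x≈0 (solve-under (entries (m g))
        ((var 0F :+ var 3F) :* (var 0F :+ var 3F)) :0
        ((entry (generic :⊗ generic) 0F 0F , :1) ∷ (entry (generic :⊗ generic) 1F 1F , :1) ∷ []) (:1 ∷ :1 ∷ []) ≡.refl
        (g² 0F 0F , g² 1F 1F)))
      cases : Dec (m g 1F 0F ≈ 0#) → _
      cases (yes r≈0) = inj₁ ((m g 0F 1F , q≉0) , ≋⇒≈ g (upᴳ (m g 0F 1F)) g≋)
        where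
        p≈1 : m g 0F 0F ≈ 1#
        p≈1 = x²≈1⇒x≈1 (solve-under (entries (m g)) (var 0F :* var 0F) :1
          ((entry (generic :⊗ generic) 0F 0F , :1) ∷ (var 2F , :0) ∷ []) (:1 ∷ var 1F ∷ []) ≡.refl (g² 0F 0F , r≈0))
        g≋ : m g ≋ Up (m g 0F 1F)
        g≋ 0F 0F = p≈1
        g≋ 0F 1F = refl
        g≋ 1F 0F = r≈0
        g≋ 1F 1F = trans (sym p≈s) p≈1
        q≉0 : ¬ m g 0F 1F ≈ 0#
        q≉0 q≈0 = GL′.nontrivial g-inv (≋⇒≈ g PG.ε (≋-trans g≋ (≋-trans (Up-cong q≈0)
          (≋-trans (solveᴹ [] (up :0) one ≡.refl) I≋))))
      cases (no r≉0) = inj₂ (s , (r , r≉0) , ≋⇒≈ g (inv′ s r) (≋-trans g≋ (≋-sym (m-inv s r))))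
        where
        p = m g 0F 0F
        r = m g 1F 0F
        -- Solves 1 + s r = p, the diagonal entry of `inv-rows`, with b = r read off from the lower
        -- left corner.
        s = (p + 1#) * r ⁻¹
        sr≈p+1 : s * r ≈ p + 1#
        sr≈p+1 = trans (*-assoc _ _ _) (trans (*-congˡ (⁻¹-inverseˡ r≉0)) (*-identityʳ _))
        1+sr≈p : 1# + s * r ≈ p
        1+sr≈p = solve-under (p ∷ s ∷ r ∷ []) (:1 :+ var 1F :* var 2F) (var 0F)
          ((var 1F :* var 2F , var 0F :+ :1) ∷ []) (:1 ∷ []) ≡.refl sr≈p+1
        -- From p² + q r = 1 one gets q r = (p + 1)² = (s r)².
        q≈ : m g 0F 1F ≈ s * s * r
        q≈ = *-cancelˡ r≉0 (solve-under (p ∷ m g 0F 1F ∷ r ∷ s ∷ [])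
          (var 2F :* var 1F) (var 2F :* (var 3F :* var 3F :* var 2F))
          ((var 0F :* var 0F :+ (var 1F :* var 2F :+ :0) , :1) ∷ (var 3F :* var 2F , var 0F :+ :1) ∷ [])
          (:1 ∷ (var 3F :* var 2F :+ var 0F :+ :1) ∷ []) ≡.refl (g² 0F 0F , sr≈p+1))
        g≋ : m g ≋ ⟦ inv-rows (var 0F) (var 1F) ⟧ᴹ (s ∷ r ∷ [])
        g≋ 0F 0F = sym 1+sr≈p
        g≋ 0F 1F = q≈
        g≋ 1F 0F = refl
        g≋ 1F 1F = trans (sym p≈s) (sym 1+sr≈p)

    product : ∀ {k} → Expr k → Expr k → MExpr 2 k
    product a b = up a :⊗ low b

    m-product : ∀ a b → m (upᴳ a PG.∙ y b) ≋ ⟦ product (var 0F) (var 1F) ⟧ᴹ (a ∷ b ∷ [])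
    m-product a b = ⊗-cong {A = Up a} ≋-refl (m-y b)

    cube : ∀ a b → m (GL′.pow 3 (upᴳ a PG.∙ y b)) ≋
      ⟦ product (var 0F) (var 1F) :⊗ (product (var 0F) (var 1F) :⊗ (product (var 0F) (var 1F) :⊗ one)) ⟧ᴹ (a ∷ b ∷ [])
    cube a b = ⊗-cong D (⊗-cong D (⊗-cong D (≋-sym I≋′)))
      where
      D = m-product a b
      I≋′ : ⟦ one ⟧ᴹ (a ∷ b ∷ []) ≋ I
      I≋′ = I≋

    -- Entry (0,1) of the cube is a (1 + a b)².
    order-3⇒ : ∀ a b → ¬ a ≈ 0# → HasOrder (PSL₂ F) (upᴳ a PG.∙ y b) 3 → a * b ≈ 1#
    order-3⇒ a b a≉0 o = sym (x+y≈0⇒x≈y (x²≈0⇒x≈0 (integral (trans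
      (solve (a ∷ b ∷ []) (var 0F :* ((:1 :+ var 0F :* var 1F) :* (:1 :+ var 0F :* var 1F)))
        (entry (product (var 0F) (var 1F) :⊗ (product (var 0F) (var 1F) :⊗ (product (var 0F) (var 1F) :⊗ one))) 0F 1F) ≡.refl)
      (trans (sym (cube a b 0F 1F)) (≈⇒≋ (GL′.pow 3 (upᴳ a PG.∙ y b)) PG.ε (HasOrder.power o) 0F 1F))) a≉0)))

    -- The matrix has trace a b = 1 and determinant 1, so it satisfies X² + X + 1 = 0. The cofactors
    -- express the cube minus the identity as a multiple of a b + 1. The lower left entry b shows
    -- that the matrix is not the identity.
    order-3⇐ : ∀ a b → a * b ≈ 1# → HasOrder (PSL₂ F) (upᴳ a PG.∙ y b) 3
    order-3⇐ a b ab≈1 = GL′.exponent-3 {D} (≋⇒≈ (GL′.pow 3 D) PG.ε (≋-trans (cube a b) (≋-trans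
        (solveᴹ-under (a ∷ b ∷ []) (P :⊗ (P :⊗ (P :⊗ one))) one ((var 0F :* var 1F , :1) ∷ [])
          (((t :* t ∷ []) ∷ (var 0F :* (t :+ :1) ∷ []) ∷ [])
          ∷ ((var 1F :* (t :+ :1) ∷ []) ∷ (t ∷ []) ∷ []) ∷ []) ≡.refl ab≈1)
        I≋)))
      (λ e → unit-≉0ʳ ab≈1 (trans (sym (solve (a ∷ b ∷ []) (entry P 1F 0F) (var 1F) ≡.refl))
        (trans (sym (m-product a b 1F 0F)) (≈⇒≋ D PG.ε e 1F 0F))))
      where
      D = upᴳ a PG.∙ y b
      P : MExpr 2 2
      P = product (var 0F) (var 1F)
      t : Expr 2
      t = var 0F :* var 1F

    tr-product : ∀ a b → tr (m (upᴳ a PG.∙ y b)) ≈ a * b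
    tr-product a b = trans (tr-cong (m-product a b))
      (solve (a ∷ b ∷ []) (Σ-expr (λ i → entry (product (var 0F) (var 1F)) i i)) (var 0F :* var 1F) ≡.refl)

    tr-y-inv : ∀ b s d → tr (m (y b PG.∙ inv′ s d)) ≈ b * d * (s * s)
    tr-y-inv b s d = trans (tr-cong (⊗-cong (m-y b) (m-inv s d)))
      (solve (b ∷ s ∷ d ∷ []) (Σ-expr (λ i → entry (low (var 0F) :⊗ inv-rows (var 1F) (var 2F)) i i))
        (var 0F :* var 2F :* (var 1F :* var 1F)) ≡.refl)

    ⁻¹-unit : ∀ {a b} → ¬ a ≈ 0# → b ≈ a ⁻¹ → a * b ≈ 1#
    ⁻¹-unit a≉0 e = trans (*-congˡ e) (⁻¹-inverseʳ a≉0)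

  rank-one : RankOne {a = c ⊔ ℓ} {ℓ} {c} {ℓ} {ℓ} {c ⊔ ℓ} (PSL₂ F) (2 ℕ.^ n) 1 (2 ℕ.^ n ℕ.∸ 1) 3
  rank-one = record
    { _≟_ = _≟ᴾ_
    ; code = codeᴾ
    ; code-injective = λ {g} {h} → codeᴾ-injective {g} {h}
    ; U = U
    ; Q = setoid
    ; U-size = nonzero-size
    ; Q-size = cardinality
    ; x = λ (a , _) → upᴳ a
    ; x-cong = λ {(a , _)} {(b , _)} e → ≋⇒≈ (upᴳ a) (upᴳ b) (Up-cong e)
    ; u = upᴳ
    ; u-cong = λ {a} {b} e → ≋⇒≈ (upᴳ a) (upᴳ b) (Up-cong e)
    ; w = swapᴳ
    ; 0Q = 0#
    ; u-0 = ≋⇒≈ (upᴳ 0#) PG.ε (≋-trans (solveᴹ [] (up :0) one ≡.refl) I≋)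
    ; 1U = 1# , 1≉0
    ; x-involution = λ (a , a≉0) → GL′.involution {upᴳ a} (unipotent-square (upᴳ a) (a , ≋-refl))
        (λ e → a≉0 (≈⇒≋ (upᴳ a) PG.ε e 0F 1F))
    ; x-conj = x-conj
    ; x-injective = λ {(a , _)} {(b , _)} e → ≈⇒≋ (upᴳ a) (upᴳ b) e 0F 1F
    ; inv-injective = λ {s} {t} {a} {b} → inv-injective s t a b
    ; classify = classify
    ; x-x-comm = λ (a , _) (b , _) → ≋⇒≈ (upᴳ a PG.∙ upᴳ b) (upᴳ b PG.∙ upᴳ a) (Up-comm a b)
    ; u-x-comm = λ a (b , _) → ≋⇒≈ (upᴳ a PG.∙ upᴳ b) (upᴳ b PG.∙ upᴳ a) (Up-comm a b)
    ; x-y-noncomm = λ (a , a≉0) (b , b≉0) e → *-≉0 a≉0 b≉0 (solve-under (a ∷ b ∷ []) (var 0F :* var 1F) :0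
        ((entry (product (var 0F) (var 1F)) 0F 0F , entry (low (var 1F) :⊗ up (var 0F)) 0F 0F) ∷ []) (:1 ∷ []) ≡.refl
        (trans (sym (m-product a b 0F 0F)) (trans (≈⇒≋ (upᴳ a PG.∙ y b) (y b PG.∙ upᴳ a) e 0F 0F)
          (⊗-cong {B = Up a} (m-y b) ≋-refl 0F 0F))))
    ; ι = λ (a , a≉0) → a ⁻¹ , ⁻¹-≉0 a≉0
    ; ι-injective = λ {(a , a≉0)} {(b , b≉0)} e → *-cancelˡ (⁻¹-≉0 a≉0)
        (trans (⁻¹-inverseˡ a≉0) (trans (sym (⁻¹-inverseˡ b≉0)) (*-congʳ (sym e))))
    ; order-χ⇒ = λ (a , a≉0) (b , _) o → ⁻¹-unique (order-3⇒ a b a≉0 (HasOrder-resp (PSL₂ F) (PG.refl {upᴳ a PG.∙ y b}) o))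
    ; order-χ⇐ = λ (a , a≉0) (b , _) e → HasOrder-resp (PSL₂ F) (PG.refl {upᴳ a PG.∙ y b}) (order-3⇐ a b (⁻¹-unit a≉0 e))
    ; Ψ = λ g → tr (m g) ≈ 1#
    ; Ψ? = λ g → tr (m g) ≟ 1#
    ; Ψ-resp = λ {g} {h} e p → trans (sym (tr-cong (≈⇒≋ g h e))) p
    ; Ψ-conj = λ g {h} p → trans (tr-conj (m g) (inv (proj₁ g)) (m h) (invˡ (proj₁ g))) p
    ; Ψ⇒ = λ (a , _) (b , _) p → ⁻¹-unique (trans (sym (tr-product a b)) p)
    ; Ψ⇐ = λ (a , a≉0) (b , _) e → trans (tr-product a b) (⁻¹-unit a≉0 e)
    ; Ψ-y-y = λ (a , _) (b , _) p → 1≉0 (trans (sym p) (trans (tr-cong (⊗-cong (m-y a) (m-y b)))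
        (solve (a ∷ b ∷ []) (Σ-expr (λ i → entry (low (var 0F) :⊗ low (var 1F)) i i)) :0 ≡.refl)))
    ; Ψ-fibre = fibre
    ; W = Unipotent
    ; W-∙ = λ {g} {h} → Unipotent-∙ {g} {h}
    ; W-comm = λ {g} (t , e) → ≋⇒≈ (g PG.∙ upᴳ 1#) (upᴳ 1# PG.∙ g)
        (≋-trans (⊗-cong {B = Up 1#} e ≋-refl) (≋-trans (Up-comm t 1#) (⊗-cong {A = Up 1#} ≋-refl (≋-sym e))))
    ; W-pow = λ {g} p → GL′.pow-* 2 {2} {g} (GL′.pow-2⇐ {g} (unipotent-square g p))
    ; W-intro = λ k (a , _) {g} → unipotent-intro k a g
    }
    where
    -- The diagonal matrix of κ and κ⁻¹ conjugates `Up 1#` to `Up (κ * κ)`, so κ is a square root of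
    -- a.
    x-conj : ∀ (a : U.Carrier) → ∃[ g ] upᴳ (proj₁ a) PG.≈ GL′.conj g (upᴳ 1#)
    x-conj (a , a≉0) = d , GL′.conj-≈⇐ d (upᴳ 1#) (upᴳ a) (≋⇒≈ (d PG.∙ upᴳ 1#) (upᴳ a PG.∙ d)
      (solveᴹ-under (λ′ ∷ μ ∷ a ∷ []) (diag (var 0F) (var 1F) :⊗ up :1) (up (var 2F) :⊗ diag (var 0F) (var 1F))
        ((var 0F :* var 0F , var 2F) ∷ (var 0F :* var 1F , :1) ∷ [])
        (([] ∷ (var 1F ∷ var 0F ∷ []) ∷ []) ∷ ([] ∷ [] ∷ []) ∷ []) ≡.refl (λ²≈a , λμ≈1)))
      where
      λ′ = proj₁ (√-exists a)
      λ²≈a = proj₂ (√-exists a)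
      λ≉0 : ¬ λ′ ≈ 0#
      λ≉0 e = a≉0 (trans (sym λ²≈a) (trans (*-congʳ e) (zeroˡ _)))
      μ = λ′ ⁻¹
      λμ≈1 = ⁻¹-inverseʳ λ≉0
      d = diagᴳ λ′ μ λμ≈1

    inv-injective : ∀ s t (a b : U.Carrier) → inv′ s (proj₁ a) PG.≈ inv′ t (proj₁ b) → s ≈ t × proj₁ a ≈ proj₁ b
    inv-injective s t (a , a≉0) (b , b≉0) e = s≈t , a≈b
      where
      e′ : ⟦ inv-rows (var 0F) (var 1F) ⟧ᴹ (s ∷ a ∷ []) ≋ ⟦ inv-rows (var 0F) (var 1F) ⟧ᴹ (t ∷ b ∷ [])
      e′ = ≋-trans (≋-sym (m-inv s a)) (≋-trans (≈⇒≋ (inv′ s a) (inv′ t b) e) (m-inv t b))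
      a≈b : a ≈ b
      a≈b = e′ 1F 0F
      s≈t : s ≈ t
      s≈t = *-cancelˡ a≉0 (solve-under (a ∷ b ∷ s ∷ t ∷ []) (var 0F :* var 2F) (var 0F :* var 3F)
        ((:1 :+ var 2F :* var 0F , :1 :+ var 3F :* var 1F) ∷ (var 0F , var 1F) ∷ []) (:1 ∷ var 3F ∷ []) ≡.refl
        (e′ 0F 0F , a≈b))

    -- The trace is b d s²: the norm form is s² here, and since squaring is a bijection each nonzero
    -- value is taken once.
    fibre : ∀ (b d : U.Carrier) → HasSize (subsetoid setoid (λ s → tr (m (y (proj₁ b) PG.∙ inv′ s (proj₁ d))) ≈ 1#)) 1
    fibre (b , b≉0) (d , d≉0) = size-⇔ setoid
      (λ s e → trans (tr-y-inv b s d) (trans (*-congˡ (trans (*-cong e e) s₀²)) (⁻¹-inverseʳ bd≉0)))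
      (λ s p → square-injective (*-cancelˡ bd≉0 (trans (sym (tr-y-inv b s d)) (trans p
        (sym (trans (*-congˡ s₀²) (⁻¹-inverseʳ bd≉0)))))))
      (singleton-size setoid s₀)
      where
      bd≉0 = *-≉0 b≉0 d≉0
      s₀ = proj₁ (√-exists ((b * d) ⁻¹))
      s₀² = proj₂ (√-exists ((b * d) ⁻¹))

-- PSU₃(q)

module UnitaryField {c ℓ : Level} (n : ℕ) (2≤q : 2 ℕ.≤ 2 ℕ.^ n) (F : FiniteField c ℓ ((2 ℕ.^ n) ℕ.^ 2)) where
  open FieldLemmas F (n ℕ.* 2) (ℕ.^-*-assoc 2 n 2)
  open SpecialUnitary n F using (bar)
  open Counting
  open import Relation.Binary.Reasoning.Setoid setoid

  private
    q = 2 ℕ.^ n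

  bar-cong : ∀ {x y} → x ≈ y → bar x ≈ bar y
  bar-cong = ^-congˡ q

  bar-+ : ∀ x y → bar (x + y) ≈ bar x + bar y
  bar-+ = ^2^k-distrib-+ F (2^k-elements⇒1+1≈0 F (n ℕ.* 2) (ℕ.^-*-assoc 2 n 2)) n

  bar-* : ∀ x y → bar (x * y) ≈ bar x * bar y
  bar-* x y = ^-distrib-* x y q

  bar-0 : bar 0# ≈ 0#
  bar-0 = 0^2^k≈0 F n

  bar-1 : bar 1# ≈ 1#
  bar-1 = 1^n≈1 F q

  bar-bar : ∀ x → bar (bar x) ≈ x
  bar-bar x = trans (^-assocʳ x q q) (trans (reflexive (≡.cong (λ k → x ^ (q ℕ.* k)) (≡.sym (ℕ.*-identityʳ q)))) (fermat x))

  -- The subfield 𝔽_q, as the fixed points of the conjugation x ↦ x^q.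
  Fixed : Pred Carrier ℓ
  Fixed x = bar x ≈ x

  Fixed-* : ∀ {x y} → Fixed x → Fixed y → Fixed (x * y)
  Fixed-* fx fy = trans (bar-* _ _) (*-cong fx fy)

  Fixed-1 : Fixed 1#
  Fixed-1 = bar-1

  Fixed-⁻¹ : ∀ {x} → ¬ x ≈ 0# → Fixed x → Fixed (x ⁻¹)
  Fixed-⁻¹ {x} x≉0 fx = ⁻¹-unique (begin
    x * bar (x ⁻¹)      ≈⟨ *-congʳ fx ⟨
    bar x * bar (x ⁻¹)  ≈⟨ bar-* x (x ⁻¹) ⟨
    bar (x * x ⁻¹)      ≈⟨ bar-cong (⁻¹-inverseʳ x≉0) ⟩
    bar 1#              ≈⟨ bar-1 ⟩
    1#                  ∎)

  Fixed-√ : ∀ {x y} → y * y ≈ x → Fixed x → Fixed y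
  Fixed-√ y²≈x fx = square-injective (trans (sym (bar-* _ _)) (trans (bar-cong y²≈x) (trans fx (sym y²≈x))))

  Fixed-trace : ∀ x → Fixed (x + bar x)
  Fixed-trace x = trans (bar-+ x (bar x)) (trans (+-congˡ (bar-bar x)) (+-comm _ _))

  Fixed-norm : ∀ x → Fixed (x * bar x)
  Fixed-norm x = trans (bar-* x (bar x)) (trans (*-congˡ (bar-bar x)) (*-comm _ _))

  norm≈0⇒≈0 : ∀ {x} → x * bar x ≈ 0# → x ≈ 0#
  norm≈0⇒≈0 {x} e with x ≟ 0#
  ... | yes x≈0 = x≈0
  ... | no x≉0  = trans (sym (bar-bar x)) (trans (bar-cong (integral e x≉0)) bar-0)

  -- X^q = X has at most q < q² solutions, so some x differs from its conjugate; its trace is then a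
  -- nonzero element of the subfield, by which x can be divided.
  trace-one : ∃[ τ ] τ + bar τ ≈ 1#
  trace-one = x * t ⁻¹ , (begin
    x * t ⁻¹ + bar (x * t ⁻¹)     ≈⟨ +-congˡ (bar-* x (t ⁻¹)) ⟩
    x * t ⁻¹ + bar x * bar (t ⁻¹) ≈⟨ +-congˡ (*-congˡ (Fixed-⁻¹ t≉0 (Fixed-trace x))) ⟩
    x * t ⁻¹ + bar x * t ⁻¹       ≈⟨ distribʳ (t ⁻¹) x (bar x) ⟨
    t * t ⁻¹                      ≈⟨ ⁻¹-inverseʳ t≉0 ⟩
    1#                            ∎)
    where
    q<q² : q ℕ.< q ℕ.^ 2
    q<q² = ≡.subst (q ℕ.<_) (≡.cong (q ℕ.*_) (≡.sym (ℕ.*-identityʳ q)))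
      (ℕ.m<m*n q q {{ℕ.>-nonZero (ℕ.≤-trans (s≤s z≤n) 2≤q)}} 2≤q)
    moved = moved-element q 2≤q q<q²
    x = proj₁ moved
    t = x + bar x
    t≉0 : ¬ t ≈ 0#
    t≉0 e = proj₂ moved (sym (x+y≈0⇒x≈y e))

  private
    τ = proj₁ trace-one

    kτ-trace : ∀ {k} → Fixed k → k * τ + bar (k * τ) ≈ k
    kτ-trace {k} fk = trans (+-congˡ (trans (bar-* k τ) (*-congʳ fk)))
      (trans (sym (distribˡ k τ (bar τ))) (trans (*-congˡ (proj₂ trace-one)) (*-identityʳ k)))

    trace-+ : ∀ x y → (x + y) + bar (x + y) ≈ (x + bar x) + (y + bar y)
    trace-+ x y = trans (+-congˡ (bar-+ x y)) (solve (x ∷ y ∷ bar x ∷ bar y ∷ [])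
      (var 0F :+ var 1F :+ (var 2F :+ var 3F)) (var 0F :+ var 2F :+ (var 1F :+ var 3F)) ≡.refl)

    K = subsetoid setoid Fixed

    -- x = (x + Tr x · τ) + Tr x · τ with both coefficients fixed by bar.
    K×K : Inverse (K ×ₛ K) setoid
    K×K = mkInverse (K ×ₛ K) setoid (λ ((k , _) , (l , _)) → k + l * τ)
      (λ x → (x + (x + bar x) * τ , fixed-part x) , (x + bar x , Fixed-trace x))
      (λ (e , e′) → +-cong e (*-congʳ e′))
      (λ e → +-cong e (*-congʳ (+-cong e (bar-cong e))) , +-cong e (bar-cong e))
      (λ x → solve (x ∷ (x + bar x) * τ ∷ []) (var 0F :+ var 1F :+ var 1F) (var 0F) ≡.refl)
      (λ ((k , fk) , (l , fl)) → let t≈l = trace-part fk fl in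
        trans (+-congˡ (*-congʳ t≈l)) (solve (k ∷ l * τ ∷ []) (var 0F :+ var 1F :+ var 1F) (var 0F) ≡.refl) , t≈l)
      where
      fixed-part : ∀ x → Fixed (x + (x + bar x) * τ)
      fixed-part x = sym (x+y≈0⇒x≈y (trans (trace-+ x _)
        (x≈y⇒x+y≈0 (sym (kτ-trace (Fixed-trace x))))))
      trace-part : ∀ {k l} → Fixed k → Fixed l → (k + l * τ) + bar (k + l * τ) ≈ l
      trace-part {k} {l} fk fl = trans (trace-+ k (l * τ))
        (trans (+-cong (x≈y⇒x+y≈0 (sym fk)) (kτ-trace fl)) (+-identityˡ l))

  -- The bijection of K × K with the whole field gives κ² = q² for the order κ of K.
  Fixed-size : HasSize (subsetoid setoid Fixed) q
  Fixed-size = ≡.subst (HasSize K) (square-root κ q (≡.trans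
      (size-unique (size-transport K×K (size-× K K (proj₂ K-size) (proj₂ K-size))) cardinality)
      (≡.cong (q ℕ.*_) (ℕ.*-identityʳ q)))) (proj₂ K-size)
    where
    K-size : ∃[ κ ] HasSize K κ
    K-size = Subset.subset-size setoid cardinality
      (λ e fx → trans (bar-cong (sym e)) (trans fx e)) (λ x → bar x ≟ x)
    κ = proj₁ K-size
    square-root : ∀ a b → a ℕ.* a ≡ b ℕ.* b → a ≡ b
    square-root a b e with ℕ.<-cmp a b
    ... | tri< a<b _ _ = contradiction e (ℕ.<⇒≢ (ℕ.*-mono-< a<b a<b))
    ... | tri≈ _ a≡b _ = a≡b
    ... | tri> _ _ b<a = contradiction (≡.sym e) (ℕ.<⇒≢ (ℕ.*-mono-< b<a b<a))

  -- The trace is additive with kernel K, and k τ has trace k, so the fibre is the coset k τ + K.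
  trace-fibre-size : ∀ {k} → Fixed k → HasSize (subsetoid setoid (λ x → x + bar x ≈ k)) q
  trace-fibre-size {k} fk = size-transport
    (mkInverse K (subsetoid setoid (λ x → x + bar x ≈ k))
      (λ (x , fx) → x + k * τ , trans (trace-+ x (k * τ)) (trans (+-cong (x≈y⇒x+y≈0 (sym fx)) (kτ-trace fk)) (+-identityˡ k)))
      (λ (x , e) → x + k * τ , sym (x+y≈0⇒x≈y (trans (trace-+ x (k * τ)) (x≈y⇒x+y≈0 (trans e (sym (kτ-trace fk)))))))
      +-congʳ +-congʳ (λ (x , _) → cancel x) (λ (x , _) → cancel x))
    Fixed-size
    where
    cancel : ∀ x → x + k * τ + k * τ ≈ x
    cancel x = solve (x ∷ k * τ ∷ []) (var 0F :+ var 1F :+ var 1F) (var 0F) ≡.refl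

  Fixed-nonzero-size : HasSize (subsetoid setoid (λ x → Fixed x × ¬ x ≈ 0#)) (q ℕ.∸ 1)
  Fixed-nonzero-size = size-flatten setoid Fixed (λ x → ¬ x ≈ 0#)
    (Subset.complement-size K Fixed-size (λ e p → trans (sym e) p) (λ (x , _) → x ≟ 0#)
      (singleton-size K (0# , bar-0)))

  -- The affine Hermitian curve. Its q³ points parametrise the unipotent group, and so the Sylow
  -- 2-subgroups other than the base one.
  Hermitian : Setoid (c ⊔ ℓ) ℓ
  Hermitian = subsetoid (setoid ×ₛ setoid) (λ (β , α) → α + bar α ≈ β * bar β)

  Hermitian-size : HasSize Hermitian (q ℕ.^ 2 ℕ.* q)
  Hermitian-size = size-fibred setoid setoid (λ β α → α + bar α ≈ β * bar β)
    (λ e p → trans p (*-cong e (bar-cong e))) cardinality (λ β → trace-fibre-size (Fixed-norm β))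

-- The projective unitary group as a group of rank one

module PSU₃-RankOne {c ℓ : Level} (n : ℕ) (2≤q : 2 ℕ.≤ 2 ℕ.^ n) (F : FiniteField c ℓ ((2 ℕ.^ n) ℕ.^ 2)) where
  open FieldLemmas F (n ℕ.* 2) (ℕ.^-*-assoc 2 n 2)
  open MatrixLemmas F (n ℕ.* 2) (ℕ.^-*-assoc 2 n 2)
  open SpecialUnitary n F using (bar; star; InSU₃; InSU₃-isSubgroup)
  open UnitaryField n 2≤q F
  open Counting

  private
    q = 2 ℕ.^ n

    U = subsetoid setoid (λ x → Fixed x × ¬ x ≈ 0#)
    module U = Setoid U
    module Q = Setoid Hermitian

    -- The unipotent matrix of (β , α), with b = bar β.
    up : ∀ {k} → Expr k → Expr k → Expr k → MExpr 3 k
    up β b α = rows ((:1 ∷ β ∷ α ∷ []) ∷ (:0 ∷ :1 ∷ b ∷ []) ∷ (:0 ∷ :0 ∷ :1 ∷ []) ∷ [])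

    xe : ∀ {k} → Expr k → MExpr 3 k
    xe a = up :0 :0 a

    low : ∀ {k} → Expr k → MExpr 3 k
    low a = rows ((:1 ∷ :0 ∷ :0 ∷ []) ∷ (:0 ∷ :1 ∷ :0 ∷ []) ∷ (a ∷ :0 ∷ :1 ∷ []) ∷ [])

    diag : ∀ {k} → Expr k → Expr k → Expr k → MExpr 3 k
    diag a b d = rows ((a ∷ :0 ∷ :0 ∷ []) ∷ (:0 ∷ b ∷ :0 ∷ []) ∷ (:0 ∷ :0 ∷ d ∷ []) ∷ [])

    swap : ∀ {k} → MExpr 3 k
    swap = rows ((:0 ∷ :0 ∷ :1 ∷ []) ∷ (:0 ∷ :1 ∷ :0 ∷ []) ∷ (:1 ∷ :0 ∷ :0 ∷ []) ∷ [])

    one : ∀ {k} → MExpr 3 k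
    one = diag :1 :1 :1

    generic : ∀ {k} → MExpr 3 (9 ℕ.+ k)
    generic = rows ((var 0F ∷ var 1F ∷ var 2F ∷ []) ∷ (var 3F ∷ var 4F ∷ var 5F ∷ []) ∷ (var 6F ∷ var 7F ∷ var 8F ∷ []) ∷ [])

    det-expr : ∀ {k} → MExpr 3 k → Expr k
    det-expr A =
      (entry A 0F 0F :* entry A 1F 1F :* entry A 2F 2F :+ entry A 0F 1F :* entry A 1F 2F :* entry A 2F 0F :+ entry A 0F 2F :* entry A 1F 0F :* entry A 2F 1F)
      :+ :- (entry A 0F 2F :* entry A 1F 1F :* entry A 2F 0F :+ entry A 0F 1F :* entry A 1F 0F :* entry A 2F 2F :+ entry A 0F 0F :* entry A 1F 2F :* entry A 2F 1F)

    trace-expr : ∀ {k} → MExpr 3 k → Expr k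
    trace-expr A = Σ-expr (λ i → entry A i i)

    single : ∀ {k} → Expr k → List (Expr k)
    single a = a ∷ []

    pointwise : ∀ {A B : Matrix 3} →
      (A 0F 0F ≈ B 0F 0F × A 0F 1F ≈ B 0F 1F × A 0F 2F ≈ B 0F 2F) →
      (A 1F 0F ≈ B 1F 0F × A 1F 1F ≈ B 1F 1F × A 1F 2F ≈ B 1F 2F) →
      (A 2F 0F ≈ B 2F 0F × A 2F 1F ≈ B 2F 1F × A 2F 2F ≈ B 2F 2F) → A ≋ B
    pointwise (e , _ , _) _ _ 0F 0F = e
    pointwise (_ , e , _) _ _ 0F 1F = e
    pointwise (_ , _ , e) _ _ 0F 2F = e
    pointwise _ (e , _ , _) _ 1F 0F = e
    pointwise _ (_ , e , _) _ 1F 1F = e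
    pointwise _ (_ , _ , e) _ 1F 2F = e
    pointwise _ _ (e , _ , _) 2F 0F = e
    pointwise _ _ (_ , e , _) 2F 1F = e
    pointwise _ _ (_ , _ , e) 2F 2F = e

    I≋ : ∀ {k} {ρ : Vec Carrier k} → ⟦ one ⟧ᴹ ρ ≋ I
    I≋ = pointwise (refl , refl , refl) (refl , refl , refl) (refl , refl , refl)

    J≋ : ∀ {k} {ρ : Vec Carrier k} → ⟦ swap ⟧ᴹ ρ ≋ J
    J≋ = pointwise (refl , refl , refl) (refl , refl , refl) (refl , refl , refl)

    Up : Carrier → Carrier → Carrier → Matrix 3
    Up β b α = ⟦ up (var 0F) (var 1F) (var 2F) ⟧ᴹ (β ∷ b ∷ α ∷ [])

    X : Carrier → Matrix 3
    X a = ⟦ xe (var 0F) ⟧ᴹ (a ∷ [])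

    SU₃ = subgroup (GL 3) InSU₃ InSU₃-isSubgroup
    module SU₃ = Group SU₃

    star-Up : ∀ {β b α a} → bar β ≈ b → bar b ≈ β → bar α ≈ a →
              star (Up β b α) ≋ ⟦ rows ((:1 ∷ :0 ∷ :0 ∷ []) ∷ (var 1F ∷ :1 ∷ :0 ∷ []) ∷ (var 2F ∷ var 0F ∷ :1 ∷ []) ∷ []) ⟧ᴹ (β ∷ b ∷ a ∷ [])
    star-Up eβ eb eα = pointwise (bar-1 , bar-0 , bar-0) (eβ , bar-1 , bar-0) (eα , eb , bar-1)

    element : ∀ β b α a → bar β ≈ b → bar b ≈ β → bar α ≈ a → α + a ≈ β * b → SU₃.Carrier
    element β b α a eβ eb eα e = record { mat = Up β b α ; inv = Up β b a
      ; invʳ = ≋-trans (solveᴹ-under ρ (up v₀ v₁ v₂ :⊗ up v₀ v₁ v₃) one hs cs ≡.refl e) (I≋ {ρ = ρ})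
      ; invˡ = ≋-trans (solveᴹ-under ρ (up v₀ v₁ v₃ :⊗ up v₀ v₁ v₂) one hs cs ≡.refl e) (I≋ {ρ = ρ}) } ,
      solve ρ (det-expr (up v₀ v₁ v₂)) :1 ≡.refl ,
      ≋-trans (⊗-cong {A = Up β b α ⊗ J} (⊗-cong {A = Up β b α} ≋-refl (≋-sym (J≋ {ρ = ρ}))) (star-Up eβ eb eα))
        (≋-trans (solveᴹ-under ρ (up v₀ v₁ v₂ :⊗ swap :⊗ rows ((:1 ∷ :0 ∷ :0 ∷ []) ∷ (v₁ ∷ :1 ∷ :0 ∷ []) ∷ (v₃ ∷ v₀ ∷ :1 ∷ []) ∷ [])) swap hs
          ((single :1 ∷ [] ∷ [] ∷ []) ∷ ([] ∷ [] ∷ [] ∷ []) ∷ ([] ∷ [] ∷ [] ∷ []) ∷ []) ≡.refl e) (J≋ {ρ = ρ}))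
      where
      ρ : Vec Carrier 4
      ρ = β ∷ b ∷ α ∷ a ∷ []
      v₀ v₁ v₂ v₃ : Expr 4
      v₀ = var 0F
      v₁ = var 1F
      v₂ = var 2F
      v₃ = var 3F
      hs : List (Expr 4 × Expr 4)
      hs = (v₂ :+ v₃ , v₀ :* v₁) ∷ []
      cs : Vec (Vec (List (Expr 4)) 3) 3
      cs = ([] ∷ [] ∷ single :1 ∷ []) ∷ ([] ∷ [] ∷ [] ∷ []) ∷ ([] ∷ [] ∷ [] ∷ []) ∷ []

    uᴳ : Q.Carrier → SU₃.Carrier
    uᴳ ((β , α) , e) = element β (bar β) α (bar α) refl (bar-bar β) refl e

    xᴳ : U.Carrier → SU₃.Carrier
    xᴳ (a , fa , _) = element 0# 0# a a bar-0 bar-0 fa (trans (x+x≈0 a) (sym (zeroˡ 0#)))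

    swapᴳ : SU₃.Carrier
    swapᴳ = record { mat = J ; inv = J ; invʳ = JJ ; invˡ = JJ } ,
      solve [] (det-expr swap) :1 ≡.refl ,
      ≋-trans (⊗-cong {A = J ⊗ J} JJ star-J) (⊗-identityˡ J)
      where
      JJ : J ⊗ J ≋ I
      JJ = ≋-trans (⊗-cong {A = J} (≋-sym (J≋ {ρ = []})) (≋-sym (J≋ {ρ = []}))) (≋-trans (solveᴹ [] (swap :⊗ swap) one ≡.refl) (I≋ {ρ = []}))
      star-J : star J ≋ J
      star-J = pointwise (bar-0 , bar-0 , bar-1) (bar-0 , bar-1 , bar-0) (bar-1 , bar-0 , bar-0)

    diagᴳ : ∀ a b → Fixed a → Fixed b → a * b ≈ 1# → SU₃.Carrier
    diagᴳ a b fa fb ab≈1 = record { mat = ⟦ D ⟧ᴹ ρ ; inv = ⟦ D′ ⟧ᴹ ρ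
      ; invʳ = ≋-trans (solveᴹ-under ρ (D :⊗ D′) one hs cs ≡.refl ab≈1) (I≋ {ρ = ρ})
      ; invˡ = ≋-trans (solveᴹ-under ρ (D′ :⊗ D) one hs cs ≡.refl ab≈1) (I≋ {ρ = ρ}) } ,
      solve-under ρ (det-expr D) :1 hs (single :1) ≡.refl ab≈1 ,
      ≋-trans (⊗-cong {A = ⟦ D ⟧ᴹ ρ ⊗ J} (⊗-cong {A = ⟦ D ⟧ᴹ ρ} ≋-refl (≋-sym (J≋ {ρ = ρ})))
          (pointwise {A = star (⟦ D ⟧ᴹ ρ)} {B = ⟦ D ⟧ᴹ ρ} (fa , bar-0 , bar-0) (bar-0 , bar-1 , bar-0) (bar-0 , bar-0 , fb)))
        (≋-trans (solveᴹ-under ρ (D :⊗ swap :⊗ D) swap hs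
          (([] ∷ [] ∷ single :1 ∷ []) ∷ ([] ∷ [] ∷ [] ∷ []) ∷ (single :1 ∷ [] ∷ [] ∷ []) ∷ []) ≡.refl ab≈1) (J≋ {ρ = ρ}))
      where
      ρ : Vec Carrier 2
      ρ = a ∷ b ∷ []
      D D′ : MExpr 3 2
      D = diag (var 0F) :1 (var 1F)
      D′ = diag (var 1F) :1 (var 0F)
      hs : List (Expr 2 × Expr 2)
      hs = (var 0F :* var 1F , :1) ∷ []
      cs : Vec (Vec (List (Expr 2)) 3) 3
      cs = (single :1 ∷ [] ∷ [] ∷ []) ∷ ([] ∷ [] ∷ [] ∷ []) ∷ ([] ∷ [] ∷ single :1 ∷ []) ∷ []

    entries : ∀ {k} → Matrix 3 → Vec Carrier k → Vec Carrier (9 ℕ.+ k)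
    entries A ρ = A 0F 0F ∷ A 0F 1F ∷ A 0F 2F ∷ A 1F 0F ∷ A 1F 1F ∷ A 1F 2F ∷ A 2F 0F ∷ A 2F 1F ∷ A 2F 2F ∷ ρ

    -- Each conclusion is one entry of the equation; entry (0,1) yields only a times the wanted
    -- entry, which is where a ≠ 0 enters.
    from-commute : ∀ (A : Matrix 3) a → ¬ a ≈ 0# → A ⊗ X 1# ≋ X a ⊗ A →
      A 1F 0F ≈ 0# × A 2F 0F ≈ 0# × A 2F 1F ≈ 0# × A 0F 0F ≈ a * A 2F 2F
    from-commute A a a≉0 e = at 1F 2F (var 3F) :0 ≡.refl , at 2F 2F (var 6F) :0 ≡.refl ,
      integral (at 0F 1F (var 9F :* var 7F) :0 ≡.refl) a≉0 , at 0F 2F (var 0F) (var 9F :* var 8F) ≡.refl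
      where
      ρ : Vec Carrier 10
      ρ = entries A (a ∷ [])
      left right : MExpr 3 10
      left  = generic :⊗ xe :1
      right = xe (var 9F) :⊗ generic
      at : ∀ i j l r → isZero (normalise (l :+ r :+ weighted ((entry left i j , entry right i j) ∷ []) (single :1))) ≡ _ →
           ⟦ l ⟧ ρ ≈ ⟦ r ⟧ ρ
      at i j l r check = solve-under ρ l r ((entry left i j , entry right i j) ∷ []) (single :1) check
        (trans (entry-sound left ρ i j) (trans (lift≋ i j) (sym (entry-sound right ρ i j))))
        where
        A≋ : ⟦ generic ⟧ᴹ ρ ≋ A
        A≋ = pointwise (refl , refl , refl) (refl , refl , refl) (refl , refl , refl)
        lift≋ : ⟦ left ⟧ᴹ ρ ≋ ⟦ right ⟧ᴹ ρ
        lift≋ = ≋-trans (⊗-cong {B = X 1#} A≋ ≋-refl) (≋-trans e (⊗-cong {A = X a} ≋-refl (≋-sym A≋)))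

    oneᵁ : U.Carrier
    oneᵁ = 1# , Fixed-1 , 1≉0

    central⇒scalar : ∀ z → Central SU₃ z → ∃[ k ] mat (proj₁ z) ≋ k · I
    central⇒scalar z central = A 0F 0F , scalar
      where
      A = mat (proj₁ z)
      τ = proj₁ trace-one
      -- An element τ of trace one makes (1 , τ) a point of the Hermitian curve. Commuting with its
      -- unipotent matrix is what equates the middle diagonal entry with the first.
      s : Q.Carrier
      s = (1# , τ) , trans (proj₂ trace-one) (sym (trans (*-identityˡ _) bar-1))
      facts = from-commute A 1# 1≉0 (central (xᴳ oneᵁ))
      z₁₀ = proj₁ facts
      z₂₀ = proj₁ (proj₂ facts)
      z₂₁ = proj₁ (proj₂ (proj₂ facts))
      z₀₀ : A 0F 0F ≈ A 2F 2F
      z₀₀ = trans (proj₂ (proj₂ (proj₂ facts))) (*-identityˡ _)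
      sw : ∀ i j → ⟦ entry (generic :⊗ swap) i j ⟧ (entries A []) ≈ ⟦ entry (swap :⊗ generic) i j ⟧ (entries A [])
      sw i j = trans (entry-sound (generic :⊗ swap) (entries A []) i j) (trans (≋-trans
        (⊗-cong A≋ (J≋ {ρ = entries A []})) (≋-trans (central swapᴳ) (≋-sym (⊗-cong (J≋ {ρ = entries A []}) A≋))) i j)
        (sym (entry-sound (swap :⊗ generic) (entries A []) i j)))
        where
        A≋ : ⟦ generic ⟧ᴹ (entries A []) ≋ A
        A≋ = pointwise (refl , refl , refl) (refl , refl , refl) (refl , refl , refl)
      z₀₂ : A 0F 2F ≈ 0#
      z₀₂ = solve-under (entries A []) (var 2F) :0
        ((entry (generic :⊗ swap) 0F 0F , entry (swap :⊗ generic) 0F 0F) ∷ (var 6F , :0) ∷ []) (:1 ∷ :1 ∷ []) ≡.refl (sw 0F 0F , z₂₀)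
      z₀₁ : A 0F 1F ≈ 0#
      z₀₁ = solve-under (entries A []) (var 1F) :0
        ((entry (generic :⊗ swap) 0F 1F , entry (swap :⊗ generic) 0F 1F) ∷ (var 7F , :0) ∷ []) (:1 ∷ :1 ∷ []) ≡.refl (sw 0F 1F , z₂₁)
      z₁₂ : A 1F 2F ≈ 0#
      z₁₂ = solve-under (entries A []) (var 5F) :0
        ((entry (generic :⊗ swap) 1F 0F , entry (swap :⊗ generic) 1F 0F) ∷ (var 3F , :0) ∷ []) (:1 ∷ :1 ∷ []) ≡.refl (sw 1F 0F , z₁₀)
      z₁₁ : A 1F 1F ≈ A 0F 0F
      z₁₁ = solve-under (entries A (bar 1# ∷ τ ∷ [])) (var 4F) (var 0F)
        ((entry (generic :⊗ up :1 (var 9F) (var (suc 9F))) 0F 1F , entry (up :1 (var 9F) (var (suc 9F)) :⊗ generic) 0F 1F) ∷ (var 7F , :0) ∷ [])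
        (:1 ∷ var (suc 9F) ∷ []) ≡.refl (central (uᴳ s) 0F 1F , z₂₁)
      scalar : A ≋ A 0F 0F · I
      scalar = pointwise (on refl , off z₀₁ , off z₀₂) (off z₁₀ , on z₁₁ , off z₁₂) (off z₂₀ , off z₂₁ , on (sym z₀₀))
        where
        on : ∀ {x} → x ≈ A 0F 0F → x ≈ A 0F 0F * 1#
        on e = trans e (sym (*-identityʳ _))
        off : ∀ {x} → x ≈ 0# → x ≈ A 0F 0F * 0#
        off e = trans e (sym (zeroʳ _))

  open Projective InSU₃ InSU₃-isSubgroup central⇒scalar public

  private
    module PG = Group (PSU₃ n F)
    module GL′ = GroupLemmas (PSU₃ n F)

    -- Equality in the quotient is proportionality by some k. Between matrices of square 1 this k
    -- satisfies k² = 1, hence k = 1.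
    exact : ∀ g h → g PG.≈ h → m g ⊗ m g ≋ I → m h ⊗ m h ≋ I → m g ≋ m h
    exact g h g≈h g² h² i j = trans (eq i j) (trans (*-congʳ k≈1) (*-identityˡ _))
      where
      k = proj₁ (≈⇒scaled g h g≈h)
      eq = proj₂ (≈⇒scaled g h g≈h)
      k²I≋I : k · k · I ≋ I
      k²I≋I = ≋-trans (·-cong (·-cong (≋-sym h²))) (≋-trans (·-cong (≋-sym (⊗-· k (m h) (m h))))
        (≋-trans (≋-sym (·-⊗ k (m h) (k · m h))) (≋-trans (≋-sym (⊗-cong eq eq)) g²)))
      k≈1 : k ≈ 1#
      k≈1 = x²≈1⇒x≈1 (trans (*-congˡ (sym (*-identityʳ k))) (k²I≋I 0F 0F))

    y : U.Carrier → PG.Carrier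
    y b = GL′.conj swapᴳ (xᴳ b)

    inv′ : Q.Carrier → U.Carrier → PG.Carrier
    inv′ s b = GL′.conj (uᴳ s) (y b)

    -- The unitary transvection 1 + t v w, with the column v = (α , b , 1) and the row w = (1 , β ,
    -- a); v is isotropic because α + a = β b.
    inv-rows : ∀ {k} (β b α a t : Expr k) → MExpr 3 k
    inv-rows β b α a t = rows
      ( (:1 :+ t :* α ∷ t :* α :* β ∷ t :* α :* a ∷ [])
      ∷ (t :* b ∷ :1 :+ t :* (b :* β) ∷ t :* b :* a ∷ [])
      ∷ (t ∷ t :* β ∷ :1 :+ t :* a ∷ [])
      ∷ [])

    Low : Carrier → Matrix 3
    Low a = ⟦ low (var 0F) ⟧ᴹ (a ∷ [])

    Inv : (β b α a t : Carrier) → Matrix 3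
    Inv β b α a t = ⟦ inv-rows (var 0F) (var 1F) (var 2F) (var 3F) (var 4F) ⟧ᴹ (β ∷ b ∷ α ∷ a ∷ t ∷ [])

    m-y : ∀ b → m (y b) ≋ Low (proj₁ b)
    m-y (b , _) = ≋-trans (⊗-cong (⊗-cong {B = X b} (≋-sym (J≋ {ρ = b ∷ []})) ≋-refl) (≋-sym (J≋ {ρ = b ∷ []})))
      (solveᴹ (b ∷ []) (swap :⊗ xe (var 0F) :⊗ swap) (low (var 0F)) ≡.refl)

    m-inv : ∀ s t → m (inv′ s t) ≋ Inv (proj₁ (proj₁ s)) (bar (proj₁ (proj₁ s))) (proj₂ (proj₁ s)) (bar (proj₂ (proj₁ s))) (proj₁ t)
    m-inv ((β , α) , e) t = ≋-trans
      (⊗-cong {B = Up β (bar β) (bar α)} (⊗-cong {A = Up β (bar β) α} ≋-refl (m-y t)) ≋-refl)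
      (solveᴹ-under (β ∷ bar β ∷ α ∷ bar α ∷ proj₁ t ∷ [])
        (up (var 0F) (var 1F) (var 2F) :⊗ low (var 4F) :⊗ up (var 0F) (var 1F) (var 3F))
        (inv-rows (var 0F) (var 1F) (var 2F) (var 3F) (var 4F))
        ((var 2F :+ var 3F , var 0F :* var 1F) ∷ [])
        (([] ∷ [] ∷ single :1 ∷ []) ∷ ([] ∷ [] ∷ [] ∷ []) ∷ ([] ∷ [] ∷ [] ∷ []) ∷ []) ≡.refl e)

    X-square : ∀ a → X a ⊗ X a ≋ I
    X-square a = ≋-trans (solveᴹ (a ∷ []) (xe (var 0F) :⊗ xe (var 0F)) one ≡.refl) (I≋ {ρ = a ∷ []})

    conj-square : ∀ g x → m x ⊗ m x ≋ I → m (GL′.conj g x) ⊗ m (GL′.conj g x) ≋ I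
    conj-square g x x² = SU₃.trans {GL′.conj g x SU₃.∙ GL′.conj g x} {GL′.conj g (x SU₃.∙ x)} {SU₃.ε}
      (SU₃.sym {GL′.conj g (x SU₃.∙ x)} {GL′.conj g x SU₃.∙ GL′.conj g x} (GroupLemmas.conj-∙ SU₃ g x x))
      (SU₃.trans {GL′.conj g (x SU₃.∙ x)} {GL′.conj g SU₃.ε} {SU₃.ε}
        (GroupLemmas.conj-congʳ SU₃ g {x SU₃.∙ x} {SU₃.ε} x²) (GroupLemmas.conj-ε SU₃ g))

    y-square : ∀ b → m (y b) ⊗ m (y b) ≋ I
    y-square b = conj-square swapᴳ (xᴳ b) (X-square (proj₁ b))

    inv-square : ∀ s b → m (inv′ s b) ⊗ m (inv′ s b) ≋ I
    inv-square s b = conj-square (uᴳ s) (y b) (y-square b)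

    -- The diagonal is required to be constant rather than 1, so that the condition does not depend
    -- on the matrix that represents g.
    Unipotent : PG.Carrier → Set ℓ
    Unipotent g = m g 1F 0F ≈ 0# × m g 2F 0F ≈ 0# × m g 2F 1F ≈ 0# × m g 0F 0F ≈ m g 2F 2F × m g 1F 1F ≈ m g 2F 2F

    scaled-up : ∀ {k} (d p r t : Expr k) → MExpr 3 k
    scaled-up d p r t = rows ((d ∷ p ∷ r ∷ []) ∷ (:0 ∷ d ∷ t ∷ []) ∷ (:0 ∷ :0 ∷ d ∷ []) ∷ [])

    unipotent-rows : ∀ g → Unipotent g →
      m g ≋ ⟦ scaled-up (var 0F) (var 1F) (var 2F) (var 3F) ⟧ᴹ (m g 2F 2F ∷ m g 0F 1F ∷ m g 0F 2F ∷ m g 1F 2F ∷ [])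
    unipotent-rows g (e₁₀ , e₂₀ , e₂₁ , e₀₀ , e₁₁) = pointwise (e₀₀ , refl , refl) (e₁₀ , e₁₁ , refl) (e₂₀ , e₂₁ , refl)

    Unipotent-∙ : ∀ {g h} → Unipotent g → Unipotent h → Unipotent (g PG.∙ h)
    Unipotent-∙ {g} {h} p p′ =
      trans (gh 1F 0F) (solve ρ (entry E 1F 0F) :0 ≡.refl) , trans (gh 2F 0F) (solve ρ (entry E 2F 0F) :0 ≡.refl) ,
      trans (gh 2F 1F) (solve ρ (entry E 2F 1F) :0 ≡.refl) ,
      trans (gh 0F 0F) (trans (solve ρ (entry E 0F 0F) (entry E 2F 2F) ≡.refl) (sym (gh 2F 2F))) ,
      trans (gh 1F 1F) (trans (solve ρ (entry E 1F 1F) (entry E 2F 2F) ≡.refl) (sym (gh 2F 2F)))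
      where
      ρ : Vec Carrier 8
      ρ = m g 2F 2F ∷ m g 0F 1F ∷ m g 0F 2F ∷ m g 1F 2F ∷ m h 2F 2F ∷ m h 0F 1F ∷ m h 0F 2F ∷ m h 1F 2F ∷ []
      E : MExpr 3 8
      E = scaled-up (var 0F) (var 1F) (var 2F) (var 3F) :⊗ scaled-up (var 4F) (var 5F) (var 6F) (var 7F)
      gh : ∀ i j → m (g PG.∙ h) i j ≈ ⟦ entry E i j ⟧ ρ
      gh i j = trans (⊗-cong (unipotent-rows g p) (unipotent-rows h p′) i j) (sym (entry-sound E ρ i j))

    Unipotent-comm : ∀ g → Unipotent g → g PG.∙ xᴳ oneᵁ PG.≈ xᴳ oneᵁ PG.∙ g
    Unipotent-comm g p = ≋⇒≈ (g PG.∙ xᴳ oneᵁ) (xᴳ oneᵁ PG.∙ g) (≋-trans (⊗-cong {B = X 1#} (unipotent-rows g p) ≋-refl)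
      (≋-trans (solveᴹ (m g 2F 2F ∷ m g 0F 1F ∷ m g 0F 2F ∷ m g 1F 2F ∷ []) (E :⊗ xe :1) (xe :1 :⊗ E) ≡.refl)
      (⊗-cong {A = X 1#} ≋-refl (≋-sym (unipotent-rows g p)))))
      where
      E : MExpr 3 4
      E = scaled-up (var 0F) (var 1F) (var 2F) (var 3F)

    -- The fourth power of d times a unitriangular matrix of size 3 is the scalar d⁴, which is
    -- trivial in the quotient.
    Unipotent-pow : ∀ g → Unipotent g → GL′.pow 4 g PG.≈ PG.ε
    Unipotent-pow g p = scaled⇒≈ (GL′.pow 4 g) PG.ε (d * d * (d * d)) (≋-trans
      (⊗-cong E≋ (⊗-cong E≋ (⊗-cong E≋ (⊗-cong {B′ = ⟦ one ⟧ᴹ ρ} E≋ (≋-sym (I≋ {ρ = ρ}))))))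
      (≋-trans (solveᴹ ρ (E :⊗ (E :⊗ (E :⊗ (E :⊗ one)))) (diag d⁴ d⁴ d⁴) ≡.refl) scalar))
      where
      d = m g 2F 2F
      ρ : Vec Carrier 4
      ρ = d ∷ m g 0F 1F ∷ m g 0F 2F ∷ m g 1F 2F ∷ []
      E : MExpr 3 4
      E = scaled-up (var 0F) (var 1F) (var 2F) (var 3F)
      E≋ : m g ≋ ⟦ E ⟧ᴹ ρ
      E≋ = unipotent-rows g p
      d⁴ : Expr 4
      d⁴ = var 0F :* var 0F :* (var 0F :* var 0F)
      scalar : ⟦ diag d⁴ d⁴ d⁴ ⟧ᴹ ρ ≋ (d * d * (d * d)) · I
      scalar = pointwise (sym (*-identityʳ _) , sym (zeroʳ _) , sym (zeroʳ _)) (sym (zeroʳ _) , sym (*-identityʳ _) , sym (zeroʳ _))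
        (sym (zeroʳ _) , sym (zeroʳ _) , sym (*-identityʳ _))

    triangular-pow : ∀ g → m g 1F 0F ≈ 0# → m g 2F 0F ≈ 0# → m g 2F 1F ≈ 0# → ∀ k →
      m (GL′.pow k g) 1F 0F ≈ 0# × m (GL′.pow k g) 2F 0F ≈ 0# × m (GL′.pow k g) 2F 1F ≈ 0# ×
      m (GL′.pow k g) 0F 0F ≈ m g 0F 0F ^ k × m (GL′.pow k g) 1F 1F ≈ m g 1F 1F ^ k × m (GL′.pow k g) 2F 2F ≈ m g 2F 2F ^ k
    triangular-pow g e₁₀ e₂₀ e₂₁ zero    = refl , refl , refl , refl , refl , refl
    triangular-pow g e₁₀ e₂₀ e₂₁ (suc k) =
      at 1F 0F :0 ≡.refl , at 2F 0F :0 ≡.refl , at 2F 1F :0 ≡.refl ,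
      at 0F 0F (var 0F :* var 6F) ≡.refl , at 1F 1F (var 1F :* var 7F) ≡.refl , at 2F 2F (var 2F :* var 8F) ≡.refl
      where
      h = GL′.pow k g
      ih = triangular-pow g e₁₀ e₂₀ e₂₁ k
      ρ : Vec Carrier 12
      ρ = m g 0F 0F ∷ m g 1F 1F ∷ m g 2F 2F ∷ m g 0F 1F ∷ m g 0F 2F ∷ m g 1F 2F
        ∷ m g 0F 0F ^ k ∷ m g 1F 1F ^ k ∷ m g 2F 2F ^ k ∷ m h 0F 1F ∷ m h 0F 2F ∷ m h 1F 2F ∷ []
      tri : ∀ {k} (d₀ d₁ d₂ p r t : Expr k) → MExpr 3 k
      tri d₀ d₁ d₂ p r t = rows ((d₀ ∷ p ∷ r ∷ []) ∷ (:0 ∷ d₁ ∷ t ∷ []) ∷ (:0 ∷ :0 ∷ d₂ ∷ []) ∷ [])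
      E : MExpr 3 12
      E = tri (var 0F) (var 1F) (var 2F) (var 3F) (var 4F) (var 5F)
        :⊗ tri (var 6F) (var 7F) (var 8F) (var 9F) (var (suc 9F)) (var (suc (suc 9F)))
      bounded : m h 1F 0F ≈ 0# × m h 2F 0F ≈ 0# × m h 2F 1F ≈ 0# ×
        m h 0F 0F ≈ m g 0F 0F ^ k × m h 1F 1F ≈ m g 1F 1F ^ k × m h 2F 2F ≈ m g 2F 2F ^ k →
        m h ≋ ⟦ tri (var 6F) (var 7F) (var 8F) (var 9F) (var (suc 9F)) (var (suc (suc 9F))) ⟧ᴹ ρ
      bounded (h₁₀ , h₂₀ , h₂₁ , h₀₀ , h₁₁ , h₂₂) = pointwise (h₀₀ , refl , refl) (h₁₀ , h₁₁ , refl) (h₂₀ , h₂₁ , h₂₂)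
      gh : m (GL′.pow (suc k) g) ≋ ⟦ E ⟧ᴹ ρ
      gh = ⊗-cong {A = m g} {A′ = ⟦ tri (var 0F) (var 1F) (var 2F) (var 3F) (var 4F) (var 5F) ⟧ᴹ ρ} {B = m h}
        (pointwise (refl , refl , refl) (e₁₀ , refl , refl) (e₂₀ , e₂₁ , refl))
        (bounded ih)
      at : ∀ i j r → isZero (normalise (entry E i j :+ r)) ≡ _ → m (GL′.pow (suc k) g) i j ≈ ⟦ r ⟧ ρ
      at i j r check = trans (gh i j) (trans (sym (entry-sound E ρ i j)) (solve ρ (entry E i j) r check))

    -- Both `x₁` and its conjugate square to 1, so `exact` lifts the hypothesis to matrices and g is
    -- upper triangular. Its diagonal entries have the same power of exponent `2 ^ k`, namely the
    -- scalar κ, and are therefore equal.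
    unipotent-intro : ∀ k a g → GL′.conj g (xᴳ oneᵁ) PG.≈ xᴳ a → GL′.pow (2 ℕ.^ k) g PG.≈ PG.ε → Unipotent g
    unipotent-intro k (a , fa , a≉0) g e e′ = e₁₀ , e₂₀ , e₂₁ , diagonal d₀ d₂ , diagonal d₁ d₂
      where
      x₁ = xᴳ oneᵁ
      xa = xᴳ (a , fa , a≉0)
      exact-conj : m (GL′.conj g x₁) ≋ m xa
      exact-conj = exact (GL′.conj g x₁) xa e (conj-square g x₁ (X-square 1#)) (X-square a)
      facts = from-commute (m g) a a≉0 (GroupLemmas.conj-≈⇒ SU₃ g x₁ xa exact-conj)
      e₁₀ = proj₁ facts
      e₂₀ = proj₁ (proj₂ facts)
      e₂₁ = proj₁ (proj₂ (proj₂ facts))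
      N = 2 ℕ.^ k
      scalar = ≈⇒scaled (GL′.pow N g) PG.ε e′
      κ = proj₁ scalar
      powers = proj₂ (proj₂ (proj₂ (triangular-pow g e₁₀ e₂₀ e₂₁ N)))
      d₀ : m g 0F 0F ^ N ≈ κ
      d₀ = trans (sym (proj₁ powers)) (trans (proj₂ scalar 0F 0F) (*-identityʳ κ))
      d₁ : m g 1F 1F ^ N ≈ κ
      d₁ = trans (sym (proj₁ (proj₂ powers))) (trans (proj₂ scalar 1F 1F) (*-identityʳ κ))
      d₂ : m g 2F 2F ^ N ≈ κ
      d₂ = trans (sym (proj₂ (proj₂ powers))) (trans (proj₂ scalar 2F 2F) (*-identityʳ κ))
      diagonal : ∀ {x y} → x ^ N ≈ κ → y ^ N ≈ κ → x ≈ y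
      diagonal ex ey = 2^k-injective k (trans ex (sym ey))

    entries-cong : ∀ {A B : Matrix 3} → A ≋ B → ∀ i → Vec.lookup (entries A []) i ≈ Vec.lookup (entries B []) i
    entries-cong e 0F = e 0F 0F
    entries-cong e 1F = e 0F 1F
    entries-cong e 2F = e 0F 2F
    entries-cong e 3F = e 1F 0F
    entries-cong e 4F = e 1F 1F
    entries-cong e 5F = e 1F 2F
    entries-cong e 6F = e 2F 0F
    entries-cong e 7F = e 2F 1F
    entries-cong e 8F = e 2F 2F

    entries≋ : ∀ {k} (A : Matrix 3) (ρ : Vec Carrier k) → ⟦ generic ⟧ᴹ (entries A ρ) ≋ A
    entries≋ A ρ = pointwise (refl , refl , refl) (refl , refl , refl) (refl , refl , refl)

    reversed-rows reversed-columns : MExpr 3 9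
    reversed-rows = rows ((var 6F ∷ var 7F ∷ var 8F ∷ []) ∷ (var 3F ∷ var 4F ∷ var 5F ∷ []) ∷ (var 0F ∷ var 1F ∷ var 2F ∷ []) ∷ [])
    reversed-columns = rows ((var 2F ∷ var 1F ∷ var 0F ∷ []) ∷ (var 5F ∷ var 4F ∷ var 3F ∷ []) ∷ (var 8F ∷ var 7F ∷ var 6F ∷ []) ∷ [])

    -- For a unitary involution B the matrix B J is Hermitian.
    hermitian : ∀ (g : PG.Carrier) → m g ⊗ m g ≋ I →
      ⟦ reversed-rows ⟧ᴹ (entries (star (m g)) []) ≋ ⟦ reversed-columns ⟧ᴹ (entries (m g) [])
    hermitian g g² = ≋-trans (≋-sym (solveᴹ (entries (star B) []) (swap :⊗ generic) reversed-rows ≡.refl))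
      (≋-trans (⊗-cong (J≋ {ρ = entries (star B) []}) (entries≋ (star B) []))
      (≋-trans JB*≋BJ
      (≋-trans (≋-sym (⊗-cong (entries≋ B []) (J≋ {ρ = entries B []})))
      (solveᴹ (entries B []) (generic :⊗ swap) reversed-columns ≡.refl))))
      where
      B = m g
      JB*≋BJ : J ⊗ star B ≋ B ⊗ J
      JB*≋BJ = ≋-trans (⊗-cong {B = star B} (≋-trans (≋-sym (⊗-identityˡ J)) (≋-trans (⊗-cong {B = J} (≋-sym g²) ≋-refl) (⊗-assoc B B J))) ≋-refl)
        (≋-trans (⊗-assoc B (B ⊗ J) (star B)) (⊗-cong {A = B} ≋-refl (proj₂ (proj₂ g))))

    -- Since B J is Hermitian, products of opposite entries such as p₃ p₇ are norms. If p₆ = 0, then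
    -- B ∙ B = 1 makes these norms vanish and B is some `X p₂`. Otherwise B + 1 has rank one, and
    -- the transvection is read off from its entries.
    classify-exact : ∀ g → m g ⊗ m g ≋ I → ¬ g PG.≈ PG.ε → (∃[ a ] g PG.≈ xᴳ a) ⊎ (∃[ s ] ∃[ t ] g PG.≈ inv′ s t)
    classify-exact g g² g≉ε = cases (p₆ ≟ 0#)
      where
      B = m g
      H = hermitian g g²
      p₀ = B 0F 0F
      p₁ = B 0F 1F
      p₂ = B 0F 2F
      p₃ = B 1F 0F
      p₄ = B 1F 1F
      p₅ = B 1F 2F
      p₆ = B 2F 0F
      p₇ = B 2F 1F
      p₈ = B 2F 2F
      bar-p₆ : bar p₆ ≈ p₆
      bar-p₆ = H 2F 2F
      bar-p₃ : bar p₃ ≈ p₇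
      bar-p₃ = H 2F 1F
      bar-p₀ : bar p₀ ≈ p₈
      bar-p₀ = H 2F 0F
      bar-p₂ : bar p₂ ≈ p₂
      bar-p₂ = H 0F 0F
      bar-p₁ : bar p₁ ≈ p₅
      bar-p₁ = H 1F 0F
      sq : ∀ {k} → Fin 3 → Fin 3 → Expr (9 ℕ.+ k)
      sq i j = entry (generic :⊗ generic) i j
      cases : Dec (p₆ ≈ 0#) → _
      cases (yes p₆≈0) = inj₁ ((p₂ , bar-p₂ , p₂≉0) , ≋⇒≈ g (xᴳ (p₂ , bar-p₂ , p₂≉0)) B≋)
        where
        p₃≈0 : p₃ ≈ 0#
        p₃≈0 = norm≈0⇒≈0 (trans (*-congˡ bar-p₃) (solve-under (entries B []) (var 3F :* var 7F) :0
          ((sq 2F 0F , :0) ∷ (var 6F , :0) ∷ []) (:1 ∷ (var 0F :+ var 8F) ∷ []) ≡.refl (g² 2F 0F , p₆≈0)))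
        p₇≈0 : p₇ ≈ 0#
        p₇≈0 = trans (sym bar-p₃) (trans (bar-cong p₃≈0) bar-0)
        p₀≈1 : p₀ ≈ 1#
        p₀≈1 = x²≈1⇒x≈1 (solve-under (entries B []) (var 0F :* var 0F) :1
          ((sq 0F 0F , :1) ∷ (var 3F , :0) ∷ (var 6F , :0) ∷ []) (:1 ∷ var 1F ∷ var 2F ∷ []) ≡.refl (g² 0F 0F , p₃≈0 , p₆≈0))
        p₈≈1 : p₈ ≈ 1#
        p₈≈1 = trans (sym bar-p₀) (trans (bar-cong p₀≈1) bar-1)
        p₄≈1 : p₄ ≈ 1#
        p₄≈1 = x²≈1⇒x≈1 (solve-under (entries B []) (var 4F :* var 4F) :1
          ((sq 1F 1F , :1) ∷ (var 3F , :0) ∷ (var 7F , :0) ∷ []) (:1 ∷ var 1F ∷ var 5F ∷ []) ≡.refl (g² 1F 1F , p₃≈0 , p₇≈0))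
        p₁≈0 : p₁ ≈ 0#
        p₁≈0 = norm≈0⇒≈0 (trans (*-congˡ bar-p₁) (solve-under (entries B []) (var 1F :* var 5F) :0
          ((sq 0F 2F , :0) ∷ (var 0F , :1) ∷ (var 8F , :1) ∷ []) (:1 ∷ var 2F ∷ var 2F ∷ []) ≡.refl (g² 0F 2F , p₀≈1 , p₈≈1)))
        p₅≈0 : p₅ ≈ 0#
        p₅≈0 = trans (sym bar-p₁) (trans (bar-cong p₁≈0) bar-0)
        B≋ : B ≋ X p₂
        B≋ = pointwise (p₀≈1 , p₁≈0 , refl) (p₃≈0 , p₄≈1 , p₅≈0) (p₆≈0 , p₇≈0 , p₈≈1)
        p₂≉0 : ¬ p₂ ≈ 0#
        p₂≉0 p₂≈0 = g≉ε (≋⇒≈ g PG.ε (pointwise (p₀≈1 , p₁≈0 , p₂≈0) (p₃≈0 , p₄≈1 , p₅≈0) (p₆≈0 , p₇≈0 , p₈≈1)))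
      cases (no p₆≉0) = inj₂ (s , t , ≋⇒≈ g (inv′ s t) (≋-trans B≋ (≋-sym (m-inv s t))))
        where
        w = p₆ ⁻¹
        pw : p₆ * w ≈ 1#
        pw = ⁻¹-inverseʳ p₆≉0
        bar-w : bar w ≈ w
        bar-w = Fixed-⁻¹ p₆≉0 bar-p₆
        t : U.Carrier
        t = p₆ , bar-p₆ , p₆≉0
        -- Comparison with `inv-rows`: t = p₆, t β = p₇ and 1 + t α = p₀.
        β = p₇ * w
        α = (p₀ + 1#) * w
        bar-β : bar β ≈ p₃ * w
        bar-β = trans (bar-* p₇ w) (*-cong (trans (bar-cong (sym bar-p₃)) (bar-bar p₃)) bar-w)
        bar-α : bar α ≈ (p₈ + 1#) * w
        bar-α = trans (bar-* _ w) (*-cong (trans (bar-+ p₀ 1#) (+-cong bar-p₀ bar-1)) bar-w)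
        ρ : Vec Carrier 10
        ρ = entries B (w ∷ [])
        a W : Expr 10
        a = var 6F
        W = var 9F
        s : Q.Carrier
        s = (β , α) , trans (+-congˡ bar-α) (trans (solve-under ρ
            ((var 0F :+ :1) :* W :+ (var 8F :+ :1) :* W) (var 7F :* W :* (var 3F :* W))
            ((sq 2F 0F , :0) ∷ (a :* W , :1) ∷ []) (W :* W ∷ W :* (var 0F :+ var 8F) ∷ []) ≡.refl (g² 2F 0F , pw))
          (*-congˡ (sym bar-β)))
        -- A 2 × 2 minor of B + 1 vanishes. The relations of B ∙ B = 1 give this only for the
        -- squares, and square roots are unique.
        e₁ : p₆ * (p₄ + 1#) ≈ p₃ * p₇
        e₁ = square-injective (solve-under ρ (a :* (var 4F :+ :1) :* (a :* (var 4F :+ :1))) (var 3F :* var 7F :* (var 3F :* var 7F))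
          ((sq 1F 1F , :1) ∷ (sq 2F 1F , :0) ∷ (sq 1F 0F , :0) ∷ (sq 2F 0F , :0) ∷ [])
          (a :* a ∷ a :* var 3F ∷ a :* var 7F ∷ var 3F :* var 7F ∷ []) ≡.refl (g² 1F 1F , g² 2F 1F , g² 1F 0F , g² 2F 0F))
        -- Equivalently, B has trace 1.
        e₂ : p₄ ≈ 1# + p₀ + p₈
        e₂ = *-cancelˡ p₆≉0 (solve-under ρ (a :* var 4F) (a :* (:1 :+ var 0F :+ var 8F))
          ((a :* (var 4F :+ :1) , var 3F :* var 7F) ∷ (sq 2F 0F , :0) ∷ []) (:1 ∷ :1 ∷ []) ≡.refl (e₁ , g² 2F 0F))
        e₃ : p₁ ≈ w * p₇ * (1# + p₀)
        e₃ = solve-under ρ (var 1F) (W :* var 7F :* (:1 :+ var 0F))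
          ((sq 2F 1F , :0) ∷ (var 4F , :1 :+ var 0F :+ var 8F) ∷ (a :* W , :1) ∷ [])
          (W ∷ W :* var 7F ∷ var 1F ∷ []) ≡.refl (g² 2F 1F , e₂ , pw)
        pwᴱ : Expr 10 × Expr 10
        pwᴱ = a :* W , :1
        B≋ : B ≋ Inv β (bar β) α (bar α) p₆
        B≋ = ≋-trans (pointwise {B = Inv β (p₃ * w) α ((p₈ + 1#) * w) p₆}
            ( solve-under ρ (var 0F) (:1 :+ a :* ((var 0F :+ :1) :* W)) (pwᴱ ∷ []) (var 0F :+ :1 ∷ []) ≡.refl pw
            , solve-under ρ (var 1F) (a :* ((var 0F :+ :1) :* W) :* (var 7F :* W))
                ((var 1F , W :* var 7F :* (:1 :+ var 0F)) ∷ pwᴱ ∷ []) (:1 ∷ W :* var 7F :* (:1 :+ var 0F) ∷ []) ≡.refl (e₃ , pw)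
            , solve-under ρ (var 2F) (a :* ((var 0F :+ :1) :* W) :* ((var 8F :+ :1) :* W))
                ((sq 0F 0F , :1) ∷ (var 1F , W :* var 7F :* (:1 :+ var 0F)) ∷ (sq 2F 0F , :0) ∷ pwᴱ ∷ [])
                (W ∷ W :* var 3F ∷ W :* W :* (:1 :+ var 0F) ∷ var 2F :+ W :* (var 0F :+ :1) :* (var 0F :+ :1) ∷ []) ≡.refl
                (g² 0F 0F , e₃ , g² 2F 0F , pw))
            ( solve-under ρ (var 3F) (a :* (var 3F :* W)) (pwᴱ ∷ []) (var 3F ∷ []) ≡.refl pw
            , solve-under ρ (var 4F) (:1 :+ a :* (var 3F :* W :* (var 7F :* W)))
                ((a :* (var 4F :+ :1) , var 3F :* var 7F) ∷ pwᴱ ∷ []) (W ∷ var 4F :+ :1 :+ W :* var 3F :* var 7F ∷ []) ≡.refl (e₁ , pw)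
            , solve-under ρ (var 5F) (a :* (var 3F :* W) :* ((var 8F :+ :1) :* W))
                ((sq 1F 0F , :0) ∷ (var 4F , :1 :+ var 0F :+ var 8F) ∷ pwᴱ ∷ [])
                (W ∷ W :* var 3F ∷ var 5F :+ W :* var 3F :* (:1 :+ var 8F) ∷ []) ≡.refl (g² 1F 0F , e₂ , pw))
            ( refl
            , solve-under ρ (var 7F) (a :* (var 7F :* W)) (pwᴱ ∷ []) (var 7F ∷ []) ≡.refl pw
            , solve-under ρ (var 8F) (:1 :+ a :* ((var 8F :+ :1) :* W)) (pwᴱ ∷ []) (var 8F :+ :1 ∷ []) ≡.refl pw))
          (⟦⟧ᴹ-cong (inv-rows (var 0F) (var 1F) (var 2F) (var 3F) (var 4F)) (β ∷ p₃ * w ∷ α ∷ (p₈ + 1#) * w ∷ p₆ ∷ []) (β ∷ bar β ∷ α ∷ bar α ∷ p₆ ∷ []) bars)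
          where
          bars : ∀ i → Vec.lookup (β ∷ p₃ * w ∷ α ∷ (p₈ + 1#) * w ∷ p₆ ∷ []) i ≈ Vec.lookup (β ∷ bar β ∷ α ∷ bar α ∷ p₆ ∷ []) i
          bars 0F = refl
          bars 1F = sym bar-β
          bars 2F = refl
          bars 3F = sym bar-α
          bars 4F = refl

    -- If g² = c is scalar, then c³ = det g² = 1 and g³ = c g squares to I.
    classify : ∀ g → Involution (PSU₃ n F) g → (∃[ a ] g PG.≈ xᴳ a) ⊎ (∃[ s ] ∃[ t ] g PG.≈ inv′ s t)
    classify g g-inv = transfer (classify-exact g³ g³-square (λ e → GL′.nontrivial g-inv (PG.trans {g} {g³} {PG.ε} g≈g³ e)))
      where
      scalar = ≈⇒scaled (g PG.∙ g) PG.ε (GL′.square g-inv)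
      k = proj₁ scalar
      g³ = g PG.∙ (g PG.∙ g)
      g³≋ : m g³ ≋ k · m g
      g³≋ = ≋-trans (⊗-cong {A = m g} ≋-refl (proj₂ scalar)) (≋-trans (⊗-· k (m g) I) (·-cong (⊗-identityʳ (m g))))
      g≈g³ : g PG.≈ g³
      g≈g³ = PG.sym {g³} {g} (scaled⇒≈ g³ g k g³≋)
      scalar-expr : MExpr 3 1
      scalar-expr = rows ((d ∷ o ∷ o ∷ []) ∷ (o ∷ d ∷ o ∷ []) ∷ (o ∷ o ∷ d ∷ []) ∷ [])
        where
        d o : Expr 1
        d = var 0F :* :1
        o = var 0F :* :0
      k³≈1 : k * k * k ≈ 1#
      k³≈1 = trans (sym (trans (⟦⟧-cong (det-expr generic) (entries (m (g PG.∙ g)) []) (entries (k · I) []) (entries-cong {m (g PG.∙ g)} {k · I} (proj₂ scalar)))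
          (solve (k ∷ []) (det-expr scalar-expr) (var 0F :* var 0F :* var 0F) ≡.refl)))
        (proj₁ (proj₂ (g PG.∙ g)))
      g³-square : m g³ ⊗ m g³ ≋ I
      g³-square i j = trans (≋-trans (⊗-cong g³≋ g³≋) (≋-trans (·-⊗ k (m g) (k · m g))
        (·-cong (≋-trans (⊗-· k (m g) (m g)) (·-cong (proj₂ scalar))))) i j)
        (trans (solve (k ∷ I i j ∷ []) (var 0F :* (var 0F :* (var 0F :* var 1F))) (var 0F :* var 0F :* var 0F :* var 1F) ≡.refl)
          (trans (*-congʳ k³≈1) (*-identityˡ _)))
      transfer : _ → _
      transfer (inj₁ (a , e)) = inj₁ (a , PG.trans {g} {g³} {xᴳ a} g≈g³ e)
      transfer (inj₂ (s , t , e)) = inj₂ (s , t , PG.trans {g} {g³} {inv′ s t} g≈g³ e)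

    product : ∀ {k} → Expr k → Expr k → MExpr 3 k
    product a b = xe a :⊗ low b

    D³ : ∀ {k} → Expr k → Expr k → MExpr 3 k
    D³ a b = product a b :⊗ (product a b :⊗ (product a b :⊗ one))

    m-product : ∀ a b → m (xᴳ a PG.∙ y b) ≋ ⟦ product (var 0F) (var 1F) ⟧ᴹ (proj₁ a ∷ proj₁ b ∷ [])
    m-product a b = ⊗-cong {A = X (proj₁ a)} ≋-refl (m-y b)

    cube : ∀ a b → m (GL′.pow 3 (xᴳ a PG.∙ y b)) ≋ ⟦ D³ (var 0F) (var 1F) ⟧ᴹ (proj₁ a ∷ proj₁ b ∷ [])
    cube a b = ⊗-cong D (⊗-cong D (⊗-cong {B′ = ⟦ one ⟧ᴹ (proj₁ a ∷ proj₁ b ∷ [])} D (≋-sym (I≋ {ρ = proj₁ a ∷ proj₁ b ∷ []}))))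
      where D = m-product a b

    cube-entry : ∀ a b i j → m (GL′.pow 3 (xᴳ a PG.∙ y b)) i j ≈ ⟦ entry (D³ (var 0F) (var 1F)) i j ⟧ (proj₁ a ∷ proj₁ b ∷ [])
    cube-entry a b i j = trans (cube a b i j) (sym (entry-sound (D³ (var 0F) (var 1F)) (proj₁ a ∷ proj₁ b ∷ []) i j))

    -- Entry (0,2) of the cube is a (1 + a b)², and off the diagonal a scalar matrix vanishes
    -- whatever the scalar.
    order-3⇒ : ∀ a b → HasOrder (PSU₃ n F) (xᴳ a PG.∙ y b) 3 → proj₁ a * proj₁ b ≈ 1#
    order-3⇒ a b o = sym (x+y≈0⇒x≈y (x²≈0⇒x≈0 (integral (trans
        (solve (proj₁ a ∷ proj₁ b ∷ []) (var 0F :* ((:1 :+ var 0F :* var 1F) :* (:1 :+ var 0F :* var 1F)))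
          (entry (D³ (var 0F) (var 1F)) 0F 2F) ≡.refl)
        (trans (sym (cube-entry a b 0F 2F)) (trans (proj₂ scalar 0F 2F) (zeroʳ _)))) (proj₂ (proj₂ a)))))
      where
      scalar = ≈⇒scaled (GL′.pow 3 (xᴳ a PG.∙ y b)) PG.ε (HasOrder.power o)

    order-3⇐ : ∀ a b → proj₁ a * proj₁ b ≈ 1# → HasOrder (PSU₃ n F) (xᴳ a PG.∙ y b) 3
    order-3⇐ a@(a′ , _) b@(b′ , _) ab≈1 = GL′.exponent-3 {D} (≋⇒≈ (GL′.pow 3 D) PG.ε (≋-trans (cube a b) (≋-trans
        (solveᴹ-under (a′ ∷ b′ ∷ []) (D³ (var 0F) (var 1F)) one ((t , :1) ∷ [])
          ( (single (t :* t) ∷ [] ∷ single (var 0F :* (t :+ :1)) ∷ [])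
          ∷ ([] ∷ [] ∷ [] ∷ [])
          ∷ (single (var 1F :* (t :+ :1)) ∷ [] ∷ single t ∷ []) ∷ []) ≡.refl ab≈1)
        (I≋ {ρ = a′ ∷ b′ ∷ []}))))
      (λ e → unit-≉0ʳ ab≈1 (trans (sym (solve (a′ ∷ b′ ∷ []) (entry (product (var 0F) (var 1F)) 2F 0F) (var 1F) ≡.refl))
        (trans (sym (m-product a b 2F 0F)) (trans (proj₂ (≈⇒scaled D PG.ε e) 2F 0F) (zeroʳ _)))))
      where
      D = xᴳ a PG.∙ y b
      t : Expr 2
      t = var 0F :* var 1F

    tr-product : ∀ a b → tr (m (xᴳ a PG.∙ y b)) ≈ 1# + proj₁ a * proj₁ b
    tr-product a b = trans (tr-cong (m-product a b))
      (solve (proj₁ a ∷ proj₁ b ∷ []) (trace-expr (product (var 0F) (var 1F))) (:1 :+ var 0F :* var 1F) ≡.refl)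

    norm : Q.Carrier → Carrier
    norm ((β , α) , _) = α * bar α

    tr-y-inv : ∀ b s t → tr (m (y b PG.∙ inv′ s t)) ≈ 1# + proj₁ b * proj₁ t * norm s
    tr-y-inv b′@(b , _) s@((β , α) , e) t = trans (tr-cong (⊗-cong (m-y b′) (m-inv s t)))
      (solve-under (β ∷ bar β ∷ α ∷ bar α ∷ proj₁ t ∷ b ∷ [])
        (trace-expr (low (var 5F) :⊗ inv-rows (var 0F) (var 1F) (var 2F) (var 3F) (var 4F)))
        (:1 :+ var 5F :* var 4F :* (var 2F :* var 3F))
        ((var 2F :+ var 3F , var 0F :* var 1F) ∷ []) (var 4F ∷ []) ≡.refl e)

    1+x≈0⇒x≈1 : ∀ {x} → 1# + x ≈ 0# → x ≈ 1#
    1+x≈0⇒x≈1 e = sym (x+y≈0⇒x≈y e)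

    x≈1⇒1+x≈0 : ∀ {x} → x ≈ 1# → 1# + x ≈ 0#
    x≈1⇒1+x≈0 e = x≈y⇒x+y≈0 (sym e)

    invᵁ : U.Carrier → U.Carrier
    invᵁ (a , fa , a≉0) = a ⁻¹ , Fixed-⁻¹ a≉0 fa , ⁻¹-≉0 a≉0

    ⁻¹-unit : ∀ {a b} → ¬ a ≈ 0# → b ≈ a ⁻¹ → a * b ≈ 1#
    ⁻¹-unit a≉0 e = trans (*-congˡ e) (⁻¹-inverseʳ a≉0)

    0Q : Q.Carrier
    0Q = (0# , 0#) , trans (+-identityˡ _) (trans bar-0 (sym (zeroˡ _)))

    norm-cong : ∀ {s t} → s Q.≈ t → norm s ≈ norm t
    norm-cong (_ , e) = *-cong e (bar-cong e)

    -- The norm vanishes only for α = 0; then β times its conjugate is the trace of α, which is 0,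
    -- and β = 0 follows.
    norm≉0 : ∀ s → ¬ s Q.≈ 0Q → ¬ norm s ≈ 0#
    norm≉0 ((β , α) , e) s≉0 N≈0 = s≉0 (norm≈0⇒≈0 (trans (sym e) (trans (+-cong α≈0 (trans (bar-cong α≈0) bar-0)) (+-identityˡ _))) , α≈0)
      where
      α≈0 : α ≈ 0#
      α≈0 = norm≈0⇒≈0 N≈0

    -- Conjugation of the unipotent group by the diagonal matrix of μ, 1, μ⁻¹ with μ in 𝔽_q. The
    -- norm is multiplied by μ⁴, and fourth powers permute 𝔽_q*.
    act : ∀ μ → Fixed μ → Q.Carrier → Q.Carrier
    act μ fμ ((β , α) , e) = (μ * β , μ * μ * α) ,
      trans (+-congˡ (trans (bar-* _ α) (*-congʳ (Fixed-* fμ fμ)))) (trans (sym (distribˡ _ _ _)) (trans (*-congˡ e)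
        (trans (solve (μ ∷ β ∷ bar β ∷ []) (var 0F :* var 0F :* (var 1F :* var 2F)) (var 0F :* var 1F :* (var 0F :* var 2F)) ≡.refl)
          (*-congˡ (sym (trans (bar-* μ β) (*-congʳ fμ)))))))

    norm-act : ∀ μ fμ s → norm (act μ fμ s) ≈ μ * μ * (μ * μ) * norm s
    norm-act μ fμ ((β , α) , _) = trans (*-congˡ (trans (bar-* _ α) (*-congʳ (Fixed-* fμ fμ))))
      (solve (μ ∷ α ∷ bar α ∷ []) (var 0F :* var 0F :* var 1F :* (var 0F :* var 0F :* var 2F))
        (var 0F :* var 0F :* (var 0F :* var 0F) :* (var 1F :* var 2F)) ≡.refl)

    act-inverse : ∀ {μ ν} fμ fν → μ * ν ≈ 1# → ∀ s → act μ fμ (act ν fν s) Q.≈ s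
    act-inverse {μ} {ν} fμ fν μν≈1 ((β , α) , _) =
      solve-under (μ ∷ ν ∷ β ∷ []) (var 0F :* (var 1F :* var 2F)) (var 2F) ((var 0F :* var 1F , :1) ∷ []) (var 2F ∷ []) ≡.refl μν≈1 ,
      solve-under (μ ∷ ν ∷ α ∷ []) (var 0F :* var 0F :* (var 1F :* var 1F :* var 2F)) (var 2F)
        ((var 0F :* var 1F , :1) ∷ []) ((var 0F :* var 1F :+ :1) :* var 2F ∷ []) ≡.refl μν≈1

    N₀ : ℕ
    N₀ = q ℕ.^ 2 ℕ.+ q ℕ.+ 1

    module _ (r≡ : q ℕ.^ 2 ℕ.* q ≡ suc ((q ℕ.∸ 1) ℕ.* N₀)) where

      NormFibre : U.Carrier → Q.Carrier → Set ℓ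
      NormFibre k s = proj₁ k * norm s ≈ 1#

      -- With ν a fourth root of k, the action of ν⁻¹ divides the norm by k and that of ν undoes it.
      fibres-equal : ∀ k → Inverse (subsetoid Hermitian (NormFibre oneᵁ)) (subsetoid Hermitian (NormFibre k))
      fibres-equal (k , fk , k≉0) = restrict Hermitian Hermitian
        (mkInverse Hermitian Hermitian (act μ fμ) (act ν fν)
          (λ (e , e′) → *-congˡ e , *-congˡ e′) (λ (e , e′) → *-congˡ e , *-congˡ e′)
          (act-inverse fμ fν μν≈1) (act-inverse fν fμ (trans (*-comm ν μ) μν≈1)))
        (λ s N≈1 → trans (*-congˡ (norm-act μ fμ s)) (trans (sym (*-assoc _ _ _)) (trans (*-congʳ kμ⁴≈1) N≈1)))
        (λ s N≈1 → trans (*-identityˡ _) (trans (norm-act ν fν s) (trans (*-congʳ ν⁴≈k) N≈1)))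
        where
        roots = √-exists k
        κ = proj₁ roots
        κ²≈k = proj₂ roots
        ν = proj₁ (√-exists κ)
        ν²≈κ = proj₂ (√-exists κ)
        fν : Fixed ν
        fν = Fixed-√ ν²≈κ (Fixed-√ κ²≈k fk)
        ν⁴≈k : ν * ν * (ν * ν) ≈ k
        ν⁴≈k = trans (*-cong ν²≈κ ν²≈κ) κ²≈k
        ν≉0 : ¬ ν ≈ 0#
        ν≉0 e = k≉0 (trans (sym ν⁴≈k) (trans (*-congʳ (trans (*-congʳ e) (zeroˡ _))) (zeroˡ _)))
        μ = ν ⁻¹
        fμ = Fixed-⁻¹ ν≉0 fν
        μν≈1 = ⁻¹-inverseˡ ν≉0
        kμ⁴≈1 : k * (μ * μ * (μ * μ)) ≈ 1#
        kμ⁴≈1 = trans (*-congʳ (sym ν⁴≈k)) (solve-under (μ ∷ ν ∷ []) (var 1F :* var 1F :* (var 1F :* var 1F) :* (var 0F :* var 0F :* (var 0F :* var 0F))) :1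
          ((t , :1) ∷ []) ((t :+ :1) :* (t :+ :1) :* (t :+ :1) ∷ []) ≡.refl μν≈1)
          where
          t : Expr 2
          t = var 0F :* var 1F

      module Norms = EqualFibres U Hermitian {{ℕ.>-nonZero (ℕ.∸-monoˡ-≤ 1 2≤q)}} Fixed-nonzero-size Hermitian-size r≡ 0Q NormFibre
        (λ e → trans (*-congʳ (sym e)))
        (λ {k} {s} {t} e → trans (*-congˡ (norm-cong {t} {s} (Q.sym {s} {t} e))))
        (λ k s → proj₁ k * norm s ≟ 1#)
        (λ {k} {s} N≈1 e → unit-≉0ʳ N≈1 (trans (norm-cong {s} {0Q} e) (zeroˡ _)))
        (λ s s≉0 → (norm s ⁻¹ , Fixed-⁻¹ (norm≉0 s s≉0) (Fixed-norm (proj₂ (proj₁ s))) , ⁻¹-≉0 (norm≉0 s s≉0)) , ⁻¹-inverseˡ (norm≉0 s s≉0))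
        (λ {k} {k′} {s} e e′ → *-cancelˡ (unit-≉0ʳ e) (trans (*-comm _ _) (trans e (trans (sym e′) (*-comm _ _)))))
        oneᵁ fibres-equal

      Ψ-fibre : ∀ b t → HasSize (subsetoid Hermitian (λ s → tr (m (y b PG.∙ inv′ s t)) ≈ 0#)) N₀
      Ψ-fibre b@(b′ , fb , b≉0) t@(t′ , ft , t≉0) = size-⇔ Hermitian
        (λ s e → trans (tr-y-inv b s t) (x≈1⇒1+x≈0 e))
        (λ s e → 1+x≈0⇒x≈1 (trans (sym (tr-y-inv b s t)) e))
        (Norms.fibre-size (b′ * t′ , Fixed-* fb ft , *-≉0 b≉0 t≉0))

    x-conj : ∀ (a : U.Carrier) → ∃[ g ] xᴳ a PG.≈ GL′.conj g (xᴳ oneᵁ)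
    x-conj a@(a′ , fa , a≉0) = d , GL′.conj-≈⇐ d (xᴳ oneᵁ) (xᴳ a) (≋⇒≈ (d PG.∙ xᴳ oneᵁ) (xᴳ a PG.∙ d)
      (solveᴹ-under (κ ∷ μ ∷ a′ ∷ []) (diag (var 0F) :1 (var 1F) :⊗ xe :1) (xe (var 2F) :⊗ diag (var 0F) :1 (var 1F))
        ((var 0F :* var 0F , var 2F) ∷ (var 0F :* var 1F , :1) ∷ [])
        (([] ∷ [] ∷ (var 1F ∷ var 0F ∷ []) ∷ []) ∷ ([] ∷ [] ∷ [] ∷ []) ∷ ([] ∷ [] ∷ [] ∷ []) ∷ []) ≡.refl (κ²≈a , κμ≈1)))
      where
      κ = proj₁ (√-exists a′)
      κ²≈a = proj₂ (√-exists a′)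
      κ≉0 : ¬ κ ≈ 0#
      κ≉0 e = a≉0 (trans (sym κ²≈a) (trans (*-congʳ e) (zeroˡ _)))
      μ = κ ⁻¹
      κμ≈1 = ⁻¹-inverseʳ κ≉0
      fκ = Fixed-√ κ²≈a fa
      d = diagᴳ κ μ fκ (Fixed-⁻¹ κ≉0 fκ) κμ≈1

    inv-injective : ∀ s s′ a b → inv′ s a PG.≈ inv′ s′ b → s Q.≈ s′ × a U.≈ b
    inv-injective s@((β , α) , _) s′@((β′ , α′) , _) a@(a₀ , _ , a≉0) b@(b₀ , _) e = (β≈ , α≈) , a≈b
      where
      e′ : Inv β (bar β) α (bar α) a₀ ≋ Inv β′ (bar β′) α′ (bar α′) b₀
      e′ = ≋-trans (≋-sym (m-inv s a)) (≋-trans (exact (inv′ s a) (inv′ s′ b) e (inv-square s a) (inv-square s′ b)) (m-inv s′ b))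
      a≈b : a₀ ≈ b₀
      a≈b = e′ 2F 0F
      β≈ : β ≈ β′
      β≈ = *-cancelˡ a≉0 (trans (e′ 2F 1F) (*-congʳ (sym a≈b)))
      α≈ : α ≈ α′
      α≈ = *-cancelˡ a≉0 (solve-under (a₀ ∷ b₀ ∷ α ∷ α′ ∷ []) (var 0F :* var 2F) (var 0F :* var 3F)
        ((:1 :+ var 0F :* var 2F , :1 :+ var 1F :* var 3F) ∷ (var 0F , var 1F) ∷ []) (:1 ∷ var 3F ∷ []) ≡.refl
        (e′ 0F 0F , a≈b))

    Up-cong : ∀ s t → s Q.≈ t → m (uᴳ s) ≋ m (uᴳ t)
    Up-cong s t (e , e′) = pointwise (refl , e , e′) (refl , refl , bar-cong e) (refl , refl , refl)

    -- The products might agree up to a factor k only, but their (1,1) entries are both 1, so k = 1;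
    -- the (0,0) entries 1 + a b and 1 then give a b = 0.
    x-y-noncomm : ∀ a b → ¬ xᴳ a PG.∙ y b PG.≈ y b PG.∙ xᴳ a
    x-y-noncomm a@(a₀ , _ , a≉0) b@(b₀ , _ , b≉0) e = *-≉0 a≉0 b≉0 (solve-under (a₀ ∷ b₀ ∷ k ∷ [])
        (var 0F :* var 1F) :0
        ((entry (product (var 0F) (var 1F)) 0F 0F , var 2F :* entry (low (var 1F) :⊗ xe (var 0F)) 0F 0F) ∷
         (entry (product (var 0F) (var 1F)) 1F 1F , var 2F :* entry (low (var 1F) :⊗ xe (var 0F)) 1F 1F) ∷ [])
        (:1 ∷ :1 ∷ []) ≡.refl (at 0F , at 1F))
      where
      scalar = ≈⇒scaled (xᴳ a PG.∙ y b) (y b PG.∙ xᴳ a) e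
      k = proj₁ scalar
      ρ : Vec Carrier 3
      ρ = a₀ ∷ b₀ ∷ k ∷ []
      at : ∀ i → ⟦ entry (product (var 0F) (var 1F)) i i ⟧ ρ ≈ k * ⟦ entry (low (var 1F) :⊗ xe (var 0F)) i i ⟧ ρ
      at i = trans (entry-sound (product (var 0F) (var 1F)) ρ i i) (trans (sym (m-product a b i i)) (trans (proj₂ scalar i i)
        (*-congˡ (trans (⊗-cong {B = X a₀} (m-y b) ≋-refl i i) (sym (entry-sound (low (var 1F) :⊗ xe (var 0F)) ρ i i))))))

  rank-one : q ℕ.^ 2 ℕ.* q ≡ suc ((q ℕ.∸ 1) ℕ.* (q ℕ.^ 2 ℕ.+ q ℕ.+ 1)) →
    RankOne {a = c ⊔ ℓ} {ℓ} {c ⊔ ℓ} {ℓ} {ℓ} {ℓ} (PSU₃ n F) (q ℕ.^ 2 ℕ.* q) (q ℕ.^ 2 ℕ.+ q ℕ.+ 1) (q ℕ.∸ 1) 3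
  rank-one r≡ = record
    { _≟_ = _≟ᴾ_
    ; code = codeᴾ
    ; code-injective = λ {g} {h} → codeᴾ-injective {g} {h}
    ; U = U
    ; Q = Hermitian
    ; U-size = Fixed-nonzero-size
    ; Q-size = Hermitian-size
    ; x = xᴳ
    ; x-cong = λ {a} {b} e → ≋⇒≈ (xᴳ a) (xᴳ b) (pointwise {X (proj₁ a)} {X (proj₁ b)} (refl , refl , e) (refl , refl , refl) (refl , refl , refl))
    ; u = uᴳ
    ; u-cong = λ {s} {t} e → ≋⇒≈ (uᴳ s) (uᴳ t) (Up-cong s t e)
    ; w = swapᴳ
    ; 0Q = 0Q
    ; u-0 = ≋⇒≈ (uᴳ 0Q) PG.ε (pointwise {m (uᴳ 0Q)} {I} (refl , refl , refl) (refl , refl , bar-0) (refl , refl , refl))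
    ; 1U = oneᵁ
    ; x-involution = λ a → GL′.involution {xᴳ a} (≋⇒≈ (xᴳ a PG.∙ xᴳ a) PG.ε (X-square (proj₁ a)))
        (λ e → proj₂ (proj₂ a) (trans (proj₂ (≈⇒scaled (xᴳ a) PG.ε e) 0F 2F) (zeroʳ _)))
    ; x-conj = x-conj
    ; x-injective = λ {a} {b} e → exact (xᴳ a) (xᴳ b) e (X-square (proj₁ a)) (X-square (proj₁ b)) 0F 2F
    ; inv-injective = λ {s} {t} {a} {b} → inv-injective s t a b
    ; classify = classify
    ; x-x-comm = λ a b → ≋⇒≈ (xᴳ a PG.∙ xᴳ b) (xᴳ b PG.∙ xᴳ a)
        (solveᴹ (proj₁ a ∷ proj₁ b ∷ []) (xe (var 0F) :⊗ xe (var 1F)) (xe (var 1F) :⊗ xe (var 0F)) ≡.refl)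
    ; u-x-comm = λ { ((β , α) , e) a → ≋⇒≈ (uᴳ ((β , α) , e) PG.∙ xᴳ a) (xᴳ a PG.∙ uᴳ ((β , α) , e))
        (solveᴹ (β ∷ bar β ∷ α ∷ proj₁ a ∷ []) (up (var 0F) (var 1F) (var 2F) :⊗ xe (var 3F)) (xe (var 3F) :⊗ up (var 0F) (var 1F) (var 2F)) ≡.refl) }
    ; x-y-noncomm = x-y-noncomm
    ; ι = invᵁ
    ; ι-injective = λ {(a , _ , a≉0)} {(b , _ , b≉0)} e → *-cancelˡ (⁻¹-≉0 a≉0)
        (trans (⁻¹-inverseˡ a≉0) (trans (sym (⁻¹-inverseˡ b≉0)) (*-congʳ (sym e))))
    ; order-χ⇒ = λ a b o → ⁻¹-unique (order-3⇒ a b (HasOrder-resp (PSU₃ n F) (PG.refl {xᴳ a PG.∙ y b}) o))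
    ; order-χ⇐ = λ a b e → HasOrder-resp (PSU₃ n F) (PG.refl {xᴳ a PG.∙ y b}) (order-3⇐ a b (⁻¹-unit (proj₂ (proj₂ a)) e))
    -- The trace of `x a ∙ y b` is 1 + a b, so a b = 1 shows as trace zero, a condition that scalars
    -- do not affect.
    ; Ψ = λ g → tr (m g) ≈ 0#
    ; Ψ? = λ g → tr (m g) ≟ 0#
    ; Ψ-resp = λ {g} {h} → Ψ-resp g h
    ; Ψ-conj = λ g {h} p → trans (tr-conj (m g) (inv (proj₁ g)) (m h) (invˡ (proj₁ g))) p
    ; Ψ⇒ = λ a b p → ⁻¹-unique (1+x≈0⇒x≈1 (trans (sym (tr-product a b)) p))
    ; Ψ⇐ = λ a b e → trans (tr-product a b) (x≈1⇒1+x≈0 (⁻¹-unit (proj₂ (proj₂ a)) e))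
    ; Ψ-y-y = λ a b p → 1≉0 (trans (sym (trans (tr-cong (⊗-cong (m-y a) (m-y b)))
        (solve (proj₁ a ∷ proj₁ b ∷ []) (trace-expr (low (var 0F) :⊗ low (var 1F))) :1 ≡.refl))) p)
    ; Ψ-fibre = Ψ-fibre r≡
    ; W = Unipotent
    ; W-∙ = λ {g} {h} → Unipotent-∙ {g} {h}
    ; W-comm = λ {g} → Unipotent-comm g
    ; W-pow = λ {g} → Unipotent-pow g
    ; W-intro = λ k a {g} → unipotent-intro k a g
    }
    where
    Ψ-resp : ∀ g h → g PG.≈ h → tr (m g) ≈ 0# → tr (m h) ≈ 0#
    Ψ-resp g h e p = trans (tr-cong (proj₂ (≈⇒scaled h g (PG.sym {g} {h} e))))
      (trans (tr-· _ (m g)) (trans (*-congˡ p) (zeroʳ _)))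

-- Sz(q)

-- The two Bruhat cells of a group of rank one: s parametrises the unipotent
-- group, d the torus, and t represents the Weyl element.
module BruhatCells {c ℓ a b : Level} (G : Group c ℓ) {A : Set a} {B : Set b}
  (s : A → Group.Carrier G) (d : B → Group.Carrier G) (t : Group.Carrier G) where
  open Group G

  Cell : Pred Carrier (a ⊔ b ⊔ ℓ)
  Cell g = (∃[ p ] ∃[ k ] g ≈ s p ∙ d k) ⊎ (∃[ p ] ∃[ k ] ∃[ p′ ] g ≈ s p ∙ (t ∙ (d k ∙ s p′)))

  module Closure
    (s-s  : ∀ p p′ → ∃[ r ] s p ∙ s p′ ≈ s r)
    (s-⁻¹ : ∀ p → ∃[ r ] s p ⁻¹ ≈ s r)
    (d-d  : ∀ k k′ → ∃[ l ] d k ∙ d k′ ≈ d l)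
    (d-⁻¹ : ∀ k → ∃[ l ] d k ⁻¹ ≈ d l)
    (d-s  : ∀ k p → ∃[ r ] d k ∙ s p ≈ s r ∙ d k)
    (d-t  : ∀ k → ∃[ l ] d k ∙ t ≈ t ∙ d l)
    (t-t  : t ∙ t ≈ ε)
    (s-1  : ∃[ p ] ε ≈ s p)
    (d-1  : ∃[ k ] ε ≈ d k)
    (t-s-t : ∀ p → s p ≈ ε ⊎ (∃[ p′ ] ∃[ k ] ∃[ r ] t ∙ (s p ∙ (t ∙ s r)) ≈ s p′ ∙ (t ∙ d k))) where
    open import Relation.Binary.Reasoning.Setoid setoid
    open import Algebra.Properties.Group G using (inverseˡ-unique)

    private
      s-d : ∀ p k → ∃[ r ] s p ∙ d k ≈ d k ∙ s r
      s-d p k = let (l , e) = d-⁻¹ k ; (r , e′) = d-s l p in r , (begin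
        s p ∙ d k                       ≈⟨ trans (∙-congʳ (inverseʳ (d k))) (identityˡ _) ⟨
        d k ∙ d k ⁻¹ ∙ (s p ∙ d k)      ≈⟨ trans (∙-congʳ (∙-congˡ e)) (trans (assoc _ _ _) (∙-congˡ (sym (assoc _ _ _)))) ⟩
        d k ∙ (d l ∙ s p ∙ d k)         ≈⟨ ∙-congˡ (trans (∙-congʳ e′) (assoc _ _ _)) ⟩
        d k ∙ (s r ∙ (d l ∙ d k))       ≈⟨ ∙-congˡ (∙-congˡ (trans (∙-congʳ (sym e)) (inverseˡ (d k)))) ⟩
        d k ∙ (s r ∙ ε)                 ≈⟨ ∙-congˡ (identityʳ _) ⟩
        d k ∙ s r                       ∎)

      -- The relation for t s t is assumed with its right unipotent factor moved to the left side,
      -- which spares an inverse there; this moves it back.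
      flip : ∀ p → s p ≈ ε ⊎ (∃[ p′ ] ∃[ k ] ∃[ r ] t ∙ (s p ∙ t) ≈ s p′ ∙ (t ∙ (d k ∙ s r)))
      flip p with t-s-t p
      ... | inj₁ e = inj₁ e
      ... | inj₂ (p′ , k , r , e) = let (o , e′) = s-⁻¹ r in inj₂ (p′ , k , o , (begin
        t ∙ (s p ∙ t)                                ≈⟨ trans (∙-congˡ (inverseʳ (s r))) (identityʳ _) ⟨
        t ∙ (s p ∙ t) ∙ (s r ∙ s r ⁻¹)               ≈⟨ assoc _ _ _ ⟨
        t ∙ (s p ∙ t) ∙ s r ∙ s r ⁻¹                 ≈⟨ ∙-congʳ (trans (assoc _ _ _) (∙-congˡ (assoc _ _ _))) ⟩
        t ∙ (s p ∙ (t ∙ s r)) ∙ s r ⁻¹               ≈⟨ ∙-cong e e′ ⟩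
        s p′ ∙ (t ∙ d k) ∙ s o                       ≈⟨ trans (assoc _ _ _) (∙-congˡ (assoc _ _ _)) ⟩
        s p′ ∙ (t ∙ (d k ∙ s o))                     ∎))

    Cell-resp : ∀ {g h} → g ≈ h → Cell g → Cell h
    Cell-resp e (inj₁ (p , k , e′))      = inj₁ (p , k , trans (sym e) e′)
    Cell-resp e (inj₂ (p , k , p′ , e′)) = inj₂ (p , k , p′ , trans (sym e) e′)

    s-Cell : ∀ p {g} → Cell g → Cell (s p ∙ g)
    s-Cell p (inj₁ (p′ , k , e)) = let (r , e′) = s-s p p′ in
      inj₁ (r , k , trans (∙-congˡ e) (trans (sym (assoc _ _ _)) (∙-congʳ e′)))
    s-Cell p (inj₂ (p′ , k , p″ , e)) = let (r , e′) = s-s p p′ in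
      inj₂ (r , k , p″ , trans (∙-congˡ e) (trans (sym (assoc _ _ _)) (∙-congʳ e′)))

    d-Cell : ∀ k {g} → Cell g → Cell (d k ∙ g)
    d-Cell k (inj₁ (p , k′ , e)) = let (r , e₁) = d-s k p ; (l , e₂) = d-d k k′ in
      inj₁ (r , l , (begin
        d k ∙ _               ≈⟨ ∙-congˡ e ⟩
        d k ∙ (s p ∙ d k′)    ≈⟨ assoc _ _ _ ⟨
        d k ∙ s p ∙ d k′      ≈⟨ ∙-congʳ e₁ ⟩
        s r ∙ d k ∙ d k′      ≈⟨ assoc _ _ _ ⟩
        s r ∙ (d k ∙ d k′)    ≈⟨ ∙-congˡ e₂ ⟩
        s r ∙ d l             ∎))
    d-Cell k (inj₂ (p , k′ , p′ , e)) =
      let (r , e₁) = d-s k p ; (l , e₂) = d-t k ; (l′ , e₃) = d-d l k′ in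
      inj₂ (r , l′ , p′ , (begin
        d k ∙ _                                 ≈⟨ ∙-congˡ e ⟩
        d k ∙ (s p ∙ (t ∙ (d k′ ∙ s p′)))       ≈⟨ assoc _ _ _ ⟨
        d k ∙ s p ∙ (t ∙ (d k′ ∙ s p′))         ≈⟨ ∙-congʳ e₁ ⟩
        s r ∙ d k ∙ (t ∙ (d k′ ∙ s p′))         ≈⟨ assoc _ _ _ ⟩
        s r ∙ (d k ∙ (t ∙ (d k′ ∙ s p′)))       ≈⟨ ∙-congˡ (assoc _ _ _) ⟨
        s r ∙ (d k ∙ t ∙ (d k′ ∙ s p′))         ≈⟨ ∙-congˡ (∙-congʳ e₂) ⟩
        s r ∙ (t ∙ d l ∙ (d k′ ∙ s p′))         ≈⟨ ∙-congˡ (assoc _ _ _) ⟩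
        s r ∙ (t ∙ (d l ∙ (d k′ ∙ s p′)))       ≈⟨ ∙-congˡ (∙-congˡ (assoc _ _ _)) ⟨
        s r ∙ (t ∙ (d l ∙ d k′ ∙ s p′))         ≈⟨ ∙-congˡ (∙-congˡ (∙-congʳ e₃)) ⟩
        s r ∙ (t ∙ (d l′ ∙ s p′))               ∎))

    private
      s-1-left : ∀ {g} → g ≈ s (proj₁ s-1) ∙ g
      s-1-left = trans (sym (identityˡ _)) (∙-congʳ (proj₂ s-1))

      ds-Cell : ∀ k p → Cell (d k ∙ s p)
      ds-Cell k p = let (r , e) = d-s k p in inj₁ (r , k , e)

      tds-Cell : ∀ k p → Cell (t ∙ (d k ∙ s p))
      tds-Cell k p = inj₂ (proj₁ s-1 , k , p , s-1-left)

    -- The only product that can change the cell. In the big cell t s t arises: for trivial s the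
    -- two t cancel and the small cell results, otherwise `flip` returns to the big cell.
    t-Cell : ∀ {g} → Cell g → Cell (t ∙ g)
    t-Cell (inj₁ (p , k , e)) = let (r , e′) = s-d p k in
      Cell-resp (sym (∙-congˡ (trans e e′))) (tds-Cell k r)
    t-Cell {g} (inj₂ (p , k , p′ , e)) with flip p
    ... | inj₁ e₁ = Cell-resp (sym (begin
        t ∙ g                                 ≈⟨ ∙-congˡ e ⟩
        t ∙ (s p ∙ (t ∙ (d k ∙ s p′)))        ≈⟨ ∙-congˡ (trans (∙-congʳ e₁) (identityˡ _)) ⟩
        t ∙ (t ∙ (d k ∙ s p′))                ≈⟨ assoc _ _ _ ⟨
        t ∙ t ∙ (d k ∙ s p′)                  ≈⟨ trans (∙-congʳ t-t) (identityˡ _) ⟩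
        d k ∙ s p′                            ∎)) (ds-Cell k p′)
    ... | inj₂ (r , l , r′ , e₁) = let (r″ , e₂) = s-d r′ k ; (l′ , e₃) = d-d l k ; (o , e₄) = s-s r″ p′ in
      inj₂ (r , l′ , o , (begin
        t ∙ g                                            ≈⟨ ∙-congˡ e ⟩
        t ∙ (s p ∙ (t ∙ (d k ∙ s p′)))                   ≈⟨ ∙-congˡ (assoc _ _ _) ⟨
        t ∙ (s p ∙ t ∙ (d k ∙ s p′))                     ≈⟨ assoc _ _ _ ⟨
        t ∙ (s p ∙ t) ∙ (d k ∙ s p′)                     ≈⟨ ∙-congʳ e₁ ⟩
        s r ∙ (t ∙ (d l ∙ s r′)) ∙ (d k ∙ s p′)          ≈⟨ trans (assoc _ _ _) (∙-congˡ (trans (assoc _ _ _) (∙-congˡ (assoc _ _ _)))) ⟩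
        s r ∙ (t ∙ (d l ∙ (s r′ ∙ (d k ∙ s p′))))        ≈⟨ ∙-congˡ (∙-congˡ (∙-congˡ (trans (sym (assoc _ _ _)) (trans (∙-congʳ e₂) (assoc _ _ _))))) ⟩
        s r ∙ (t ∙ (d l ∙ (d k ∙ (s r″ ∙ s p′))))        ≈⟨ ∙-congˡ (∙-congˡ (trans (sym (assoc _ _ _)) (∙-cong e₃ e₄))) ⟩
        s r ∙ (t ∙ (d l′ ∙ s o))                         ∎))

    private
      -- Left multiplication by the inverse is included so that the inverse step of the induction
      -- over generated elements merely exchanges the two halves.
      Stable : Pred Carrier (c ⊔ a ⊔ b ⊔ ℓ)
      Stable g = (∀ {h} → Cell h → Cell (g ∙ h)) × (∀ {h} → Cell h → Cell (g ⁻¹ ∙ h))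

      resp : ∀ {g h} → g ≈ h → Stable g → Stable h
      resp e (p , q) = (λ x → Cell-resp (∙-congʳ e) (p x)) , (λ x → Cell-resp (∙-congʳ (⁻¹-cong e)) (q x))

    s-Stable : ∀ p → Stable (s p)
    s-Stable p = s-Cell p , λ x → Cell-resp (∙-congʳ (sym (proj₂ (s-⁻¹ p)))) (s-Cell _ x)

    d-Stable : ∀ k → Stable (d k)
    d-Stable k = d-Cell k , λ x → Cell-resp (∙-congʳ (sym (proj₂ (d-⁻¹ k)))) (d-Cell _ x)

    t-Stable : Stable t
    t-Stable = t-Cell , λ x → Cell-resp (∙-congʳ (inverseˡ-unique t t t-t)) (t-Cell x)

    generated⊆Cell : ∀ {p} {S : Pred Carrier p} →
      (∀ {g} → S g → (∃[ q ] g ≈ s q) ⊎ (∃[ k ] g ≈ d k) ⊎ (g ≈ t)) →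
      ∀ {g} → ⟨_⟩ G S g → Cell g
    generated⊆Cell {S = S} generator x = Cell-resp (identityʳ _) (proj₁ (stable x)
      (Cell-resp (sym (trans (proj₂ d-1) s-1-left)) (inj₁ (_ , _ , refl))))
      where
      open import Algebra.Properties.Group G using (⁻¹-anti-homo-∙; ⁻¹-involutive; ε⁻¹≈ε)
      stable : ∀ {g} → ⟨_⟩ G S g → Stable g
      stable (incl g∈S) with generator g∈S
      ... | inj₁ (q , e)        = resp (sym e) (s-Stable q)
      ... | inj₂ (inj₁ (k , e)) = resp (sym e) (d-Stable k)
      ... | inj₂ (inj₂ e)       = resp (sym e) t-Stable
      stable ε-gen = Cell-resp (sym (identityˡ _)) , Cell-resp (sym (trans (∙-congʳ ε⁻¹≈ε) (identityˡ _)))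
      stable (∙-gen {g} {h} p q) = let (p₁ , p₂) = stable p ; (q₁ , q₂) = stable q in
        (λ x → Cell-resp (sym (assoc g h _)) (p₁ (q₁ x))) ,
        (λ x → Cell-resp (trans (sym (assoc _ _ _)) (∙-congʳ (sym (⁻¹-anti-homo-∙ g h)))) (q₂ (p₂ x)))
      stable (⁻¹-gen p) = let (p₁ , p₂) = stable p in
        p₂ , (λ x → Cell-resp (∙-congʳ (sym (⁻¹-involutive _))) (p₁ x))
      stable (≈-gen e p) = resp e (stable p)

  module Involutions {u : Level} {U : Set u} (x : U → Carrier) (1U : U)
    (cell  : ∀ g → Cell g)
    (s-s   : ∀ p p′ → ∃[ r ] s p ∙ s p′ ≈ s r)
    (s-x   : ∀ p a → s p ∙ x a ≈ x a ∙ s p)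
    (d-x   : ∀ k a → ∃[ a′ ] d k ∙ x a ≈ x a′ ∙ d k)
    (t-d   : ∀ k → ∃[ l ] d l ∙ t ≈ t ∙ d k ∙ d l)
    (t-x   : ∃[ h ] h ∙ x 1U ≈ t ∙ h)
    (s-d-square : ∀ p k → (s p ∙ d k) ∙ (s p ∙ d k) ≈ ε → s p ∙ d k ≈ ε ⊎ (∃[ a ] s p ∙ d k ≈ x a))
    (t-d-s-square : ∀ k p → (t ∙ (d k ∙ s p)) ∙ (t ∙ (d k ∙ s p)) ≈ ε → s p ≈ ε) where
    open GroupLemmas G

    private
      big-conj-x : ∀ {g p k p′} a → g ≈ s p ∙ (t ∙ (d k ∙ s p′)) → ∃[ a′ ] conj g (x a) ≈ conj (s p) (conj t (x a′))
      big-conj-x {g} {p} {k} {p′} a e = let (a′ , e′) = d-x k a in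
        a′ , trans (conj-cong e refl) (trans (sym (conj-conj _ _ _)) (conj-congʳ (s p)
          (trans (sym (conj-conj _ _ _)) (conj-congʳ t (trans (sym (conj-conj _ _ _))
            (trans (conj-congʳ (d k) (conj-fix (s-x p′ a))) (sym (conj-≈⇐ _ _ _ e′))))))))

    conj-x : ∀ g a → (∃[ a′ ] conj g (x a) ≈ x a′) ⊎ (∃[ p ] ∃[ a′ ] conj g (x a) ≈ conj (s p) (conj t (x a′)))
    conj-x g a with cell g
    ... | inj₁ (p , k , e) = let (a′ , e′) = d-x k a in
      inj₁ (a′ , trans (conj-cong e refl) (trans (sym (conj-conj _ _ _))
        (trans (conj-congʳ (s p) (sym (conj-≈⇐ _ _ _ e′))) (conj-fix (s-x p a′)))))
    ... | inj₂ (p , k , p′ , e) = inj₂ (p , big-conj-x a e)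

    -- From the big cell g carries x a into the class opposite to the base. That alternative is kept
    -- in the conclusion, to be refuted on matrix entries.
    normaliser : ∀ g a a′ → conj g (x a) ≈ x a′ → (∃[ p ] ∃[ k ] g ≈ s p ∙ d k) ⊎ (∃[ a″ ] x a′ ≈ conj t (x a″))
    normaliser g a a′ e with cell g
    ... | inj₁ q = inj₁ q
    ... | inj₂ (p , k , p′ , e′) = let (a″ , e″) = big-conj-x a e′ in
      inj₂ (a″ , conj-injective (s p) (trans (conj-fix (s-x p a′)) (trans (sym e) e″)))

    -- An involution of the big cell is conjugate by s p to an element t d s, whose s must be
    -- trivial. Then t d is conjugate to t by a torus element and t to `x 1U`. So g is a conjugate
    -- of `x 1U`, and `conj-x` gives its label.
    classify : ∀ g → Involution G g → (∃[ a ] g ≈ x a) ⊎ (∃[ p ] ∃[ a ] g ≈ conj (s p) (conj t (x a)))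
    classify g g-inv with cell g
    ... | inj₁ (p , k , e) with s-d-square p k (trans (∙-cong (sym e) (sym e)) (square g-inv))
    ...   | inj₁ e′       = contradiction (trans e e′) (nontrivial g-inv)
    ...   | inj₂ (a , e′) = inj₁ (a , trans e e′)
    classify g g-inv | inj₂ (p , k , p′ , e) = transfer (conj-x h 1U)
      where
      r = proj₁ (s-s p′ p)
      g′ = t ∙ (d k ∙ s r)
      g≈ : g ≈ conj (s p) g′
      g≈ = trans e (conj-≈⇐ (s p) g′ _ (sym (trans (assoc _ _ _) (∙-congˡ (trans (assoc _ _ _)
        (∙-congˡ (trans (assoc _ _ _) (∙-congˡ (proj₂ (s-s p′ p))))))))))
      g′² : g′ ∙ g′ ≈ ε
      g′² = conj-injective (s p) (trans (conj-∙ (s p) g′ g′) (trans (∙-cong (sym g≈) (sym g≈))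
        (trans (square g-inv) (sym (conj-ε (s p))))))
      g′≈td : g′ ≈ t ∙ d k
      g′≈td = ∙-congˡ (trans (∙-congˡ (t-d-s-square k r g′²)) (identityʳ _))
      l = proj₁ (t-d k)
      h = s p ∙ (d l ∙ proj₁ t-x)
      g≈conj : g ≈ conj h (x 1U)
      g≈conj = trans g≈ (trans (conj-congʳ (s p) (trans g′≈td (trans (conj-≈⇐ (d l) t _ (proj₂ (t-d k)))
        (trans (conj-congʳ (d l) (conj-≈⇐ _ _ _ (proj₂ t-x))) (conj-conj _ _ _))))) (conj-conj _ _ _))
      transfer : _ ⊎ _ → _
      transfer (inj₁ (a , e′))     = inj₁ (a , trans g≈conj e′)
      transfer (inj₂ (q , a , e′)) = inj₂ (q , a , trans g≈conj e′)

-- The automorphism θ and the norm of the Suzuki group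

module SuzukiField {c ℓ : Level} (m : ℕ) (F : FiniteField c ℓ (2 ℕ.^ (1 ℕ.+ 2 ℕ.* m))) where
  open FieldLemmas F (1 ℕ.+ 2 ℕ.* m) ≡.refl
  open Suzuki m F using (θ)
  open import Relation.Binary.Reasoning.Setoid setoid

  private
    q = 2 ℕ.^ (1 ℕ.+ 2 ℕ.* m)

  θ-cong : ∀ {x y} → x ≈ y → θ x ≈ θ y
  θ-cong = ^-congˡ (2 ℕ.^ (1 ℕ.+ m))

  θ-+ : ∀ x y → θ (x + y) ≈ θ x + θ y
  θ-+ = ^2^k-distrib-+ F (2^k-elements⇒1+1≈0 F (1 ℕ.+ 2 ℕ.* m) ≡.refl) (1 ℕ.+ m)

  θ-* : ∀ x y → θ (x * y) ≈ θ x * θ y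
  θ-* x y = ^-distrib-* x y (2 ℕ.^ (1 ℕ.+ m))

  θ-0 : θ 0# ≈ 0#
  θ-0 = 0^2^k≈0 F (1 ℕ.+ m)

  θ-1 : θ 1# ≈ 1#
  θ-1 = 1^n≈1 F (2 ℕ.^ (1 ℕ.+ m))

  θ-unit : ∀ {x y} → x * y ≈ 1# → θ x * θ y ≈ 1#
  θ-unit e = trans (sym (θ-* _ _)) (trans (θ-cong e) θ-1)

  -- The exponent of θ ∘ θ is 2 ^ (2 m + 2) = 2 q, and x^q = x.
  θθ : ∀ x → θ (θ x) ≈ x * x
  θθ x = begin
    θ (θ x)                                        ≈⟨ ^-assocʳ x (2 ℕ.^ (1 ℕ.+ m)) (2 ℕ.^ (1 ℕ.+ m)) ⟩
    x ^ (2 ℕ.^ (1 ℕ.+ m) ℕ.* 2 ℕ.^ (1 ℕ.+ m))      ≈⟨ reflexive (≡.cong (x ^_) exponent) ⟩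
    x ^ (q ℕ.* 2)                                  ≈⟨ ^-assocʳ x q 2 ⟨
    (x ^ q) ^ 2                                    ≈⟨ ^-congˡ 2 (fermat x) ⟩
    x * (x * 1#)                                   ≈⟨ *-congˡ (*-identityʳ x) ⟩
    x * x                                          ∎
    where
    sum-exponent : ∀ m → 1 ℕ.+ m ℕ.+ (1 ℕ.+ m) ≡ 1 ℕ.+ 2 ℕ.* m ℕ.+ 1
    sum-exponent = ℕ-Solver.solve-∀
    exponent : 2 ℕ.^ (1 ℕ.+ m) ℕ.* 2 ℕ.^ (1 ℕ.+ m) ≡ q ℕ.* 2
    exponent = ≡.trans (≡.sym (ℕ.^-distribˡ-+-* 2 (1 ℕ.+ m) (1 ℕ.+ m)))
      (≡.trans (≡.cong (2 ℕ.^_) (sum-exponent m)) (ℕ.^-distribˡ-+-* 2 (1 ℕ.+ 2 ℕ.* m) 1))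

  θ-inverse : ∀ x → (x ^ (2 ℕ.^ m)) ^ (2 ℕ.^ (1 ℕ.+ m)) ≈ x
  θ-inverse x = trans (^-assocʳ x (2 ℕ.^ m) (2 ℕ.^ (1 ℕ.+ m))) (trans (reflexive (≡.cong (x ^_) exponent)) (fermat x))
    where
    sum-exponent : ∀ m → m ℕ.+ (1 ℕ.+ m) ≡ 1 ℕ.+ 2 ℕ.* m
    sum-exponent = ℕ-Solver.solve-∀
    exponent : 2 ℕ.^ m ℕ.* 2 ℕ.^ (1 ℕ.+ m) ≡ q
    exponent = ≡.trans (≡.sym (ℕ.^-distribˡ-+-* 2 m (1 ℕ.+ m))) (≡.cong (2 ℕ.^_) (sum-exponent m))

  θ-inverse′ : ∀ x → θ x ^ (2 ℕ.^ m) ≈ x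
  θ-inverse′ x = trans (^-assocʳ x (2 ℕ.^ (1 ℕ.+ m)) (2 ℕ.^ m)) (trans
    (reflexive (≡.cong (x ^_) (ℕ.*-comm (2 ℕ.^ (1 ℕ.+ m)) (2 ℕ.^ m))))
    (trans (sym (^-assocʳ x (2 ℕ.^ m) (2 ℕ.^ (1 ℕ.+ m)))) (θ-inverse x)))

  θ-injective : ∀ {x y} → θ x ≈ θ y → x ≈ y
  θ-injective e = trans (sym (θ-inverse′ _)) (trans (^-congˡ (2 ℕ.^ m) e) (θ-inverse′ _))

  θ≈0⇒≈0 : ∀ {x} → θ x ≈ 0# → x ≈ 0#
  θ≈0⇒≈0 e = θ-injective (trans e (sym θ-0))

  -- The lower left entry of `S a b`, which is also the form that defines the Suzuki-Tits ovoid.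
  norm : Carrier → Carrier → Carrier
  norm a b = a * a * θ a + a * b + θ b

  norm-cong : ∀ {a a′ b b′} → a ≈ a′ → b ≈ b′ → norm a b ≈ norm a′ b′
  norm-cong e e′ = +-cong (+-cong (*-cong (*-cong e e) (θ-cong e)) (*-cong e e′)) (θ-cong e′)

  -- With b = a θ(a) t the norm is a² θ(a) (1 + t + θ(t)), and θ(t) = t + 1
  -- would give t² = θ(θ(t)) = t.
  norm≈0⇒≈0 : ∀ {a b} → norm a b ≈ 0# → a ≈ 0# × b ≈ 0#
  norm≈0⇒≈0 {a} {b} N≈0 with a ≟ 0#
  ... | yes a≈0 = a≈0 , θ≈0⇒≈0 (trans (sym (trans (norm-cong a≈0 refl)
      (solve (θ 0# ∷ b ∷ θ b ∷ []) (:0 :* :0 :* var 0F :+ :0 :* var 1F :+ var 2F) (var 2F) ≡.refl))) N≈0)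
  ... | no a≉0 = contradiction (x²≈x⇒0∨1 t²≈t) λ where
      (inj₁ t≈0) → 1≉0 (trans (sym (trans (+-cong (trans (+-congˡ t≈0) (+-identityʳ _)) (trans (θ-cong t≈0) θ-0)) (+-identityʳ _))) 1+t+θt≈0)
      (inj₂ t≈1) → 1≉0 (trans (sym (trans (+-cong (trans (+-congˡ t≈1) (x+x≈0 1#)) (trans (θ-cong t≈1) θ-1)) (+-identityˡ _))) 1+t+θt≈0)
    where
    aθa≉0 : ¬ a * θ a ≈ 0#
    aθa≉0 = *-≉0 a≉0 (λ e → a≉0 (θ≈0⇒≈0 e))
    t = (a * θ a) ⁻¹ * b
    aθat≈b : a * θ a * t ≈ b
    aθat≈b = trans (sym (*-assoc _ _ _)) (trans (*-congʳ (⁻¹-inverseʳ aθa≉0)) (*-identityˡ b))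
    θb≈ : θ b ≈ θ a * (a * a) * θ t
    θb≈ = trans (θ-cong (sym aθat≈b)) (trans (θ-* _ t) (*-congʳ (trans (θ-* a (θ a)) (*-congˡ (θθ a)))))
    1+t+θt≈0 : 1# + t + θ t ≈ 0#
    1+t+θt≈0 = integral (trans (solve-under (a ∷ θ a ∷ b ∷ θ b ∷ t ∷ θ t ∷ [])
        (var 0F :* (var 0F :* var 1F) :* (:1 :+ var 4F :+ var 5F)) (var 0F :* var 0F :* var 1F :+ var 0F :* var 2F :+ var 3F)
        ((var 0F :* var 1F :* var 4F , var 2F) ∷ (var 3F , var 1F :* (var 0F :* var 0F) :* var 5F) ∷ [])
        (var 0F ∷ :1 ∷ []) ≡.refl (aθat≈b , θb≈)) N≈0) (*-≉0 a≉0 aθa≉0)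
    θt≈1+t : θ t ≈ 1# + t
    θt≈1+t = sym (x+y≈0⇒x≈y 1+t+θt≈0)
    t²≈t : t * t ≈ t
    t²≈t = trans (sym (θθ t)) (trans (θ-cong θt≈1+t) (trans (θ-+ 1# t) (trans (+-cong θ-1 θt≈1+t)
      (solve (t ∷ []) (:1 :+ (:1 :+ var 0F)) (var 0F) ≡.refl))))

  -- Its injectivity comes from θ (weight x) = (x θ(x))².
  weight : Carrier → Carrier
  weight x = x * x * θ x

  private
    θ-weight : ∀ x → θ (weight x) ≈ x * θ x * (x * θ x)
    θ-weight x = trans (θ-* (x * x) (θ x)) (trans (*-cong (θ-* x x) (θθ x))
      (solve (x ∷ θ x ∷ []) (var 1F :* var 1F :* (var 0F :* var 0F)) (var 0F :* var 1F :* (var 0F :* var 1F)) ≡.refl))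

    weight-root : ∀ {x y} → weight x ≈ weight y → x * θ x ≈ y * θ y
    weight-root e = square-injective (trans (sym (θ-weight _)) (trans (θ-cong e) (θ-weight _)))

  weight-injective : ∀ {x y} → weight x ≈ weight y → x ≈ y
  weight-injective {x} {y} e with x * θ x ≟ 0#
  ... | yes xθx≈0 = trans (vanish xθx≈0) (sym (vanish (trans (sym xθx≈yθy) xθx≈0)))
    where
    xθx≈yθy = weight-root e
    vanish : ∀ {x} → x * θ x ≈ 0# → x ≈ 0#
    vanish {x} p with x ≟ 0#
    ... | yes x≈0 = x≈0
    ... | no x≉0  = θ≈0⇒≈0 (integral p x≉0)
  ... | no xθx≉0 = *-cancelˡ xθx≉0 (trans (*-comm _ _) (trans (sym (*-assoc x x (θ x))) (trans e
      (trans (*-assoc y y (θ y)) (trans (*-congˡ (sym (weight-root e))) (*-comm _ _))))))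

  weight-surjective : ∀ y → ∃[ x ] weight x ≈ y
  weight-surjective = injective⇒surjective weight (λ e → *-cong (*-cong e e) (θ-cong e)) weight-injective

  weight-≉0 : ∀ {x} → ¬ weight x ≈ 0# → ¬ x ≈ 0#
  weight-≉0 w≉0 x≈0 = w≉0 (trans (*-congʳ (trans (*-congʳ x≈0) (zeroˡ _))) (zeroˡ _))

-- The Suzuki group as a group of rank one

module Sz-RankOne {c ℓ : Level} (m₀ : ℕ) (F : FiniteField c ℓ (2 ℕ.^ (1 ℕ.+ 2 ℕ.* m₀))) where
  open FieldLemmas F (1 ℕ.+ 2 ℕ.* m₀) ≡.refl
  open MatrixLemmas F (1 ℕ.+ 2 ℕ.* m₀) ≡.refl
  open Suzuki m₀ F using (θ; S; M; T; Generator; isS; isM; isT)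
  open SuzukiField m₀ F
  open Counting

  private
    q = 2 ℕ.^ (1 ℕ.+ 2 ℕ.* m₀)

    U = subsetoid setoid (λ x → ¬ x ≈ 0#)
    Q = setoid ×ₛ setoid
    module U = Setoid U
    module Q = Setoid Q

    -- The matrix S(a , b) with a′ = θ(a) and b′ = θ(b).
    se : ∀ {k} (a b a′ b′ : Expr k) → MExpr 4 k
    se a b a′ b′ = rows
      ( (:1 ∷ :0 ∷ :0 ∷ :0 ∷ [])
      ∷ (a ∷ :1 ∷ :0 ∷ :0 ∷ [])
      ∷ (b ∷ a′ ∷ :1 ∷ :0 ∷ [])
      ∷ (a :* a :* a′ :+ a :* b :+ b′ ∷ a :* a′ :+ b ∷ a ∷ :1 ∷ []) ∷ [])

    -- The matrix S(a , b) with a′ = θ(a) and z = norm a b.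
    sz : ∀ {k} (a b a′ z : Expr k) → MExpr 4 k
    sz a b a′ z = rows
      ( (:1 ∷ :0 ∷ :0 ∷ :0 ∷ [])
      ∷ (a ∷ :1 ∷ :0 ∷ :0 ∷ [])
      ∷ (b ∷ a′ ∷ :1 ∷ :0 ∷ [])
      ∷ (z ∷ a :* a′ :+ b ∷ a ∷ :1 ∷ []) ∷ [])

    -- Suzuki's torus matrix in the parameter η = u ^ (2 ^ m₀), for which u = θ η: the entries
    -- become products of η, θ η and their inverses.
    de : ∀ {k} (η η′ ν ν′ : Expr k) → MExpr 4 k
    de η η′ ν ν′ = rows
      ( (η′ :* η ∷ :0 ∷ :0 ∷ :0 ∷ [])
      ∷ (:0 ∷ η ∷ :0 ∷ :0 ∷ [])
      ∷ (:0 ∷ :0 ∷ ν ∷ :0 ∷ [])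
      ∷ (:0 ∷ :0 ∷ :0 ∷ ν′ :* ν ∷ []) ∷ [])

    te : ∀ {k} → MExpr 4 k
    te = rows
      ( (:0 ∷ :0 ∷ :0 ∷ :1 ∷ [])
      ∷ (:0 ∷ :0 ∷ :1 ∷ :0 ∷ [])
      ∷ (:0 ∷ :1 ∷ :0 ∷ :0 ∷ [])
      ∷ (:1 ∷ :0 ∷ :0 ∷ :0 ∷ []) ∷ [])

    one : ∀ {k} → MExpr 4 k
    one = rows
      ( (:1 ∷ :0 ∷ :0 ∷ :0 ∷ [])
      ∷ (:0 ∷ :1 ∷ :0 ∷ :0 ∷ [])
      ∷ (:0 ∷ :0 ∷ :1 ∷ :0 ∷ [])
      ∷ (:0 ∷ :0 ∷ :0 ∷ :1 ∷ []) ∷ [])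

    v₀ v₁ v₂ v₃ : ∀ {k} → Expr (4 ℕ.+ k)
    v₀ = var 0F
    v₁ = var 1F
    v₂ = var 2F
    v₃ = var 3F

    single : ∀ {k} → Expr k → List (Expr k)
    single a = a ∷ []

    pointwise : ∀ {A B : Matrix 4} → (∀ j → A 0F j ≈ B 0F j) → (∀ j → A 1F j ≈ B 1F j) →
                (∀ j → A 2F j ≈ B 2F j) → (∀ j → A 3F j ≈ B 3F j) → A ≋ B
    pointwise r₀ r₁ r₂ r₃ 0F = r₀
    pointwise r₀ r₁ r₂ r₃ 1F = r₁
    pointwise r₀ r₁ r₂ r₃ 2F = r₂
    pointwise r₀ r₁ r₂ r₃ 3F = r₃

    row : ∀ {f g : Fin 4 → Carrier} → f 0F ≈ g 0F → f 1F ≈ g 1F → f 2F ≈ g 2F → f 3F ≈ g 3F → ∀ j → f j ≈ g j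
    row e₀ e₁ e₂ e₃ 0F = e₀
    row e₀ e₁ e₂ e₃ 1F = e₁
    row e₀ e₁ e₂ e₃ 2F = e₂
    row e₀ e₁ e₂ e₃ 3F = e₃

    I≋ : ∀ {k} (ρ : Vec Carrier k) → ⟦ one ⟧ᴹ ρ ≋ I
    I≋ ρ = pointwise (row refl refl refl refl) (row refl refl refl refl) (row refl refl refl refl) (row refl refl refl refl)

    Sr : (a b a′ b′ : Carrier) → Matrix 4
    Sr a b a′ b′ = ⟦ se v₀ v₁ v₂ v₃ ⟧ᴹ (a ∷ b ∷ a′ ∷ b′ ∷ [])

    Dr : (η η′ ν ν′ : Carrier) → Matrix 4
    Dr η η′ ν ν′ = ⟦ de v₀ v₁ v₂ v₃ ⟧ᴹ (η ∷ η′ ∷ ν ∷ ν′ ∷ [])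

    four-cong : ∀ {x y z w x′ y′ z′ w′} → x ≈ x′ → y ≈ y′ → z ≈ z′ → w ≈ w′ →
                ∀ i → Vec.lookup (x ∷ y ∷ z ∷ w ∷ []) i ≈ Vec.lookup (x′ ∷ y′ ∷ z′ ∷ w′ ∷ []) i
    four-cong e₀ e₁ e₂ e₃ 0F = e₀
    four-cong e₀ e₁ e₂ e₃ 1F = e₁
    four-cong e₀ e₁ e₂ e₃ 2F = e₂
    four-cong e₀ e₁ e₂ e₃ 3F = e₃

    Sr-cong : ∀ {a b c d a′ b′ c′ d′} → a ≈ a′ → b ≈ b′ → c ≈ c′ → d ≈ d′ → Sr a b c d ≋ Sr a′ b′ c′ d′
    Sr-cong e₀ e₁ e₂ e₃ = ⟦⟧ᴹ-cong (se v₀ v₁ v₂ v₃) (_ ∷ _ ∷ _ ∷ _ ∷ []) (_ ∷ _ ∷ _ ∷ _ ∷ []) (four-cong e₀ e₁ e₂ e₃)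

    Dr-cong : ∀ {a b c d a′ b′ c′ d′} → a ≈ a′ → b ≈ b′ → c ≈ c′ → d ≈ d′ → Dr a b c d ≋ Dr a′ b′ c′ d′
    Dr-cong e₀ e₁ e₂ e₃ = ⟦⟧ᴹ-cong (de v₀ v₁ v₂ v₃) (_ ∷ _ ∷ _ ∷ _ ∷ []) (_ ∷ _ ∷ _ ∷ _ ∷ []) (four-cong e₀ e₁ e₂ e₃)

    S-raw : ∀ {a b a′ b′} → θ a ≈ a′ → θ b ≈ b′ → S a b ≋ Sr a b a′ b′
    S-raw e e′ = Sr-cong refl refl e e′

    S-cong : ∀ {a b a′ b′} → a ≈ a′ → b ≈ b′ → S a b ≋ S a′ b′
    S-cong e e′ = Sr-cong e e′ (θ-cong e) (θ-cong e′)

    S-0 : S 0# 0# ≋ I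
    S-0 = ≋-trans (S-raw θ-0 θ-0) (≋-trans (solveᴹ (0# ∷ 0# ∷ 0# ∷ 0# ∷ []) (se :0 :0 :0 :0) one ≡.refl) (I≋ (0# ∷ 0# ∷ 0# ∷ 0# ∷ [])))

    X-raw : ∀ a → S 0# a ≋ Sr 0# a 0# (θ a)
    X-raw a = S-raw θ-0 refl

    -- The product is again of the form S because θ (θ a) = a²: the symbolic product has a² θ a₁
    -- exactly where θ (θ a * a₁) is wanted.
    S-S : ∀ a b a₁ b₁ → S a b ⊗ S a₁ b₁ ≋ S (a + a₁) (b + b₁ + θ a * a₁)
    S-S a b a₁ b₁ = ≋-trans (solveᴹ (a ∷ b ∷ θ a ∷ θ b ∷ a₁ ∷ b₁ ∷ θ a₁ ∷ θ b₁ ∷ [])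
        (se v₀ v₁ v₂ v₃ :⊗ se (var 4F) (var 5F) (var 6F) (var 7F))
        (se (v₀ :+ var 4F) (v₁ :+ var 5F :+ v₂ :* var 4F) (v₂ :+ var 6F) (v₃ :+ var 7F :+ v₀ :* v₀ :* var 6F)) ≡.refl)
      (≋-sym (S-raw (θ-+ a a₁) (trans (θ-+ _ _) (+-cong (θ-+ b b₁) (trans (θ-* _ _) (*-congʳ (θθ a)))))))

    S-inverse : ∀ a b → S a b ⊗ S a (b + a * θ a) ≋ I
    S-inverse a b = ≋-trans (S-S a b a (b + a * θ a)) (≋-trans (S-cong (x+x≈0 a)
      (solve (a ∷ b ∷ θ a ∷ []) (var 1F :+ (var 1F :+ var 0F :* var 2F) :+ var 2F :* var 0F) :0 ≡.refl)) S-0)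

    S-inverse′ : ∀ a b → S a (b + a * θ a) ⊗ S a b ≋ I
    S-inverse′ a b = ≋-trans (S-S a (b + a * θ a) a b) (≋-trans (S-cong (x+x≈0 a)
      (solve (a ∷ b ∷ θ a ∷ []) (var 1F :+ var 0F :* var 2F :+ var 1F :+ var 2F :* var 0F) :0 ≡.refl)) S-0)

    Torus : Set (c ⊔ ℓ)
    Torus = Σ (Carrier × Carrier) λ (η , ν) → η * ν ≈ 1#

    Dm : Torus → Matrix 4
    Dm ((η , ν) , _) = Dr η (θ η) ν (θ ν)

    flip : Torus → Torus
    flip ((η , ν) , e) = (ν , η) , trans (*-comm ν η) e

    D-inverse : ∀ k → Dm k ⊗ Dm (flip k) ≋ I
    D-inverse ((η , ν) , e) = ≋-trans (solveᴹ-under ρ (de v₀ v₁ v₂ v₃ :⊗ de v₂ v₃ v₀ v₁) one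
      ((v₀ :* v₂ , :1) ∷ (v₁ :* v₃ , :1) ∷ [])
      ( ((v₁ :* v₃ ∷ :1 ∷ []) ∷ [] ∷ [] ∷ [] ∷ [])
      ∷ ([] ∷ single :1 ∷ [] ∷ [] ∷ [])
      ∷ ([] ∷ [] ∷ single :1 ∷ [] ∷ [])
      ∷ ([] ∷ [] ∷ [] ∷ (v₁ :* v₃ ∷ :1 ∷ []) ∷ []) ∷ []) ≡.refl (e , θ-unit e)) (I≋ ρ)
      where
      ρ : Vec Carrier 4
      ρ = η ∷ θ η ∷ ν ∷ θ ν ∷ []

    D-D : ∀ k l → ∃[ n ] Dm k ⊗ Dm l ≋ Dm n
    D-D ((η , ν) , e) ((κ , μ) , e′) = ((η * κ , ν * μ) , solve-under (η ∷ ν ∷ κ ∷ μ ∷ []) (v₀ :* v₂ :* (v₁ :* v₃)) :1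
        ((v₀ :* v₁ , :1) ∷ (v₂ :* v₃ , :1) ∷ []) (v₂ :* v₃ ∷ :1 ∷ []) ≡.refl (e , e′)) ,
      ≋-trans (solveᴹ (η ∷ θ η ∷ ν ∷ θ ν ∷ κ ∷ θ κ ∷ μ ∷ θ μ ∷ [])
        (de v₀ v₁ v₂ v₃ :⊗ de (var 4F) (var 5F) (var 6F) (var 7F))
        (de (v₀ :* var 4F) (v₁ :* var 5F) (v₂ :* var 6F) (v₃ :* var 7F)) ≡.refl)
      (Dr-cong refl (sym (θ-* η κ)) refl (sym (θ-* ν μ)))

    D-S : ∀ η ν (e : η * ν ≈ 1#) a b →
      Dm ((η , ν) , e) ⊗ S a b ≋ S (θ ν * a) (ν * ν * θ ν * b) ⊗ Dm ((η , ν) , e)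
    D-S η ν e a b = ≋-trans (solveᴹ-under (η ∷ θ η ∷ ν ∷ θ ν ∷ a ∷ b ∷ θ a ∷ θ b ∷ [])
        (de v₀ v₁ v₂ v₃ :⊗ se α β α′ β′)
        (se (v₃ :* α) (v₂ :* v₂ :* v₃ :* β) (v₂ :* v₂ :* α′) (v₃ :* v₃ :* (v₂ :* v₂) :* β′) :⊗ de v₀ v₁ v₂ v₃)
        ((v₀ :* v₂ , :1) ∷ (v₁ :* v₃ , :1) ∷ [])
        ( ([] ∷ [] ∷ [] ∷ [] ∷ [])
        ∷ ((:0 ∷ v₀ :* α ∷ []) ∷ [] ∷ [] ∷ [] ∷ [])
        ∷ ((v₂ :* v₁ :* v₃ :* β ∷ v₂ :* β ∷ []) ∷ single (v₂ :* α′) ∷ [] ∷ [] ∷ [])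
        ∷ ((v₁ :* v₃ :* v₂ :* v₃ :* z ∷ v₂ :* v₃ :* z ∷ []) ∷ single (v₂ :* v₃ :* (α :* α′ :+ β)) ∷ [] ∷ [] ∷ []) ∷ [])
        ≡.refl (e , θ-unit e))
      (⊗-cong {B = Dm ((η , ν) , e)} (≋-sym (S-raw (trans (θ-* (θ ν) a) (*-congʳ (θθ ν)))
        (trans (θ-* _ b) (*-congʳ (trans (θ-* _ (θ ν)) (*-cong (θ-* ν ν) (θθ ν))))))) ≋-refl)
      where
      α β α′ β′ z : Expr 8
      α = var 4F
      β = var 5F
      α′ = var 6F
      β′ = var 7F
      z = α :* α :* α′ :+ α :* β :+ β′

    D-T : ∀ k → Dm k ⊗ T ≋ T ⊗ Dm (flip k)
    D-T ((η , ν) , e) = solveᴹ (η ∷ θ η ∷ ν ∷ θ ν ∷ []) (de v₀ v₁ v₂ v₃ :⊗ te) (te :⊗ de v₂ v₃ v₀ v₁) ≡.refl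

    T-T : T ⊗ T ≋ I
    T-T = ≋-trans (solveᴹ [] (te :⊗ te) one ≡.refl) (I≋ [])

    -- As θ (θ b) = b², the value θ z of the norm z is a polynomial in a, b, θ a and z. This makes
    -- the identity for T S T a polynomial one.
    norm-θ : ∀ a b → θ (norm a b) ≈ θ a * norm a b + a * b * θ a + b * b
    norm-θ a b = trans (θ-+ _ _) (trans (+-cong (trans (θ-+ _ _) (+-cong (trans (θ-* _ _) (*-cong (θ-* a a) (θθ a))) (θ-* a b))) (θθ b))
      (solve (a ∷ b ∷ θ a ∷ θ b ∷ []) (v₂ :* v₂ :* (v₀ :* v₀) :+ v₂ :* v₃ :+ v₁ :* v₁)
        (v₂ :* (v₀ :* v₀ :* v₂ :+ v₀ :* v₁ :+ v₃) :+ v₀ :* v₁ :* v₂ :+ v₁ :* v₁) ≡.refl))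

    -- T S(a , b) T lies in the big cell: T S(a , b) e₀ = z S(b / z , a / z) e₀
    -- determines the left factor, and the right one follows by inversion.
    module TST (a b w : Carrier) (zw≈1 : norm a b * w ≈ 1#) where
      z w′ Z : Carrier
      z = norm a b
      w′ = θ w
      Z = θ z
      p = b * w
      p₁ = a * w
      r = (a * θ a + b) * w
      k : Torus
      k = (w′ * z , Z * w) , solve-under (z ∷ w ∷ Z ∷ w′ ∷ []) (v₃ :* v₀ :* (v₂ :* v₁)) :1
        ((v₀ :* v₁ , :1) ∷ (v₂ :* v₃ , :1) ∷ []) (v₂ :* v₃ ∷ :1 ∷ []) ≡.refl (zw≈1 , θ-unit zw≈1)
      private
        ρ : Vec Carrier 6
        ρ = a ∷ b ∷ θ a ∷ z ∷ w ∷ w′ ∷ []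
        -- B stands for θ b and `Zᴱ` for θ z: the definition of z eliminates the former, `norm-θ`
        -- the latter. The relations left are z w = 1 and θ z θ w = 1.
        A W W′ B Zᴱ zw : Expr 6
        A = v₂
        W = var 4F
        W′ = var 5F
        B = v₃ :+ v₀ :* v₀ :* A :+ v₀ :* v₁
        Zᴱ = A :* v₃ :+ v₀ :* v₁ :* A :+ v₁ :* v₁
        zw = v₃ :* W
        hs : List (Expr 6 × Expr 6)
        hs = (zw , :1) ∷ (W′ :* Zᴱ , :1) ∷ []
        holds : Holds ρ hs
        holds = zw≈1 , trans (*-comm _ _) (trans (*-congʳ (sym (norm-θ a b))) (θ-unit zw≈1))
        θb≈ : θ b ≈ ⟦ B ⟧ ρ
        θb≈ = solve (a ∷ b ∷ θ a ∷ θ b ∷ []) v₃ (v₀ :* v₀ :* v₂ :+ v₀ :* v₁ :+ v₃ :+ v₀ :* v₀ :* v₂ :+ v₀ :* v₁) ≡.refl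
        θr≈ : θ r ≈ ⟦ (A :* (v₀ :* v₀) :+ B) :* W′ ⟧ ρ
        θr≈ = trans (θ-* _ w) (*-congʳ (trans (θ-+ _ b) (+-cong (trans (θ-* a (θ a)) (*-congˡ (θθ a))) θb≈)))
        θp≈ : θ p ≈ ⟦ B :* W′ ⟧ ρ
        θp≈ = trans (θ-* b w) (*-congʳ θb≈)
        θp₁≈ : θ p₁ ≈ ⟦ A :* W′ ⟧ ρ
        θp₁≈ = θ-* a w
        norm-r : norm r p₁ ≈ w
        norm-r = trans (+-cong (+-congʳ (*-congˡ θr≈)) θp₁≈) (solve-under ρ
          (((v₀ :* A :+ v₁) :* W) :* ((v₀ :* A :+ v₁) :* W) :* ((A :* (v₀ :* v₀) :+ B) :* W′) :+ (v₀ :* A :+ v₁) :* W :* (v₀ :* W) :+ A :* W′) W hs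
          (W′ :* (A :+ v₁ :* v₁ :* W :+ v₀ :* v₁ :* A :* W) ∷ W :+ v₀ :* v₁ :* W :* W :+ v₀ :* v₀ :* A :* W :* W ∷ []) ≡.refl holds)
        norm-p : norm p p₁ ≈ w
        norm-p = trans (+-cong (+-congʳ (*-congˡ θp≈)) θp₁≈) (solve-under ρ
          ((v₁ :* W) :* (v₁ :* W) :* (B :* W′) :+ v₁ :* W :* (v₀ :* W) :+ A :* W′) W hs
          (W′ :* (A :+ v₁ :* v₁ :* W :+ v₀ :* v₁ :* A :* W) ∷ W :+ v₀ :* v₁ :* W :* W ∷ []) ≡.refl holds)
        S-norm : ∀ {x y x′ n} → θ x ≈ x′ → norm x y ≈ n → S x y ≋ ⟦ sz v₀ v₁ v₂ v₃ ⟧ᴹ (x ∷ y ∷ x′ ∷ n ∷ [])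
        S-norm e e′ = pointwise (row refl refl refl refl) (row refl refl refl refl) (row refl e refl refl)
          (row e′ (+-congʳ (*-congˡ e)) refl refl)
        right : S r p₁ ≋ ⟦ sz ((v₀ :* A :+ v₁) :* W) (v₀ :* W) ((A :* (v₀ :* v₀) :+ B) :* W′) W ⟧ᴹ ρ
        right = S-norm θr≈ norm-r
        left : S p p₁ ≋ ⟦ sz (v₁ :* W) (v₀ :* W) (B :* W′) W ⟧ᴹ ρ
        left = S-norm θp≈ norm-p
        torus : Dm k ≋ ⟦ de (W′ :* v₃) (W :* W :* Zᴱ) (Zᴱ :* W) (v₃ :* v₃ :* W′) ⟧ᴹ ρ
        torus = Dr-cong refl (trans (θ-* w′ z) (*-cong (θθ w) (norm-θ a b))) (*-congʳ (norm-θ a b))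
          (trans (θ-* Z w) (*-congʳ (θθ z)))

      identity : T ⊗ (S a b ⊗ (T ⊗ S r p₁)) ≋ S p p₁ ⊗ (T ⊗ Dm k)
      identity = ≋-trans (⊗-cong {A = T} ≋-refl (⊗-cong {A = S a b} ≋-refl (⊗-cong {A = T} ≋-refl right)))
        (≋-trans (solveᴹ-under ρ
          (te :⊗ (sz v₀ v₁ A v₃ :⊗ (te :⊗ sz ((v₀ :* A :+ v₁) :* W) (v₀ :* W) ((A :* (v₀ :* v₀) :+ B) :* W′) W)))
          (sz (v₁ :* W) (v₀ :* W) (B :* W′) W :⊗ (te :⊗ de (W′ :* v₃) (W :* W :* Zᴱ) (Zᴱ :* W) (v₃ :* v₃ :* W′))) hs
          ( (single :1 ∷ single (v₁ :* v₃ :* W′ :+ v₀ :+ v₀ :* W′ :* Zᴱ) ∷ single (v₁ :+ v₀ :* A) ∷ (v₃ :* W′ :* Zᴱ ∷ v₃ ∷ []) ∷ [])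
          ∷ ([] ∷ (v₁ :* v₁ :* W′ ∷ :1 :+ v₀ :* v₁ :* W ∷ []) ∷ single A ∷ (v₁ :* W′ :* Zᴱ :* (:1 :+ zw) ∷ v₁ ∷ []) ∷ [])
          ∷ ([] ∷ (v₀ :* v₁ :* W′ ∷ v₀ :* v₀ :* W ∷ [])
              ∷ (W′ :* Zᴱ ∷ :1 :+ v₀ :* v₁ :* W :+ v₀ :* v₀ :* A :* W ∷ []) ∷ (v₀ :* W′ :* Zᴱ :* (:1 :+ zw) ∷ v₀ ∷ []) ∷ [])
          ∷ ((W :* W′ :* Zᴱ ∷ W ∷ []) ∷ (:0 ∷ v₀ :* W ∷ [])
              ∷ (v₁ :* W :* W′ :* Zᴱ :+ v₀ :* A :* W ∷ v₁ :* W :+ v₀ :* v₁ :* v₁ :* W :* W :+ v₀ :* v₀ :* v₁ :* A :* W :* W ∷ [])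
              ∷ (W′ :* Zᴱ :* (:1 :+ zw) ∷ :1 ∷ []) ∷ []) ∷ [])
          ≡.refl holds)
        (⊗-cong (≋-sym left) (⊗-cong {A = T} ≋-refl (≋-sym torus))))

    GL₄ = GL 4
    module GL₄ = Group GL₄

    sᴸ : Q.Carrier → Invertible 4
    sᴸ (a , b) = record { mat = S a b ; inv = S a (b + a * θ a) ; invʳ = S-inverse a b ; invˡ = S-inverse′ a b }

    dᴸ : Torus → Invertible 4
    dᴸ k = record { mat = Dm k ; inv = Dm (flip k) ; invʳ = D-inverse k ; invˡ = D-inverse (flip k) }

    tᴸ : Invertible 4
    tᴸ = record { mat = T ; inv = T ; invʳ = T-T ; invˡ = T-T }

    module C = BruhatCells GL₄ sᴸ dᴸ tᴸ

    t-s-t : ∀ p → mat (sᴸ p) ≋ I ⊎ (∃[ p′ ] ∃[ k ] ∃[ r ] T ⊗ (mat (sᴸ p) ⊗ (T ⊗ mat (sᴸ r))) ≋ mat (sᴸ p′) ⊗ (T ⊗ Dm k))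
    t-s-t (a , b) with norm a b ≟ 0#
    ... | yes z≈0 = let (a≈0 , b≈0) = norm≈0⇒≈0 z≈0 in inj₁ (≋-trans (S-cong a≈0 b≈0) S-0)
    ... | no z≉0  = inj₂ ((E.p , E.p₁) , E.k , (E.r , E.p₁) , E.identity)
      where module E = TST a b (norm a b ⁻¹) (⁻¹-inverseʳ z≉0)

    module Cl = C.Closure
      (λ (a , b) (a₁ , b₁) → _ , S-S a b a₁ b₁)
      (λ p → (proj₁ p , proj₂ p + proj₁ p * θ (proj₁ p)) , λ i j → refl)
      D-D (λ k → flip k , λ i j → refl)
      (λ ((η , ν) , e) (a , b) → _ , D-S η ν e a b)
      (λ k → flip k , D-T k) T-T
      ((0# , 0#) , ≋-sym S-0)
      (((1# , 1#) , *-identityˡ 1#) , ≋-sym (≋-trans (Dr-cong {a′ = 1#} {1#} {1#} {1#} refl θ-1 refl θ-1)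
        (≋-trans (solveᴹ [] (de :1 :1 :1 :1) one ≡.refl) (I≋ []))))
      t-s-t

    -- As x ↦ x ^ (2 ^ m₀) inverts θ, the two parametrisations describe the same torus: this
    -- direction puts the generators into the cells, `D≋M` the matrices `Dm k` into the group.
    M≋D : ∀ u w (e : u * w ≈ 1#) → ∃[ k ] M u w ≋ Dm k
    M≋D u w e = ((u ^ (2 ℕ.^ m₀) , w ^ (2 ℕ.^ m₀)) , trans (sym (^-distrib-* u w (2 ℕ.^ m₀))) (trans (^-congˡ (2 ℕ.^ m₀) e) (1^n≈1 F (2 ℕ.^ m₀)))) ,
      pointwise (row (*-congʳ (sym (θ-inverse u))) refl refl refl) (row refl refl refl refl)
        (row refl refl refl refl) (row refl refl refl (*-congʳ (sym (θ-inverse w))))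

    D≋M : ∀ k → Dm k ≋ M (θ (proj₁ (proj₁ k))) (θ (proj₂ (proj₁ k)))
    D≋M ((η , ν) , e) = pointwise (row (*-congˡ (sym (θ-inverse′ η))) refl refl refl) (row refl (sym (θ-inverse′ η)) refl refl)
      (row refl refl (sym (θ-inverse′ ν)) refl) (row refl refl refl (*-congˡ (sym (θ-inverse′ ν))))

    generator-cell : ∀ {g} → Generator g → (∃[ p ] mat g ≋ mat (sᴸ p)) ⊎ (∃[ k ] mat g ≋ Dm k) ⊎ (mat g ≋ T)
    generator-cell (isS a b e)   = inj₁ ((a , b) , e)
    generator-cell (isM u w e g≋) = let (k , e′) = M≋D u w e in inj₂ (inj₁ (k , ≋-trans g≋ e′))
    generator-cell (isT e)       = inj₂ (inj₂ e)

  private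
    module SZ = Group (Sz m₀ F)
    module GL′ = GroupLemmas (Sz m₀ F)

    m : SZ.Carrier → Matrix 4
    m g = mat (proj₁ g)

    sᴳ : Q.Carrier → SZ.Carrier
    sᴳ p = sᴸ p , incl (isS (proj₁ p) (proj₂ p) ≋-refl)

    dᴳ : Torus → SZ.Carrier
    dᴳ k = dᴸ k , incl (isM _ _ (θ-unit (proj₂ k)) (D≋M k))

    tᴳ : SZ.Carrier
    tᴳ = tᴸ , incl (isT ≋-refl)

    module CG = BruhatCells (Sz m₀ F) sᴳ dᴳ tᴳ

    cell : ∀ g → CG.Cell g
    cell (g , g∈) = Cl.generated⊆Cell generator-cell g∈

    xᴳ : U.Carrier → SZ.Carrier
    xᴳ (a , _) = sᴳ (0# , a)

    oneᵁ : U.Carrier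
    oneᵁ = 1# , 1≉0

    xe : ∀ {k} → Expr k → Expr k → MExpr 4 k
    xe a a′ = se :0 a :0 a′

    X : ∀ (a : U.Carrier) → m (xᴳ a) ≋ ⟦ xe (var 0F) (var 1F) ⟧ᴹ (proj₁ a ∷ θ (proj₁ a) ∷ [])
    X (a , _) = X-raw a

    s-x : ∀ (p : Q.Carrier) (a : U.Carrier) → S (proj₁ p) (proj₂ p) ⊗ S 0# (proj₁ a) ≋ S 0# (proj₁ a) ⊗ S (proj₁ p) (proj₂ p)
    s-x (a , b) (t , _) = ≋-trans (S-S a b 0# t) (≋-trans (S-cong (+-comm a 0#)
        (trans (+-cong (+-comm b t) (trans (zeroʳ _) (sym (trans (*-congʳ θ-0) (zeroˡ a))))) refl))
      (≋-sym (S-S 0# t a b)))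

    d-x : ∀ k (a : U.Carrier) → ∃[ a′ ] Dm k ⊗ m (xᴳ a) ≋ m (xᴳ a′) ⊗ Dm k
    d-x ((η , ν) , e) (a , a≉0) =
      (ν * ν * θ ν * a , *-≉0 (*-≉0 (*-≉0 ν≉0 ν≉0) (λ p → ν≉0 (θ≈0⇒≈0 p))) a≉0) ,
      ≋-trans (D-S η ν e 0# a) (⊗-cong {B = Dm ((η , ν) , e)} (S-cong (zeroʳ _) refl) ≋-refl)
      where
      ν≉0 : ¬ ν ≈ 0#
      ν≉0 = unit-≉0ʳ e

    -- T inverts the torus, so the claim is that `Dm l` squares to the inverse of `Dm k`; hence the
    -- square root κ of ν.
    t-d : ∀ k → ∃[ l ] Dm l ⊗ T ≋ T ⊗ Dm k ⊗ Dm l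
    t-d ((η , ν) , e) = ((κ , η * κ) , κηκ≈1) , ≋-trans (D-T ((κ , η * κ) , κηκ≈1))
      (≋-trans (⊗-cong {A = T} ≋-refl (≋-trans (Dr-cong refl (θ-* η κ) κ≈ (trans (θ-cong κ≈) (θ-* ν (η * κ))))
        (≋-sym (solveᴹ (η ∷ θ η ∷ ν ∷ θ ν ∷ κ ∷ θ κ ∷ η * κ ∷ θ (η * κ) ∷ [])
          (de v₀ v₁ v₂ v₃ :⊗ de (var 4F) (var 5F) (var 6F) (var 7F))
          (de (v₀ :* var 4F) (v₁ :* var 5F) (v₂ :* var 6F) (v₃ :* var 7F)) ≡.refl))))
      (≋-sym (⊗-assoc T (Dm ((η , ν) , e)) (Dm ((κ , η * κ) , κηκ≈1)))))
      where
      κ = proj₁ (√-exists ν)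
      κ²≈ν = proj₂ (√-exists ν)
      κηκ≈1 : κ * (η * κ) ≈ 1#
      κηκ≈1 = solve-under (η ∷ ν ∷ κ ∷ []) (var 2F :* (var 0F :* var 2F)) :1
        ((var 2F :* var 2F , var 1F) ∷ (var 0F :* var 1F , :1) ∷ []) (var 0F ∷ :1 ∷ []) ≡.refl (κ²≈ν , e)
      κ≈ : κ ≈ ν * (η * κ)
      κ≈ = solve-under (η ∷ ν ∷ κ ∷ []) (var 2F) (var 1F :* (var 0F :* var 2F))
        ((var 0F :* var 1F , :1) ∷ []) (var 2F ∷ []) ≡.refl e

    -- x T has order 5 for x = S(0 , 1), so x T x T conjugates x to T.
    t-x : ∃[ h ] m h ⊗ m (xᴳ oneᵁ) ≋ T ⊗ m h
    t-x = x₁ SZ.∙ (tᴳ SZ.∙ (x₁ SZ.∙ tᴳ)) , ≋-trans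
      (⊗-cong (⊗-cong x≋ (⊗-cong {A = T} ≋-refl (⊗-cong {B = T} x≋ ≋-refl))) x≋)
      (≋-trans (solveᴹ [] (xe :1 :1 :⊗ (te :⊗ (xe :1 :1 :⊗ te)) :⊗ xe :1 :1) (te :⊗ (xe :1 :1 :⊗ (te :⊗ (xe :1 :1 :⊗ te)))) ≡.refl)
      (⊗-cong {A = T} ≋-refl (≋-sym (⊗-cong x≋ (⊗-cong {A = T} ≋-refl (⊗-cong {B = T} x≋ ≋-refl))))))
      where
      x₁ = xᴳ oneᵁ
      x≋ : S 0# 1# ≋ ⟦ xe :1 :1 ⟧ᴹ []
      x≋ = S-raw θ-0 θ-1

    D-1 : ∀ k → proj₁ (proj₁ k) ≈ 1# → Dm k ≋ I
    D-1 ((η , ν) , e) η≈1 = ≋-trans (Dr-cong η≈1 (trans (θ-cong η≈1) θ-1) ν≈1 (trans (θ-cong ν≈1) θ-1))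
      (≋-trans (solveᴹ [] (de :1 :1 :1 :1) one ≡.refl) (I≋ []))
      where
      ν≈1 : ν ≈ 1#
      ν≈1 = trans (sym (*-identityˡ ν)) (trans (*-congʳ (sym η≈1)) e)

    -- The diagonal of the square gives η² = 1, so the torus factor is trivial, and entry (2,0) of
    -- the square of `S a b` is a θ a, so a = 0.
    s-d-square : ∀ (p : Q.Carrier) k → (S (proj₁ p) (proj₂ p) ⊗ Dm k) ⊗ (S (proj₁ p) (proj₂ p) ⊗ Dm k) ≋ I →
      (S (proj₁ p) (proj₂ p) ⊗ Dm k ≋ I) ⊎ (∃[ a ] S (proj₁ p) (proj₂ p) ⊗ Dm k ≋ m (xᴳ a))
    s-d-square (a , b) k@((η , ν) , e) sq = cases (b ≟ 0#)
      where
      ρ : Vec Carrier 8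
      ρ = a ∷ b ∷ θ a ∷ θ b ∷ η ∷ θ η ∷ ν ∷ θ ν ∷ []
      E : MExpr 4 8
      E = se v₀ v₁ v₂ v₃ :⊗ de (var 4F) (var 5F) (var 6F) (var 7F)
      η≈1 : η ≈ 1#
      η≈1 = x²≈1⇒x≈1 (trans (solve ρ (var 4F :* var 4F) (entry (E :⊗ E) 1F 1F) ≡.refl)
        (trans (entry-sound (E :⊗ E) ρ 1F 1F) (sq 1F 1F)))
      SD≋S : S a b ⊗ Dm k ≋ S a b
      SD≋S = ≋-trans (⊗-cong {A = S a b} ≋-refl (D-1 k η≈1)) (⊗-identityʳ (S a b))
      a≈0 : a ≈ 0#
      a≈0 with a ≟ 0#
      ... | yes p = p
      ... | no a≉0 = θ≈0⇒≈0 (integral (trans (solve ρ (v₀ :* v₂) (entry (se v₀ v₁ v₂ v₃ :⊗ se v₀ v₁ v₂ v₃) 2F 0F) ≡.refl)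
        (trans (entry-sound (se v₀ v₁ v₂ v₃ :⊗ se v₀ v₁ v₂ v₃) ρ 2F 0F)
          (trans (sym (⊗-cong SD≋S SD≋S 2F 0F)) (sq 2F 0F)))) a≉0)
      cases : Dec (b ≈ 0#) → _
      cases (yes b≈0) = inj₁ (≋-trans SD≋S (≋-trans (S-cong a≈0 b≈0) S-0))
      cases (no b≉0)  = inj₂ ((b , b≉0) , ≋-trans SD≋S (S-cong a≈0 refl))

    -- The torus factors cancel in the lower left entry of the square, which leaves the norm of (a ,
    -- b), and the norm is anisotropic.
    t-d-s-square : ∀ k (p : Q.Carrier) → (T ⊗ (Dm k ⊗ S (proj₁ p) (proj₂ p))) ⊗ (T ⊗ (Dm k ⊗ S (proj₁ p) (proj₂ p))) ≋ I → S (proj₁ p) (proj₂ p) ≋ I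
    t-d-s-square ((η , ν) , e) (a , b) sq = ≋-trans (S-cong (proj₁ zeros) (proj₂ zeros)) S-0
      where
      ρ : Vec Carrier 8
      ρ = a ∷ b ∷ θ a ∷ θ b ∷ η ∷ θ η ∷ ν ∷ θ ν ∷ []
      E : MExpr 4 8
      E = te :⊗ (de (var 4F) (var 5F) (var 6F) (var 7F) :⊗ se v₀ v₁ v₂ v₃)
      z : Expr 8
      z = v₀ :* v₀ :* v₂ :+ v₀ :* v₁ :+ v₃
      zeros : a ≈ 0# × b ≈ 0#
      zeros = norm≈0⇒≈0 (solve-under ρ z :0
        ((entry (E :⊗ E) 3F 0F , :0) ∷ (var 4F :* var 6F , :1) ∷ (var 5F :* var 7F , :1) ∷ [])
        (:1 ∷ var 5F :* var 7F :* z ∷ z ∷ []) ≡.refl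
        (trans (entry-sound (E :⊗ E) ρ 3F 0F) (sq 3F 0F) , e , θ-unit e))

    module CI = CG.Involutions xᴳ oneᵁ cell
      (λ (a , b) (a₁ , b₁) → _ , S-S a b a₁ b₁)
      s-x d-x t-d t-x s-d-square t-d-s-square

    y : U.Carrier → SZ.Carrier
    y b = GL′.conj tᴳ (xᴳ b)

    inv′ : Q.Carrier → U.Carrier → SZ.Carrier
    inv′ s b = GL′.conj (sᴳ s) (y b)

    ye : ∀ {k} → Expr k → Expr k → MExpr 4 k
    ye b b′ = rows
      ( (:1 ∷ :0 ∷ b ∷ b′ ∷ [])
      ∷ (:0 ∷ :1 ∷ :0 ∷ b ∷ [])
      ∷ (:0 ∷ :0 ∷ :1 ∷ :0 ∷ [])
      ∷ (:0 ∷ :0 ∷ :0 ∷ :1 ∷ []) ∷ [])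

    m-y : ∀ b → m (y b) ≋ ⟦ ye (var 0F) (var 1F) ⟧ᴹ (proj₁ b ∷ θ (proj₁ b) ∷ [])
    m-y b = ≋-trans (⊗-cong {B = T} (⊗-cong {A = T} ≋-refl (X b)) ≋-refl)
      (solveᴹ (proj₁ b ∷ θ (proj₁ b) ∷ []) (te :⊗ xe (var 0F) (var 1F) :⊗ te) (ye (var 0F) (var 1F)) ≡.refl)

    inv-expr : ∀ {k} → MExpr 4 (6 ℕ.+ k)
    inv-expr = se v₀ v₁ v₂ v₃ :⊗ ye (var 4F) (var 5F) :⊗ se v₀ (v₁ :+ v₀ :* v₂) v₂ (v₃ :+ v₂ :* (v₀ :* v₀))

    m-inv : ∀ a b t → m (inv′ (a , b) t) ≋ ⟦ inv-expr ⟧ᴹ (a ∷ b ∷ θ a ∷ θ b ∷ proj₁ t ∷ θ (proj₁ t) ∷ [])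
    m-inv a b t = ⊗-cong (⊗-cong {A = S a b} ≋-refl (m-y t))
      (S-raw refl (trans (θ-+ b _) (+-congˡ (trans (θ-* a (θ a)) (*-congˡ (θθ a))))))

    module Entries (a b : Carrier) (t : U.Carrier) where
      ρ : Vec Carrier 6
      ρ = a ∷ b ∷ θ a ∷ θ b ∷ proj₁ t ∷ θ (proj₁ t) ∷ []
      at : ∀ j r → isZero (normalise (entry inv-expr 0F j :+ r)) ≡ _ → m (inv′ (a , b) t) 0F j ≈ ⟦ r ⟧ ρ
      at j r check = trans (m-inv a b t 0F j) (trans (sym (entry-sound inv-expr ρ 0F j)) (solve ρ (entry inv-expr 0F j) r check))
      first : m (inv′ (a , b) t) 0F 1F ≈ proj₁ t * θ a + θ (proj₁ t) * b
      first = at 1F (var 4F :* v₂ :+ var 5F :* v₁) ≡.refl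
      second : m (inv′ (a , b) t) 0F 2F ≈ proj₁ t + θ (proj₁ t) * a
      second = at 2F (var 4F :+ var 5F :* v₀) ≡.refl
      third : m (inv′ (a , b) t) 0F 3F ≈ θ (proj₁ t)
      third = at 3F (var 5F) ≡.refl

    -- The top row of the matrix, read from the right, determines θ t, then a, then b.
    inv-injective : ∀ s s′ t t′ → inv′ s t SZ.≈ inv′ s′ t′ → s Q.≈ s′ × t U.≈ t′
    inv-injective (a , b) (a₁ , b₁) t@(t₀ , t≉0) t′@(t₁ , _) e = (a≈ , b≈) , t≈
      where
      module E = Entries a b t
      module E′ = Entries a₁ b₁ t′
      θt≈ : θ t₀ ≈ θ t₁
      θt≈ = trans (sym E.third) (trans (e 0F 3F) E′.third)
      t≈ : t₀ ≈ t₁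
      t≈ = θ-injective θt≈
      θt≉0 : ¬ θ t₀ ≈ 0#
      θt≉0 p = t≉0 (θ≈0⇒≈0 p)
      a≈ : a ≈ a₁
      a≈ = *-cancelˡ θt≉0 (solve-under (t₀ ∷ t₁ ∷ θ t₀ ∷ θ t₁ ∷ a ∷ a₁ ∷ [])
        (v₂ :* var 4F) (v₂ :* var 5F) ((v₀ :+ v₂ :* var 4F , v₁ :+ v₃ :* var 5F) ∷ (v₀ , v₁) ∷ (v₂ , v₃) ∷ [])
        (:1 ∷ :1 ∷ var 5F ∷ []) ≡.refl (trans (sym E.second) (trans (e 0F 2F) E′.second) , t≈ , θt≈))
      b≈ : b ≈ b₁
      b≈ = *-cancelˡ θt≉0 (solve-under (t₀ ∷ t₁ ∷ θ t₀ ∷ θ t₁ ∷ θ a ∷ θ a₁ ∷ b ∷ b₁ ∷ [])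
        (v₂ :* var 6F) (v₂ :* var 7F)
        ((v₀ :* var 4F :+ v₂ :* var 6F , v₁ :* var 5F :+ v₃ :* var 7F) ∷ (v₀ , v₁) ∷ (v₂ , v₃) ∷ (var 4F , var 5F) ∷ [])
        (:1 ∷ var 5F ∷ var 7F ∷ v₀ ∷ []) ≡.refl
        (trans (sym E.first) (trans (e 0F 1F) E′.first) , t≈ , θt≈ , θ-cong a≈))

    product : MExpr 4 4
    product = xe v₀ v₁ :⊗ ye v₂ v₃

    values : U.Carrier → U.Carrier → Vec Carrier 4
    values a b = proj₁ a ∷ θ (proj₁ a) ∷ proj₁ b ∷ θ (proj₁ b) ∷ []

    m-product : ∀ a b → m (xᴳ a SZ.∙ y b) ≋ ⟦ product ⟧ᴹ (values a b)
    m-product a b = ⊗-cong (X a) (m-y b)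

    fifth : MExpr 4 4
    fifth = product :⊗ ((product :⊗ product) :⊗ (product :⊗ product))

    m-fifth : ∀ a b → let D = xᴳ a SZ.∙ y b in m (D SZ.∙ ((D SZ.∙ D) SZ.∙ (D SZ.∙ D))) ≋ ⟦ fifth ⟧ᴹ (values a b)
    m-fifth a b = ⊗-cong D (⊗-cong (⊗-cong D D) (⊗-cong D D))
      where D = m-product a b

    -- Entry (1,2) of the fifth power is (1 + θ a θ b)² times the nonzero factor b² (θ a)² θ b.
    order-5⇒ : ∀ a b → HasOrder (Sz m₀ F) (xᴳ a SZ.∙ y b) 5 → proj₁ a * proj₁ b ≈ 1#
    order-5⇒ a@(a₀ , a≉0) b@(b₀ , b≉0) o = θ-injective (trans (θ-* a₀ b₀) (trans (sym θaθb≈1) (sym θ-1)))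
      where
      D = xᴳ a SZ.∙ y b
      D⁵ : m (D SZ.∙ ((D SZ.∙ D) SZ.∙ (D SZ.∙ D))) ≋ I
      D⁵ = SZ.trans {D SZ.∙ ((D SZ.∙ D) SZ.∙ (D SZ.∙ D))} {GL′.pow 5 D} {SZ.ε}
        (SZ.sym {GL′.pow 5 D} {D SZ.∙ ((D SZ.∙ D) SZ.∙ (D SZ.∙ D))} (GL′.pow-5 D)) (HasOrder.power o)
      θa≉0 : ¬ θ a₀ ≈ 0#
      θa≉0 p = a≉0 (θ≈0⇒≈0 p)
      θb≉0 : ¬ θ b₀ ≈ 0#
      θb≉0 p = b≉0 (θ≈0⇒≈0 p)
      t : Expr 4
      t = v₁ :* v₃
      θaθb≈1 : 1# ≈ θ a₀ * θ b₀
      θaθb≈1 = x+y≈0⇒x≈y (x²≈0⇒x≈0 (integral {b₀ * b₀ * (θ a₀ * θ a₀ * θ b₀)} (trans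
          (solve (values a b) (v₂ :* v₂ :* (v₁ :* v₁ :* v₃) :* ((:1 :+ t) :* (:1 :+ t))) (entry fifth 1F 2F) ≡.refl)
          (trans (entry-sound fifth (values a b) 1F 2F) (trans (sym (m-fifth a b 1F 2F)) (D⁵ 1F 2F))))
        (*-≉0 (*-≉0 b≉0 b≉0) (*-≉0 (*-≉0 θa≉0 θa≉0) θb≉0))))

    -- D, D² and D⁴ are reduced in turn by a b = 1 and θ a θ b = 1, which keeps the cofactors short;
    -- the reduced D⁴ is the inverse of D.
    order-5⇐ : ∀ a b → proj₁ a * proj₁ b ≈ 1# → HasOrder (Sz m₀ F) (xᴳ a SZ.∙ y b) 5
    order-5⇐ a@(a₀ , a≉0) b@(b₀ , _) ab≈1 = GL′.exponent-5 {D}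
      (SZ.trans {GL′.pow 5 D} {D SZ.∙ ((D SZ.∙ D) SZ.∙ (D SZ.∙ D))} {SZ.ε} (GL′.pow-5 D) D⁵)
      (λ e → a≉0 (trans (sym (solve ρ (entry product 2F 0F) v₀ ≡.refl))
        (trans (entry-sound product ρ 2F 0F) (trans (sym (m-product a b 2F 0F)) (e 2F 0F)))))
      where
      D = xᴳ a SZ.∙ y b
      ρ = values a b
      α α′ β β′ : Expr 4
      α = v₀
      α′ = v₁
      β = v₂
      β′ = v₃
      hs : List (Expr 4 × Expr 4)
      hs = (α :* β , :1) ∷ (α′ :* β′ , :1) ∷ []
      holds : Holds ρ hs
      holds = ab≈1 , θ-unit ab≈1
      P₁ P₂ P₄ : MExpr 4 4
      P₁ = rows
        ( (:1 ∷ :0 ∷ β ∷ β′ ∷ [])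
        ∷ (:0 ∷ :1 ∷ :0 ∷ β ∷ [])
        ∷ (α ∷ :0 ∷ :0 ∷ α :* β′ ∷ [])
        ∷ (α′ ∷ α ∷ β :* α′ ∷ :1 ∷ []) ∷ [])
      P₂ = rows
        ( (:1 ∷ α :* β′ ∷ :0 ∷ β′ ∷ [])
        ∷ (β :* α′ ∷ :0 ∷ β :* β :* α′ ∷ :0 ∷ [])
        ∷ (:0 ∷ α :* α :* β′ ∷ :0 ∷ :0 ∷ [])
        ∷ (α′ ∷ :0 ∷ :0 ∷ :0 ∷ []) ∷ [])
      P₄ = rows
        ( (:1 ∷ α :* β′ ∷ β ∷ β′ ∷ [])
        ∷ (β :* α′ ∷ :0 ∷ :0 ∷ β ∷ [])
        ∷ (α ∷ :0 ∷ :1 ∷ :0 ∷ [])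
        ∷ (α′ ∷ α ∷ :0 ∷ :1 ∷ []) ∷ [])
      D₁ : m D ≋ ⟦ P₁ ⟧ᴹ ρ
      D₁ = ≋-trans (m-product a b) (solveᴹ-under ρ product P₁ hs
        ( ([] ∷ [] ∷ [] ∷ [] ∷ [])
        ∷ ([] ∷ [] ∷ [] ∷ [] ∷ [])
        ∷ ([] ∷ [] ∷ single :1 ∷ [] ∷ [])
        ∷ ([] ∷ [] ∷ [] ∷ (:1 ∷ :1 ∷ []) ∷ []) ∷ []) ≡.refl holds)
      D₂ : m (D SZ.∙ D) ≋ ⟦ P₂ ⟧ᴹ ρ
      D₂ = ≋-trans (⊗-cong D₁ D₁) (solveᴹ-under ρ (P₁ :⊗ P₁) P₂ hs
        ( ((:1 ∷ :1 ∷ []) ∷ [] ∷ (:0 ∷ β ∷ []) ∷ single β′ ∷ [])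
        ∷ ([] ∷ single :1 ∷ [] ∷ [] ∷ [])
        ∷ ((:0 ∷ α ∷ []) ∷ [] ∷ (:1 :+ α′ :* β′ ∷ :1 ∷ []) ∷ [] ∷ [])
        ∷ (single α′ ∷ [] ∷ [] ∷ single (:1 :+ α′ :* β′) ∷ []) ∷ []) ≡.refl holds)
      D₄ : m ((D SZ.∙ D) SZ.∙ (D SZ.∙ D)) ≋ ⟦ P₄ ⟧ᴹ ρ
      D₄ = ≋-trans (⊗-cong D₂ D₂) (solveᴹ-under ρ (P₂ :⊗ P₂) P₄ hs
        ( (single (α′ :* β′) ∷ [] ∷ (β :* α′ :* β′ ∷ β ∷ []) ∷ [] ∷ [])
        ∷ ([] ∷ single (α :* β :* α′ :* β′) ∷ [] ∷ (:0 ∷ β ∷ []) ∷ [])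
        ∷ ((α :* α′ :* β′ ∷ α ∷ []) ∷ [] ∷ (α′ :* β′ :+ α :* β :* α′ :* β′ ∷ :1 ∷ []) ∷ [] ∷ [])
        ∷ ([] ∷ (:0 ∷ α ∷ []) ∷ [] ∷ (:0 ∷ :1 ∷ []) ∷ []) ∷ []) ≡.refl holds)
      D⁵ : m (D SZ.∙ ((D SZ.∙ D) SZ.∙ (D SZ.∙ D))) ≋ I
      D⁵ = ≋-trans (⊗-cong D₁ D₄) (≋-trans (solveᴹ-under ρ (P₁ :⊗ P₄) one hs
        ( ((:1 ∷ :1 ∷ []) ∷ [] ∷ [] ∷ [] ∷ [])
        ∷ ([] ∷ single :1 ∷ [] ∷ [] ∷ [])
        ∷ ((:0 ∷ α ∷ []) ∷ [] ∷ single :1 ∷ [] ∷ [])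
        ∷ ([] ∷ (:0 ∷ α ∷ []) ∷ [] ∷ (:1 ∷ :1 ∷ []) ∷ []) ∷ []) ≡.refl holds) (I≋ ρ))

    trace-expr : ∀ {k} → MExpr 4 k → Expr k
    trace-expr A = Σ-expr (λ i → entry A i i)

    tr-sound : ∀ {k} (A : MExpr 4 k) ρ → tr (⟦ A ⟧ᴹ ρ) ≈ ⟦ trace-expr A ⟧ ρ
    tr-sound A ρ = sym (+-cong (entry-sound A ρ 0F 0F) (+-cong (entry-sound A ρ 1F 1F)
      (+-cong (entry-sound A ρ 2F 2F) (+-congʳ (entry-sound A ρ 3F 3F)))))

    tr-product : ∀ a b → tr (m (xᴳ a SZ.∙ y b)) ≈ θ (proj₁ a * proj₁ b)
    tr-product a b = trans (tr-cong (m-product a b)) (trans (tr-sound product (values a b))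
      (trans (solve (values a b) (trace-expr product) (v₁ :* v₃) ≡.refl) (sym (θ-* _ _))))

    tr-y-inv : ∀ b s t → tr (m (y b SZ.∙ inv′ s t)) ≈ θ (proj₁ b * proj₁ t) * (norm (proj₁ s) (proj₂ s) * norm (proj₁ s) (proj₂ s))
    tr-y-inv b (a₀ , b₀) t = trans (tr-cong (⊗-cong {A′ = ⟦ ye (var 6F) (var 7F) ⟧ᴹ ρ} {B′ = ⟦ inv-expr ⟧ᴹ ρ} (m-y b) (m-inv a₀ b₀ t)))
      (trans (tr-sound (ye (var 6F) (var 7F) :⊗ inv-expr) ρ)
      (trans (solve ρ (trace-expr (ye (var 6F) (var 7F) :⊗ inv-expr)) (var 7F :* var 5F :* (z :* z)) ≡.refl)
      (*-congʳ (sym (θ-* _ _)))))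
      where
      ρ : Vec Carrier 8
      ρ = a₀ ∷ b₀ ∷ θ a₀ ∷ θ b₀ ∷ proj₁ t ∷ θ (proj₁ t) ∷ proj₁ b ∷ θ (proj₁ b) ∷ []
      z : Expr 8
      z = v₀ :* v₀ :* v₂ :+ v₀ :* v₁ :+ v₃

    act : Carrier → Q.Carrier → Q.Carrier
    act μ (a , b) = μ * a , μ * θ μ * b

    act-cong : ∀ μ {s s′} → s Q.≈ s′ → act μ s Q.≈ act μ s′
    act-cong μ (e , e′) = *-congˡ e , *-congˡ e′

    act-inverse : ∀ {μ ν} → μ * ν ≈ 1# → ∀ s → act μ (act ν s) Q.≈ s
    act-inverse {μ} {ν} e (a , b) =
      trans (sym (*-assoc μ ν a)) (trans (*-congʳ e) (*-identityˡ a)) ,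
      solve-under (μ ∷ θ μ ∷ ν ∷ θ ν ∷ b ∷ []) (v₀ :* v₁ :* (v₂ :* v₃ :* var 4F)) (var 4F)
        ((v₀ :* v₂ , :1) ∷ (v₁ :* v₃ , :1) ∷ []) (v₁ :* v₃ :* var 4F ∷ var 4F ∷ []) ≡.refl (e , θ-unit e)

    -- The torus multiplies the norm by `weight μ`; `weight` is a bijection, so the nonzero values
    -- of the norm form one orbit.
    norm-act : ∀ μ a b → norm (μ * a) (μ * θ μ * b) ≈ weight μ * norm a b
    norm-act μ a b = trans (+-cong (+-congʳ (*-congˡ (θ-* μ a))) (trans (θ-* _ b) (*-congʳ (trans (θ-* μ (θ μ)) (*-congˡ (θθ μ))))))
      (solve (μ ∷ θ μ ∷ a ∷ θ a ∷ b ∷ θ b ∷ [])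
        (v₀ :* v₂ :* (v₀ :* v₂) :* (v₁ :* v₃) :+ v₀ :* v₂ :* (v₀ :* v₁ :* var 4F) :+ v₁ :* (v₀ :* v₀) :* var 5F)
        (v₀ :* v₀ :* v₁ :* (v₂ :* v₂ :* v₃ :+ v₂ :* var 4F :+ var 5F)) ≡.refl)

    ⁻¹-unit : ∀ {a b} → ¬ a ≈ 0# → b ≈ a ⁻¹ → a * b ≈ 1#
    ⁻¹-unit a≉0 e = trans (*-congˡ e) (⁻¹-inverseʳ a≉0)

    module _ (2≤q : 2 ℕ.≤ q) (r≡ : q ℕ.* q ≡ suc ((q ℕ.∸ 1) ℕ.* (q ℕ.+ 1))) where

      NormFibre : U.Carrier → Q.Carrier → Set ℓ
      NormFibre (k , _) (a , b) = k * (norm a b * norm a b) ≈ 1#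

      -- The condition involves the squared norm, so ν is chosen with weight the square root κ of k.
      fibres-equal : ∀ k → Inverse (subsetoid Q (NormFibre oneᵁ)) (subsetoid Q (NormFibre k))
      fibres-equal (k , k≉0) = restrict Q Q
        (mkInverse Q Q (act μ) (act ν) (act-cong μ) (act-cong ν) (act-inverse (⁻¹-inverseˡ ν≉0)) (act-inverse (⁻¹-inverseʳ ν≉0)))
        (λ (a , b) N≈1 → trans (*-congˡ (*-cong (norm-act μ a b) (norm-act μ a b)))
          (solve-under (k ∷ κ ∷ weight μ ∷ norm a b ∷ []) (v₀ :* (v₂ :* v₃ :* (v₂ :* v₃))) :1
            ((v₁ :* v₁ , v₀) ∷ (v₂ :* v₁ , :1) ∷ (:1 :* (v₃ :* v₃) , :1) ∷ [])
            (v₂ :* v₃ :* (v₂ :* v₃) ∷ (v₂ :* v₁ :+ :1) :* v₃ :* v₃ ∷ :1 ∷ []) ≡.refl (κ²≈k , μκ , N≈1)))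
        (λ (a , b) N≈1 → trans (*-congˡ (*-cong (norm-act ν a b) (norm-act ν a b)))
          (solve-under (k ∷ κ ∷ weight ν ∷ norm a b ∷ []) (:1 :* (v₂ :* v₃ :* (v₂ :* v₃))) :1
            ((v₁ :* v₁ , v₀) ∷ (v₂ , v₁) ∷ (v₀ :* (v₃ :* v₃) , :1) ∷ [])
            (v₃ :* v₃ ∷ (v₂ :+ v₁) :* v₃ :* v₃ ∷ :1 ∷ []) ≡.refl (κ²≈k , νκ , N≈1)))
        where
        κ = proj₁ (√-exists k)
        κ²≈k = proj₂ (√-exists k)
        ν = proj₁ (weight-surjective κ)
        νκ : weight ν ≈ κ
        νκ = proj₂ (weight-surjective κ)
        κ≉0 : ¬ κ ≈ 0#
        κ≉0 p = k≉0 (trans (sym κ²≈k) (trans (*-congʳ p) (zeroˡ _)))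
        ν≉0 : ¬ ν ≈ 0#
        ν≉0 = weight-≉0 (λ p → κ≉0 (trans (sym νκ) p))
        μ = ν ⁻¹
        μκ : weight μ * κ ≈ 1#
        μκ = trans (*-congˡ (sym νκ)) (solve-under (μ ∷ θ μ ∷ ν ∷ θ ν ∷ []) (v₀ :* v₀ :* v₁ :* (v₂ :* v₂ :* v₃)) :1
          ((v₀ :* v₂ , :1) ∷ (v₁ :* v₃ , :1) ∷ []) ((v₀ :* v₂ :+ :1) :* v₁ :* v₃ ∷ :1 ∷ []) ≡.refl
          (⁻¹-inverseˡ ν≉0 , θ-unit (⁻¹-inverseˡ ν≉0)))

      norm≉0 : ∀ a b → ¬ (a , b) Q.≈ (0# , 0#) → ¬ norm a b * norm a b ≈ 0#
      norm≉0 a b s≉0 e = s≉0 (norm≈0⇒≈0 (x²≈0⇒x≈0 e))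

      NormFibre-apart : ∀ {k s} → NormFibre k s → ¬ s Q.≈ (0# , 0#)
      NormFibre-apart N≈1 (a≈0 , b≈0) = unit-≉0ʳ N≈1 (trans (*-congʳ (trans (norm-cong a≈0 b≈0)
        (trans (+-cong (+-cong (trans (*-congʳ (zeroˡ 0#)) (zeroˡ _)) (zeroˡ 0#)) θ-0) (trans (+-identityʳ _) (+-identityʳ _))))) (zeroˡ _))

      module Norms = EqualFibres U Q {{ℕ.>-nonZero (ℕ.∸-monoˡ-≤ 1 2≤q)}} nonzero-size (size-× setoid setoid cardinality cardinality) r≡
        (0# , 0#) NormFibre
        (λ e → trans (*-congʳ (sym e)))
        (λ (e , e′) → trans (*-congˡ (*-cong (norm-cong (sym e) (sym e′)) (norm-cong (sym e) (sym e′)))))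
        (λ (k , _) (a , b) → k * (norm a b * norm a b) ≟ 1#)
        (λ {k} {s} → NormFibre-apart {k} {s})
        (λ (a , b) s≉0 → ((norm a b * norm a b) ⁻¹ , ⁻¹-≉0 (norm≉0 a b s≉0)) , ⁻¹-inverseˡ (norm≉0 a b s≉0))
        (λ e e′ → *-cancelˡ (unit-≉0ʳ e) (trans (*-comm _ _) (trans e (trans (sym e′) (*-comm _ _)))))
        oneᵁ fibres-equal

      Ψ-fibre : ∀ b t → HasSize (subsetoid Q (λ s → tr (m (y b SZ.∙ inv′ s t)) ≈ 1#)) (q ℕ.+ 1)
      Ψ-fibre b@(b₀ , b≉0) t@(t₀ , t≉0) = size-⇔ Q
        (λ s e → trans (tr-y-inv b s t) e) (λ s e → trans (sym (tr-y-inv b s t)) e)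
        (Norms.fibre-size (θ (b₀ * t₀) , λ p → *-≉0 b≉0 t≉0 (θ≈0⇒≈0 p)))

    Unipotent : SZ.Carrier → Set (c ⊔ ℓ)
    Unipotent g = ∃[ a ] ∃[ b ] m g ≋ S a b

    -- Column 1 suffices, because its diagonal entry in a product of S with a torus matrix is the
    -- torus parameter η itself.
    triangular-pow : ∀ g → m g 0F 1F ≈ 0# → m g 0F 2F ≈ 0# → m g 0F 3F ≈ 0# → m g 1F 2F ≈ 0# → m g 1F 3F ≈ 0# →
      ∀ n → m (GL′.pow n g) 0F 1F ≈ 0# × m (GL′.pow n g) 1F 1F ≈ m g 1F 1F ^ n
    triangular-pow g e₀₁ e₀₂ e₀₃ e₁₂ e₁₃ zero    = refl , refl
    triangular-pow g e₀₁ e₀₂ e₀₃ e₁₂ e₁₃ (suc n) =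
      solve-under (m g 0F 0F ∷ m g 0F 1F ∷ m g 0F 2F ∷ m g 0F 3F ∷ column)
        (v₀ :* var 4F :+ (v₁ :* var 5F :+ (v₂ :* var 6F :+ (v₃ :* var 7F :+ :0)))) :0
        ((var 4F , :0) ∷ (v₁ , :0) ∷ (v₂ , :0) ∷ (v₃ , :0) ∷ []) (v₀ ∷ var 5F ∷ var 6F ∷ var 7F ∷ []) ≡.refl
        (proj₁ ih , e₀₁ , e₀₂ , e₀₃) ,
      solve-under (m g 1F 0F ∷ m g 1F 1F ∷ m g 1F 2F ∷ m g 1F 3F ∷ column)
        (v₀ :* var 4F :+ (v₁ :* var 5F :+ (v₂ :* var 6F :+ (v₃ :* var 7F :+ :0)))) (v₁ :* var 8F)
        ((var 4F , :0) ∷ (var 5F , var 8F) ∷ (v₂ , :0) ∷ (v₃ , :0) ∷ []) (v₀ ∷ v₁ ∷ var 6F ∷ var 7F ∷ []) ≡.refl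
        (proj₁ ih , proj₂ ih , e₁₂ , e₁₃)
      where
      ih = triangular-pow g e₀₁ e₀₂ e₀₃ e₁₂ e₁₃ n
      h = GL′.pow n g
      column : Vec Carrier 5
      column = m h 0F 1F ∷ m h 1F 1F ∷ m h 2F 1F ∷ m h 3F 1F ∷ m g 1F 1F ^ n ∷ []

    borel-unipotent : ∀ k (p : Q.Carrier) l g → m g ≋ S (proj₁ p) (proj₂ p) ⊗ Dm l → GL′.pow (2 ℕ.^ k) g SZ.≈ SZ.ε → Unipotent g
    borel-unipotent k (a₀ , b₀) l@((η , ν) , ην≈1) g g≋ e′ = a₀ , b₀ ,
      ≋-trans g≋ (≋-trans (⊗-cong {A = S a₀ b₀} ≋-refl (D-1 l η≈1)) (⊗-identityʳ (S a₀ b₀)))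
      where
      ρ : Vec Carrier 8
      ρ = a₀ ∷ b₀ ∷ θ a₀ ∷ θ b₀ ∷ η ∷ θ η ∷ ν ∷ θ ν ∷ []
      E : MExpr 4 8
      E = se v₀ v₁ v₂ v₃ :⊗ de (var 4F) (var 5F) (var 6F) (var 7F)
      at : ∀ i j r → isZero (normalise (entry E i j :+ r)) ≡ _ → m g i j ≈ ⟦ r ⟧ ρ
      at i j r check = trans (g≋ i j) (trans (sym (entry-sound E ρ i j)) (solve ρ (entry E i j) r check))
      N = 2 ℕ.^ k
      powers : m (GL′.pow N g) 1F 1F ≈ m g 1F 1F ^ N
      powers = proj₂ (triangular-pow g (at 0F 1F :0 ≡.refl) (at 0F 2F :0 ≡.refl) (at 0F 3F :0 ≡.refl) (at 1F 2F :0 ≡.refl) (at 1F 3F :0 ≡.refl) N)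
      η≈1 : η ≈ 1#
      η≈1 = trans (sym (at 1F 1F (var 4F) ≡.refl))
        (2^k-injective k (trans (sym powers) (trans (e′ 1F 1F) (sym (1^n≈1 F N)))))

    unipotent-intro : ∀ k a g → GL′.conj g (xᴳ oneᵁ) SZ.≈ xᴳ a → GL′.pow (2 ℕ.^ k) g SZ.≈ SZ.ε → Unipotent g
    unipotent-intro k a g e e′ = cases (CI.normaliser g oneᵁ a e)
      where
      cases : (∃[ p ] ∃[ l ] g SZ.≈ sᴳ p SZ.∙ dᴳ l) ⊎ (∃[ t ] xᴳ a SZ.≈ y t) → Unipotent g
      -- Entry (2,0) is a ≠ 0 in `xᴳ a` and 0 in `y t`, so a normalising g cannot come from the big
      -- cell.
      cases (inj₂ (t , p)) = contradiction (trans (p 2F 0F) (m-y t 2F 0F)) (proj₂ a)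
      cases (inj₁ (p , l , g≋)) = borel-unipotent k p l g g≋ e′

    S-square : ∀ a b → S a b ⊗ S a b ≋ S 0# (θ a * a)
    S-square a b = ≋-trans (S-S a b a b) (S-cong (x+x≈0 a) (trans (+-congʳ (x+x≈0 b)) (+-identityˡ _)))

    X-square : ∀ a → S 0# a ⊗ S 0# a ≋ I
    X-square a = ≋-trans (S-square 0# a) (≋-trans (S-cong refl (zeroʳ _)) S-0)

    unipotent-pow : ∀ g → Unipotent g → GL′.pow 4 g SZ.≈ SZ.ε
    unipotent-pow g (a , b , e) = ≋-trans (⊗-cong {A = m g} {B = m (GL′.pow 3 g)} ≋-refl
        (⊗-cong {A = m g} {B = m (GL′.pow 2 g)} ≋-refl g²))
      (≋-trans (≋-sym (⊗-assoc (m g) (m g) (S 0# (θ a * a))))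
      (≋-trans (⊗-cong {B = S 0# (θ a * a)} (≋-trans (⊗-cong e e) (S-square a b)) ≋-refl) (X-square (θ a * a))))
      where
      g² : m (GL′.pow 2 g) ≋ S 0# (θ a * a)
      g² = ≋-trans (⊗-cong {A = m g} ≋-refl (⊗-identityʳ (m g))) (≋-trans (⊗-cong e e) (S-square a b))

    x-y-noncomm : ∀ a b → ¬ xᴳ a SZ.∙ y b SZ.≈ y b SZ.∙ xᴳ a
    x-y-noncomm a@(a₀ , a≉0) b@(b₀ , b≉0) e = *-≉0 a≉0 b≉0 (solve-under ρ (v₀ :* v₂) :0
      ((entry product 2F 2F , entry (ye v₂ v₃ :⊗ xe v₀ v₁) 2F 2F) ∷ []) (:1 ∷ []) ≡.refl
      (trans (entry-sound product ρ 2F 2F) (trans (sym (m-product a b 2F 2F)) (trans (e 2F 2F)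
        (trans (⊗-cong {B′ = ⟦ xe v₀ v₁ ⟧ᴹ ρ} (m-y b) (X a) 2F 2F) (sym (entry-sound (ye v₂ v₃ :⊗ xe v₀ v₁) ρ 2F 2F)))))))
      where
      ρ = values a b

  rank-one : 2 ℕ.≤ q → q ℕ.* q ≡ suc ((q ℕ.∸ 1) ℕ.* (q ℕ.+ 1)) →
    RankOne {a = c ⊔ ℓ} {ℓ} {c} {ℓ} {ℓ} {c ⊔ ℓ} (Sz m₀ F) (q ℕ.* q) (q ℕ.+ 1) (q ℕ.∸ 1) 5
  rank-one 2≤q r≡ = record
    { _≟_ = λ g h → m g ≟ᴹ m h
    ; code = λ g → codeᴹ (m g)
    ; code-injective = λ {g} {h} e → codeᴹ-injective (m g) (m h) e
    ; U = U
    ; Q = Q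
    ; U-size = nonzero-size
    ; Q-size = size-× setoid setoid cardinality cardinality
    ; x = xᴳ
    ; x-cong = λ e → S-cong refl e
    ; u = sᴳ
    ; u-cong = λ (e , e′) → S-cong e e′
    ; w = tᴳ
    ; 0Q = 0# , 0#
    ; u-0 = S-0
    ; 1U = oneᵁ
    ; x-involution = λ a → GL′.involution {xᴳ a} (X-square (proj₁ a)) (λ e → proj₂ a (e 2F 0F))
    ; x-conj = x-conj
    ; x-injective = λ e → e 2F 0F
    ; inv-injective = λ {s} {t} {a} {b} → inv-injective s t a b
    ; classify = CI.classify
    ; x-x-comm = λ a b → s-x (0# , proj₁ a) b
    ; u-x-comm = s-x
    ; x-y-noncomm = x-y-noncomm
    ; ι = λ (a , a≉0) → a ⁻¹ , ⁻¹-≉0 a≉0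
    ; ι-injective = λ {(a , a≉0)} {(b , b≉0)} e → *-cancelˡ (⁻¹-≉0 a≉0)
        (trans (⁻¹-inverseˡ a≉0) (trans (sym (⁻¹-inverseˡ b≉0)) (*-congʳ (sym e))))
    ; order-χ⇒ = λ a b o → ⁻¹-unique (order-5⇒ a b (HasOrder-resp (Sz m₀ F) (SZ.refl {xᴳ a SZ.∙ y b}) o))
    ; order-χ⇐ = λ a b e → HasOrder-resp (Sz m₀ F) (SZ.refl {xᴳ a SZ.∙ y b}) (order-5⇐ a b (⁻¹-unit (proj₂ a) e))
    ; Ψ = λ g → tr (m g) ≈ 1#
    ; Ψ? = λ g → tr (m g) ≟ 1#
    ; Ψ-resp = λ e p → trans (sym (tr-cong e)) p
    ; Ψ-conj = λ g {h} p → trans (tr-conj (m g) (inv (proj₁ g)) (m h) (invˡ (proj₁ g))) p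
    ; Ψ⇒ = λ a b p → ⁻¹-unique (θ-injective (trans (sym (tr-product a b)) (trans p (sym θ-1))))
    ; Ψ⇐ = λ a b e → trans (tr-product a b) (trans (θ-cong (⁻¹-unit (proj₂ a) e)) θ-1)
    ; Ψ-y-y = λ a b p → 1≉0 (trans (sym p) (trans (tr-cong (⊗-cong {A′ = ⟦ ye v₀ v₁ ⟧ᴹ (values a b)} {B′ = ⟦ ye v₂ v₃ ⟧ᴹ (values a b)} (m-y a) (m-y b)))
        (trans (tr-sound (ye v₀ v₁ :⊗ ye v₂ v₃) (values a b))
          (solve (values a b) (trace-expr (ye v₀ v₁ :⊗ ye v₂ v₃)) :0 ≡.refl))))
    ; Ψ-fibre = Ψ-fibre 2≤q r≡
    ; W = Unipotent
    ; W-∙ = λ (a , b , e) (a₁ , b₁ , e₁) → _ , _ , ≋-trans (⊗-cong e e₁) (S-S a b a₁ b₁)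
    ; W-comm = λ {g} (a , b , e) → ≋-trans (⊗-cong {B = S 0# 1#} e ≋-refl) (≋-trans (s-x (a , b) oneᵁ) (⊗-cong {A = S 0# 1#} ≋-refl (≋-sym e)))
    ; W-pow = λ {g} → unipotent-pow g
    ; W-intro = λ k a {g} → unipotent-intro k a g
    }
    where
    x-conj : ∀ (a : U.Carrier) → ∃[ g ] xᴳ a SZ.≈ GL′.conj g (xᴳ oneᵁ)
    x-conj a@(a₀ , a≉0) = dᴳ k , GL′.conj-≈⇐ (dᴳ k) (xᴳ oneᵁ) (xᴳ a)
      (≋-trans (proj₂ (d-x k oneᵁ)) (⊗-cong {B = Dm k} (S-cong refl (trans (*-identityʳ _) (proj₂ (weight-surjective a₀)))) ≋-refl))
      where
      ν = proj₁ (weight-surjective a₀)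
      ν≉0 : ¬ ν ≈ 0#
      ν≉0 = weight-≉0 (λ p → a≉0 (trans (sym (proj₂ (weight-surjective a₀))) p))
      k : Torus
      k = (ν ⁻¹ , ν) , ⁻¹-inverseˡ ν≉0

-- Assembly of the three families

open import Data.Nat.Base using (_+_; _*_; _∸_; _^_; _≤_)
open import Relation.Binary.PropositionalEquality using (refl)

open Parameters

theorem2p1 : ∀ {c ℓ} (n : ℕ) → let q = 2 ^ n in 4 ≤ q →
    ((F : FiniteField c ℓ q) → let G = PSL₂ F in
    ∀ t → Involution G t →
    FusionGraphProperties G (ConjugacyClass G t) 3
    (q ^ 2 ∸ 1) (q * (q ∸ 2)) (q * (q ∸ 3)) ((q ∸ 2) ^ 2))
    × ((m : ℕ) → n ≡ 1 + 2 * m →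
    (F : FiniteField c ℓ (2 ^ (1 + 2 * m))) → let G = Sz m F in
    ∀ t → Involution G t →
    FusionGraphProperties G (ConjugacyClass G t) 5
    ((q ^ 2 + 1) * (q ∸ 1)) (q ^ 2 * (q ∸ 2)) ((q ∸ 2) ^ 2 * (q + 1)) (q ^ 2 * (q ∸ 3)))
    × ((F : FiniteField c ℓ (q ^ 2)) → let G = PSU₃ n F in
    ∀ t → Involution G t →
    FusionGraphProperties G (ConjugacyClass G t) 3
    ((q ^ 3 + 1) * (q ∸ 1)) (q ^ 3 * (q ∸ 2)) ((q ∸ 2) ^ 2 * (q ^ 2 + q + 1)) (q ^ 3 * (q ∸ 3)))
theorem2p1 {c} {ℓ} n 4≤q = linear , suzuki n 4≤q , unitary
  where
  linear : (F : FiniteField c ℓ (2 ^ n)) → ∀ t → Involution (PSL₂ F) t → _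
  -- For PSL₂(q) the larger parameter b belongs to the commuting pairs, contrary to the other two
  -- families; hence `inj₂`.
  linear F t t-inv = FusionGraph.fusion-graph-properties (PSL₂-RankOne.rank-one n F) t t-inv
    0<same 0<other 0<m∸1 v≡ k≡ a≤b (inj₂ (proj₂ (psl₂ (2 ^ n) 4≤q)))
    where open Arithmetic (proj₁ (psl₂ (2 ^ n) 4≤q))

  -- Quantifies over n afresh, so that matching on n ≡ 1 + 2 m can replace n everywhere in the
  -- parameters.
  suzuki : ∀ n → 4 ≤ 2 ^ n → (m : ℕ) → n ≡ 1 + 2 * m → (F : FiniteField c ℓ (2 ^ (1 + 2 * m))) →
    ∀ t → Involution (Sz m F) t → FusionGraphProperties (Sz m F) (ConjugacyClass (Sz m F) t) 5
      (((2 ^ n) ^ 2 + 1) * (2 ^ n ∸ 1)) ((2 ^ n) ^ 2 * (2 ^ n ∸ 2)) ((2 ^ n ∸ 2) ^ 2 * (2 ^ n + 1)) ((2 ^ n) ^ 2 * (2 ^ n ∸ 3))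
  suzuki .(1 + 2 * m) 4≤q m refl F t t-inv = FusionGraph.fusion-graph-properties
    (Sz-RankOne.rank-one m F (ℕ.≤-trans (s≤s (s≤s z≤n)) 4≤q) (proj₂ (proj₂ (sz q 4≤q)))) t t-inv
    0<same 0<other 0<m∸1 v≡ k≡ a≤b (inj₁ (proj₁ (proj₂ (sz q 4≤q))))
    where
    q = 2 ^ (1 + 2 * m)
    open Arithmetic (proj₁ (sz q 4≤q))

  unitary : (F : FiniteField c ℓ ((2 ^ n) ^ 2)) → ∀ t → Involution (PSU₃ n F) t → _
  unitary F t t-inv = FusionGraph.fusion-graph-properties
    (PSU₃-RankOne.rank-one n (ℕ.≤-trans (s≤s (s≤s z≤n)) 4≤q) F (proj₂ (proj₂ (psu₃ (2 ^ n) 4≤q)))) t t-inv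
    0<same 0<other 0<m∸1 v≡ k≡ a≤b (inj₁ (proj₁ (proj₂ (psu₃ (2 ^ n) 4≤q))))
    where open Arithmetic (proj₁ (psu₃ (2 ^ n) 4≤q))
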